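{- Let $G$ be a connected graph with $n$ vertices. If $G$ has maximum degree at most $4$, then $\mathrm{pn}(G)\le\lfloor n/2\rfloor$, or $G$ is isomorphic to $K_3$, to $K_5$, or to $K_5^-$.
   Context: All graphs are finite and simple. A path decomposition of a graph $G$ is a set of pairwise edge-disjoint paths of $G$ that together cover $E(G)$; $\mathrm{pn}(G)$ is the minimum size of a path decomposition of $G$ (it is $0$ if $G$ has no edges). $K_5^-$ is the graph obtained from $K_5$ by removing exactly one edge. -}

module Defs where

open import Data.Fin.Base using (Fin; zero; suc)
open import Data.Fin.Properties as Fin using (all?)
open import Data.List.Base
  using (List; []; _∷_; length; map; filter; allFin; concatMap; upTo;
         cartesianProductWith; cartesianProduct; lookup)
open import Data.List.Extrema.Nat using (max)
open import Data.List.Membership.Propositional using (_∈_)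
open import Data.List.Membership.Propositional.Properties
  using (∈-allFin; ∈-upTo⁺; ∈-cartesianProductWith⁺; ∈-cartesianProduct⁺;
         ∈-concatMap⁺; ∈-lookup)
open import Data.List.Relation.Unary.All as All using (All; []; _∷_)
open import Data.List.Relation.Unary.All.Properties using (¬Any⇒All¬)
open import Data.List.Relation.Unary.AllPairs
  using (AllPairs; []; _∷_; allPairs?)
open import Data.List.Relation.Unary.Any as Any using (Any; here; there; any?)
open import Data.List.Relation.Unary.Linked
  using (Linked; []; [-]; _∷_; linked?)
open import Data.List.Relation.Unary.Unique.Propositional using (Unique)
open import Data.Nat.Base using (ℕ; zero; suc; _≤_; z≤n; s≤s)
open import Data.Nat.Properties as ℕ using (_≤?_)
open import Data.Product.Base using (∃; ∃-syntax; _×_; _,_; proj₁; proj₂)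
open import Data.Product.Properties using () renaming (≡-dec to ×-≡-dec)
open import Data.Sum.Base using (_⊎_; inj₁; inj₂; swap)
open import Function.Base using (_∘_)
open import Function.Bundles using (_↔_; _⇔_; Inverse)
open import Level using (0ℓ)
open import Relation.Binary.Construct.Closure.ReflexiveTransitive using (Star)
open import Relation.Binary.Core using (Rel)
open import Relation.Binary.Definitions using (Decidable; Symmetric; Irreflexive)
open import Relation.Binary.PropositionalEquality
  using (_≡_; _≢_; refl; sym; cong; subst)
open import Relation.Nullary using (¬_; yes; no; contradiction)
open import Relation.Nullary.Decidable
  using (map′; ¬?; _×-dec_; _⊎-dec_; _→-dec_)
import Relation.Unary as U

record Graph (n : ℕ) : Set₁ where
  infix 4 _~_ _~?_
  field
    _~_     : Rel (Fin n) 0ℓ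
    _~?_    : Decidable _~_
    ~-sym   : Symmetric _~_
    ~-irrefl : Irreflexive _≡_ _~_

open Graph

degree : ∀ {n} → Graph n → Fin n → ℕ
degree {n} G v = length (filter (_~?_ G v) (allFin n))

maxDegree : ∀ {n} → Graph n → ℕ
maxDegree {n} G = max 0 (map (degree G) (allFin n))

Connected : ∀ {n} → Graph n → Set
Connected {n} G = (u v : Fin n) → Star (_~_ G) u v

record _≅_ {m n : ℕ} (G : Graph m) (H : Graph n) : Set where
  field
    bijection : Fin m ↔ Fin n
    adjacency : ∀ u v →
      _~_ G u v ⇔ _~_ H (Inverse.to bijection u) (Inverse.to bijection v)

complete : ∀ n → Graph n
complete n = record
  { _~_      = _≢_
  ; _~?_     = λ u v → ¬? (u Fin.≟ v)
  ; ~-sym    = λ u≢v v≡u → u≢v (sym v≡u)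
  ; ~-irrefl = λ u≡v u≢v → u≢v u≡v
  }

deleteEdge : ∀ {n} → Graph n → Fin n → Fin n → Graph n
deleteEdge {n} G a b = record
  { _~_      = λ u v → _~_ G u v × ¬ IsAB u v
  ; _~?_     = λ u v → _~?_ G u v ×-dec ¬? (isAB? u v)
  ; ~-sym    = λ (u~v , ¬ab) → ~-sym G u~v , ¬ab ∘ swapAB
  ; ~-irrefl = λ u≡v (u~v , _) → ~-irrefl G u≡v u~v
  }
  where
  IsAB : Rel (Fin n) 0ℓ
  IsAB u v = (u ≡ a × v ≡ b) ⊎ (u ≡ b × v ≡ a)
  isAB? : Decidable IsAB
  isAB? u v = (u Fin.≟ a ×-dec v Fin.≟ b) ⊎-dec (u Fin.≟ b ×-dec v Fin.≟ a)
  swapAB : ∀ {u v} → IsAB u v → IsAB v u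
  swapAB (inj₁ (p , q)) = inj₂ (q , p)
  swapAB (inj₂ (p , q)) = inj₁ (q , p)

K₃ : Graph 3
K₃ = complete 3

K₅ : Graph 5
K₅ = complete 5

K₅⁻ : Graph 5
K₅⁻ = deleteEdge K₅ zero (suc zero)

-- A path is listed as its sequence of vertices (a path and its reversal are
-- the same subgraph).  Paths have at least one edge; single-vertex paths
-- would contribute no edges and so would not change pn.
record IsPath {n} (G : Graph n) (p : List (Fin n)) : Set where
  constructor mkIsPath
  field
    nontrivial : 2 ≤ length p
    adjacent   : Linked (_~_ G) p
    distinct   : Unique p

steps : ∀ {A : Set} → List A → List (A × A)
steps []           = []
steps (x ∷ [])     = []
steps (x ∷ y ∷ xs) = (x , y) ∷ steps (y ∷ xs)

-- The undirected edge uv lies on the path p.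
HasEdge : ∀ {n} → List (Fin n) → Fin n → Fin n → Set
HasEdge p u v = (u , v) ∈ steps p ⊎ (v , u) ∈ steps p

EdgeDisjoint : ∀ {n} → Rel (List (Fin n)) 0ℓ
EdgeDisjoint p q = ∀ u v → HasEdge p u v → ¬ HasEdge q u v

-- The list D stands for a set: as paths have an edge, pairwise edge-disjoint
-- entries are distinct (also up to reversal), so the set has length D elements.
record IsPathDecomposition {n} (G : Graph n) (D : List (List (Fin n))) : Set where
  constructor mkIsPathDecomposition
  field
    paths    : All (IsPath G) D
    disjoint : AllPairs EdgeDisjoint D
    covers   : ∀ u v → _~_ G u v → Any (λ p → HasEdge p u v) D

HasDecompositionOfSize : ∀ {n} → Graph n → ℕ → Set
HasDecompositionOfSize G k = ∃[ D ] (IsPathDecomposition G D × length D ≡ k)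

IsLeast : (ℕ → Set) → ℕ → Set
IsLeast P k = P k × (∀ j → P j → k ≤ j)

-- The minimum in the definition of pn exists: sizes of path decompositions are
-- decidable by exhaustive search, and single edges give a path decomposition.

least : ∀ {P : ℕ → Set} → U.Decidable P → ∀ m → P m → ∃ (IsLeast P)
least P? zero    p0 = 0 , p0 , λ _ _ → z≤n
least {P} P? (suc m) pm with P? 0
... | yes p0 = 0 , p0 , λ _ _ → z≤n
... | no ¬p0 with least {P ∘ suc} (P? ∘ suc) m pm
...   | k , pk , k≤ = suc k , pk , λ where
          zero    p0 → contradiction p0 ¬p0
          (suc j) pj → s≤s (k≤ j pj)

listsOfLength : ∀ {A : Set} → List A → ℕ → List (List A)
listsOfLength as zero    = [] ∷ []
listsOfLength as (suc k) = cartesianProductWith _∷_ as (listsOfLength as k)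

∈-listsOfLength : ∀ {A : Set} {as xs : List A} →
                  All (_∈ as) xs → xs ∈ listsOfLength as (length xs)
∈-listsOfLength []         = here refl
∈-listsOfLength (px ∷ pxs) = ∈-cartesianProductWith⁺ _∷_ px (∈-listsOfLength pxs)

hasEdge? : ∀ {n} (p : List (Fin n)) → Decidable (HasEdge p)
hasEdge? p u v = (u , v) ∈? steps p ⊎-dec (v , u) ∈? steps p
  where _∈?_ = λ e es → any? (×-≡-dec Fin._≟_ Fin._≟_ e) es

edgeDisjoint? : ∀ {n} → Decidable (EdgeDisjoint {n})
edgeDisjoint? p q = all? λ u → all? λ v → hasEdge? p u v →-dec ¬? (hasEdge? q u v)

isPath? : ∀ {n} (G : Graph n) → U.Decidable (IsPath G)
isPath? G p =
  map′ (λ (l , a , d) → mkIsPath l a d)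
       (λ (mkIsPath l a d) → l , a , d)
       (2 ≤? length p ×-dec linked? (_~?_ G) p
         ×-dec allPairs? (λ u v → ¬? (u Fin.≟ v)) p)

isPathDecomposition? : ∀ {n} (G : Graph n) → U.Decidable (IsPathDecomposition G)
isPathDecomposition? G D =
  map′ (λ (p , d , c) → mkIsPathDecomposition p d c)
       (λ (mkIsPathDecomposition p d c) → p , d , c)
       (All.all? (isPath? G) D ×-dec allPairs? edgeDisjoint? D
         ×-dec (all? λ u → all? λ v →
           _~?_ G u v →-dec any? (λ p → hasEdge? p u v) D))

pathCandidates : ∀ n → List (List (Fin n))
pathCandidates n = concatMap (listsOfLength (allFin n)) (upTo (suc n))

lookup-injective : ∀ {A : Set} {xs : List A} → Unique xs →
                   ∀ i j → lookup xs i ≡ lookup xs j → i ≡ j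
lookup-injective (x∉ ∷ u) zero    zero    _  = refl
lookup-injective (x∉ ∷ u) zero    (suc j) eq =
  contradiction eq (All.lookup x∉ (∈-lookup j))
lookup-injective (x∉ ∷ u) (suc i) zero    eq =
  contradiction (sym eq) (All.lookup x∉ (∈-lookup i))
lookup-injective (x∉ ∷ u) (suc i) (suc j) eq = cong suc (lookup-injective u i j eq)

unique⇒length≤ : ∀ {n} {p : List (Fin n)} → Unique p → length p ≤ n
unique⇒length≤ u = Fin.injective⇒≤ (λ {i} {j} → lookup-injective u i j)

isPath⇒candidate : ∀ {n} {G : Graph n} {p} → IsPath G p → p ∈ pathCandidates n
isPath⇒candidate {n} {p = p} P =
  ∈-concatMap⁺ (listsOfLength (allFin n))
    (Any.map (λ { refl → ∈-listsOfLength (All.universal ∈-allFin p) })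
      (∈-upTo⁺ (s≤s (unique⇒length≤ (IsPath.distinct P)))))

hasDecompositionOfSize? : ∀ {n} (G : Graph n) → U.Decidable (HasDecompositionOfSize G)
hasDecompositionOfSize? {n} G k =
  map′ Any.satisfied
       (λ (D , isD , len) →
         Any.map (λ { refl → isD , len })
           (subst (λ k → D ∈ listsOfLength (pathCandidates n) k) len
             (∈-listsOfLength
               (All.map isPath⇒candidate (IsPathDecomposition.paths isD)))))
       (any? (λ D → isPathDecomposition? G D ×-dec length D ℕ.≟ k)
         (listsOfLength (pathCandidates n) k))

decomposition : ∀ {n} (G : Graph n) → ∃ (IsPathDecomposition G)
decomposition {n} G =
  let D , ps , dis , cov = greedy (cartesianProduct (allFin n) (allFin n))
  in D , mkIsPathDecomposition ps dis λ u v →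
       cov u v (∈-cartesianProduct⁺ (∈-allFin u) (∈-allFin v))
  where
  Covers : List (Fin n × Fin n) → List (List (Fin n)) → Set
  Covers es D = ∀ u v → (u , v) ∈ es → _~_ G u v → Any (λ p → HasEdge p u v) D

  greedy : ∀ es → ∃[ D ] (All (IsPath G) D × AllPairs EdgeDisjoint D × Covers es D)
  greedy [] = [] , [] , [] , λ _ _ ()
  greedy ((a , b) ∷ es) with greedy es
  ... | D , ps , dis , cov with _~?_ G a b | any? (λ p → hasEdge? p a b) D
  ...   | no ¬a~b | _ = D , ps , dis , λ where
            u v (here refl) u~v → contradiction u~v ¬a~b
            u v (there e)   u~v → cov u v e u~v
  ...   | yes _ | yes used = D , ps , dis , λ where
            u v (here refl) _   → used
            u v (there e)   u~v → cov u v e u~v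
  ...   | yes a~b | no unused =
            (a ∷ b ∷ []) ∷ D , isPath ∷ ps
            , All.map disjointFrom (¬Any⇒All¬ D unused) ∷ dis , λ where
                u v (here refl) _   → here (inj₁ (here refl))
                u v (there e)   u~v → there (cov u v e u~v)
    where
    isPath : IsPath G (a ∷ b ∷ [])
    isPath = mkIsPath (s≤s (s≤s z≤n)) (a~b ∷ [-])
               (((λ a≡b → ~-irrefl G a≡b a~b) ∷ []) ∷ [] ∷ [])
    disjointFrom : ∀ {q} → ¬ HasEdge q a b → EdgeDisjoint (a ∷ b ∷ []) q
    disjointFrom ¬q _ _ (inj₁ (here refl)) = ¬q
    disjointFrom ¬q _ _ (inj₂ (here refl)) = ¬q ∘ swap

leastSize : ∀ {n} (G : Graph n) → ∃ (IsLeast (HasDecompositionOfSize G))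
leastSize G =
  let D , isD = decomposition G
  in least (hasDecompositionOfSize? G) (length D) (D , isD , refl)

pn : ∀ {n} → Graph n → ℕ
pn G = proj₁ (leastSize G)

pn-isLeast : ∀ {n} (G : Graph n) → IsLeast (HasDecompositionOfSize G) (pn G)
pn-isLeast G = proj₂ (leastSize G)

{-# OPTIONS --safe #-}

-- By strong induction on n, every graph of maximum degree at most four on n
-- listed vertices, connected or not, has a decomposition into at most ⌊n/2⌋
-- paths or an exceptional component: K₃, K₅ or K₅⁻.  For the induction step,
-- isolate a few vertices, paid for by a few new paths through them, and keep
-- the degrees of other vertices by lifting: two non-adjacent neighbours c, d of
-- an isolated vertex v are joined, and v is put back on the path through cd.
--
-- If the reduced graph has an exceptional component S, then either S misses the
-- neighbours of the isolated vertices and is a component of the original graph,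
-- or a new path ends in S and is prolonged by one edge of S, after which S falls
-- apart into (|S| − 1)/2 paths, or S contains a lifted edge, and lifting another
-- pair instead joins S to the rest, since edges of S lie in triangles.
--
-- The reductions are tried in this order: K₅⁻; K₄; on an even number of vertices
-- any vertex will do, as it may be traded for a path; on an odd number, a vertex
-- of degree two; a vertex of degree four next to one of degree one or four.
-- Otherwise the neighbours of a vertex of degree four have degree three, and a
-- vertex of degree four exists because the sum of the degrees is even.

module Submission where

open import Defs
open import Data.Bool.Base using (Bool; true; false; _∧_; _∨_; not; if_then_else_)
open import Data.Empty using (⊥; ⊥-elim)
open import Data.Fin.Base as Fin using (Fin)
open import Data.Fin.Properties as Fin using (_≟_)
open import Data.List.Base using (List; []; _∷_; _++_; _∷ʳ_; length; lookup; map; reverse; concatMap; filter; allFin; initLast; _∷ʳ′_)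
open import Data.List.Extrema.Nat using (xs≤max)
open import Data.List.Membership.Propositional using (_∈_; _∉_; find; lose)
open import Data.List.Membership.Propositional.Properties using (∈-++⁺ˡ; ∈-++⁺ʳ; ∈-++⁻; ∈-∃++; ∈-filter⁺; ∈-allFin; ∈-map⁺)
open import Data.List.Properties using (length-++; unfold-reverse; reverse-involutive; length-reverse; length-tabulate; ++-assoc; reverse-++)
open import Data.List.Relation.Binary.Permutation.Propositional using (_↭_; ↭-refl; ↭-sym; ↭-trans; prep; swap; ↭⇒↭ₛ)
open import Data.List.Relation.Binary.Permutation.Propositional.Properties using (shift; shifts; ↭-reverse; ++-comm; ∈-resp-↭; All-resp-↭; ↭-length)
import Data.List.Relation.Binary.Permutation.Setoid.Properties as PermS
open import Data.List.Relation.Unary.All as All using (All; []; _∷_)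
import Data.List.Relation.Unary.All.Properties as Allₚ
open import Data.List.Relation.Unary.AllPairs as AllPairs using (AllPairs; []; _∷_)
open import Data.List.Relation.Unary.Any as Any using (Any; here; there)
open import Data.List.Relation.Unary.Any.Properties using (lookup-index)
open import Data.List.Relation.Unary.Linked using (Linked; []; [-]; _∷_)
open import Data.List.Relation.Unary.Unique.Propositional using (Unique)
import Data.List.Relation.Unary.Unique.Propositional.Properties as Uniqueₚ
open import Data.Nat.Base using (ℕ; zero; suc; _+_; _*_; _≤_; _<_; z≤n; s≤s; _<ᵇ_; _≡ᵇ_; ⌊_/2⌋)
open import Data.Nat.Properties as ℕ using (+-comm; +-assoc; +-identityʳ; ≤-refl; ≤-trans; m≤m+n; m≤n+m; ≤-reflexive)
open import Data.Nat.Tactic.RingSolver using (solve-∀)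
open import Data.Product.Base using (∃-syntax; _×_; _,_; proj₁; proj₂)
open import Data.Sum.Base using (_⊎_; inj₁; inj₂; [_,_]′)
open import Data.Unit.Base using (⊤; tt)
open import Data.Vec.Base as Vec using (Vec; []; _∷_)
import Data.Vec.Properties as Vecₚ
open import Function.Base using (_∘_; case_of_)
open import Function.Bundles using (_⇔_; mk⇔; mk↔ₛ′)
open import Relation.Binary.Construct.Closure.ReflexiveTransitive using (Star; ε; _◅_)
open import Relation.Binary.PropositionalEquality
open import Relation.Nullary using (¬_; Dec; yes; no; contradiction; does)
open import Relation.Nullary.Decidable using (map′; _×-dec_; ¬?)

-- The exceptions come from counting: ⌊n/2⌋ paths on n vertices cover at most ⌊n/2⌋(n - 1) edges,
-- which is 2 of the 3 edges of K₃ and 8 of the 9 or 10 edges of K₅⁻ and K₅. Handing one edge to a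
-- path from outside makes K₃ and K₅⁻ exactly tight but leaves K₅ one edge over. Hence every entry
-- vertex is required to have degree at most three in the reduced graph, which rules out K₅.
--
-- Absorption must spare the lifted edges, because a removed vertex is put back on the old path
-- through such an edge. So the edge taken from a component must be no lifted edge and must lead to
-- a vertex off the new path. In a triangle this leaves little choice, and most side conditions
-- below serve to keep one choice open.
--
-- Removed vertices stay as isolated vertices. All graphs thus share one vertex type, and a list `W`
-- containing the non-isolated vertices does the counting.
--
-- A decomposition is treated as an equation between edge multiplicities. This expresses
-- disjointness and covering at once, and makes cutting, prolonging and rerouting of paths additive
-- arithmetic.

private variable
  N : ℕ

-- Lists without repetition.

unique-resp-↭ : {xs ys : List (Fin N)} → xs ↭ ys → Unique xs → Unique ys
unique-resp-↭ {N} p = PermS.Unique-resp-↭ (setoid (Fin N)) (↭⇒↭ₛ p)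

unique-reverse : {xs : List (Fin N)} → Unique xs → Unique (reverse xs)
unique-reverse {xs = xs} = unique-resp-↭ (↭-sym (↭-reverse xs))

unique-++⁻ˡ : ∀ xs {ys : List (Fin N)} → Unique (xs ++ ys) → Unique xs
unique-++⁻ˡ [] _ = []
unique-++⁻ˡ (x ∷ xs) (px ∷ u) = Allₚ.++⁻ˡ xs px ∷ unique-++⁻ˡ xs u

unique-++⁻ʳ : ∀ xs {ys : List (Fin N)} → Unique (xs ++ ys) → Unique ys
unique-++⁻ʳ [] u = u
unique-++⁻ʳ (x ∷ xs) (_ ∷ u) = unique-++⁻ʳ xs u

∉⇒All≢ : {x : Fin N} {xs : List (Fin N)} → x ∉ xs → All (x ≢_) xs
∉⇒All≢ {xs = []} _ = []
∉⇒All≢ {xs = _ ∷ _} x∉ = (λ eq → x∉ (here eq)) ∷ ∉⇒All≢ (x∉ ∘ there)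

All≢⇒∉ : {x : Fin N} {xs : List (Fin N)} → All (x ≢_) xs → x ∉ xs
All≢⇒∉ a x∈ = All.lookup a x∈ refl

Disj : List (Fin N) → List (Fin N) → Set
Disj xs ys = ∀ {x} → x ∈ xs → x ∉ ys

unique-++ : {xs ys : List (Fin N)} → Unique xs → Unique ys → Disj xs ys → Unique (xs ++ ys)
unique-++ u v d = Uniqueₚ.++⁺ u v (λ (a , b) → d a b)

member? : (x : Fin N) (xs : List (Fin N)) → Dec (x ∈ xs)
member? x xs = Any.any? (x ≟_) xs

any₁ : ∀ {A R : Set} {P : A → Set} {a} → (P a → R) → Any P (a ∷ []) → R
any₁ f (here p) = f p

any₂ : ∀ {A R : Set} {P : A → Set} {a b} → (P a → R) → (P b → R) → Any P (a ∷ b ∷ []) → R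
any₂ f g (here p) = f p
any₂ f g (there i) = any₁ g i

any₃ : ∀ {A R : Set} {P : A → Set} {a b c} → (P a → R) → (P b → R) → (P c → R) → Any P (a ∷ b ∷ c ∷ []) → R
any₃ f g h (here p) = f p
any₃ f g h (there i) = any₂ g h i

any₄ : ∀ {A R : Set} {P : A → Set} {a b c d} → (P a → R) → (P b → R) → (P c → R) → (P d → R) →
       Any P (a ∷ b ∷ c ∷ d ∷ []) → R
any₄ f g h k (here p) = f p
any₄ f g h k (there i) = any₃ g h k i

-- Edge multiplicities of walks.

-- Edge sets are compared as multiplicity functions: δ x y u v counts the edge xy at the pair uv.

ι : Fin N → Fin N → ℕ
ι x u with x ≟ u
... | yes _ = 1
... | no _ = 0

ι-refl : (x : Fin N) → ι x x ≡ 1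
ι-refl x with x ≟ x
... | yes _ = refl
... | no x≢x = contradiction refl x≢x

ι-≢ : {x u : Fin N} → x ≢ u → ι x u ≡ 0
ι-≢ {x = x} {u} x≢u with x ≟ u
... | yes eq = contradiction eq x≢u
... | no _ = refl

Is : Fin N → Fin N → Fin N → Fin N → Set
Is x y u v = (x ≡ u × y ≡ v) ⊎ (x ≡ v × y ≡ u)

opaque
 δ : Fin N → Fin N → Fin N → Fin N → ℕ
 δ x y u v = ι x u * ι y v + ι x v * ι y u

 δ-comm : (x y u v : Fin N) → δ x y u v ≡ δ y x u v
 δ-comm x y u v = lemma (ι x u) (ι y v) (ι x v) (ι y u)
   where
   lemma : ∀ a b c d → a * b + c * d ≡ d * c + b * a
   lemma = solve-∀

 δ-sym : (x y u v : Fin N) → δ x y u v ≡ δ x y v u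
 δ-sym x y u v = +-comm (ι x u * ι y v) _

 δ-≢ : {x y u v : Fin N} → ¬ Is x y u v → δ x y u v ≡ 0
 δ-≢ {x = x} {y} {u} {v} n with x ≟ u | y ≟ v | x ≟ v | y ≟ u
 ... | yes a | yes b | _ | _ = contradiction (inj₁ (a , b)) n
 ... | yes _ | no _ | no _ | _ = refl
 ... | yes _ | no _ | yes _ | no _ = refl
 ... | _ | _ | yes a | yes b = contradiction (inj₂ (a , b)) n
 ... | no _ | _ | no _ | _ = refl
 ... | no _ | _ | yes _ | no _ = refl

 δ-≡ : {x y : Fin N} → x ≢ y → δ x y x y ≡ 1
 δ-≡ {x = x} {y} x≢y rewrite ι-refl x | ι-refl y | ι-≢ x≢y = refl

 δ-pos : {x y u v : Fin N} → 1 ≤ δ x y u v → Is x y u v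
 δ-pos {x = x} {y} {u} {v} p with x ≟ u | y ≟ v | x ≟ v | y ≟ u
 ... | yes a | yes b | _ | _ = inj₁ (a , b)
 ... | _ | _ | yes a | yes b = inj₂ (a , b)
 δ-pos () | yes _ | no _ | no _ | _
 δ-pos () | yes _ | no _ | yes _ | no _
 δ-pos () | no _ | _ | no _ | _
 δ-pos () | no _ | _ | yes _ | no _

Weight : ℕ → Set
Weight N = Fin N → Fin N → ℕ

infix 4 _≗₂_
_≗₂_ : Weight N → Weight N → Set
f ≗₂ g = ∀ u v → f u v ≡ g u v

wt : List (Fin N) → Weight N
wt [] u v = 0
wt (x ∷ []) u v = 0
wt (x ∷ y ∷ p) u v = δ x y u v + wt (y ∷ p) u v

WT : List (List (Fin N)) → Weight N
WT [] u v = 0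
WT (p ∷ ps) u v = wt p u v + WT ps u v

WT-++ : ∀ (ps qs : List (List (Fin N))) u v → WT (ps ++ qs) u v ≡ WT ps u v + WT qs u v
WT-++ [] qs u v = refl
WT-++ (p ∷ ps) qs u v rewrite WT-++ ps qs u v = sym (+-assoc (wt p u v) _ _)

wt-sym : ∀ (p : List (Fin N)) u v → wt p u v ≡ wt p v u
wt-sym [] u v = refl
wt-sym (x ∷ []) u v = refl
wt-sym (x ∷ y ∷ p) u v = cong₂ _+_ (δ-sym x y u v) (wt-sym (y ∷ p) u v)

WT-sym : ∀ (ps : List (List (Fin N))) u v → WT ps u v ≡ WT ps v u
WT-sym [] u v = refl
WT-sym (p ∷ ps) u v = cong₂ _+_ (wt-sym p u v) (WT-sym ps u v)

wt-split : ∀ (xs : List (Fin N)) y ys u v →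
           wt (xs ++ y ∷ ys) u v ≡ wt (xs ∷ʳ y) u v + wt (y ∷ ys) u v
wt-split [] y ys u v = refl
wt-split (x ∷ []) y ys u v rewrite +-identityʳ (δ x y u v) = refl
wt-split (x ∷ z ∷ xs) y ys u v rewrite wt-split (z ∷ xs) y ys u v =
  sym (+-assoc (δ x z u v) _ _)

wt-reverse : ∀ (p : List (Fin N)) u v → wt (reverse p) u v ≡ wt p u v
wt-reverse [] u v = refl
wt-reverse (x ∷ []) u v = refl
wt-reverse (x ∷ y ∷ p) u v = begin
  wt (reverse (x ∷ y ∷ p)) u v                   ≡⟨ cong (λ l → wt l u v) eq ⟩
  wt (reverse p ++ y ∷ x ∷ []) u v               ≡⟨ wt-split (reverse p) y (x ∷ []) u v ⟩
  wt (reverse p ∷ʳ y) u v + (δ y x u v + 0)      ≡⟨ cong (λ l → wt l u v + (δ y x u v + 0)) (sym (unfold-reverse y p)) ⟩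
  wt (reverse (y ∷ p)) u v + (δ y x u v + 0)     ≡⟨ cong₂ _+_ (wt-reverse (y ∷ p) u v) (trans (+-identityʳ _) (δ-comm y x u v)) ⟩
  wt (y ∷ p) u v + δ x y u v                     ≡⟨ +-comm (wt (y ∷ p) u v) _ ⟩
  δ x y u v + wt (y ∷ p) u v ∎
  where
  open ≡-Reasoning
  eq : reverse (x ∷ y ∷ p) ≡ reverse p ++ y ∷ x ∷ []
  eq = trans (unfold-reverse x (y ∷ p))
         (trans (cong (_∷ʳ x) (unfold-reverse y p)) (++-assoc (reverse p) _ _))

zero⊎pos : ∀ n → n ≡ 0 ⊎ 1 ≤ n
zero⊎pos zero = inj₁ refl
zero⊎pos (suc n) = inj₂ (s≤s z≤n)

wt-∈ : ∀ (p : List (Fin N)) {u v} → 1 ≤ wt p u v → u ∈ p × v ∈ p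
wt-∈ (x ∷ q@(y ∷ p)) {u} {v} pos = [ (λ z → let a , b = wt-∈ q (subst (λ k → 1 ≤ k + wt q u v) z pos) in there a , there b)
  , (λ d → case δ-pos {x = x} {y} {u} {v} d of λ where
    (inj₁ (refl , refl)) → here refl , there (here refl)
    (inj₂ (refl , refl)) → there (here refl) , here refl) ]′ (zero⊎pos (δ x y u v))

wt-∉ : ∀ (p : List (Fin N)) {u v} → u ∉ p → wt p u v ≡ 0
wt-∉ p {u} {v} u∉ with wt p u v in eq
... | zero = refl
... | suc _ = contradiction (proj₁ (wt-∈ p (subst (1 ≤_) (sym eq) (s≤s z≤n)))) u∉

-- A step of p, read in the direction given by one of p and reverse p.
wt-step : ∀ (p : List (Fin N)) {u v} → 1 ≤ wt p u v →
          (∃[ A ] ∃[ B ] p ≡ A ++ u ∷ v ∷ B) ⊎ (∃[ A ] ∃[ B ] p ≡ A ++ v ∷ u ∷ B)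
wt-step (x ∷ q@(y ∷ p)) {u} {v} pos = [ (λ z → case wt-step q (subst (λ k → 1 ≤ k + wt q u v) z pos) of λ where
      (inj₁ (A , B , e)) → inj₁ (x ∷ A , B , cong (x ∷_) e)
      (inj₂ (A , B , e)) → inj₂ (x ∷ A , B , cong (x ∷_) e))
  , (λ d → case δ-pos {x = x} {y} {u} {v} d of λ where
    (inj₁ (refl , refl)) → inj₁ ([] , p , refl)
    (inj₂ (refl , refl)) → inj₂ ([] , p , refl)) ]′ (zero⊎pos (δ x y u v))

-- Paths: detours, prolongations, cuts.

IsP : List (Fin N) → Set
IsP p = Unique p × 2 ≤ length p

isP-reverse : {p : List (Fin N)} → IsP p → IsP (reverse p)
isP-reverse {p = p} (u , l) = unique-reverse u , subst (2 ≤_) (sym (length-reverse p)) l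

∈-has-edge : ∀ {p : List (Fin N)} {u} → IsP p → u ∈ p → ∃[ v ] 1 ≤ wt p u v
∈-has-edge {p = x ∷ y ∷ p} {u} ((x≢ ∷ _) , _) (here refl) =
  y , ≤-trans (≤-reflexive (sym (δ-≡ (All.head x≢)))) (m≤m+n _ _)
∈-has-edge {p = x ∷ y ∷ []} {u} ((x≢ ∷ _) , _) (there (here refl)) =
  x , ≤-trans (≤-reflexive (sym (trans (δ-sym x y y x) (δ-≡ (All.head x≢))))) (m≤m+n _ _)
∈-has-edge {p = x ∷ y ∷ z ∷ p} {u} ((_ ∷ un) , _) (there u∈) =
  let v , pos = ∈-has-edge (un , s≤s (s≤s z≤n)) u∈ in v , ≤-trans pos (m≤n+m _ (δ x y u v))
∈-has-edge {p = x ∷ []} (_ , s≤s ()) (here refl)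

WT-pos : ∀ (D : List (List (Fin N))) {u v} → 1 ≤ WT D u v →
         ∃[ A ] ∃[ p ] ∃[ B ] (D ≡ A ++ p ∷ B × 1 ≤ wt p u v)
WT-pos (p ∷ D) {u} {v} pos with wt p u v in eq
... | suc _ = [] , p , D , refl , subst (1 ≤_) (sym eq) (s≤s z≤n)
... | zero = let A , q , B , e , l = WT-pos D pos in p ∷ A , q , B , cong (p ∷_) e , l

WT-∈ : ∀ {D : List (List (Fin N))} {p} → p ∈ D → ∀ u v → wt p u v ≤ WT D u v
WT-∈ (here refl) u v = m≤m+n _ _
WT-∈ {D = q ∷ D} (there p∈) u v = ≤-trans (WT-∈ p∈ u v) (m≤n+m _ (wt q u v))

WT-mid : ∀ (A : List (List (Fin N))) p B u v → WT (A ++ p ∷ B) u v ≡ wt p u v + WT (A ++ B) u v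
WT-mid A p B u v rewrite WT-++ A (p ∷ B) u v | WT-++ A B u v =
  lemma (WT A u v) (wt p u v) (WT B u v)
  where
  lemma : ∀ a b c → a + (b + c) ≡ b + (a + c)
  lemma = solve-∀

Fresh : Fin N → List (List (Fin N)) → Set
Fresh x D = All (x ∉_) D

fresh : ∀ {x : Fin N} {D} → All IsP D → (∀ y → WT D x y ≡ 0) → Fresh x D
fresh {x = x} {[]} [] z = []
fresh {x = x} {p ∷ D} (P ∷ Ps) z =
  (λ x∈ → let v , pos = ∈-has-edge P x∈ in
    case subst (1 ≤_) (ℕ.m+n≡0⇒m≡0 _ (z v)) pos of λ ())
  ∷ fresh Ps (λ y → ℕ.m+n≡0⇒n≡0 (wt p x y) (z y))

-- Replacing the edge cd of one path by a detour through fresh vertices.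
record Subdivided (D : List (List (Fin N))) (c d : Fin N) (I : List (Fin N)) : Set where
  field
    D′     : List (List (Fin N))
    isP    : All IsP D′
    len    : length D′ ≡ length D
    weight : ∀ u v → WT D′ u v + δ c d u v ≡ WT D u v + wt (c ∷ I ∷ʳ d) u v
    fresh′ : ∀ {x} → Fresh x D → x ∉ I → Fresh x D′

mid-All : ∀ {ℓ} {A : Set} {P : A → Set ℓ} (xs : List A) {y ys} → All P (xs ++ y ∷ ys) → All P xs × P y × All P ys
mid-All xs a with Allₚ.++⁻ xs a
... | as , b ∷ bs = as , b , bs

-- Positive weight only says that some path runs through `c d` or `d c`; in the second case the path
-- is reversed first. The lost edge is added on the other side of the weight equation because
-- multiplicities cannot be subtracted.
subdivide : ∀ {D : List (List (Fin N))} {c d} I → All IsP D → 1 ≤ WT D c d →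
            Unique I → (∀ {x} → x ∈ I → Fresh x D) → Subdivided D c d I
subdivide {N} {D} {c} {d} I isPs pos uI fr with WT-pos D pos
... | X , p , Y , refl , pp = go (wt-step p pp)
  where
  parts = mid-All X isPs
  build : ∀ A B → (wt (A ++ c ∷ d ∷ B) ≗₂ wt p) → IsP (A ++ c ∷ d ∷ B) →
          (∀ {x} → x ∉ p → x ∉ A ++ c ∷ d ∷ B) → Subdivided (X ++ p ∷ Y) c d I
  build A B weq (un , _) tr = record
    { D′ = X ++ q ∷ Y
    ; isP = Allₚ.++⁺ (proj₁ parts) ((uq , lq A) ∷ proj₂ (proj₂ parts))
    ; len = trans (length-++ X) (sym (length-++ X))
    ; weight = w
    ; fresh′ = λ {x} f x∉I → let a , b , e = mid-All X f in
        Allₚ.++⁺ a ((λ x∈ → case ∈-resp-↭ perm x∈ of λ x∈′ → case ∈-++⁻ I x∈′ of λ where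
           (inj₁ i) → x∉I i
           (inj₂ i) → tr b i) ∷ e)
    }
    where
    q = A ++ c ∷ I ++ d ∷ B
    -- The new path rearranges `I` together with the old one, so distinctness and freshness can be
    -- read off without looking at positions.
    perm : q ↭ I ++ (A ++ c ∷ d ∷ B)
    perm = subst₂ _↭_ (++-assoc A (c ∷ []) (I ++ d ∷ B))
             (cong (I ++_) (++-assoc A (c ∷ []) (d ∷ B))) (shifts (A ∷ʳ c) I)
      where open import Data.List.Relation.Binary.Permutation.Propositional.Properties using (shifts)
    uq : Unique q
    uq = unique-resp-↭ (↭-sym perm)
           (unique-++ uI un (λ x∈I → tr (proj₁ (proj₂ (mid-All X (fr x∈I))))))
    lq : ∀ A → 2 ≤ length (A ++ c ∷ I ++ d ∷ B)
    lq [] = s≤s (l I)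
      where
      l : ∀ I → 1 ≤ length (I ++ d ∷ B)
      l [] = s≤s z≤n
      l (_ ∷ _) = s≤s z≤n
    lq (a ∷ []) = s≤s (s≤s z≤n)
    lq (a ∷ _ ∷ _) = s≤s (s≤s z≤n)
    w : ∀ u v → WT (X ++ q ∷ Y) u v + δ c d u v ≡ WT (X ++ p ∷ Y) u v + wt (c ∷ I ∷ʳ d) u v
    w u v rewrite WT-mid X q Y u v | WT-mid X p Y u v | sym (weq u v)
                | wt-split A c (I ++ d ∷ B) u v | wt-split A c (d ∷ B) u v
                | wt-split (c ∷ I) d B u v =
      lemma (wt (A ∷ʳ c) u v) (wt (c ∷ I ∷ʳ d) u v) (wt (d ∷ B) u v) (WT (X ++ Y) u v) (δ c d u v)
      where
      lemma : ∀ a i b x e → a + (i + b) + x + e ≡ a + (e + b) + x + i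
      lemma = solve-∀
  go : (∃[ A ] ∃[ B ] p ≡ A ++ c ∷ d ∷ B) ⊎ (∃[ A ] ∃[ B ] p ≡ A ++ d ∷ c ∷ B) → Subdivided (X ++ p ∷ Y) c d I
  go (inj₁ (A , B , refl)) = build A B (λ _ _ → refl) (proj₁ (proj₂ parts)) (λ z → z)
  go (inj₂ (A , B , refl)) =
    build (reverse B) (reverse A) weq (subst IsP eq (isP-reverse (proj₁ (proj₂ parts))))
      (λ x∉ x∈ → x∉ (∈-resp-↭ (↭-reverse (A ++ d ∷ c ∷ B)) (subst (_ ∈_) (sym eq) x∈)))
    where
    eq : reverse (A ++ d ∷ c ∷ B) ≡ reverse B ++ c ∷ d ∷ reverse A
    eq = trans (reverse-++ A (d ∷ c ∷ B)) (trans (cong (_++ reverse A)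
          (trans (unfold-reverse d (c ∷ B)) (trans (cong (_∷ʳ d) (unfold-reverse c B)) (++-assoc (reverse B) _ _))))
          (++-assoc (reverse B) _ _))
    weq : wt (reverse B ++ c ∷ d ∷ reverse A) ≗₂ wt (A ++ d ∷ c ∷ B)
    weq u v = trans (cong (λ l → wt l u v) (sym eq)) (wt-reverse (A ++ d ∷ c ∷ B) u v)

record Extended (D : List (List (Fin N))) (b : Fin N) (I : List (Fin N)) : Set where
  field
    D′     : List (List (Fin N))
    isP    : All IsP D′
    len    : length D′ ≡ length D
    weight : ∀ u v → WT D′ u v ≡ WT D u v + wt (b ∷ I) u v
    fresh′ : ∀ {x} → Fresh x D → x ∉ I → Fresh x D′

-- A vertex of degree one is an end of the path through it.
end-path : ∀ (p : List (Fin N)) {b t} → IsP p → (∀ y → 1 ≤ wt p b y → y ≡ t) → 1 ≤ wt p b t →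
           ∃[ B ] (p ≡ b ∷ B ⊎ reverse p ≡ b ∷ B)
end-path {N} p {b} {t} P only pos = case wt-step p pos of λ where
    (inj₁ (A , B , e)) → let C , e′ = go p A B P only e in C , inj₁ e′
    (inj₂ (A , B , e)) → let C , e′ = go (reverse p) (reverse B) (reverse A) (isP-reverse P)
                                        (λ y l → only y (subst (1 ≤_) (wt-reverse p b y) l))
                                        (rev A B e)
                         in C , inj₂ e′
  where
  rev : ∀ A B → p ≡ A ++ t ∷ b ∷ B → reverse p ≡ reverse B ++ b ∷ t ∷ reverse A
  rev A B refl = trans (reverse-++ A (t ∷ b ∷ B)) (trans (cong (_++ reverse A)
          (trans (unfold-reverse t (b ∷ B)) (trans (cong (_∷ʳ t) (unfold-reverse b B)) (++-assoc (reverse B) _ _))))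
          (++-assoc (reverse B) _ _))
  go : ∀ p A B → IsP p → (∀ y → 1 ≤ wt p b y → y ≡ t) → p ≡ A ++ b ∷ t ∷ B → ∃[ C ] p ≡ b ∷ C
  go p A B P only e with initLast A
  ... | [] = t ∷ B , e
  ... | A′ ∷ʳ′ a = contradiction (only a l) a≢t
    where
    e′ : p ≡ A′ ++ a ∷ b ∷ t ∷ B
    e′ = trans e (++-assoc A′ _ _)
    un : Unique (a ∷ b ∷ t ∷ B)
    un = unique-++⁻ʳ A′ (subst Unique e′ (proj₁ P))
    a≢t : a ≢ t
    a≢t with un
    ... | (_ ∷ q ∷ _) ∷ _ = q
    a≢b : a ≢ b
    a≢b with un
    ... | (q ∷ _) ∷ _ = q
    l : 1 ≤ wt p b a
    l = subst (λ q → 1 ≤ wt q b a) (sym e′) (subst (1 ≤_) (sym (wt-split A′ a (b ∷ t ∷ B) b a))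
          (≤-trans (≤-trans (≤-reflexive (sym (trans (δ-sym a b b a) (δ-≡ a≢b)))) (m≤m+n _ _))
                   (m≤n+m _ (wt (A′ ∷ʳ a) b a))))

-- If the path went on beyond `b`, then `b` would have a second neighbour; so `b` is an end and the
-- detour can be attached there.
extend : ∀ {D : List (List (Fin N))} {b t} I → All IsP D → 1 ≤ WT D b t →
         (∀ y → 1 ≤ WT D b y → y ≡ t) → Unique I → (∀ {x} → x ∈ I → Fresh x D) → Extended D b I
extend {N} {D} {b} {t} I isPs pos only uI fr with WT-pos D pos
... | X , p , Y , refl , pp = go (end-path p (proj₁ (proj₂ (mid-All X isPs))) (λ y l → only y (≤-trans l (WT-∈ (∈-++⁺ʳ X (here refl)) b y))) pp)
  where
  parts = mid-All X isPs
  build : ∀ B → (wt (b ∷ B) ≗₂ wt p) → IsP (b ∷ B) → (∀ {x} → x ∉ p → x ∉ b ∷ B) → Extended (X ++ p ∷ Y) b I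
  build B weq (un , lb) tr = record
    { D′ = X ++ q ∷ Y
    ; isP = Allₚ.++⁺ (proj₁ parts) ((uq , lq) ∷ proj₂ (proj₂ parts))
    ; len = trans (length-++ X) (sym (length-++ X))
    ; weight = w
    ; fresh′ = λ {x} f x∉I → let a , c , e = mid-All X f in
        Allₚ.++⁺ a ((λ x∈ → case ∈-++⁻ (reverse I) x∈ of λ where
           (inj₁ i) → x∉I (∈-resp-↭ (↭-reverse I) i)
           (inj₂ i) → tr c i) ∷ e)
    }
    where
    q = reverse I ++ b ∷ B
    uq : Unique q
    uq = unique-++ (unique-reverse uI) un
          (λ x∈I → tr (proj₁ (proj₂ (mid-All X (fr (∈-resp-↭ (↭-reverse I) x∈I))))))
    lq : 2 ≤ length q
    lq = subst (2 ≤_) (sym (length-++ (reverse I))) (≤-trans lb (m≤n+m _ (length (reverse I))))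
    w : ∀ u v → WT (X ++ q ∷ Y) u v ≡ WT (X ++ p ∷ Y) u v + wt (b ∷ I) u v
    w u v rewrite WT-mid X q Y u v | WT-mid X p Y u v | wt-split (reverse I) b B u v
                | sym (unfold-reverse b I) | wt-reverse (b ∷ I) u v | weq u v =
      lemma (wt (b ∷ I) u v) (wt p u v) (WT (X ++ Y) u v)
      where
      lemma : ∀ i p x → i + p + x ≡ p + x + i
      lemma = solve-∀
  go : (∃[ B ] (p ≡ b ∷ B ⊎ reverse p ≡ b ∷ B)) → Extended (X ++ p ∷ Y) b I
  go (B , inj₁ refl) = build B (λ _ _ → refl) (proj₁ (proj₂ parts)) (λ z → z)
  go (B , inj₂ e) = build B (λ u v → trans (cong (λ l → wt l u v) (sym e)) (wt-reverse p u v))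
    (subst IsP e (isP-reverse (proj₁ (proj₂ parts))))
    (λ x∉ x∈ → x∉ (∈-resp-↭ (↭-reverse p) (subst (_ ∈_) (sym e) x∈)))

record Split (D : List (List (Fin N))) (b : Fin N) (Z Y : List (Fin N)) : Set where
  field
    D′     : List (List (Fin N))
    isP    : All IsP D′
    len    : length D′ ≡ suc (length D)
    weight : ∀ u v → WT D′ u v ≡ WT D u v + (wt (b ∷ Z) u v + wt (b ∷ Y) u v)

-- Cutting at b the path through b, and attaching detours to both halves.
split : ∀ {D : List (List (Fin N))} {b t} z Z y Y → All IsP D → 1 ≤ WT D b t →
        Unique (z ∷ Z) → Unique (y ∷ Y) → (∀ {x} → x ∈ z ∷ Z → Fresh x D) → (∀ {x} → x ∈ y ∷ Y → Fresh x D) →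
        Split D b (z ∷ Z) (y ∷ Y)
split {N} {D} {b} {t} z Z y Y isPs pos uZ uY frZ frY with WT-pos D pos
... | X , p , V , refl , pp with ∈-∃++ (proj₁ (wt-∈ p pp))
...   | A , B , refl = record
  { D′ = q₁ ∷ q₂ ∷ X ++ V
  ; isP = (u₁ , l₁ A) ∷ (u₂ , l₂) ∷ Allₚ.++⁺ (proj₁ parts) (proj₂ (proj₂ parts))
  ; len = cong suc (trans (cong suc (length-++ X)) (sym (trans (length-++ X) (ℕ.+-suc _ _))))
  ; weight = w
  }
  where
  parts = mid-All X isPs
  un = proj₁ (proj₁ (proj₂ parts))
  q₁ = A ++ b ∷ z ∷ Z
  q₂ = reverse (y ∷ Y) ++ b ∷ B
  notIn : ∀ {x} → Fresh x (X ++ (A ++ b ∷ B) ∷ V) → x ∉ A ++ b ∷ B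
  notIn f = proj₁ (proj₂ (mid-All X f))
  u₁ : Unique q₁
  u₁ = subst Unique (++-assoc A (b ∷ []) (z ∷ Z)) (unique-++ (unique-++⁻ˡ (A ∷ʳ b)
         (subst Unique (sym (++-assoc A (b ∷ []) B)) un)) uZ
         (λ x∈ x∈Z → notIn (frZ x∈Z) (subst (_ ∈_) (++-assoc A (b ∷ []) B) (∈-++⁺ˡ x∈))))
  l₁ : ∀ A → 2 ≤ length (A ++ b ∷ z ∷ Z)
  l₁ [] = s≤s (s≤s z≤n)
  l₁ (_ ∷ A) = ≤-trans (l₁ A) (ℕ.n≤1+n _)
  u₂ : Unique q₂
  u₂ = unique-++ (unique-reverse uY) (unique-++⁻ʳ A un)
         (λ x∈ x∈B → notIn (frY (∈-resp-↭ (↭-reverse (y ∷ Y)) x∈)) (∈-++⁺ʳ A x∈B))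
  l₂ : 2 ≤ length q₂
  l₂ = subst (2 ≤_) (sym (trans (length-++ (reverse (y ∷ Y)) {b ∷ B})
         (cong (_+ suc (length B)) (length-reverse (y ∷ Y)))))
         (s≤s (ℕ.≤-trans (s≤s z≤n) (m≤n+m (suc (length B)) (length Y))))
  w : ∀ u v → WT (q₁ ∷ q₂ ∷ X ++ V) u v ≡ WT (X ++ (A ++ b ∷ B) ∷ V) u v + (wt (b ∷ z ∷ Z) u v + wt (b ∷ y ∷ Y) u v)
  w u v rewrite WT-mid X (A ++ b ∷ B) V u v | wt-split A b (z ∷ Z) u v | wt-split (reverse (y ∷ Y)) b B u v
              | sym (unfold-reverse b (y ∷ Y)) | wt-reverse (b ∷ y ∷ Y) u v | wt-split A b B u v =
    lemma (wt (A ∷ʳ b) u v) (wt (b ∷ z ∷ Z) u v) (wt (b ∷ y ∷ Y) u v) (wt (b ∷ B) u v) (WT (X ++ V) u v)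
    where
    lemma : ∀ a z y b x → a + z + (y + b + x) ≡ a + b + x + (z + y)
    lemma = solve-∀

-- Edge balances computed on vertex names.

-- Deciding that two families of walks on named vertices use the same edges.

Code : Set
Code = ℕ × ℕ

norm : Code → Code
norm (i , j) = if i <ᵇ j then (i , j) else (j , i)

edges : List ℕ → List Code
edges [] = []
edges (i ∷ []) = []
edges (i ∷ j ∷ p) = (i , j) ∷ edges (j ∷ p)

_≤ᶜ_ : Code → Code → Bool
(i , j) ≤ᶜ (k , l) = (i <ᵇ k) ∨ ((i ≡ᵇ k) ∧ (j <ᵇ suc l))

insert : Code → List Code → List Code
insert c [] = c ∷ []
insert c (d ∷ ds) = if c ≤ᶜ d then c ∷ d ∷ ds else d ∷ insert c ds

sortCodes : List Code → List Code
sortCodes [] = []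
sortCodes (c ∷ cs) = insert (norm c) (sortCodes cs)

canonical : List (List ℕ) → List Code
canonical ps = sortCodes (concatMap edges ps)

-- The default `d` merely makes the lookup total.
at : List (Fin N) → Fin N → ℕ → Fin N
at [] d _ = d
at (x ∷ ρ) d zero = x
at (x ∷ ρ) d (suc n) = at ρ d n

module _ (ρ : ℕ → Fin N) (u v : Fin N) where

  val : Code → ℕ
  val (i , j) = δ (ρ i) (ρ j) u v

  vals : List Code → ℕ
  vals [] = 0
  vals (c ∷ cs) = val c + vals cs

  val-norm : ∀ c → val (norm c) ≡ val c
  val-norm (i , j) with i <ᵇ j
  ... | true = refl
  ... | false = δ-comm (ρ j) (ρ i) u v

  vals-insert : ∀ c cs → vals (insert c cs) ≡ val c + vals cs
  vals-insert c [] = refl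
  vals-insert c (d ∷ ds) with c ≤ᶜ d
  ... | true = refl
  ... | false rewrite vals-insert c ds = lemma (val c) (val d) (vals ds)
    where
    lemma : ∀ a b c → b + (a + c) ≡ a + (b + c)
    lemma = solve-∀

  vals-sort : ∀ cs → vals (sortCodes cs) ≡ vals cs
  vals-sort [] = refl
  vals-sort (c ∷ cs) rewrite vals-insert (norm c) (sortCodes cs) | val-norm c | vals-sort cs = refl

  vals-++ : ∀ cs ds → vals (cs ++ ds) ≡ vals cs + vals ds
  vals-++ [] ds = refl
  vals-++ (c ∷ cs) ds rewrite vals-++ cs ds = sym (+-assoc (val c) _ _)

  vals-edges : ∀ p → vals (edges p) ≡ wt (map ρ p) u v
  vals-edges [] = refl
  vals-edges (i ∷ []) = refl
  vals-edges (i ∷ j ∷ p) = cong (δ (ρ i) (ρ j) u v +_) (vals-edges (j ∷ p))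

  vals-all : ∀ ps → vals (concatMap edges ps) ≡ WT (map (map ρ) ps) u v
  vals-all [] = refl
  vals-all (p ∷ ps) rewrite vals-++ (edges p) (concatMap edges ps) | vals-edges p | vals-all ps = refl

  -- Sorting normalised codes leaves the multiset of named edges as the only information. Equal
  -- multisets have equal weight under every valuation of the names, so each concrete rearrangement
  -- of edges is checked by `refl`.
  balance : ∀ ps qs → canonical ps ≡ canonical qs → WT (map (map ρ) ps) u v ≡ WT (map (map ρ) qs) u v
  balance ps qs eq = begin
    WT (map (map ρ) ps) u v      ≡⟨ sym (trans (vals-sort (concatMap edges ps)) (vals-all ps)) ⟩
    vals (canonical ps)          ≡⟨ cong vals eq ⟩
    vals (canonical qs)          ≡⟨ trans (vals-sort (concatMap edges qs)) (vals-all qs) ⟩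
    WT (map (map ρ) qs) u v ∎
    where open ≡-Reasoning

-- Graphs of degree at most four; deleting vertices, adding edges.

-- Simple graphs of maximum degree at most four, on the vertices Fin N.
record SG (N : ℕ) : Set where
  no-eta-equality
  field
    adj    : Fin N → Fin N → Bool
    symm   : ∀ u v → adj u v ≡ adj v u
    irr    : ∀ u → adj u u ≡ false
    bound′ : ∀ v {ns} → Unique ns → All (λ u → adj v u ≡ true) ns → length ns ≤ 4
open SG public

-- Being a record, an adjacency determines its graph and its ends even when `adj` computes.
record Adj {N : ℕ} (h : SG N) (u v : Fin N) : Set where
  constructor edge
  field holds : adj h u v ≡ true
open Adj public

bound : (h : SG N) (v : Fin N) {ns : List (Fin N)} → Unique ns → All (Adj h v) ns → length ns ≤ 4
bound h v un al = bound′ h v un (All.map holds al)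

Adj-sym : (h : SG N) {u v : Fin N} → Adj h u v → Adj h v u
Adj-sym h {u} {v} (edge a) = edge (trans (symm h v u) a)

Adj⇒≢ : (h : SG N) {u v : Fin N} → Adj h u v → u ≢ v
Adj⇒≢ h {u} (edge a) refl = case trans (sym a) (irr h u) of λ ()

Adj? : (h : SG N) (u v : Fin N) → Adj h u v ⊎ adj h u v ≡ false
Adj? h u v with adj h u v in eq
... | true = inj₁ (edge eq)
... | false = inj₂ refl

¬Adj : {h : SG N} {u v : Fin N} → Adj h u v → adj h u v ≢ false
¬Adj (edge a) b = case trans (sym a) b of λ ()

¬Adj⇒false : {h : SG N} {u v : Fin N} → ¬ Adj h u v → adj h u v ≡ false
¬Adj⇒false {h = h} {u} {v} n with adj h u v in eq
... | true = contradiction (edge eq) n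
... | false = refl

¬true⇒false : {b : Bool} → b ≢ true → b ≡ false
¬true⇒false {true} n = contradiction refl n
¬true⇒false {false} n = refl

b2n : Bool → ℕ
b2n true = 1
b2n false = 0

⟨_⟩ : SG N → Weight N
⟨ h ⟩ u v = b2n (adj h u v)

⟨⟩-adj : (h : SG N) {u v : Fin N} → Adj h u v → ⟨ h ⟩ u v ≡ 1
⟨⟩-adj h (edge e) = cong b2n e

⟨⟩-¬adj : (h : SG N) {u v : Fin N} → adj h u v ≡ false → ⟨ h ⟩ u v ≡ 0
⟨⟩-¬adj h e = cong b2n e

⟨⟩-pos : (h : SG N) {u v : Fin N} → 1 ≤ ⟨ h ⟩ u v → Adj h u v
⟨⟩-pos h {u} {v} l with adj h u v in eq
... | true = edge eq
⟨⟩-pos h () | false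

-- Deletion isolates `x` instead of shrinking the vertex type, so paths of the reduced graph are
-- paths on the same vertices.
del-adj : Fin N → SG N → Fin N → Fin N → Bool
del-adj x h u v with u ≟ x | v ≟ x
... | no _ | no _ = adj h u v
... | _ | _ = false

del⁻′ : (x : Fin N) (h : SG N) (u v : Fin N) → del-adj x h u v ≡ true → u ≢ x × v ≢ x × Adj h u v
del⁻′ x h u v a with u ≟ x | v ≟ x
... | no p | no q = p , q , edge a
del⁻′ x h u v () | no _ | yes _
del⁻′ x h u v () | yes _ | yes _
del⁻′ x h u v () | yes _ | no _

del⁺′ : (x : Fin N) (h : SG N) {u v : Fin N} → u ≢ x → v ≢ x → del-adj x h u v ≡ adj h u v
del⁺′ x h {u} {v} p q with u ≟ x | v ≟ x
... | no _ | no _ = refl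
... | yes e | _ = contradiction e p
... | no _ | yes e = contradiction e q

opaque
 del : Fin N → SG N → SG N
 del x h = record
   { adj = del-adj x h
   ; symm = λ u v → sy u v
   ; irr = λ u → ¬true⇒false (λ a → Adj⇒≢ h (proj₂ (proj₂ (del⁻′ x h u u a))) refl)
   ; bound′ = λ v un al → bound h v un (All.map (λ {u} a → proj₂ (proj₂ (del⁻′ x h v u a))) al)
   }
   where
   sy : ∀ u v → del-adj x h u v ≡ del-adj x h v u
   sy u v with u ≟ x | v ≟ x
   ... | no _ | no _ = symm h u v
   ... | no _ | yes _ = refl
   ... | yes _ | no _ = refl
   ... | yes _ | yes _ = refl

 del⁺ : (x : Fin N) (h : SG N) {u v : Fin N} → u ≢ x → v ≢ x → Adj h u v → Adj (del x h) u v
 del⁺ x h p q (edge a) = edge (trans (del⁺′ x h p q) a)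

 del⁻ : (x : Fin N) (h : SG N) {u v : Fin N} → Adj (del x h) u v → u ≢ x × v ≢ x × Adj h u v
 del⁻ x h {u} {v} (edge a) = del⁻′ x h u v a

opaque
 dels : List (Fin N) → SG N → SG N
 dels [] h = h
 dels (x ∷ xs) h = dels xs (del x h)

 dels⁻ : (xs : List (Fin N)) (h : SG N) {u v : Fin N} → Adj (dels xs h) u v → u ∉ xs × v ∉ xs × Adj h u v
 dels⁻ [] h a = (λ ()) , (λ ()) , a
 dels⁻ (x ∷ xs) h a =
   let p , q , b = dels⁻ xs (del x h) a
       p′ , q′ , b′ = del⁻ x h b
   in (λ where (here e) → p′ e ; (there i) → p i) , (λ where (here e) → q′ e ; (there i) → q i) , b′

 dels⁺ : (xs : List (Fin N)) (h : SG N) {u v : Fin N} → u ∉ xs → v ∉ xs → Adj h u v → Adj (dels xs h) u v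
 dels⁺ [] h p q a = a
 dels⁺ (x ∷ xs) h p q a = dels⁺ xs (del x h) (p ∘ there) (q ∘ there) (del⁺ x h (p ∘ here) (q ∘ here) a)

star : Fin N → List (Fin N) → List (List (Fin N))
star x ns = map (λ t → x ∷ t ∷ []) ns

-- The order of the list is free, so that each case can name the neighbours as its paths require.
record Nb (h : SG N) (x : Fin N) (ns : List (Fin N)) : Set where
  constructor nbr
  field
    uniq  : Unique ns
    all   : All (Adj h x) ns
    cover : ∀ {u} → Adj h x u → u ∈ ns
open Nb public

too-many : ∀ {h : SG N} {A : Set} {x a b c d e ms} → Nb h x (a ∷ b ∷ c ∷ d ∷ e ∷ ms) → A
too-many {h = h} {x = x} nb = case bound h x (uniq nb) (all nb) of λ where (s≤s (s≤s (s≤s (s≤s ()))))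

Nb-↭ : {h : SG N} {x : Fin N} {ns ms : List (Fin N)} → ns ↭ ms → Nb h x ns → Nb h x ms
Nb-↭ p (nbr u a c) = nbr (unique-resp-↭ p u) (All-resp-↭ p a) (λ e → ∈-resp-↭ p (c e))

Nb-irr : {h : SG N} {x : Fin N} {ns : List (Fin N)} → Nb h x ns → x ∉ ns
Nb-irr {h = h} nb x∈ = Adj⇒≢ h (All.lookup (all nb) x∈) refl

Nb-∉ : {h : SG N} {x u : Fin N} {ns : List (Fin N)} → Nb h x ns → u ∉ ns → adj h x u ≡ false
Nb-∉ nb u∉ = ¬Adj⇒false (u∉ ∘ cover nb)

Nb-del-∉ : {h : SG N} {x v : Fin N} {ns : List (Fin N)} → x ≢ v → Nb h x ns → v ∉ ns → Nb (del v h) x ns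
Nb-del-∉ {h = h} {x} {v} x≢v (nbr u a c) v∉ =
  nbr u (All.tabulate λ {t} t∈ → del⁺ v h x≢v (λ e → v∉ (subst (_∈ _) e t∈)) (All.lookup a t∈))
        (λ e → c (proj₂ (proj₂ (del⁻ v h e))))

Nb-del : {h : SG N} {x v : Fin N} {ns : List (Fin N)} → Nb h x (v ∷ ns) → Nb (del v h) x ns
Nb-del {h = h} {x} {v} nb@(nbr (v≢ ∷ u) (e ∷ a) c) =
  nbr u (All.tabulate λ {t} t∈ → del⁺ v h (Adj⇒≢ h e) (λ eq → All≢⇒∉ v≢ (subst (_∈ _) eq t∈)) (All.lookup a t∈))
        (λ e → case c (proj₂ (proj₂ (del⁻ v h e))) of λ where
           (here eq) → contradiction eq (proj₁ (proj₂ (del⁻ v h e)))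
           (there i) → i)

opaque
 unfolding δ
 star-≢ : ∀ x (ns : List (Fin N)) {u v} → x ≢ u → x ≢ v → WT (star x ns) u v ≡ 0
 star-≢ x [] p q = refl
 star-≢ x (t ∷ ns) p q rewrite ι-≢ p | ι-≢ q = star-≢ x ns p q

 star-hit : ∀ x (ns : List (Fin N)) {v} → x ∉ ns → Unique ns → v ∈ ns → WT (star x ns) x v ≡ 1
 star-miss : ∀ x (ns : List (Fin N)) {v} → x ∉ ns → v ∉ ns → WT (star x ns) x v ≡ 0
 star-hit x (t ∷ ns) x∉ (t≢ ∷ u) (here refl)
   rewrite δ-≡ {x = x} {t} (x∉ ∘ here) | star-miss x ns (x∉ ∘ there) (All≢⇒∉ t≢) = refl
 star-hit x (t ∷ ns) {v} x∉ (t≢ ∷ u) (there v∈) rewrite ι-≢ {x = t} {v} (λ e → All≢⇒∉ t≢ (subst (_∈ ns) (sym e) v∈))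
   | ι-≢ {x = t} {x} (λ e → x∉ (here (sym e))) | ℕ.*-zeroʳ (ι x x) | ℕ.*-zeroʳ (ι x v) = star-hit x ns (x∉ ∘ there) u v∈
 star-miss x [] x∉ v∉ = refl
 star-miss x (t ∷ ns) {v} x∉ v∉ rewrite ι-≢ {x = t} {v} (λ e → v∉ (here (sym e)))
   | ι-≢ {x = t} {x} (λ e → x∉ (here (sym e))) | ℕ.*-zeroʳ (ι x x) | ℕ.*-zeroʳ (ι x v) = star-miss x ns (x∉ ∘ there) (v∉ ∘ there)

opaque
 unfolding del
 del-weight : {h : SG N} {x : Fin N} {ns : List (Fin N)} → Nb h x ns →
              ∀ u v → ⟨ h ⟩ u v ≡ ⟨ del x h ⟩ u v + WT (star x ns) u v
 del-weight {h = h} {x} {ns} nb u v with u ≟ x | v ≟ x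
 ... | no p | no q = sym (trans (cong (⟨ h ⟩ u v +_) (star-≢ x ns (p ∘ sym) (q ∘ sym))) (+-identityʳ _))
 ... | yes refl | _ = at-x v
   where
   at-x : ∀ v → ⟨ h ⟩ x v ≡ WT (star x ns) x v
   at-x v with member? v ns
   ... | yes v∈ = trans (⟨⟩-adj h (All.lookup (all nb) v∈)) (sym (star-hit x ns (Nb-irr nb) (uniq nb) v∈))
   ... | no v∉ = trans (⟨⟩-¬adj h (Nb-∉ nb v∉)) (sym (star-miss x ns (Nb-irr nb) v∉))
 ... | no p | yes refl with member? u ns
 ...   | yes u∈ = trans (cong b2n (symm h u x)) (trans (⟨⟩-adj h (All.lookup (all nb) u∈))
                    (sym (trans (WT-sym (star x ns) u x) (star-hit x ns (Nb-irr nb) (uniq nb) u∈))))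
 ...   | no u∉ = trans (cong b2n (symm h u x)) (trans (⟨⟩-¬adj h (Nb-∉ nb u∉))
                    (sym (trans (WT-sym (star x ns) u x) (star-miss x ns (Nb-irr nb) u∉))))

-- An edge between two stripped vertices is listed once, at whichever end is deleted earlier.
data Strip {N : ℕ} : SG N → List (Fin N) → List (List (Fin N)) → Set where
  []  : ∀ {h} → Strip h [] []
  _∷_ : ∀ {h x ns xs es} → Nb h x ns → Strip (del x h) xs es → Strip h (x ∷ xs) (star x ns ++ es)
infixr 5 _∷_

opaque
 unfolding dels
 strip-weight : {h : SG N} {xs : List (Fin N)} {es : List (List (Fin N))} → Strip h xs es →
                ∀ u v → ⟨ h ⟩ u v ≡ ⟨ dels xs h ⟩ u v + WT es u v
 strip-weight [] u v = sym (+-identityʳ _)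
 strip-weight {h = h} (_∷_ {x = x} {ns} {xs} {es} nb s) u v
   rewrite WT-++ (star x ns) es u v | del-weight nb u v | strip-weight s u v =
     lemma (⟨ dels xs (del x h) ⟩ u v) (WT es u v) (WT (star x ns) u v)
   where
   lemma : ∀ a b c → a + b + c ≡ a + (c + b)
   lemma = solve-∀

-- Degree at most three serves twice: an edge can be added at `c`, and `c` cannot lie in a component
-- K₅.
Room : SG N → Fin N → Set
Room h c = ∀ {ns} → Unique ns → All (Adj h c) ns → length ns ≤ 3

_⊑_ : SG N → SG N → Set
h ⊑ g = ∀ {u v} → Adj h u v → Adj g u v

dels-⊑ : (xs : List (Fin N)) (h : SG N) → dels xs h ⊑ h
dels-⊑ xs h a = proj₂ (proj₂ (dels⁻ xs h a))

record Gap (h : SG N) (c d : Fin N) : Set where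
  constructor gap
  field
    c≢d   : c ≢ d
    apart : adj h c d ≡ false
    roomˡ : Room h c
    roomʳ : Room h d
open Gap public

Is-sym : {c d u t : Fin N} → Is c d u t → Is u t c d
Is-sym (inj₁ (p , q)) = inj₁ (sym p , sym q)
Is-sym (inj₂ (p , q)) = inj₂ (sym q , sym p)

Is-trans : {c d u t e f : Fin N} → Is c d u t → Is u t e f → Is c d e f
Is-trans (inj₁ (refl , refl)) i = i
Is-trans (inj₂ (refl , refl)) (inj₁ (p , q)) = inj₂ (q , p)
Is-trans (inj₂ (refl , refl)) (inj₂ (p , q)) = inj₁ (q , p)

is? : (c d u v : Fin N) → Dec (Is c d u v)
is? c d u v with c ≟ u | d ≟ v | c ≟ v | d ≟ u
... | yes a | yes b | _ | _ = yes (inj₁ (a , b))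
... | _ | _ | yes a | yes b = yes (inj₂ (a , b))
... | no a | _ | no b | _ = no ([ (λ (p , _) → a p) , (λ (p , _) → b p) ]′)
... | no a | _ | yes _ | no b = no ([ (λ (p , _) → a p) , (λ (_ , p) → b p) ]′)
... | yes _ | no a | no b | _ = no ([ (λ (_ , p) → a p) , (λ (p , _) → b p) ]′)
... | yes _ | no a | yes _ | no b = no ([ (λ (_ , p) → a p) , (λ (_ , p) → b p) ]′)

Is-flip : {c d u v : Fin N} → Is c d u v → Is c d v u
Is-flip (inj₁ (a , b)) = inj₂ (a , b)
Is-flip (inj₂ (a , b)) = inj₁ (a , b)

add-adj : Fin N → Fin N → SG N → Fin N → Fin N → Bool
add-adj c d h u v = does (is? c d u v) ∨ adj h u v

add⁻′ : (c d : Fin N) (h : SG N) (u v : Fin N) → add-adj c d h u v ≡ true → Adj h u v ⊎ Is c d u v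
add⁻′ c d h u v a with is? c d u v
... | yes i = inj₂ i
... | no _ = inj₁ (edge a)

extract : {x : Fin N} {ns : List (Fin N)} → x ∈ ns → ∃[ ms ] ns ↭ x ∷ ms
extract {x = x} x∈ with ∈-∃++ x∈
... | A , B , refl = A ++ B , shift x A B

opaque
 add : (c d : Fin N) (h : SG N) → Gap h c d → SG N
 add {N} c d h gp = record
   { adj = add-adj c d h
   ; symm = sy
   ; irr = λ u → ¬true⇒false (λ a → case add⁻′ c d h u u a of
       [ (λ b → Adj⇒≢ h b refl)
       , [ (λ (p , q) → c≢d gp (trans p (sym q))) , (λ (p , q) → c≢d gp (trans p (sym q))) ]′ ]′)
   ; bound′ = bd
   }
   where
   sy : ∀ u v → add-adj c d h u v ≡ add-adj c d h v u
   sy u v with is? c d u v | is? c d v u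
   ... | yes _ | yes _ = refl
   ... | no _ | no _ = symm h u v
   ... | yes i | no n = contradiction (Is-flip i) n
   ... | no n | yes i = contradiction (Is-flip i) n
   old : ∀ {v ns} {P : Fin N → Set} → (∀ {t} → Is c d v t → ¬ P t) → All P ns →
         All (λ u → add-adj c d h v u ≡ true) ns → All (Adj h v) ns
   old n [] [] = []
   old {v} {t ∷ ns} n (p ∷ ps) (a ∷ al) = ([ (λ b → b) , (λ i → contradiction p (n i)) ]′ (add⁻′ c d h v t a)) ∷ old n ps al
   one : ∀ {v e ns} → Room h v → (∀ {t} → Is c d v t → t ≡ e) → Unique ns →
         All (λ u → add-adj c d h v u ≡ true) ns → length ns ≤ 4
   one {v} {e} {ns} rm o un al with member? e ns
   ... | no e∉ = ≤-trans (rm un (old {P = e ≢_} (λ i ne → ne (sym (o i))) (∉⇒All≢ e∉) al)) (ℕ.n≤1+n 3)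
   ... | yes e∈ with extract e∈
   ...   | ms , p with unique-resp-↭ p un | All-resp-↭ p al
   ...     | e≢ ∷ un′ | _ ∷ al′ = subst (_≤ 4) (sym (↭-length p)) (s≤s (rm un′ (old {P = e ≢_} (λ i ne → ne (sym (o i))) e≢ al′)))
   bd : ∀ v {ns} → Unique ns → All (λ u → add-adj c d h v u ≡ true) ns → length ns ≤ 4
   bd v {ns} un al with v ≟ c | v ≟ d
   ... | yes refl | _ = one {e = d} (roomˡ gp) ([ (λ (_ , q) → sym q) , (λ (_ , q) → contradiction (sym q) (c≢d gp)) ]′) un al
   ... | no _ | yes refl = one {e = c} (roomʳ gp) ([ (λ (q , _) → contradiction q (c≢d gp)) , (λ (q , _) → sym q) ]′) un al
   ... | no p | no q = bound h v un (old {P = λ _ → Fin N} (λ where (inj₁ (e , _)) _ → p (sym e) ; (inj₂ (_ , e)) _ → q (sym e)) (All.universal (λ x → x) ns) al)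

 add⁻ : {c d : Fin N} {h : SG N} (gp : Gap h c d) {u v : Fin N} → Adj (add c d h gp) u v → Adj h u v ⊎ Is c d u v
 add⁻ {c = c} {d} {h} gp {u} {v} (edge a) = add⁻′ c d h u v a

 add⁺ : {c d : Fin N} {h : SG N} (gp : Gap h c d) {u v : Fin N} → Adj h u v → Adj (add c d h gp) u v
 add⁺ {c = c} {d} {h} gp {u} {v} (edge a) = edge ad
   where
   ad : add-adj c d h u v ≡ true
   ad with is? c d u v
   ... | yes _ = refl
   ... | no _ = a

 add-new : {c d : Fin N} {h : SG N} (gp : Gap h c d) → Adj (add c d h gp) c d
 add-new {c = c} {d} {h} gp = edge ad
   where
   ad : add-adj c d h c d ≡ true
   ad with is? c d c d
   ... | yes _ = refl
   ... | no n = contradiction (inj₁ (refl , refl)) n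

 add-weight : {c d : Fin N} {h : SG N} (gp : Gap h c d) → ∀ u v → ⟨ add c d h gp ⟩ u v ≡ ⟨ h ⟩ u v + δ c d u v
 add-weight {c = c} {d} {h} gp u v with is? c d u v
 ... | no n = sym (trans (cong (⟨ h ⟩ u v +_) (δ-≢ n)) (+-identityʳ _))
 ... | yes (inj₁ (refl , refl)) rewrite apart gp = sym (δ-≡ (c≢d gp))
 ... | yes (inj₂ (refl , refl)) rewrite symm h d c | apart gp = sym (trans (δ-sym c d d c) (δ-≡ (c≢d gp)))

-- Exceptional components.

-- Exceptional components: K₃, and K₅ with or without the edge pq.

Closed : SG N → List (Fin N) → Set
Closed h S = ∀ {u v} → u ∈ S → Adj h u v → v ∈ S

record Near5 {N : ℕ} (h : SG N) (p q x y z : Fin N) : Set where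
  constructor near5
  field
    p≢q : p ≢ q
    px  : Adj h p x
    py  : Adj h p y
    pz  : Adj h p z
    qx  : Adj h q x
    qy  : Adj h q y
    qz  : Adj h q z
    xy  : Adj h x y
    xz  : Adj h x z
    yz  : Adj h y z

data Exc {N : ℕ} (h : SG N) : List (Fin N) → Set where
  k3 : ∀ {a b c} → Adj h a b → Adj h a c → Adj h b c → Closed h (a ∷ b ∷ c ∷ []) → Exc h (a ∷ b ∷ c ∷ [])
  k5 : ∀ {p q x y z} → Near5 h p q x y z → Closed h (p ∷ q ∷ x ∷ y ∷ z ∷ []) → Exc h (p ∷ q ∷ x ∷ y ∷ z ∷ [])

exc-closed : {h : SG N} {S : List (Fin N)} → Exc h S → Closed h S
exc-closed (k3 _ _ _ c) = c
exc-closed (k5 _ c) = c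

exc-unique : {h : SG N} {S : List (Fin N)} → Exc h S → Unique S
exc-unique {h = h} (k3 a b c _) = (Adj⇒≢ h a ∷ Adj⇒≢ h b ∷ []) ∷ (Adj⇒≢ h c ∷ []) ∷ [] ∷ []
exc-unique {h = h} (k5 (near5 n a b c d e f i j k) _) = (n ∷ Adj⇒≢ h a ∷ Adj⇒≢ h b ∷ Adj⇒≢ h c ∷ [])
  ∷ (Adj⇒≢ h d ∷ Adj⇒≢ h e ∷ Adj⇒≢ h f ∷ []) ∷ (Adj⇒≢ h i ∷ Adj⇒≢ h j ∷ []) ∷ (Adj⇒≢ h k ∷ []) ∷ [] ∷ []

exc-transport : {h g : SG N} {S : List (Fin N)} → (∀ {u v} → u ∈ S → v ∈ S → Adj h u v → Adj g u v) →
                (∀ {u v} → u ∈ S → Adj g u v → Adj h u v) → Exc h S → Exc g S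
exc-transport f b (k3 i j k c) = k3 (f (here refl) (there (here refl)) i) (f (here refl) (there (there (here refl))) j)
  (f (there (here refl)) (there (there (here refl))) k) (λ u∈ a → c u∈ (b u∈ a))
exc-transport f b (k5 (near5 n p₁ p₂ p₃ q₁ q₂ q₃ r s t) c) = k5
  (near5 n (f P X p₁) (f P Y p₂) (f P Z p₃) (f Q X q₁) (f Q Y q₂) (f Q Z q₃) (f X Y r) (f X Z s) (f Y Z t))
  (λ u∈ a → c u∈ (b u∈ a))
  where
  P = here refl
  Q = there (here refl)
  X = there (there (here refl))
  Y = there (there (there (here refl)))
  Z = there (there (there (there (here refl))))

-- This excludes isolated and pendant vertices from exceptional components, and it leaves a second
-- way on when one neighbour must be avoided.
exc-degree : {h : SG N} {S : List (Fin N)} {u : Fin N} → Exc h S → u ∈ S →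
             ∃[ s ] ∃[ t ] (s ≢ t × Adj h u s × Adj h u t)
exc-degree {h = h} (k3 i j k c) (here refl) = _ , _ , Adj⇒≢ h k , i , j
exc-degree {h = h} (k3 i j k c) (there (here refl)) = _ , _ , Adj⇒≢ h j , Adj-sym h i , k
exc-degree {h = h} (k3 i j k c) (there (there (here refl))) = _ , _ , Adj⇒≢ h i , Adj-sym h j , Adj-sym h k
exc-degree {h = h} (k5 (near5 n p₁ p₂ p₃ q₁ q₂ q₃ r s t) c) (here refl) = _ , _ , Adj⇒≢ h r , p₁ , p₂
exc-degree {h = h} (k5 (near5 n p₁ p₂ p₃ q₁ q₂ q₃ r s t) c) (there (here refl)) = _ , _ , Adj⇒≢ h r , q₁ , q₂
exc-degree {h = h} (k5 (near5 n p₁ p₂ p₃ q₁ q₂ q₃ r s t) c) (there (there (here refl))) = _ , _ , Adj⇒≢ h t , r , s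
exc-degree {h = h} (k5 (near5 n p₁ p₂ p₃ q₁ q₂ q₃ r s t) c) (there (there (there (here refl)))) = _ , _ , Adj⇒≢ h s , Adj-sym h r , t
exc-degree {h = h} (k5 (near5 n p₁ p₂ p₃ q₁ q₂ q₃ r s t) c) (there (there (there (there (here refl))))) = _ , _ , Adj⇒≢ h r , Adj-sym h s , Adj-sym h t

-- Used contrapositively: a lifted edge joining two otherwise separate parts is in no triangle,
-- hence in no exceptional component.
exc-triangle : {h : SG N} {S : List (Fin N)} {u v : Fin N} → Exc h S → u ∈ S → Adj h u v →
               ∃[ t ] (Adj h u t × Adj h v t)
exc-triangle {h = h} {u = u} {v} E u∈ a = go E u∈ (exc-closed E u∈ a) a
  where
  S = Adj-sym h
  ir : ∀ {A : Set} {x} → Adj h x x → A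
  ir e = contradiction refl (Adj⇒≢ h e)
  go : ∀ {S u v} → Exc h S → u ∈ S → v ∈ S → Adj h u v → ∃[ t ] (Adj h u t × Adj h v t)
  go (k3 i j k _) (here refl) (here refl) e = ir e
  go (k3 i j k _) (here refl) (there (here refl)) e = _ , j , k
  go (k3 i j k _) (here refl) (there (there (here refl))) e = _ , i , S k
  go (k3 i j k _) (there (here refl)) (here refl) e = _ , k , j
  go (k3 i j k _) (there (here refl)) (there (here refl)) e = ir e
  go (k3 i j k _) (there (here refl)) (there (there (here refl))) e = _ , S i , S j
  go (k3 i j k _) (there (there (here refl))) (here refl) e = _ , S k , i
  go (k3 i j k _) (there (there (here refl))) (there (here refl)) e = _ , S j , S i
  go (k3 i j k _) (there (there (here refl))) (there (there (here refl))) e = ir e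
  go (k5 (near5 n p₁ p₂ p₃ q₁ q₂ q₃ r s t) _) (here refl) w e = pw w e
    where
    pw : ∀ {w} → w ∈ _ ∷ _ ∷ _ ∷ _ ∷ _ ∷ [] → Adj h _ w → ∃[ t ] (Adj h _ t × Adj h w t)
    pw (here refl) e = ir e
    pw (there (here refl)) e = _ , p₁ , q₁
    pw (there (there (here refl))) e = _ , p₂ , r
    pw (there (there (there (here refl)))) e = _ , p₁ , S r
    pw (there (there (there (there (here refl))))) e = _ , p₁ , S s
  go (k5 (near5 n p₁ p₂ p₃ q₁ q₂ q₃ r s t) _) (there (here refl)) w e = qw w e
    where
    qw : ∀ {w} → w ∈ _ ∷ _ ∷ _ ∷ _ ∷ _ ∷ [] → Adj h _ w → ∃[ t ] (Adj h _ t × Adj h w t)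
    qw (here refl) e = _ , q₁ , p₁
    qw (there (here refl)) e = ir e
    qw (there (there (here refl))) e = _ , q₂ , r
    qw (there (there (there (here refl)))) e = _ , q₁ , S r
    qw (there (there (there (there (here refl))))) e = _ , q₁ , S s
  go (k5 (near5 n p₁ p₂ p₃ q₁ q₂ q₃ r s t) _) (there (there (here refl))) w e = xw w e
    where
    xw : ∀ {w} → w ∈ _ ∷ _ ∷ _ ∷ _ ∷ _ ∷ [] → Adj h _ w → ∃[ t ] (Adj h _ t × Adj h w t)
    xw (here refl) e = _ , r , p₂
    xw (there (here refl)) e = _ , r , q₂
    xw (there (there (here refl))) e = ir e
    xw (there (there (there (here refl)))) e = _ , s , t
    xw (there (there (there (there (here refl))))) e = _ , r , S t
  go (k5 (near5 n p₁ p₂ p₃ q₁ q₂ q₃ r s t) _) (there (there (there (here refl)))) w e = yw w e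
    where
    yw : ∀ {w} → w ∈ _ ∷ _ ∷ _ ∷ _ ∷ _ ∷ [] → Adj h _ w → ∃[ t ] (Adj h _ t × Adj h w t)
    yw (here refl) e = _ , t , p₃
    yw (there (here refl)) e = _ , t , q₃
    yw (there (there (here refl))) e = _ , t , s
    yw (there (there (there (here refl)))) e = ir e
    yw (there (there (there (there (here refl))))) e = _ , S r , S s
  go (k5 (near5 n p₁ p₂ p₃ q₁ q₂ q₃ r s t) _) (there (there (there (there (here refl))))) w e = zw w e
    where
    zw : ∀ {w} → w ∈ _ ∷ _ ∷ _ ∷ _ ∷ _ ∷ [] → Adj h _ w → ∃[ t ] (Adj h _ t × Adj h w t)
    zw (here refl) e = _ , S t , p₂
    zw (there (here refl)) e = _ , S t , q₂
    zw (there (there (here refl))) e = _ , S t , r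
    zw (there (there (there (here refl)))) e = _ , S s , S r
    zw (there (there (there (there (here refl))))) e = ir e

-- The statement proved by induction.

-- `W` may also contain isolated vertices; its length, not the number of non-isolated vertices, is
-- the order that enters the bound.
Supp : SG N → List (Fin N) → Set
Supp h W = ∀ {u v} → Adj h u v → u ∈ W

Good : SG N → ℕ → Set
Good h k = ∃[ D ] (All IsP D × length D ≤ k × (WT D ≗₂ ⟨ h ⟩))

Result : SG N → ℕ → Set
Result h k = Good h k ⊎ ∃[ S ] Exc h S

Below : (N : ℕ) → ℕ → Set
Below N n = ∀ (h : SG N) {W} → Unique W → length W < n → Supp h W → Result h ⌊ length W /2⌋

removeAll : {xs W : List (Fin N)} → Unique xs → All (_∈ W) xs → ∃[ W′ ] W ↭ xs ++ W′
removeAll {W = W} [] [] = W , ↭-refl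
removeAll {xs = x ∷ xs} (x≢ ∷ un) (x∈ ∷ xs∈) with extract x∈
... | W₁ , p with removeAll {xs = xs} {W₁} un
      (All.tabulate λ {y} y∈ → case ∈-resp-↭ p (All.lookup xs∈ y∈) of λ where
        (here eq) → contradiction (subst (_∈ xs) eq y∈) (All≢⇒∉ x≢)
        (there i) → i)
...   | W₂ , q = W₂ , ↭-trans p (prep x q)

∉-rest : {xs W W′ : List (Fin N)} → W ↭ xs ++ W′ → ∀ {u} → u ∈ W → u ∉ xs → u ∈ W′
∉-rest {xs = xs} p u∈ u∉ = case ∈-++⁻ xs (∈-resp-↭ p u∈) of
  [ (λ i → contradiction i u∉)
  , (λ i → i) ]′

Supp-dels : {h : SG N} {xs W W′ : List (Fin N)} → Supp h W → W ↭ xs ++ W′ → Supp (dels xs h) W′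
Supp-dels {h = h} {xs} s p a = let u∉ , _ , b = dels⁻ xs h a in ∉-rest p (s b) u∉

-- Absorption of exceptional components.

WTv : ∀ {r} → Vec (List (Fin N)) r → Weight N
WTv Ns = WT (Vec.toList Ns)

End : Fin N → List (Fin N) → Set
End a p = (∃[ q ] p ≡ a ∷ q) ⊎ (∃[ q ] reverse p ≡ a ∷ q)

-- The exceptional component S can be absorbed: the i-th new path ends at a ∈ S
-- and may be continued along ax, which is not one of the lifted edges prot.
record Touch {N r : ℕ} (h : SG N) (Ns : Vec (List (Fin N)) r) (prot : List (Fin N × Fin N)) (S : List (Fin N)) : Set where
  constructor touching
  field
    i    : Fin r
    a x  : Fin N
    end  : End a (Vec.lookup Ns i)
    a∈   : a ∈ S
    ax   : Adj h a x
    x∉   : x ∉ Vec.lookup Ns i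
    rm   : Room h a
    free : All (λ cd → ¬ Is a x (proj₁ cd) (proj₂ cd)) prot

-- Only the total weight is fixed, as edges may pass from `h` to the new paths. `kept` says that the
-- protected pairs did not pass over, so their edges still lie on old paths; `below` keeps the old
-- paths away from vertices that are isolated in `h`.
record Absorbed {N r : ℕ} (h : SG N) (k : ℕ) (Ns : Vec (List (Fin N)) r) (prot : List (Fin N × Fin N)) : Set where
  field
    D      : List (List (Fin N))
    Ns′    : Vec (List (Fin N)) r
    isP    : All IsP D
    isN    : All IsP (Vec.toList Ns′)
    len    : length D ≤ k
    weight : ∀ u v → WT D u v + WTv Ns′ u v ≡ ⟨ h ⟩ u v + WTv Ns u v
    kept   : All (λ cd → WT D (proj₁ cd) (proj₂ cd) ≡ ⟨ h ⟩ (proj₁ cd) (proj₂ cd)) prot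
    below  : ∀ u v → WT D u v ≤ ⟨ h ⟩ u v

-- Paths covering an exceptional component except for its edge ax.
record Peel {N : ℕ} (h : SG N) (S : List (Fin N)) (a x : Fin N) : Set where
  field
    D      : List (List (Fin N))
    isP    : All IsP D
    len    : length S ≡ suc (length D + length D)
    weight : ∀ u v → WT D u v + δ a x u v + ⟨ dels S h ⟩ u v ≡ ⟨ h ⟩ u v

dels-↭ : {h : SG N} {S S′ : List (Fin N)} → S ↭ S′ → ∀ u v → ⟨ dels S h ⟩ u v ≡ ⟨ dels S′ h ⟩ u v
dels-↭ {h = h} {S} {S′} p u v with Adj? (dels S h) u v | Adj? (dels S′ h) u v
... | inj₁ a | inj₁ b = trans (⟨⟩-adj (dels S h) a) (sym (⟨⟩-adj (dels S′ h) b))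
... | inj₂ a | inj₂ b = trans (⟨⟩-¬adj (dels S h) a) (sym (⟨⟩-¬adj (dels S′ h) b))
... | inj₁ a | inj₂ b = let i , j , e = dels⁻ S h a in
  contradiction b (¬Adj (dels⁺ S′ h (i ∘ ∈-resp-↭ (↭-sym p)) (j ∘ ∈-resp-↭ (↭-sym p)) e))
... | inj₂ a | inj₁ b = let i , j , e = dels⁻ S′ h b in
  contradiction a (¬Adj (dels⁺ S h (i ∘ ∈-resp-↭ p) (j ∘ ∈-resp-↭ p) e))

peel-↭ : {h : SG N} {S S′ : List (Fin N)} {a x : Fin N} → S′ ↭ S → Peel h S a x → Peel h S′ a x
peel-↭ {h = h} p P = record
  { D = D ; isP = isP ; len = trans (↭-length p) len
  ; weight = λ u v → trans (cong (WT D u v + _ +_) (dels-↭ {h = h} p u v)) (weight u v) }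
  where open Peel P

peel-flip : {h : SG N} {S : List (Fin N)} {a x : Fin N} → Peel h S a x → Peel h S x a
peel-flip {h = h} {S} {a} {x} P = record
  { D = D ; isP = isP ; len = len
  ; weight = λ u v → trans (cong (λ k → WT D u v + k + ⟨ dels S h ⟩ u v) (δ-comm x a u v)) (weight u v) }
  where open Peel P

closed-↭ : {h : SG N} {S S′ : List (Fin N)} → S ↭ S′ → Closed h S → Closed h S′
closed-↭ p c u∈ a = ∈-resp-↭ p (c (∈-resp-↭ (↭-sym p) u∈) a)

nb-closed : {h : SG N} {x : Fin N} {ns : List (Fin N)} → Unique ns → All (Adj h x) ns → Closed h (x ∷ ns) → Nb h x ns
nb-closed {h = h} un al c = nbr un al λ e → case c (here refl) e of λ where
  (here eq) → contradiction (sym eq) (Adj⇒≢ h e)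
  (there i) → i

mapAt : List (Fin N) → Fin N → List (List ℕ) → List (List (Fin N))
mapAt ρ d = map (map (at ρ d))

infix 4 _≈_
record _≈_ {N : ℕ} (ps qs : List (List (Fin N))) : Set where
  constructor same
  field weights : ∀ u v → WT ps u v ≡ WT qs u v
open _≈_ public

balanced : (ρ : List (Fin N)) (d : Fin N) (is js : List (List ℕ)) {ps qs : List (List (Fin N))} →
           ps ≡ mapAt ρ d is → qs ≡ mapAt ρ d js → canonical is ≡ canonical js → ps ≈ qs
balanced ρ d is js refl refl eq = same λ u v → balance (at ρ d) u v is js eq

peel-weight : {h : SG N} {S : List (Fin N)} {es D : List (List (Fin N))} {a x : Fin N} →
              Strip h S es → es ≈ (a ∷ x ∷ []) ∷ D →
              ∀ u v → WT D u v + δ a x u v + ⟨ dels S h ⟩ u v ≡ ⟨ h ⟩ u v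
peel-weight {h = h} {S} {es} {D} {a} {x} st eq u v
  rewrite strip-weight st u v | weights eq u v =
    lemma (WT D u v) (δ a x u v) (⟨ dels S h ⟩ u v)
  where
  lemma : ∀ d e s → d + e + s ≡ s + (e + 0 + d)
  lemma = solve-∀

peel3 : {h : SG N} {a x y : Fin N} → Adj h a x → Adj h a y → Adj h x y → Closed h (a ∷ x ∷ y ∷ []) →
        Peel h (a ∷ x ∷ y ∷ []) a x
peel3 {h = h} {a} {x} {y} i j k c = record
  { D = (a ∷ y ∷ x ∷ []) ∷ []
  ; isP = (((Adj⇒≢ h j ∷ Adj⇒≢ h i ∷ []) ∷ (Adj⇒≢ h (Adj-sym h k) ∷ []) ∷ [] ∷ []) , s≤s (s≤s z≤n)) ∷ []
  ; len = refl
  ; weight = peel-weight st (balanced (a ∷ x ∷ y ∷ []) a ((0 ∷ 1 ∷ []) ∷ (0 ∷ 2 ∷ []) ∷ (1 ∷ 2 ∷ []) ∷ [])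
        ((0 ∷ 1 ∷ []) ∷ (0 ∷ 2 ∷ 1 ∷ []) ∷ []) refl refl refl)
  }
  where
  S = Adj-sym h
  na : Nb h a (x ∷ y ∷ [])
  na = nb-closed ((Adj⇒≢ h k ∷ []) ∷ [] ∷ []) (i ∷ j ∷ []) c
  nx : Nb h x (a ∷ y ∷ [])
  nx = nb-closed ((Adj⇒≢ h j ∷ []) ∷ [] ∷ []) (S i ∷ k ∷ []) (closed-↭ (swap a x ↭-refl) c)
  ny : Nb h y (a ∷ x ∷ [])
  ny = nb-closed ((Adj⇒≢ h i ∷ []) ∷ [] ∷ []) (S j ∷ S k ∷ []) (closed-↭ (++-comm (a ∷ x ∷ []) (y ∷ [])) c)
  st : Strip h (a ∷ x ∷ y ∷ []) _
  st = na ∷ Nb-del nx ∷ Nb-del (Nb-del ny) ∷ []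

-- K₅⁻ without one edge has eight edges, so two paths covering it must both be Hamiltonian. Up to
-- symmetry the removed edge either meets the missing pair `p q` or lies in the triangle `x y z`,
-- which gives the two explicit pairs of paths.
module K5⁻ {N : ℕ} {h : SG N} {p q x y z : Fin N} (nr : Near5 h p q x y z) (pq : adj h p q ≡ false)
           (c : Closed h (p ∷ q ∷ x ∷ y ∷ z ∷ [])) where
  private
    S : ∀ {u v} → Adj h u v → Adj h v u
    S = Adj-sym h
    ne : ∀ {u v} → Adj h u v → u ≢ v
    ne = Adj⇒≢ h

  open Near5 nr

  np : Nb h p (x ∷ y ∷ z ∷ [])
  np = nbr ((ne xy ∷ ne xz ∷ []) ∷ (ne yz ∷ []) ∷ [] ∷ []) (px ∷ py ∷ pz ∷ []) λ e → case c (here refl) e of λ where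
    (here eq) → contradiction (sym eq) (ne e)
    (there (here refl)) → contradiction pq (¬Adj e)
    (there (there i)) → i
  nq : Nb h q (x ∷ y ∷ z ∷ [])
  nq = nbr ((ne xy ∷ ne xz ∷ []) ∷ (ne yz ∷ []) ∷ [] ∷ []) (qx ∷ qy ∷ qz ∷ []) λ e → case c (there (here refl)) e of λ where
    (here refl) → contradiction pq (¬Adj (S e))
    (there (here eq)) → contradiction (sym eq) (ne e)
    (there (there i)) → i
  nx : Nb h x (p ∷ q ∷ y ∷ z ∷ [])
  nx = nb-closed ((p≢q ∷ ne py ∷ ne pz ∷ []) ∷ (ne qy ∷ ne qz ∷ []) ∷ (ne yz ∷ []) ∷ [] ∷ []) (S px ∷ S qx ∷ xy ∷ xz ∷ [])
         (closed-↭ (shift x (p ∷ q ∷ []) (y ∷ z ∷ [])) c)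
  ny : Nb h y (p ∷ q ∷ x ∷ z ∷ [])
  ny = nb-closed ((p≢q ∷ ne px ∷ ne pz ∷ []) ∷ (ne qx ∷ ne qz ∷ []) ∷ (ne xz ∷ []) ∷ [] ∷ []) (S py ∷ S qy ∷ S xy ∷ yz ∷ [])
         (closed-↭ (shift y (p ∷ q ∷ x ∷ []) (z ∷ [])) c)
  nz : Nb h z (p ∷ q ∷ x ∷ y ∷ [])
  nz = nb-closed ((p≢q ∷ ne px ∷ ne py ∷ []) ∷ (ne qx ∷ ne qy ∷ []) ∷ (ne xy ∷ []) ∷ [] ∷ []) (S pz ∷ S qz ∷ S xz ∷ S yz ∷ [])
         (closed-↭ (shift z (p ∷ q ∷ x ∷ y ∷ []) []) c)

  strip5 : Strip h (p ∷ q ∷ x ∷ y ∷ z ∷ [])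
             (star p (x ∷ y ∷ z ∷ []) ++ star q (x ∷ y ∷ z ∷ []) ++ star x (y ∷ z ∷ []) ++ star y (z ∷ []) ++ [])
  strip5 = np ∷ Nb-del-∉ (p≢q ∘ sym) nq p∉ ∷ Nb-del (Nb-del nx) ∷ Nb-del (Nb-del (Nb-del ny)) ∷ Nb-del (Nb-del (Nb-del (Nb-del nz))) ∷ []
    where
    p∉ : p ∉ x ∷ y ∷ z ∷ []
    p∉ (here e) = ne px e
    p∉ (there (here e)) = ne py e
    p∉ (there (there (here e))) = ne pz e

  peel-px : Peel h (p ∷ q ∷ x ∷ y ∷ z ∷ []) p x
  peel-px = record
    { D = (p ∷ y ∷ z ∷ q ∷ x ∷ []) ∷ (p ∷ z ∷ x ∷ y ∷ q ∷ []) ∷ []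
    ; isP = ((((ne py ∷ ne pz ∷ p≢q ∷ ne px ∷ []) ∷ (ne yz ∷ ne (S qy) ∷ ne (S xy) ∷ []) ∷ (ne (S qz) ∷ ne (S xz) ∷ []) ∷ (ne qx ∷ []) ∷ [] ∷ [])) , s≤s (s≤s z≤n))
          ∷ ((((ne pz ∷ ne px ∷ ne py ∷ p≢q ∷ []) ∷ (ne (S xz) ∷ ne (S yz) ∷ ne (S qz) ∷ []) ∷ (ne xy ∷ ne (S qx) ∷ []) ∷ (ne (S qy) ∷ []) ∷ [] ∷ [])) , s≤s (s≤s z≤n)) ∷ []
    ; len = refl
    ; weight = peel-weight strip5 (balanced (p ∷ q ∷ x ∷ y ∷ z ∷ []) p
        ((0 ∷ 2 ∷ []) ∷ (0 ∷ 3 ∷ []) ∷ (0 ∷ 4 ∷ []) ∷ (1 ∷ 2 ∷ []) ∷ (1 ∷ 3 ∷ []) ∷ (1 ∷ 4 ∷ []) ∷ (2 ∷ 3 ∷ []) ∷ (2 ∷ 4 ∷ []) ∷ (3 ∷ 4 ∷ []) ∷ [])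
        ((0 ∷ 2 ∷ []) ∷ (0 ∷ 3 ∷ 4 ∷ 1 ∷ 2 ∷ []) ∷ (0 ∷ 4 ∷ 2 ∷ 3 ∷ 1 ∷ []) ∷ []) refl refl refl)
    }

  peel-xy : Peel h (p ∷ q ∷ x ∷ y ∷ z ∷ []) x y
  peel-xy = record
    { D = (p ∷ x ∷ q ∷ z ∷ y ∷ []) ∷ (x ∷ z ∷ p ∷ y ∷ q ∷ []) ∷ []
    ; isP = ((((ne px ∷ p≢q ∷ ne pz ∷ ne py ∷ []) ∷ (ne (S qx) ∷ ne xz ∷ ne xy ∷ []) ∷ (ne qz ∷ ne qy ∷ []) ∷ (ne (S yz) ∷ []) ∷ [] ∷ [])) , s≤s (s≤s z≤n))
          ∷ ((((ne xz ∷ ne (S px) ∷ ne xy ∷ ne (S qx) ∷ []) ∷ (ne (S pz) ∷ ne (S yz) ∷ ne (S qz) ∷ []) ∷ (ne py ∷ p≢q ∷ []) ∷ (ne (S qy) ∷ []) ∷ [] ∷ [])) , s≤s (s≤s z≤n)) ∷ []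
    ; len = refl
    ; weight = peel-weight strip5 (balanced (p ∷ q ∷ x ∷ y ∷ z ∷ []) p
        ((0 ∷ 2 ∷ []) ∷ (0 ∷ 3 ∷ []) ∷ (0 ∷ 4 ∷ []) ∷ (1 ∷ 2 ∷ []) ∷ (1 ∷ 3 ∷ []) ∷ (1 ∷ 4 ∷ []) ∷ (2 ∷ 3 ∷ []) ∷ (2 ∷ 4 ∷ []) ∷ (3 ∷ 4 ∷ []) ∷ [])
        ((2 ∷ 3 ∷ []) ∷ (0 ∷ 2 ∷ 1 ∷ 4 ∷ 3 ∷ []) ∷ (2 ∷ 4 ∷ 0 ∷ 3 ∷ 1 ∷ []) ∷ []) refl refl refl)
    }

near-pq : {h : SG N} {p q x y z : Fin N} → Near5 h p q x y z → Near5 h q p x y z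
near-pq (near5 n a b c d e f i j k) = near5 (n ∘ sym) d e f a b c i j k

near-xy : {h : SG N} {p q x y z : Fin N} → Near5 h p q x y z → Near5 h p q y x z
near-xy {h = h} (near5 n a b c d e f i j k) = near5 n b a c e d f (Adj-sym h i) k j

near-yz : {h : SG N} {p q x y z : Fin N} → Near5 h p q x y z → Near5 h p q x z y
near-yz {h = h} (near5 n a b c d e f i j k) = near5 n a c b d f e j i (Adj-sym h k)

room-≠4 : {h : SG N} {a s t u v : Fin N} → Room h a → Unique (s ∷ t ∷ u ∷ v ∷ []) → All (Adj h a) (s ∷ t ∷ u ∷ v ∷ []) → ⊥
room-≠4 rm un al = case rm un al of λ where (s≤s (s≤s (s≤s ())))

module _ {N : ℕ} {h : SG N} where

  private
    PeelAt : List (Fin N) → Fin N → Fin N → Set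
    PeelAt = Peel h

    irx : ∀ {A : Set} {x} → Adj h x x → A
    irx e = contradiction refl (Adj⇒≢ h e)

    module Five {p q x y z : Fin N} (nr : Near5 h p q x y z) (pq : adj h p q ≡ false)
                (c : Closed h (p ∷ q ∷ x ∷ y ∷ z ∷ [])) where
      S5 : List (Fin N)
      S5 = p ∷ q ∷ x ∷ y ∷ z ∷ []
      σpq = swap {xs = x ∷ y ∷ z ∷ []} p q ↭-refl
      σxy = λ (p q : Fin N) → prep p (prep q (swap {xs = z ∷ []} x y ↭-refl))
      σxz : ∀ p q → p ∷ q ∷ x ∷ y ∷ z ∷ [] ↭ p ∷ q ∷ z ∷ y ∷ x ∷ []
      σxz p q = ↭-sym (prep p (prep q (↭-reverse (x ∷ y ∷ z ∷ []))))
      σyz = λ (p q : Fin N) → prep p (prep q (prep x (swap {xs = []} y z ↭-refl)))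
      σx→z : ∀ p q → p ∷ q ∷ x ∷ y ∷ z ∷ [] ↭ p ∷ q ∷ y ∷ z ∷ x ∷ []
      σx→z p q = prep p (prep q (++-comm (x ∷ []) (y ∷ z ∷ [])))
      qp = trans (symm h q p) pq
      near-xz : ∀ {p q} → Near5 h p q x y z → Near5 h p q z y x
      near-xz n = near-xy (near-yz (near-xy n))
      near-rot : ∀ {p q} → Near5 h p q x y z → Near5 h p q y z x
      near-rot n = near-yz (near-xy n)

      px : PeelAt S5 p x
      px = K5⁻.peel-px nr pq c
      py : PeelAt S5 p y
      py = peel-↭ (σxy p q) (K5⁻.peel-px (near-xy nr) pq (closed-↭ (σxy p q) c))
      pz : PeelAt S5 p z
      pz = peel-↭ (σxz p q) (K5⁻.peel-px (near-xz nr) pq (closed-↭ (σxz p q) c))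
      qx : PeelAt S5 q x
      qx = peel-↭ σpq (K5⁻.peel-px (near-pq nr) qp (closed-↭ σpq c))
      qy : PeelAt S5 q y
      qy = peel-↭ σ (K5⁻.peel-px (near-xy (near-pq nr)) qp (closed-↭ σ c))
        where σ = ↭-trans σpq (σxy q p)
      qz : PeelAt S5 q z
      qz = peel-↭ σ (K5⁻.peel-px (near-xz (near-pq nr)) qp (closed-↭ σ c))
        where σ = ↭-trans σpq (σxz q p)
      xy : PeelAt S5 x y
      xy = K5⁻.peel-xy nr pq c
      xz : PeelAt S5 x z
      xz = peel-↭ (σyz p q) (K5⁻.peel-xy (near-yz nr) pq (closed-↭ (σyz p q) c))
      yz : PeelAt S5 y z
      yz = peel-↭ (σx→z p q) (K5⁻.peel-xy (near-rot nr) pq (closed-↭ (σx→z p q) c))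

      go : ∀ {a b} → a ∈ S5 → b ∈ S5 → Adj h a b → PeelAt S5 a b
      go (here refl) (here refl) e = irx e
      go (here refl) (there (here refl)) e = contradiction pq (¬Adj e)
      go (here refl) (there (there (here refl))) e = px
      go (here refl) (there (there (there (here refl)))) e = py
      go (here refl) (there (there (there (there (here refl))))) e = pz
      go (there (here refl)) (here refl) e = contradiction pq (¬Adj (Adj-sym h e))
      go (there (here refl)) (there (here refl)) e = irx e
      go (there (here refl)) (there (there (here refl))) e = qx
      go (there (here refl)) (there (there (there (here refl)))) e = qy
      go (there (here refl)) (there (there (there (there (here refl))))) e = qz
      go (there (there (here refl))) (here refl) e = peel-flip px
      go (there (there (here refl))) (there (here refl)) e = peel-flip qx
      go (there (there (here refl))) (there (there (here refl))) e = irx e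
      go (there (there (here refl))) (there (there (there (here refl)))) e = xy
      go (there (there (here refl))) (there (there (there (there (here refl))))) e = xz
      go (there (there (there (here refl)))) (here refl) e = peel-flip py
      go (there (there (there (here refl)))) (there (here refl)) e = peel-flip qy
      go (there (there (there (here refl)))) (there (there (here refl))) e = peel-flip xy
      go (there (there (there (here refl)))) (there (there (there (here refl)))) e = irx e
      go (there (there (there (here refl)))) (there (there (there (there (here refl))))) e = yz
      go (there (there (there (there (here refl))))) (here refl) e = peel-flip pz
      go (there (there (there (there (here refl))))) (there (here refl)) e = peel-flip qz
      go (there (there (there (there (here refl))))) (there (there (here refl))) e = peel-flip xz
      go (there (there (there (there (here refl))))) (there (there (there (here refl)))) e = peel-flip yz
      go (there (there (there (there (here refl))))) (there (there (there (there (here refl))))) e = irx e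

    three : ∀ {a b c s t} → Adj h a b → Adj h a c → Adj h b c → Closed h (a ∷ b ∷ c ∷ []) →
            s ∈ a ∷ b ∷ c ∷ [] → t ∈ a ∷ b ∷ c ∷ [] → Adj h s t → PeelAt (a ∷ b ∷ c ∷ []) s t
    three {a} {b} {c} i j k cl s∈ t∈ e = go s∈ t∈ {e}
      where
      S = Adj-sym h
      σ₁ : a ∷ b ∷ c ∷ [] ↭ a ∷ c ∷ b ∷ []
      σ₁ = prep a (swap b c ↭-refl)
      σ₂ : a ∷ b ∷ c ∷ [] ↭ b ∷ c ∷ a ∷ []
      σ₂ = ++-comm (a ∷ []) (b ∷ c ∷ [])
      ab = peel3 i j k cl
      ac = peel-↭ σ₁ (peel3 j i (S k) (closed-↭ σ₁ cl))
      bc = peel-↭ σ₂ (peel3 k (S i) (S j) (closed-↭ {h = h} σ₂ cl))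
      go : ∀ {s t} → s ∈ a ∷ b ∷ c ∷ [] → t ∈ a ∷ b ∷ c ∷ [] → {Adj h s t} → PeelAt (a ∷ b ∷ c ∷ []) s t
      go (here refl) (here refl) {e} = irx e
      go (here refl) (there (here refl)) = ab
      go (here refl) (there (there (here refl))) = ac
      go (there (here refl)) (here refl) = peel-flip ab
      go (there (here refl)) (there (here refl)) {e} = irx e
      go (there (here refl)) (there (there (here refl))) = bc
      go (there (there (here refl))) (here refl) = peel-flip ac
      go (there (there (here refl))) (there (here refl)) = peel-flip bc
      go (there (there (here refl))) (there (there (here refl))) {e} = irx e

  IsK5 : List (Fin N) → Set
  IsK5 S = ∃[ p ] ∃[ q ] ∃[ x ] ∃[ y ] ∃[ z ] (S ≡ p ∷ q ∷ x ∷ y ∷ z ∷ [] × Near5 h p q x y z × Adj h p q)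

  -- K₅ needs an outcome of its own: without one edge it still has nine edges, and two paths on five
  -- vertices cover at most eight.
  peel? : ∀ {S a x} → Exc h S → a ∈ S → Adj h a x → Peel h S a x ⊎ IsK5 S
  peel? (k3 i j k c) a∈ e = inj₁ (three i j k c a∈ (c a∈ e) e)
  peel? (k5 {p} {q} nr c) a∈ e with Adj? h p q
  ... | inj₂ pq = inj₁ (Five.go nr pq c a∈ (c a∈ e) e)
  ... | inj₁ pq = inj₂ (_ , _ , _ , _ , _ , refl , nr , pq)

  K5-full : ∀ {S a} → Room h a → IsK5 S → a ∈ S → ⊥
  K5-full {a = a} rm (p , q , x , y , z , refl , near5 n p₁ p₂ p₃ q₁ q₂ q₃ r s t , pq) a∈ = full a∈
    where
    Sy = Adj-sym h
    ne : ∀ {u v} → Adj h u v → u ≢ v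
    ne = Adj⇒≢ h
    full : a ∈ p ∷ q ∷ _ ∷ _ ∷ _ ∷ [] → ⊥
    full (here refl) = room-≠4 rm ((ne q₁ ∷ ne q₂ ∷ ne q₃ ∷ []) ∷ (ne r ∷ ne s ∷ []) ∷ (ne t ∷ []) ∷ [] ∷ []) (pq ∷ p₁ ∷ p₂ ∷ p₃ ∷ [])
    full (there (here refl)) = room-≠4 rm ((ne p₁ ∷ ne p₂ ∷ ne p₃ ∷ []) ∷ (ne r ∷ ne s ∷ []) ∷ (ne t ∷ []) ∷ [] ∷ []) (Sy pq ∷ q₁ ∷ q₂ ∷ q₃ ∷ [])
    full (there (there (here refl))) = room-≠4 rm ((ne pq ∷ ne p₂ ∷ ne p₃ ∷ []) ∷ (ne q₂ ∷ ne q₃ ∷ []) ∷ (ne t ∷ []) ∷ [] ∷ []) (Sy p₁ ∷ Sy q₁ ∷ r ∷ s ∷ [])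
    full (there (there (there (here refl)))) = room-≠4 rm ((ne pq ∷ ne p₁ ∷ ne p₃ ∷ []) ∷ (ne q₁ ∷ ne q₃ ∷ []) ∷ (ne s ∷ []) ∷ [] ∷ []) (Sy p₂ ∷ Sy q₂ ∷ Sy r ∷ t ∷ [])
    full (there (there (there (there (here refl))))) = room-≠4 rm ((ne pq ∷ ne p₁ ∷ ne p₂ ∷ []) ∷ (ne q₁ ∷ ne q₂ ∷ []) ∷ (ne r ∷ []) ∷ [] ∷ []) (Sy p₃ ∷ Sy q₃ ∷ Sy s ∷ Sy t ∷ [])

  peel : ∀ {S a x} → Exc h S → a ∈ S → Adj h a x → Room h a → Peel h S a x
  peel E a∈ e rm with peel? E a∈ e
  ... | inj₁ P = P
  ... | inj₂ K = ⊥-elim (K5-full rm K a∈)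

-- The component has 2k + 1 vertices and is charged k paths; its odd vertex can only raise the
-- rounded half.
⌊/2⌋-peel : ∀ {d k s w w′} → d ≤ ⌊ w′ /2⌋ → s ≡ suc (k + k) → w ≡ s + w′ → k + d ≤ ⌊ w /2⌋
⌊/2⌋-peel {d} {k} {_} {_} {w′} d≤ refl refl = ≤-trans (ℕ.+-monoʳ-≤ k d≤)
  (≤-trans (≤-reflexive (twice k w′)) (ℕ.⌊n/2⌋-mono (ℕ.n≤1+n _)))
  where
  twice : ∀ k w → k + ⌊ w /2⌋ ≡ ⌊ k + k + w /2⌋
  twice zero w = refl
  twice (suc k) w rewrite ℕ.+-suc k k = cong suc (twice k w)

WTv-update : ∀ {r} (Ns : Vec (List (Fin N)) r) (i : Fin r) {q e} u v →
             wt q u v ≡ e + wt (Vec.lookup Ns i) u v → WTv (Ns Vec.[ i ]≔ q) u v ≡ e + WTv Ns u v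
WTv-update (n ∷ Ns) Fin.zero {q} {e} u v eq rewrite eq = +-assoc e _ _
WTv-update (n ∷ Ns) (Fin.suc i) {q} {e} u v eq = trans (cong (wt n u v +_) (WTv-update Ns i {q} {e} u v eq)) (lemma (wt n u v) e (WTv Ns u v))
  where
  lemma : ∀ a b c → a + (b + c) ≡ b + (a + c)
  lemma = solve-∀

All-update : ∀ {P : List (Fin N) → Set} {r} (Ns : Vec (List (Fin N)) r) (i : Fin r) {q} →
             All P (Vec.toList Ns) → P q → All P (Vec.toList (Ns Vec.[ i ]≔ q))
All-update (n ∷ Ns) Fin.zero (_ ∷ ps) p = p ∷ ps
All-update (n ∷ Ns) (Fin.suc i) (p′ ∷ ps) p = p′ ∷ All-update Ns i ps p

All-lookup : ∀ {P : List (Fin N) → Set} {r} (Ns : Vec (List (Fin N)) r) (i : Fin r) →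
             All P (Vec.toList Ns) → P (Vec.lookup Ns i)
All-lookup (n ∷ Ns) Fin.zero (p ∷ _) = p
All-lookup (n ∷ Ns) (Fin.suc i) (_ ∷ ps) = All-lookup Ns i ps

-- Lengthening a path at one end leaves its other end unchanged.
record Longer (p : List (Fin N)) (a x : Fin N) : Set where
  field
    q      : List (Fin N)
    isP    : IsP q
    weight : ∀ u v → wt q u v ≡ δ a x u v + wt p u v
    ends   : ∀ {b} → b ≢ a → End b p → End b q
    ∉q     : ∀ {y} → y ≢ x → y ∉ p → y ∉ q

longer : ∀ {p : List (Fin N)} {a x} → IsP p → End a p → x ∉ p → Longer p a x
longer {N} {p} {a} {x} (un , l) (inj₁ (r , refl)) x∉ = record
  { q = x ∷ a ∷ r ; isP = (∉⇒All≢ x∉ ∷ un) , s≤s (s≤s z≤n)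
  ; weight = λ u v → cong (_+ wt (a ∷ r) u v) (δ-comm x a u v)
  ; ends = λ where
      b≢a (inj₁ (_ , refl)) → contradiction refl b≢a
      b≢a (inj₂ (s , e)) → inj₂ (s ∷ʳ x , trans (unfold-reverse x (a ∷ r)) (cong (_∷ʳ x) e))
  ; ∉q = λ where
      y≢x y∉ (here e) → y≢x e
      y≢x y∉ (there i) → y∉ i }
longer {N} {p} {a} {x} (un , l) (inj₂ (r , e)) x∉ = record
  { q = x ∷ reverse p
  ; isP = (∉⇒All≢ (x∉ ∘ ∈-resp-↭ (↭-reverse p)) ∷ unique-reverse un) , s≤s (subst (1 ≤_) (sym (length-reverse p)) (≤-trans (s≤s z≤n) l))
  ; weight = λ u v → trans (cong (λ t → wt (x ∷ t) u v) e)
      (cong₂ _+_ (δ-comm x a u v) (trans (cong (λ t → wt t u v) (sym e)) (wt-reverse p u v)))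
  ; ends = λ where
      b≢a (inj₁ (s , refl)) → inj₂ (s ∷ʳ x , trans (unfold-reverse x (reverse (_ ∷ s))) (cong (_∷ʳ x) (reverse-involutive (_ ∷ s))))
      b≢a (inj₂ (s , e′)) → contradiction (∷-injˡ (trans (sym e′) e)) b≢a
  ; ∉q = λ where
      y≢x y∉ (here e) → y≢x e
      y≢x y∉ (there i) → y∉ (∈-resp-↭ (↭-reverse p) i) }
  where
  ∷-injˡ : ∀ {a b : Fin N} {as bs : List (Fin N)} → a ∷ as ≡ b ∷ bs → a ≡ b
  ∷-injˡ refl = refl

exc-⊆ : {h : SG N} {S W : List (Fin N)} → Supp h W → Exc h S → All (_∈ W) S
exc-⊆ sp E = All.tabulate λ u∈ → let _ , _ , _ , a , _ = exc-degree E u∈ in sp a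

-- Deleting a whole component changes no edge elsewhere, so the exceptional components of the
-- remainder are the other ones of `h`.
exc-dels : {h : SG N} {S S′ : List (Fin N)} → Exc h S → Exc (dels S h) S′ → Exc h S′ × Disj S′ S
exc-dels {h = h} {S} E E′ =
  exc-transport (λ _ _ → dels-⊑ S h) (λ u∈ e → dels⁺ S h (dis u∈) (λ v∈ → dis u∈ (exc-closed E v∈ (Adj-sym h e))) e) E′ , dis
  where
  dis : ∀ {u} → u ∈ _ → u ∉ S
  dis u∈ = let _ , _ , _ , b , _ = exc-degree E′ u∈ in proj₁ (dels⁻ S h b)

-- New paths may be lengthened into the exceptional components that they end
-- in; what remains of such a component is not exceptional.
absorb : ∀ {n r} (h : SG N) {W} → Below N n → Unique W → length W < n → Supp h W →
         (Ns : Vec (List (Fin N)) r) → All IsP (Vec.toList Ns) → (prot : List (Fin N × Fin N)) →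
         (U : List (Fin N) → Set) → (∀ {S} → Exc h S → Touch h Ns prot S ⊎ U S) →
         Absorbed h ⌊ length W /2⌋ Ns prot ⊎ ∃[ S ] (Exc h S × U S)
absorb {N} {n} {r} h₀ {W₀} below-n un₀ <n₀ sp₀ Ns₀ isN₀ prot U touch₀ =
  go (length W₀) h₀ ≤-refl un₀ <n₀ sp₀ Ns₀ isN₀ touch₀
  where
  -- `m` bounds the number of vertices left and decreases with each absorbed component.
  go : ∀ m (h : SG N) {W} → length W ≤ m → Unique W → length W < n → Supp h W →
       (Ns : Vec (List (Fin N)) r) → All IsP (Vec.toList Ns) →
       (∀ {S} → Exc h S → Touch h Ns prot S ⊎ U S) →
       Absorbed h ⌊ length W /2⌋ Ns prot ⊎ ∃[ S ] (Exc h S × U S)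
  go m h {W} W≤m un <n sp Ns isN touch with below-n h un <n sp
  ... | inj₁ (D , isP , len , w) = inj₁ record
    { D = D ; Ns′ = Ns ; isP = isP ; isN = isN ; len = len
    ; weight = λ u v → cong (_+ WTv Ns u v) (w u v)
    ; kept = All.universal (λ cd → w (proj₁ cd) (proj₂ cd)) prot
    ; below = λ u v → ≤-reflexive (w u v) }
  ... | inj₂ (S , E) with touch E
  ...   | inj₂ t = inj₂ (S , E , t)
  ...   | inj₁ t = step m W≤m
    where
    open Touch t
    P = peel E a∈ ax rm
    L = longer (All-lookup Ns i isN) end x∉
    module P = Peel P
    module L = Longer L
    h′ = dels S h
    rmv = removeAll (exc-unique E) (exc-⊆ sp E)
    W′ = proj₁ rmv
    W↭ : W ↭ S ++ W′
    W↭ = proj₂ rmv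
    lenW : length W ≡ length S + length W′
    lenW = trans (↭-length W↭) (length-++ S)
    Ns₁ = Ns Vec.[ i ]≔ L.q
    lift-exc : ∀ {S′} → Exc h′ S′ → Exc h S′ × Disj S′ S
    lift-exc = exc-dels E
    -- What was promised for another component `S′` survives: `S′` is disjoint from `S`, so its
    -- entry vertex is not `a` and its next vertex is not `x`, even if the same path has just been
    -- prolonged.
    touch′ : ∀ {S′} → Exc h′ S′ → Touch h′ Ns₁ prot S′ ⊎ U S′
    touch′ {S′} E′ with lift-exc E′
    ... | E″ , dis with touch E″
    ...   | inj₂ t = inj₂ t
    ...   | inj₁ (touching j b y end′ b∈ by y∉ rm′ free′) = inj₁ (tch (j Fin.≟ i))
      where
      y∈ : y ∈ S′
      y∈ = exc-closed E″ b∈ by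
      by′ : Adj h′ b y
      by′ = dels⁺ S h (dis b∈) (dis y∈) by
      b≢a : b ≢ a
      b≢a refl = dis b∈ a∈
      y≢x : y ≢ x
      y≢x refl = dis y∈ (exc-closed E a∈ ax)
      rm″ : Room h′ b
      rm″ un al = rm′ un (All.map (dels-⊑ S h) al)
      tch : Dec (j ≡ i) → Touch h′ Ns₁ prot S′
      tch (yes refl) = touching i b y (subst (End b) (sym (Vecₚ.lookup∘update i Ns L.q)) (L.ends b≢a end′)) b∈ by′
        (subst (y ∉_) (sym (Vecₚ.lookup∘update i Ns L.q)) (L.∉q y≢x y∉)) rm″ free′
      tch (no j≢i) = touching j b y (subst (End b) (sym (Vecₚ.lookup∘update′ j≢i Ns L.q)) end′) b∈ by′
        (subst (y ∉_) (sym (Vecₚ.lookup∘update′ j≢i Ns L.q)) y∉) rm″ free′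
    len′ : length W′ < length W
    len′ = subst (length W′ <_) (sym (trans lenW (cong (_+ length W′) P.len))) (s≤s (m≤n+m _ _))
    combine : Absorbed h′ ⌊ length W′ /2⌋ Ns₁ prot → Absorbed h ⌊ length W /2⌋ Ns prot
    combine A = record
      { D = P.D ++ R.D ; Ns′ = R.Ns′ ; isP = Allₚ.++⁺ P.isP R.isP ; isN = R.isN
      ; len = subst (_≤ _) (sym (length-++ P.D)) (⌊/2⌋-peel R.len P.len lenW)
      ; weight = λ u v → trans (cong (_+ WTv R.Ns′ u v) (WT-++ P.D R.D u v)) (trans (+-assoc (WT P.D u v) _ _)
          (trans (cong (WT P.D u v +_) (trans (R.weight u v) (cong (⟨ h′ ⟩ u v +_) (WTv-update Ns i u v (L.weight u v)))))
            (trans (lemma (WT P.D u v) (⟨ h′ ⟩ u v) (δ a x u v) (WTv Ns u v)) (cong (_+ WTv Ns u v) (P.weight u v)))))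
      -- A protected pair is not `ax`, the one edge of `S` that the peeled paths leave out.
      ; kept = All.tabulate λ {cd} cd∈ → let c , d = cd in
          trans (WT-++ P.D R.D c d) (trans (cong (WT P.D c d +_) (All.lookup R.kept cd∈))
            (trans (cong (_+ ⟨ h′ ⟩ c d) (sym (trans (cong (WT P.D c d +_) (δ-≢ (All.lookup free cd∈))) (+-identityʳ _))))
              (P.weight c d)))
      ; below = λ u v → subst₂ _≤_ (sym (WT-++ P.D R.D u v)) (P.weight u v)
          (ℕ.+-mono-≤ (m≤m+n (WT P.D u v) _) (R.below u v)) }
      where
      module R = Absorbed A
      lemma : ∀ p h e n → p + (h + (e + n)) ≡ p + e + h + n
      lemma = solve-∀
    step : ∀ m → length W ≤ m → Absorbed h ⌊ length W /2⌋ Ns prot ⊎ ∃[ S ] (Exc h S × U S)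
    step zero W≤0 = case ≤-trans len′ W≤0 of λ ()
    step (suc m) W≤m with go m h′ (ℕ.≤-pred (≤-trans len′ W≤m))
                            (unique-++⁻ʳ S (unique-resp-↭ W↭ un))
                            (ℕ.<-trans len′ <n) (Supp-dels sp W↭) Ns₁
                            (All-update Ns i isN L.isP) touch′
    ... | inj₁ A = inj₁ (combine A)
    ... | inj₂ (S′ , E′ , t) = inj₂ (S′ , proj₁ (lift-exc E′) , t)

-- Distinctness of named vertices, decided on their names.

memberᵇ : ℕ → List ℕ → Bool
memberᵇ i [] = false
memberᵇ i (j ∷ js) = (i ≡ᵇ j) ∨ memberᵇ i js

distinctᵇ : ℕ → List ℕ → Bool
distinctᵇ b [] = true
distinctᵇ b (i ∷ is) = (i <ᵇ b) ∧ not (memberᵇ i is) ∧ distinctᵇ b is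

∧-true : ∀ {a b} → a ∧ b ≡ true → a ≡ true × b ≡ true
∧-true {true} {true} _ = refl , refl

at-∈ : (ρ : List (Fin N)) (d : Fin N) (i : ℕ) → (i <ᵇ length ρ) ≡ true → at ρ d i ∈ ρ
at-∈ (x ∷ ρ) d zero _ = here refl
at-∈ (x ∷ ρ) d (suc i) l = there (at-∈ ρ d i l)

at-≢ : {ρ : List (Fin N)} (d : Fin N) (i j : ℕ) → Unique ρ → (i <ᵇ length ρ) ≡ true → (j <ᵇ length ρ) ≡ true →
       (i ≡ᵇ j) ≡ false → at ρ d i ≢ at ρ d j
at-≢ {ρ = x ∷ ρ} d zero (suc j) (x≢ ∷ _) _ l _ = All.lookup x≢ (at-∈ ρ d j l)
at-≢ {ρ = x ∷ ρ} d (suc i) zero (x≢ ∷ _) l _ _ e = All.lookup x≢ (at-∈ ρ d i l) (sym e)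
at-≢ {ρ = x ∷ ρ} d (suc i) (suc j) (_ ∷ u) k l ne = at-≢ d i j u k l ne

named-unique : {ρ : List (Fin N)} (d : Fin N) (is : List ℕ) → Unique ρ → distinctᵇ (length ρ) is ≡ true →
               Unique (map (at ρ d) is)
named-unique d [] u _ = []
named-unique {ρ = ρ} d (i ∷ is) u t with ∧-true {i <ᵇ length ρ} t
... | il , t′ with ∧-true {not (memberᵇ i is)} t′
...   | nm , di = go is nm di ∷ named-unique d is u di
  where
  go : ∀ js → not (memberᵇ i js) ≡ true → distinctᵇ (length ρ) js ≡ true → All (at ρ d i ≢_) (map (at ρ d) js)
  go [] _ _ = []
  go (j ∷ js) n t with i ≡ᵇ j in e | ∧-true {j <ᵇ length ρ} t
  ... | false | jl , t″ = at-≢ d i j u il jl e ∷ go js n (proj₂ (∧-true {not (memberᵇ j js)} t″))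

named : (ρ : List (Fin N)) (d : Fin N) (i j : ℕ) (is : List ℕ) {p : List (Fin N)} → p ≡ map (at ρ d) (i ∷ j ∷ is) →
        Unique ρ → distinctᵇ (length ρ) (i ∷ j ∷ is) ≡ true → IsP p
named ρ d i j is refl u t = named-unique d (i ∷ j ∷ is) u t , s≤s (s≤s z≤n)

-- Putting removed vertices back on old paths.

-- Detours: an edge cd of the reduced graph stands for the path c I d, and a
-- path ending at the pendant vertex b is continued through I.

data Job (N : ℕ) : Set where
  lft : (c d : Fin N) (I : List (Fin N)) → Job N
  pnd : (b t : Fin N) (I : List (Fin N)) → Job N

jobPath interior : Job N → List (Fin N)
jobPath (lft c d I) = c ∷ I ∷ʳ d
jobPath (pnd b t I) = b ∷ I
interior (lft c d I) = I
interior (pnd b t I) = I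

jobPair : Job N → Fin N × Fin N
jobPair (lft c d I) = c , d
jobPair (pnd b t I) = b , t

lifts : List (Job N) → List (Fin N × Fin N)
lifts [] = []
lifts (lft c d I ∷ js) = (c , d) ∷ lifts js
lifts (pnd b t I ∷ js) = lifts js

Δ : List (Fin N × Fin N) → Weight N
Δ [] u v = 0
Δ ((c , d) ∷ ls) u v = δ c d u v + Δ ls u v

Ready : (Fin N → Fin N → ℕ) → Job N → Set
Ready w (lft c d I) = 1 ≤ w c d
Ready w (pnd b t I) = 1 ≤ w b t × (∀ y → 1 ≤ w b y → y ≡ t)

Outside : List (Fin N) → Job N → Set
Outside I j = proj₁ (jobPair j) ∉ I

-- Jobs are done in list order, so the condition is one-sided: the earlier job must leave the later
-- one ready. Prolonging a path only adds edges and never spoils a later lift.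
Indep : Job N → Job N → Set
Indep (lft c d _) (lft c′ d′ _) = ¬ Is c d c′ d′
Indep (lft c d _) (pnd b _ _) = b ≢ c × b ≢ d
Indep (pnd _ _ _) (lft _ _ _) = ⊤
Indep (pnd b _ _) (pnd b′ _ _) = b′ ≢ b

record Worked {N : ℕ} (D : List (List (Fin N))) (js : List (Job N)) : Set where
  field
    D′     : List (List (Fin N))
    isP    : All IsP D′
    len    : length D′ ≡ length D
    weight : ∀ u v → WT D′ u v + Δ (lifts js) u v ≡ WT D u v + WT (map jobPath js) u v

unique-++⁻-disj : ∀ (xs : List (Fin N)) {ys} → Unique (xs ++ ys) → Disj xs ys
unique-++⁻-disj (x ∷ xs) (x≢ ∷ u) (here refl) y∈ = All.lookup (Allₚ.++⁻ʳ xs x≢) y∈ refl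
unique-++⁻-disj (x ∷ xs) (_ ∷ u) (there i) y∈ = unique-++⁻-disj xs u i y∈

work : (js : List (Job N)) {D : List (List (Fin N))} → All IsP D → All (Ready (WT D)) js → AllPairs Indep js →
       Unique (concatMap interior js) → (∀ {x} → x ∈ concatMap interior js → Fresh x D) →
       All (Outside (concatMap interior js)) js → Worked D js
work [] {D} isP _ _ _ _ _ = record { D′ = D ; isP = isP ; len = refl ; weight = λ _ _ → refl }
work (lft c d I ∷ js) {D} isP (r ∷ rs) (ind ∷ inds) un fr (_ ∷ out) = record
  { D′ = R.D′ ; isP = R.isP ; len = trans R.len Sd.len
  ; weight = λ u v → trans (lemma₁ (WT R.D′ u v) (δ c d u v) _) (trans (cong (_+ δ c d u v) (R.weight u v))
      (trans (lemma₂ (WT Sd.D′ u v) (WT (map jobPath js) u v) (δ c d u v))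
        (trans (cong (_+ WT (map jobPath js) u v) (Sd.weight u v)) (+-assoc (WT D u v) _ _)))) }
  where
  dj = unique-++⁻-disj I un
  sd = subdivide I isP r (unique-++⁻ˡ I un) (fr ∘ ∈-++⁺ˡ)
  module Sd = Subdivided sd
  ready : ∀ {j} → Ready (WT D) j → Indep (lft c d I) j → Outside (I ++ concatMap interior js) j → Ready (WT Sd.D′) j
  ready {lft c′ d′ _} r i _ = ≤-trans r (≤-trans (m≤m+n _ _) (≤-reflexive (trans (sym (Sd.weight c′ d′))
    (trans (cong (WT Sd.D′ c′ d′ +_) (δ-≢ i)) (+-identityʳ _)))))
  ready {pnd b t _} (r , o) (b≢c , b≢d) out = ≤-trans r (≤-reflexive (eq t)) , λ y l → o y (≤-trans l (≤-reflexive (sym (eq y))))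
    where
    -- The pendant vertex of a later job lies off this detour and is no end of the replaced edge, so
    -- its only edge remains its only edge.
    eq : ∀ y → WT D b y ≡ WT Sd.D′ b y
    eq y = trans (sym (+-identityʳ _)) (trans (cong (WT D b y +_) (sym (wt-∉ (c ∷ I ∷ʳ d) λ where
        (here e) → b≢c e
        (there i) → case ∈-++⁻ I i of
          [ (λ k → out (∈-++⁺ˡ k))
          , any₁ b≢d ]′)))
      (trans (sym (Sd.weight b y)) (trans (cong (WT Sd.D′ b y +_) (δ-≢ ([ (λ (e , _) → b≢c (sym e))
        , (λ (_ , e) → b≢d (sym e)) ]′))) (+-identityʳ _))))
  rest = work js Sd.isP (All.tabulate λ k → ready (All.lookup rs k) (All.lookup ind k) (All.lookup out k)) inds
           (unique-++⁻ʳ I un) (λ k → Sd.fresh′ (fr (∈-++⁺ʳ I k)) (λ i → dj i k))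
           (All.map (λ o → o ∘ ∈-++⁺ʳ I) out)
  module R = Worked rest
  lemma₁ : ∀ a b c → a + (b + c) ≡ a + c + b
  lemma₁ = solve-∀
  lemma₂ : ∀ a b c → a + b + c ≡ a + c + b
  lemma₂ = solve-∀
work (pnd b t I ∷ js) {D} isP ((r , o) ∷ rs) (ind ∷ inds) un fr (_ ∷ out) = record
  { D′ = R.D′ ; isP = R.isP ; len = trans R.len Ex.len
  ; weight = λ u v → trans (R.weight u v) (trans (cong (_+ WT (map jobPath js) u v) (Ex.weight u v)) (+-assoc (WT D u v) _ _)) }
  where
  dj = unique-++⁻-disj I un
  ex = extend I isP r o (unique-++⁻ˡ I un) (fr ∘ ∈-++⁺ˡ)
  module Ex = Extended ex
  ready : ∀ {j} → Ready (WT D) j → Indep (pnd b t I) j → Outside (I ++ concatMap interior js) j → Ready (WT Ex.D′) j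
  ready {lft c′ d′ _} r i _ = ≤-trans r (≤-trans (m≤m+n _ _) (≤-reflexive (sym (Ex.weight c′ d′))))
  ready {pnd b′ t′ _} (r , o) b′≢b out = ≤-trans r (≤-reflexive (eq t′)) , λ y l → o y (≤-trans l (≤-reflexive (sym (eq y))))
    where
    eq : ∀ y → WT D b′ y ≡ WT Ex.D′ b′ y
    eq y = trans (sym (+-identityʳ _)) (trans (cong (WT D b′ y +_) (sym (wt-∉ (b ∷ I) λ where
        (here e) → b′≢b e
        (there i) → out (∈-++⁺ˡ i)))) (sym (Ex.weight b′ y)))
  rest = work js Ex.isP (All.tabulate λ k → ready (All.lookup rs k) (All.lookup ind k) (All.lookup out k)) inds
           (unique-++⁻ʳ I un) (λ k → Ex.fresh′ (fr (∈-++⁺ʳ I k)) (λ i → dj i k))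
           (All.map (λ o → o ∘ ∈-++⁺ʳ I) out)
  module R = Worked rest

-- Reduced graphs and their components.

-- h arises from g by isolating xs and adding edges between former neighbours of xs.
data Lifted {N : ℕ} (g : SG N) (xs : List (Fin N)) : List (Fin N × Fin N) → SG N → Set where
  none : Lifted g xs [] (dels xs g)
  lift : ∀ {ls h c d s t} → c ∉ xs → d ∉ xs → s ∈ xs → Adj g s c → t ∈ xs → Adj g t d →
         Lifted g xs ls h → (gp : Gap h c d) → Lifted g xs ((c , d) ∷ ls) (add c d h gp)

lifted-adj : {g : SG N} {xs : List (Fin N)} {ls : List (Fin N × Fin N)} {h : SG N} → Lifted g xs ls h →
             ∀ {u v} → Adj h u v → (u ∉ xs × v ∉ xs × Adj g u v) ⊎ (u ∉ xs × v ∉ xs × Any (λ cd → Is (proj₁ cd) (proj₂ cd) u v) ls)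
lifted-adj none a = inj₁ (dels⁻ _ _ a)
lifted-adj (lift c∉ d∉ _ _ _ _ L gp) a with add⁻ gp a
... | inj₂ i@(inj₁ (refl , refl)) = inj₂ (c∉ , d∉ , here i)
... | inj₂ i@(inj₂ (refl , refl)) = inj₂ (d∉ , c∉ , here i)
... | inj₁ b with lifted-adj L b
...   | inj₁ x = inj₁ x
...   | inj₂ (p , q , i) = inj₂ (p , q , there i)

lifted-∉ : {g : SG N} {xs : List (Fin N)} {ls : List (Fin N × Fin N)} {h : SG N} → Lifted g xs ls h →
           ∀ {u v} → Adj h u v → u ∉ xs
lifted-∉ L a = [ proj₁ , proj₁ ]′ (lifted-adj L a)

lifted-old : {g : SG N} {xs : List (Fin N)} {ls : List (Fin N × Fin N)} {h : SG N} → Lifted g xs ls h →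
             ∀ {u v} → u ∉ xs → v ∉ xs → Adj g u v → Adj h u v
lifted-old none u∉ v∉ a = dels⁺ _ _ u∉ v∉ a
lifted-old (lift _ _ _ _ _ _ L gp) u∉ v∉ a = add⁺ gp (lifted-old L u∉ v∉ a)

lifted-new : {g : SG N} {xs : List (Fin N)} {ls : List (Fin N × Fin N)} {h : SG N} → Lifted g xs ls h →
             All (λ cd → Adj h (proj₁ cd) (proj₂ cd)) ls
lifted-new none = []
lifted-new (lift _ _ _ _ _ _ L gp) = add-new gp ∷ All.map (add⁺ gp) (lifted-new L)

lifted-weight : {g : SG N} {xs : List (Fin N)} {ls : List (Fin N × Fin N)} {h : SG N} → Lifted g xs ls h →
                ∀ u v → ⟨ h ⟩ u v ≡ ⟨ dels xs g ⟩ u v + Δ ls u v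
lifted-weight none u v = sym (+-identityʳ _)
lifted-weight {g = g} {xs} (lift {ls = ls} {c = c} {d} _ _ _ _ _ _ L gp) u v =
  trans (add-weight gp u v) (trans (cong (_+ δ c d u v) (lifted-weight L u v))
    (trans (+-assoc (⟨ dels xs g ⟩ u v) (Δ ls u v) (δ c d u v)) (cong (⟨ dels xs g ⟩ u v +_) (+-comm (Δ ls u v) (δ c d u v)))))

lifted-supp : {g : SG N} {xs W W′ : List (Fin N)} {ls : List (Fin N × Fin N)} {h : SG N} → Lifted g xs ls h →
              Supp g W → W ↭ xs ++ W′ → Supp h W′
lifted-supp none sp p = Supp-dels sp p
lifted-supp {g = g} (lift c∉ d∉ s∈ sc t∈ td L gp) sp p a with add⁻ gp a
... | inj₁ b = lifted-supp L sp p b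
... | inj₂ (inj₁ (refl , _)) = ∉-rest p (sp (Adj-sym g sc)) c∉
... | inj₂ (inj₂ (_ , refl)) = ∉-rest p (sp (Adj-sym g td)) d∉

Untouched : SG N → List (Fin N) → List (Fin N) → Set
Untouched g xs S = ∀ {x y} → x ∈ xs → Adj g x y → y ∉ S

-- Both ends of a lifted edge are former neighbours of `xs`. A component avoiding all such
-- neighbours contains no lifted edge and has lost no edge.
untouched : {g : SG N} {xs S : List (Fin N)} {ls : List (Fin N × Fin N)} {h : SG N} → Lifted g xs ls h →
            Untouched g xs S → Exc h S → Exc g S
untouched {g = g} {xs} {S} {ls} {h} L far E = exc-transport f b E
  where
  out : ∀ {u} → u ∈ S → u ∉ xs
  out u∈ = let _ , _ , _ , a , _ = exc-degree E u∈ in lifted-∉ L a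
  notLift : ∀ {ls h} → Lifted g xs ls h → ∀ {u v} → u ∈ S → ¬ Any (λ cd → Is (proj₁ cd) (proj₂ cd) u v) ls
  notLift (lift _ _ s∈ sc _ _ L _) u∈ (here (inj₁ (refl , _))) = far s∈ sc u∈
  notLift (lift _ _ _ _ t∈ td L _) u∈ (here (inj₂ (_ , refl))) = far t∈ td u∈
  notLift (lift _ _ _ _ _ _ L _) u∈ (there i) = notLift L u∈ i
  f : ∀ {u v} → u ∈ S → v ∈ S → Adj h u v → Adj g u v
  f u∈ _ a = case lifted-adj L a of
    [ (λ (_ , _ , e) → e)
    , (λ (_ , _ , i) → contradiction i (notLift L u∈)) ]′
  b : ∀ {u v} → u ∈ S → Adj g u v → Adj h u v
  b u∈ e = lifted-old L (out u∈) (λ v∈ → far v∈ (Adj-sym g e) u∈) e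

PendantIn : SG N → Job N → Set
PendantIn h (lft _ _ _) = ⊤
PendantIn h (pnd b t I) = Adj h b t × (∀ {y} → Adj h b y → y ≡ t)

-- One reduction step and its cost.

record Setting (N : ℕ) : Set where
  no-eta-equality
  field
    g  : SG N
    W  : List (Fin N)
    ih : Below N (length W)
    un : Unique W
    sp : Supp g W

module Step {N : ℕ} (𝒮 : Setting N) where
  open Setting 𝒮

  Goal : Set
  Goal = Good g ⌊ length W /2⌋

  -- Removing x vertices pays for r new paths.
  Budget : ℕ → ℕ → Set
  Budget x r = ∀ w → length W ≡ x + w → r + ⌊ w /2⌋ ≤ ⌊ length W /2⌋

  half : ∀ k → ⌊ k + k /2⌋ ≡ k
  half zero = refl
  half (suc k) rewrite ℕ.+-suc k k = cong suc (half k)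

  half+ : ∀ r w → r + ⌊ w /2⌋ ≡ ⌊ (r + r) + w /2⌋
  half+ zero w = refl
  half+ (suc r) w rewrite ℕ.+-suc r r = cong suc (half+ r w)

  one-for-none : Budget 1 0
  one-for-none w e rewrite e = ℕ.⌊n/2⌋-mono (ℕ.n≤1+n w)

  -- From even order the remaining order is odd, and its half is rounded down by a whole path.
  one-for-one : ∀ {k} → length W ≡ k + k → Budget 1 1
  one-for-one {k} ev w e rewrite e = ≤-reflexive (begin
    ⌊ suc (suc w) /2⌋     ≡⟨ cong (λ m → ⌊ suc m /2⌋) ev ⟩
    ⌊ suc (k + k) /2⌋     ≡⟨ sym (trans (half k) (odd-half k)) ⟩
    ⌊ k + k /2⌋           ≡⟨ cong ⌊_/2⌋ (sym ev) ⟩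
    ⌊ suc w /2⌋ ∎)
    where
    open ≡-Reasoning
    odd-half : ∀ k → k ≡ ⌊ suc (k + k) /2⌋
    odd-half zero = refl
    odd-half (suc k) rewrite ℕ.+-suc k k = cong suc (odd-half k)

  -- Two vertices pay for each path and the remaining vertex is given away.
  odd-for : ∀ {k} r → length W ≡ suc (k + k) → Budget (suc (r + r)) r
  odd-for {k} r od w e rewrite e = ≤-trans (≤-reflexive (half+ r w)) (ℕ.⌊n/2⌋-mono (ℕ.n≤1+n _))

  two-for-one : Budget 2 1
  two-for-one w e rewrite e = ≤-refl

  four-for-two : Budget 4 2
  four-for-two w e rewrite e = ≤-refl

  six-for-three : Budget 6 3
  six-for-three w e rewrite e = ≤-refl

  inW : ∀ {xs} → All (λ x → ∃[ y ] Adj g x y) xs → All (_∈ W) xs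
  inW = All.map (λ (_ , a) → sp a)

  -- The common frame of the reductions: the edges `es` at the removed vertices are redistributed
  -- over new paths `Ns` and detours `js`. Only the components described by `U`, which no new path
  -- can absorb, are returned to the caller.
  reduce : ∀ {xs es h r} (js : List (Job N)) → Strip g xs es → Lifted g xs (lifts js) h → Unique xs →
           All (_∈ W) xs →
           (Ns : Vec (List (Fin N)) r) → All IsP (Vec.toList Ns) →
           All (PendantIn h) js → AllPairs Indep js → Unique (concatMap interior js) → All (_∈ xs) (concatMap interior js) →
           es ≈ Vec.toList Ns ++ map jobPath js →
           1 ≤ length xs → Budget (length xs) r →
           (U : List (Fin N) → Set) → (∀ {S} → Exc h S → Touch h Ns (map jobPair js) S ⊎ U S) →
           Goal ⊎ ∃[ S ] (Exc h S × U S)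
  reduce {xs} {es} {h} {r} js st L unx ex Ns isN pen ind unI I⊆ bal xs≥1 budget U touch =
    [ inj₁ ∘ finish , inj₂ ]′ (absorb h ih (unique-++⁻ʳ xs (unique-resp-↭ W↭ un)) W′<W (lifted-supp L sp W↭) Ns isN (map jobPair js) U touch)
    where
    rmv = removeAll {W = W} unx ex
    W′ = proj₁ rmv
    W↭ : W ↭ xs ++ W′
    W↭ = proj₂ rmv
    lenW : length W ≡ length xs + length W′
    lenW = trans (↭-length W↭) (length-++ xs)
    W′<W : length W′ < length W
    W′<W = subst (length W′ <_) (sym lenW) (ℕ.+-monoˡ-≤ (length W′) xs≥1)
    finish : Absorbed h ⌊ length W′ /2⌋ Ns (map jobPair js) → Goal
    finish A = Vec.toList R.Ns′ ++ Q.D′ , Allₚ.++⁺ R.isN Q.isP , len , weight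
      where
      module R = Absorbed A
      -- The old paths never exceed `h`, where removed vertices are isolated; so every detour runs
      -- through fresh vertices.
      zeroOn : ∀ {x} → x ∈ xs → ∀ y → WT R.D x y ≡ 0
      zeroOn {x} x∈ y = ℕ.n≤0⇒n≡0 (≤-trans (R.below x y) (≤-reflexive (⟨⟩-¬adj h (¬Adj⇒false (λ a → lifted-∉ L a x∈)))))
      ready : ∀ js → All (λ cd → WT R.D (proj₁ cd) (proj₂ cd) ≡ ⟨ h ⟩ (proj₁ cd) (proj₂ cd)) (map jobPair js) →
              All (λ cd → Adj h (proj₁ cd) (proj₂ cd)) (lifts js) → All (PendantIn h) js → All (Ready (WT R.D)) js
      ready [] _ _ _ = []
      ready (lft c d I ∷ js) (k ∷ ks) (a ∷ as) (_ ∷ ps) = ≤-reflexive (sym (trans k (⟨⟩-adj h a))) ∷ ready js ks as ps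
      ready (pnd b t I ∷ js) (k ∷ ks) as ((a , o) ∷ ps) =
        (≤-reflexive (sym (trans k (⟨⟩-adj h a))) , λ y l → o (⟨⟩-pos h (≤-trans l (R.below b y)))) ∷ ready js ks as ps
      out : ∀ {ls h} js → Lifted g xs ls h → All (λ cd → Adj h (proj₁ cd) (proj₂ cd)) (lifts js) → All (PendantIn h) js →
            All (λ j → proj₁ (jobPair j) ∉ xs) js
      out [] _ _ _ = []
      out (lft c d I ∷ js) L (a ∷ as) (_ ∷ ps) = lifted-∉ L a ∷ out js L as ps
      out (pnd b t I ∷ js) L as ((a , _) ∷ ps) = lifted-∉ L a ∷ out js L as ps
      wk = work js R.isP (ready js R.kept (lifted-new L) pen) ind unI (λ i → fresh R.isP (zeroOn (All.lookup I⊆ i)))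
             (All.map (λ o i → o (All.lookup I⊆ i)) (out js L (lifted-new L) pen))
      module Q = Worked wk
      len : length (Vec.toList R.Ns′ ++ Q.D′) ≤ ⌊ length W /2⌋
      len = ≤-trans (≤-reflexive (trans (length-++ (Vec.toList R.Ns′)) (cong₂ _+_ (Vecₚ.length-toList R.Ns′) Q.len)))
              (≤-trans (ℕ.+-monoʳ-≤ r R.len) (budget (length W′) lenW))
      weight : ∀ u v → WT (Vec.toList R.Ns′ ++ Q.D′) u v ≡ ⟨ g ⟩ u v
      -- The lifted edges are present in `h` but not in `g`; their weight is carried along on both
      -- sides and cancelled.
      weight u v = ℕ.+-cancelʳ-≡ (Δ (lifts js) u v) _ _ (begin
        WT (Vec.toList R.Ns′ ++ Q.D′) u v + Δ (lifts js) u v                        ≡⟨ cong (_+ Δ (lifts js) u v) (WT-++ (Vec.toList R.Ns′) Q.D′ u v) ⟩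
        WTv R.Ns′ u v + WT Q.D′ u v + Δ (lifts js) u v                              ≡⟨ +-assoc (WTv R.Ns′ u v) _ _ ⟩
        WTv R.Ns′ u v + (WT Q.D′ u v + Δ (lifts js) u v)                            ≡⟨ cong (WTv R.Ns′ u v +_) (Q.weight u v) ⟩
        WTv R.Ns′ u v + (WT R.D u v + WT (map jobPath js) u v)                      ≡⟨ lemma₁ (WTv R.Ns′ u v) (WT R.D u v) _ ⟩
        WT R.D u v + WTv R.Ns′ u v + WT (map jobPath js) u v                        ≡⟨ cong (_+ WT (map jobPath js) u v) (R.weight u v) ⟩
        ⟨ h ⟩ u v + WTv Ns u v + WT (map jobPath js) u v                            ≡⟨ cong (λ k → k + WTv Ns u v + WT (map jobPath js) u v) (lifted-weight L u v) ⟩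
        ⟨ dels xs g ⟩ u v + Δ (lifts js) u v + WTv Ns u v + WT (map jobPath js) u v ≡⟨ lemma₂ (⟨ dels xs g ⟩ u v) (Δ (lifts js) u v) (WTv Ns u v) _ ⟩
        ⟨ dels xs g ⟩ u v + (WTv Ns u v + WT (map jobPath js) u v) + Δ (lifts js) u v ≡⟨ cong (λ k → ⟨ dels xs g ⟩ u v + k + Δ (lifts js) u v)
                                                                                         (trans (sym (WT-++ (Vec.toList Ns) (map jobPath js) u v)) (sym (weights bal u v))) ⟩
        ⟨ dels xs g ⟩ u v + WT es u v + Δ (lifts js) u v                            ≡⟨ cong (_+ Δ (lifts js) u v) (sym (strip-weight st u v)) ⟩
        ⟨ g ⟩ u v + Δ (lifts js) u v ∎)
        where
        open ≡-Reasoning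
        lemma₁ : ∀ a b c → a + (b + c) ≡ b + a + c
        lemma₁ = solve-∀
        lemma₂ : ∀ a b c d → a + b + c + d ≡ a + (c + d) + b
        lemma₂ = solve-∀

  settle : ∀ {xs ls h} → Lifted g xs ls h → Goal ⊎ ∃[ S ] (Exc h S × Untouched g xs S) → Result g ⌊ length W /2⌋
  settle L (inj₁ good) = inj₁ good
  settle L (inj₂ (S , E , u)) = inj₂ (S , untouched L u E)

-- Counting degrees after a deletion.

RoomN : SG N → Fin N → ℕ → Set
RoomN h c k = ∀ {ns} → Unique ns → All (Adj h c) ns → length ns ≤ k

-- The deleted neighbours `ls` and the remaining ones together are distinct neighbours of `c` in
-- `g`, hence at most four.
roomN : {g : SG N} {c : Fin N} {xs : List (Fin N)} (ls : List (Fin N)) {k : ℕ} → Unique ls → All (_∈ xs) ls → All (Adj g c) ls →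
        4 ≡ length ls + k → RoomN (dels xs g) c k
roomN {g = g} {c} {xs} ls {k} ul l∈ la e un al = ℕ.+-cancelˡ-≤ (length ls) _ _
  (subst₂ _≤_ (length-++ ls) e (bound g c
    (unique-++ ul un (λ {t} t∈l t∈n → proj₁ (proj₂ (dels⁻ xs g (All.lookup al t∈n))) (All.lookup l∈ t∈l)))
    (Allₚ.++⁺ la (All.map (dels-⊑ xs g) al))))

roomN-add : {h : SG N} {c d b : Fin N} {k : ℕ} (gp : Gap h c d) → RoomN h b k → RoomN (add c d h gp) b (suc k)
roomN-add {N} {h} {c} {d} {b} {k} gp rm {ns} un al = case partner of λ (e , o) → one e o (member? e ns)
  where
  partner : ∃[ e ] (∀ {t} → Is c d b t → t ≡ e)
  partner with b ≟ c
  ... | yes refl = d , ([ (λ (_ , q) → sym q) , (λ (_ , q) → contradiction (sym q) (c≢d gp)) ]′)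
  ... | no b≢c = c , ([ (λ (q , _) → contradiction (sym q) b≢c) , (λ (q , _) → sym q) ]′)
  old : ∀ {e ms} → (∀ {t} → Is c d b t → t ≡ e) → e ∉ ms → All (Adj (add c d h gp) b) ms → All (Adj h b) ms
  old {e} {ms} o e∉ al = All.tabulate λ t∈ → case add⁻ gp (All.lookup al t∈) of
    [ (λ a → a)
    , (λ i → contradiction (subst (_∈ ms) (o i) t∈) e∉) ]′
  one : ∀ e → (∀ {t} → Is c d b t → t ≡ e) → Dec (e ∈ ns) → length ns ≤ suc k
  one e o (no e∉) = ≤-trans (rm un (old o e∉ al)) (ℕ.n≤1+n k)
  one e o (yes e∈) with extract e∈
  ... | ms , p with unique-resp-↭ p un | All-resp-↭ p al
  ...   | e≢ ∷ un′ | _ ∷ al′ = subst (_≤ suc k) (sym (↭-length p)) (s≤s (rm un′ (old o (All≢⇒∉ e≢) al′)))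

room-mono : {h : SG N} {c : Fin N} {j k : ℕ} → j ≤ k → RoomN h c j → RoomN h c k
room-mono le rm un al = ≤-trans (rm un al) le

nbs : (g : SG N) (v : Fin N) → ∃[ ns ] Nb g v ns
nbs {N} g v = filter P? (allFin N) , nbr (Uniqueₚ.filter⁺ P? (Uniqueₚ.allFin⁺ N)) (Allₚ.all-filter P? (allFin N)) (λ {u} a → ∈-filter⁺ P? (∈-allFin u) a)
  where
  P? : ∀ u → Dec (Adj g v u)
  P? u with adj g v u in eq
  ... | true = yes (edge eq)
  ... | false = no λ (edge e) → case trans (sym e) eq of λ ()

nb-front : {g : SG N} {v : Fin N} (ks : List (Fin N)) → Unique ks → All (Adj g v) ks → ∃[ ms ] Nb g v (ks ++ ms)
nb-front {g = g} {v} ks uk ak with nbs g v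
... | ns , nb with removeAll uk (All.map (cover nb) ak)
...   | ms , p = ms , Nb-↭ p nb

nb4 : {g : SG N} {v a b c d : Fin N} → Unique (a ∷ b ∷ c ∷ d ∷ []) → All (Adj g v) (a ∷ b ∷ c ∷ d ∷ []) → Nb g v (a ∷ b ∷ c ∷ d ∷ [])
nb4 {g = g} {v} u al with nb-front _ u al
... | [] , nb = nb
... | e ∷ ms , nb = too-many nb

data Fourth {N : ℕ} (g : SG N) (v a b c : Fin N) : Set where
  none : Nb g v (a ∷ b ∷ c ∷ []) → Fourth g v a b c
  one  : ∀ t → Nb g v (a ∷ b ∷ c ∷ t ∷ []) → Fourth g v a b c

fourth : {g : SG N} {v a b c : Fin N} → Unique (a ∷ b ∷ c ∷ []) → All (Adj g v) (a ∷ b ∷ c ∷ []) → Fourth g v a b c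
fourth {g = g} {v} u al with nb-front _ u al
... | [] , nb = none nb
... | t ∷ [] , nb = one t nb
... | t ∷ t′ ∷ ms , nb = too-many nb

nb-dels : {g : SG N} {xs : List (Fin N)} {v : Fin N} (ks : List (Fin N)) {ms : List (Fin N)} → v ∉ xs → Nb g v (ks ++ ms) →
          All (_∈ xs) ks → All (_∉ xs) ms → Nb (dels xs g) v ms
nb-dels {g = g} {xs} ks v∉ nb k∈ m∉ = nbr (unique-++⁻ʳ ks (uniq nb))
  (All.tabulate λ t∈ → dels⁺ xs g v∉ (All.lookup m∉ t∈) (All.lookup (all nb) (∈-++⁺ʳ ks t∈)))
  λ a → let _ , u∉ , b = dels⁻ xs g a in case ∈-++⁻ ks (cover nb b) of
    [ (λ i → contradiction (All.lookup k∈ i) u∉)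
    , (λ i → i) ]′

untouchedBy : {g : SG N} {xs S : List (Fin N)} {ls : List (Fin N × Fin N)} {h : SG N} → Lifted g xs ls h → Exc h S →
              All (λ x → ∃[ ns ] (Nb g x ns × All (λ y → y ∈ xs ⊎ y ∉ S) ns)) xs → Untouched g xs S
untouchedBy L E al x∈ a y∈ with All.lookup al x∈
... | ns , nb , out with All.lookup out (cover nb a)
...   | inj₂ y∉ = y∉ y∈
...   | inj₁ y∈xs = let _ , _ , _ , b , _ = exc-degree E y∈ in lifted-∉ L b y∈xs

-- Of the two neighbours that `a` has in `S`, one differs from `f`. The vertex `f` is avoided
-- because it lies on the new path or because `af` is a lifted edge; all other vertices of the path
-- are removed or outside `S`.
touch2 : ∀ {N r} {g : SG N} {xs ls h} {Ns : Vec (List (Fin N)) r} {prot S} → Lifted g xs ls h → Exc h S →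
         (i : Fin r) (a : Fin N) → End a (Vec.lookup Ns i) → a ∈ S → Room h a → (f : Fin N) →
         All (λ y → y ∈ a ∷ f ∷ xs ⊎ y ∉ S) (Vec.lookup Ns i) →
         (∀ {x} → x ∈ S → x ≢ f → All (λ cd → ¬ Is a x (proj₁ cd) (proj₂ cd)) prot) → Touch h Ns prot S
touch2 {h = h} {Ns} {prot} {S} L E i a en a∈ rm f inp free with exc-degree E a∈
... | s , t , s≢t , as , at = case s ≟ f of λ where
    (no s≢f) → go as s≢f
    (yes refl) → go at (s≢t ∘ sym)
  where
  go : ∀ {x} → Adj h a x → x ≢ f → Touch h Ns prot S
  go {x} ax x≢f = touching i a x en a∈ ax x∉ rm (free (exc-closed E a∈ ax) x≢f)
    where
    x∉ : x ∉ Vec.lookup Ns i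
    x∉ x∈ = case All.lookup inp x∈ of λ where
      (inj₁ (here e)) → Adj⇒≢ h ax (sym e)
      (inj₁ (there (here e))) → x≢f e
      (inj₁ (there (there k))) → lifted-∉ L (Adj-sym h ax) k
      (inj₂ x∉S) → x∉S (exc-closed E a∈ ax)

touch1 : ∀ {N r} {g : SG N} {xs ls h} {Ns : Vec (List (Fin N)) r} {prot S} → Lifted g xs ls h → Exc h S →
         (i : Fin r) (a : Fin N) → End a (Vec.lookup Ns i) → a ∈ S → Room h a → (f : Fin N) →
         All (_∈ a ∷ f ∷ xs) (Vec.lookup Ns i) →
         (∀ {x} → x ∈ S → x ≢ f → All (λ cd → ¬ Is a x (proj₁ cd) (proj₂ cd)) prot) → Touch h Ns prot S
touch1 L E i a en a∈ rm f inp = touch2 L E i a en a∈ rm f (All.map inj₁ inp)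

-- Subgraphs K₅⁻.

module K5⁻Phase {N : ℕ} (𝒮 : Setting N) where
  open Setting 𝒮
  open Step 𝒮

  module Core {p q x y z : Fin N} (nr : Near5 g p q x y z) (pq : adj g p q ≡ false) where
    open Near5 nr
    private
      S : ∀ {u v} → Adj g u v → Adj g v u
      S = Adj-sym g
      ne : ∀ {u v} → Adj g u v → u ≢ v
      ne = Adj⇒≢ g
    u5 : Unique (p ∷ q ∷ x ∷ y ∷ z ∷ [])
    u5 = (p≢q ∷ ne px ∷ ne py ∷ ne pz ∷ []) ∷ (ne qx ∷ ne qy ∷ ne qz ∷ []) ∷ (ne xy ∷ ne xz ∷ []) ∷ (ne yz ∷ []) ∷ [] ∷ []
    pick : ∀ i j k l → distinctᵇ 5 (i ∷ j ∷ k ∷ l ∷ []) ≡ true → Unique (map (at (p ∷ q ∷ x ∷ y ∷ z ∷ []) p) (i ∷ j ∷ k ∷ l ∷ []))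
    pick i j k l t = named-unique p (i ∷ j ∷ k ∷ l ∷ []) u5 t
    nx : Nb g x (p ∷ q ∷ y ∷ z ∷ [])
    nx = nb4 (pick 0 1 3 4 refl) (S px ∷ S qx ∷ xy ∷ xz ∷ [])
    ny : Nb g y (x ∷ p ∷ q ∷ z ∷ [])
    ny = nb4 (pick 2 0 1 4 refl) (S xy ∷ S py ∷ S qy ∷ yz ∷ [])
    nz : Nb g z (x ∷ y ∷ p ∷ q ∷ [])
    nz = nb4 (pick 2 3 0 1 refl) (S xz ∷ S yz ∷ S pz ∷ S qz ∷ [])
    xs : List (Fin N)
    xs = x ∷ y ∷ z ∷ q ∷ []
    h₀ = dels xs g
    uxs : Unique xs
    uxs = pick 2 3 4 1 refl
    strip : ∀ {ns} → Nb g q (x ∷ y ∷ z ∷ ns) → Strip g xs _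
    strip nq = nx ∷ Nb-del ny ∷ Nb-del (Nb-del nz) ∷ Nb-del (Nb-del (Nb-del nq)) ∷ []
    p∉ : p ∉ xs
    p∉ (here e) = ne px e
    p∉ (there (here e)) = ne py e
    p∉ (there (there (here e))) = ne pz e
    p∉ (there (there (there (here e)))) = p≢q e
    ex : All (λ x → ∃[ y ] Adj g x y) xs
    ex = (_ , S px) ∷ (_ , S py) ∷ (_ , S pz) ∷ (_ , qx) ∷ []

    nb-p : ∀ {t} → Nb g p (x ∷ y ∷ z ∷ t ∷ []) → Nb h₀ p (t ∷ [])
    nb-p np@(nbr ((_ ∷ _ ∷ n₁ ∷ []) ∷ (_ ∷ n₂ ∷ []) ∷ (n₃ ∷ []) ∷ _) (_ ∷ _ ∷ _ ∷ pt ∷ []) _) =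
      nb-dels (x ∷ y ∷ z ∷ []) p∉ np (here refl ∷ there (here refl) ∷ there (there (here refl)) ∷ [])
        ((λ where (here refl) → n₁ refl
                  (there (here refl)) → n₂ refl
                  (there (there (here refl))) → n₃ refl
                  (there (there (there (here refl)))) → contradiction pq (¬Adj pt)) ∷ [])

    -- q is merged into p: the edge pq′ stands for the path p x y z q q′.
    merge : ∀ {p′ q′} → Nb g p (x ∷ y ∷ z ∷ p′ ∷ []) → Nb g q (x ∷ y ∷ z ∷ q′ ∷ []) → p′ ≢ q′ → Result g ⌊ length W /2⌋
    merge {p′} {q′} np nq p′≢q′ = [ inj₁ , (λ (S , E , u) → inj₂ (S , untouched L u E)) ]′
      (reduce (lft p q′ xs ∷ []) (strip nq) L uxs (inW ex) Ns
        (named ρ p 0 3 (1 ∷ []) refl u5 refl ∷ named ρ p 0 4 (2 ∷ 1 ∷ []) refl u5 refl ∷ [])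
        (tt ∷ []) ([] ∷ []) uxs (All.tabulate λ i → i)
        (balanced (p ∷ q ∷ x ∷ y ∷ z ∷ q′ ∷ []) p
          ((2 ∷ 0 ∷ []) ∷ (2 ∷ 1 ∷ []) ∷ (2 ∷ 3 ∷ []) ∷ (2 ∷ 4 ∷ []) ∷ (3 ∷ 0 ∷ []) ∷ (3 ∷ 1 ∷ []) ∷ (3 ∷ 4 ∷ []) ∷ (4 ∷ 0 ∷ []) ∷ (4 ∷ 1 ∷ []) ∷ (1 ∷ 5 ∷ []) ∷ [])
          ((0 ∷ 3 ∷ 1 ∷ []) ∷ (0 ∷ 4 ∷ 2 ∷ 1 ∷ []) ∷ (0 ∷ 2 ∷ 3 ∷ 4 ∷ 1 ∷ 5 ∷ []) ∷ []) refl refl refl)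
        (s≤s z≤n) four-for-two (Untouched g xs) touch)
      where
      ρ = p ∷ q ∷ x ∷ y ∷ z ∷ []
      Ns = (p ∷ y ∷ q ∷ []) ∷ (p ∷ z ∷ x ∷ q ∷ []) ∷ []
      qq′ : Adj g q q′
      qq′ = All.lookup (all nq) (there (there (there (here refl))))
      p≢q′ : p ≢ q′
      p≢q′ refl = contradiction pq (¬Adj (S qq′))
      q′∉ : q′ ∉ xs
      q′∉ (here refl) with uniq nq
      ... | (_ ∷ _ ∷ n ∷ []) ∷ _ = n refl
      q′∉ (there (here refl)) with uniq nq
      ... | _ ∷ (_ ∷ n ∷ []) ∷ _ = n refl
      q′∉ (there (there (here refl))) with uniq nq
      ... | _ ∷ _ ∷ (n ∷ []) ∷ _ = n refl
      q′∉ (there (there (there (here e)))) = ne qq′ (sym e)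
      np₀ : Nb h₀ p (p′ ∷ [])
      np₀ = nb-p np
      gp : Gap h₀ p q′
      gp = gap p≢q′ (Nb-∉ np₀ (any₁ (λ e → p′≢q′ (sym e))))
             (roomN (x ∷ []) ([] ∷ []) (here refl ∷ []) (px ∷ []) refl)
             (roomN (q ∷ []) ([] ∷ []) (there (there (there (here refl))) ∷ []) (S qq′ ∷ []) refl)
      h = add p q′ h₀ gp
      L : Lifted g xs _ h
      L = lift p∉ q′∉ (here refl) (S px) (there (there (there (here refl)))) qq′ none gp
      touch : ∀ {S} → Exc h S → Touch h Ns ((p , q′) ∷ []) S ⊎ Untouched g xs S
      touch {S′} E with member? p S′
      ... | yes p∈ = inj₁ (touch1 L E Fin.zero p (inj₁ (_ , refl)) p∈
              (room-mono (s≤s (s≤s z≤n)) (roomN-add gp room-p)) q′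
              (here refl ∷ there (there (there (here refl))) ∷ there (there (there (there (there (here refl))))) ∷ [])
              (λ _ x≢ → ([ (λ (_ , e) → x≢ e) , (λ (e , _) → p≢q′ e) ]′) ∷ []))
        where
        room-p : RoomN h₀ p 1
        room-p = roomN (x ∷ y ∷ z ∷ []) ((ne xy ∷ ne xz ∷ []) ∷ (ne yz ∷ []) ∷ [] ∷ [])
          (here refl ∷ there (here refl) ∷ there (there (here refl)) ∷ []) (px ∷ py ∷ pz ∷ []) refl
      ... | no p∉S = inj₂ (untouchedBy L E ((_ , nx , (inj₂ p∉S ∷ Q ∷ Y ∷ Z ∷ [])) ∷ (_ , ny , (X ∷ inj₂ p∉S ∷ Q ∷ Z ∷ []))
              ∷ (_ , nz , (X ∷ Y ∷ inj₂ p∉S ∷ Q ∷ [])) ∷ (_ , nq , (X ∷ Y ∷ Z ∷ inj₂ q′∉S ∷ [])) ∷ []))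
        where
        X = inj₁ (here refl)
        Y = inj₁ (there (here refl))
        Z = inj₁ (there (there (here refl)))
        Q = inj₁ (there (there (there (here refl))))
        q′∉S : q′ ∉ S′
        q′∉S q′∈ = p∉S (exc-closed E q′∈ (Adj-sym h (add-new gp)))

    -- A path ending at the pendant vertex p continues through x, y, z and q.
    pendant : ∀ {t ns} → Nb g p (x ∷ y ∷ z ∷ t ∷ []) → Nb g q (x ∷ y ∷ z ∷ ns) → All (_≡ t) ns → (P : List (Fin N)) → IsP P →
              star q ns ++ (q ∷ x ∷ z ∷ p ∷ []) ∷ [] ≈ P ∷ [] → Result g ⌊ length W /2⌋
    pendant {t} {ns} np nq ns≡t P isPP bal = [ inj₁ , (λ (S , E , u) → inj₂ (S , untouched none u E)) ]′
      (reduce (pnd p t xs ∷ []) (strip nq) none uxs (inW ex) Ns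
        (named ρ p 0 3 (1 ∷ []) refl u5 refl ∷ isPP ∷ [])
        ((pt , only) ∷ []) ([] ∷ []) uxs (All.tabulate λ i → i)
        (same λ u v → trans (trans (WT-++ (star x (p ∷ q ∷ y ∷ z ∷ []) ++ star y (p ∷ q ∷ z ∷ []) ++ star z (p ∷ q ∷ [])) (star q ns ++ []) u v) (cong (_+ WT (star q ns ++ []) u v) (weights core u v)))
                        (lemma (δ p y u v) (δ y q u v) (δ q x u v) (δ x z u v) (δ z p u v) (δ p x u v) (δ x y u v) (δ y z u v) (δ z q u v)
                           (WT (star q ns) u v) (wt P u v) (WT-++ (star q ns) [] u v) (trans (sym (WT-++ (star q ns) ((q ∷ x ∷ z ∷ p ∷ []) ∷ []) u v)) (weights bal u v))))
        (s≤s z≤n) four-for-two (Untouched g xs) touch)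
      where
      ρ = p ∷ q ∷ x ∷ y ∷ z ∷ []
      Ns = (p ∷ y ∷ q ∷ []) ∷ P ∷ []
      core : star x (p ∷ q ∷ y ∷ z ∷ []) ++ star y (p ∷ q ∷ z ∷ []) ++ star z (p ∷ q ∷ []) ≈
             (p ∷ y ∷ q ∷ []) ∷ (q ∷ x ∷ z ∷ p ∷ []) ∷ (p ∷ x ∷ y ∷ z ∷ q ∷ []) ∷ []
      core = balanced ρ p
          ((2 ∷ 0 ∷ []) ∷ (2 ∷ 1 ∷ []) ∷ (2 ∷ 3 ∷ []) ∷ (2 ∷ 4 ∷ []) ∷ (3 ∷ 0 ∷ []) ∷ (3 ∷ 1 ∷ []) ∷ (3 ∷ 4 ∷ []) ∷ (4 ∷ 0 ∷ []) ∷ (4 ∷ 1 ∷ []) ∷ [])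
          ((0 ∷ 3 ∷ 1 ∷ []) ∷ (1 ∷ 2 ∷ 4 ∷ 0 ∷ []) ∷ (0 ∷ 2 ∷ 3 ∷ 4 ∷ 1 ∷ []) ∷ []) refl refl refl
      lemma : ∀ py yq qx xz zp px xy yz zq s w {s′} → s′ ≡ s + 0 → s + (qx + (xz + (zp + 0)) + 0) ≡ w + 0 →
              py + (yq + 0) + (qx + (xz + (zp + 0)) + (px + (xy + (yz + (zq + 0))) + 0)) + s′ ≡
              py + (yq + 0) + (w + (px + (xy + (yz + (zq + 0))) + 0))
      lemma py yq qx xz zp px xy yz zq s w refl e = trans (l₁ py yq (qx + (xz + (zp + 0))) (px + (xy + (yz + (zq + 0))) + 0) s)
          (cong (λ k → py + (yq + 0) + (k + (px + (xy + (yz + (zq + 0))) + 0))) (trans e (+-identityʳ w)))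
        where
        l₁ : ∀ a b c d s → a + (b + 0) + (c + d) + (s + 0) ≡ a + (b + 0) + (s + (c + 0) + d)
        l₁ = solve-∀
      pt : Adj h₀ p t
      pt = All.head (all (nb-p np))
      only : ∀ {v} → Adj h₀ p v → v ≡ t
      only a = case cover (nb-p np) a of any₁ (λ e → e)
      -- Nothing has to be absorbed: `p` has degree one in the reduced graph and `t` is joined to
      -- it, so neither is in an exceptional component.
      touch : ∀ {S} → Exc h₀ S → Touch h₀ Ns ((p , t) ∷ []) S ⊎ Untouched g xs S
      touch {S′} E = inj₂ (untouchedBy none E ((_ , nx , (inj₂ p∉S ∷ Q ∷ Y ∷ Z ∷ [])) ∷ (_ , ny , (X ∷ inj₂ p∉S ∷ Q ∷ Z ∷ []))
              ∷ (_ , nz , (X ∷ Y ∷ inj₂ p∉S ∷ Q ∷ [])) ∷ (_ , nq , (X ∷ Y ∷ Z ∷ All.map (λ e → inj₂ (subst (_∉ S′) (sym e) t∉S)) ns≡t)) ∷ []))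
        where
        X = inj₁ (here refl)
        Y = inj₁ (there (here refl))
        Z = inj₁ (there (there (here refl)))
        Q = inj₁ (there (there (there (here refl))))
        p∉S : p ∉ S′
        p∉S p∈ = let s , r , s≢r , as , ar = exc-degree E p∈ in s≢r (trans (only as) (sym (only ar)))
        t∉S : t ∉ S′
        t∉S t∈ = p∉S (exc-closed E t∈ (Adj-sym h₀ pt))

  -- If `p` and `q` are adjacent, all five degrees are exhausted and K₅ is a component. Otherwise
  -- `x`, `y`, `z` are saturated, and only the at most one outer neighbour of `p` and of `q`
  -- matters.
  near-K5 : ∀ {p q x y z} → Near5 g p q x y z → Result g ⌊ length W /2⌋
  near-K5 {p} {q} {x} {y} {z} nr with Adj? g p q
  ... | inj₁ pq = inj₂ (_ , k5 nr λ u∈ a → cl u∈ a)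
    where
    open Near5 nr
    Sy = λ {u v} → Adj-sym g {u} {v}
    u5 : Unique (p ∷ q ∷ x ∷ y ∷ z ∷ [])
    u5 = (p≢q ∷ Adj⇒≢ g px ∷ Adj⇒≢ g py ∷ Adj⇒≢ g pz ∷ []) ∷ (Adj⇒≢ g qx ∷ Adj⇒≢ g qy ∷ Adj⇒≢ g qz ∷ []) ∷ (Adj⇒≢ g xy ∷ Adj⇒≢ g xz ∷ []) ∷ (Adj⇒≢ g yz ∷ []) ∷ [] ∷ []
    nb : ∀ i j k l → distinctᵇ 5 (i ∷ j ∷ k ∷ l ∷ []) ≡ true → ∀ {v} → All (Adj g v) (map (at (p ∷ q ∷ x ∷ y ∷ z ∷ []) p) (i ∷ j ∷ k ∷ l ∷ [])) →
         ∀ {w} → Adj g v w → w ∈ map (at (p ∷ q ∷ x ∷ y ∷ z ∷ []) p) (i ∷ j ∷ k ∷ l ∷ [])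
    nb i j k l t al a = cover (nb4 (named-unique p (i ∷ j ∷ k ∷ l ∷ []) u5 t) al) a
    cl : Closed g (p ∷ q ∷ x ∷ y ∷ z ∷ [])
    cl (here refl) a = ∈-resp-↭ ↭-refl (there (nb 1 2 3 4 refl (pq ∷ px ∷ py ∷ pz ∷ []) a))
    cl (there (here refl)) a = ∈-resp-↭ (swap q p ↭-refl) (there (nb 0 2 3 4 refl (Sy pq ∷ qx ∷ qy ∷ qz ∷ []) a))
    cl (there (there (here refl))) a = ∈-resp-↭ (↭-sym (shift x (p ∷ q ∷ []) (y ∷ z ∷ []))) (there (nb 0 1 3 4 refl (Sy px ∷ Sy qx ∷ xy ∷ xz ∷ []) a))
    cl (there (there (there (here refl)))) a = ∈-resp-↭ (↭-sym (shift y (p ∷ q ∷ x ∷ []) (z ∷ []))) (there (nb 0 1 2 4 refl (Sy py ∷ Sy qy ∷ Sy xy ∷ yz ∷ []) a))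
    cl (there (there (there (there (here refl))))) a = ∈-resp-↭ (↭-sym (shift z (p ∷ q ∷ x ∷ y ∷ []) [])) (there (nb 0 1 2 3 refl (Sy pz ∷ Sy qz ∷ Sy xz ∷ Sy yz ∷ []) a))
  ... | inj₂ pq = go (fourth uxyz (px ∷ py ∷ pz ∷ [])) (fourth uxyz (qx ∷ qy ∷ qz ∷ []))
    where
    open Near5 nr
    Sy = λ {u v} → Adj-sym g {u} {v}
    open Core nr pq
    module C′ = Core (near-pq nr) (trans (symm g q p) pq)
    uxyz : Unique (x ∷ y ∷ z ∷ [])
    uxyz = (Adj⇒≢ g xy ∷ Adj⇒≢ g xz ∷ []) ∷ (Adj⇒≢ g yz ∷ []) ∷ [] ∷ []
    back : ∀ {t} → Nb g p (x ∷ y ∷ z ∷ t ∷ []) → Unique (p ∷ q ∷ x ∷ y ∷ z ∷ t ∷ [])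
    back np@(nbr ((n₁ ∷ n₂ ∷ n₃ ∷ []) ∷ (n₄ ∷ n₅ ∷ []) ∷ (n₆ ∷ []) ∷ [] ∷ []) (_ ∷ _ ∷ _ ∷ pt ∷ []) _) =
      (p≢q ∷ Adj⇒≢ g px ∷ Adj⇒≢ g py ∷ Adj⇒≢ g pz ∷ Adj⇒≢ g pt ∷ [])
      ∷ (Adj⇒≢ g qx ∷ Adj⇒≢ g qy ∷ Adj⇒≢ g qz ∷ (λ where refl → contradiction pq (¬Adj pt)) ∷ [])
      ∷ (n₁ ∷ n₂ ∷ n₃ ∷ []) ∷ (n₄ ∷ n₅ ∷ []) ∷ (n₆ ∷ []) ∷ [] ∷ []
    go : Fourth g p x y z → Fourth g q x y z → Result g ⌊ length W /2⌋
    go (none np) (none nq) = inj₂ (_ , k5 nr λ where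
      (here refl) a → there (there (cover np a))
      (there (here refl)) a → there (there (cover nq a))
      (there (there (here refl))) a → ∈-resp-↭ (↭-sym (shift x (p ∷ q ∷ []) (y ∷ z ∷ []))) (there (cover nx a))
      (there (there (there (here refl)))) a → ∈-resp-↭ (↭-trans (prep y (↭-sym (shift x [] (p ∷ q ∷ z ∷ [])))) (↭-sym σy)) (there (cover ny a))
      (there (there (there (there (here refl))))) a → ∈-resp-↭ (↭-sym σz) (there (cover nz a)))
      where
      σy : p ∷ q ∷ x ∷ y ∷ z ∷ [] ↭ y ∷ x ∷ p ∷ q ∷ z ∷ []
      σy = ↭-trans (shift y (p ∷ q ∷ x ∷ []) (z ∷ [])) (prep y (shift x (p ∷ q ∷ []) (z ∷ [])))
      σz : p ∷ q ∷ x ∷ y ∷ z ∷ [] ↭ z ∷ x ∷ y ∷ p ∷ q ∷ []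
      σz = ↭-trans (shift z (p ∷ q ∷ x ∷ y ∷ []) []) (prep z (++-comm (p ∷ q ∷ []) (x ∷ y ∷ [])))
    go (one p′ np) (none nq) = pendant np nq [] (q ∷ x ∷ z ∷ p ∷ []) (named (p ∷ q ∷ x ∷ y ∷ z ∷ []) p 1 2 (4 ∷ 0 ∷ []) refl u5 refl) (same λ _ _ → refl)
    go (none np) (one q′ nq) = C′.pendant nq np [] (p ∷ x ∷ z ∷ q ∷ []) (named (p ∷ q ∷ x ∷ y ∷ z ∷ []) p 0 2 (4 ∷ 1 ∷ []) refl u5 refl) (same λ _ _ → refl)
    go (one p′ np) (one q′ nq) with p′ ≟ q′
    ... | no p′≢q′ = merge np nq p′≢q′
    -- With a common outer neighbour the lifted edge `pq′` would already be present. The edge from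
    -- `q` to it is put at the start of the second new path instead.
    ... | yes refl = pendant np nq (refl ∷ []) (p′ ∷ q ∷ x ∷ z ∷ p ∷ [])
          (named (p ∷ q ∷ x ∷ y ∷ z ∷ p′ ∷ []) p 5 1 (2 ∷ 4 ∷ 0 ∷ []) refl (back np) refl)
          (balanced (p ∷ q ∷ x ∷ y ∷ z ∷ p′ ∷ []) p ((1 ∷ 5 ∷ []) ∷ (1 ∷ 2 ∷ 4 ∷ 0 ∷ []) ∷ []) ((5 ∷ 1 ∷ 2 ∷ 4 ∷ 0 ∷ []) ∷ []) refl refl refl)

-- Subgraphs K₄.

Short : List (Fin N) → Set
Short X = length X ≤ 1

Apart : List (Fin N) → List (Fin N) → Set
Apart X Y = ∀ {t} → t ∈ X → t ∉ Y

wt-through : (X Y : List (Fin N)) (p q r s : Fin N) → Short X → Short Y → ∀ u v →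
             wt (X ++ p ∷ q ∷ r ∷ s ∷ Y) u v ≡ WT (star p X) u v + (δ p q u v + (δ q r u v + δ r s u v)) + WT (star s Y) u v
wt-through [] [] p q r s _ _ u v = lemma (δ p q u v) (δ q r u v) (δ r s u v)
  where
  lemma : ∀ a b c → a + (b + (c + 0)) ≡ a + (b + c) + 0
  lemma = solve-∀
wt-through (x ∷ []) [] p q r s _ _ u v rewrite δ-comm x p u v = lemma (δ p x u v) (δ p q u v) (δ q r u v) (δ r s u v)
  where
  lemma : ∀ x a b c → x + (a + (b + (c + 0))) ≡ x + 0 + 0 + (a + (b + c)) + 0
  lemma = solve-∀
wt-through [] (y ∷ []) p q r s _ _ u v = lemma (δ s y u v) (δ p q u v) (δ q r u v) (δ r s u v)
  where
  lemma : ∀ x a b c → a + (b + (c + (x + 0))) ≡ a + (b + c) + (x + 0 + 0)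
  lemma = solve-∀
wt-through (x ∷ []) (y ∷ []) p q r s _ _ u v rewrite δ-comm x p u v = lemma (δ p x u v) (δ s y u v) (δ p q u v) (δ q r u v) (δ r s u v)
  where
  lemma : ∀ x y a b c → x + (a + (b + (c + (y + 0)))) ≡ x + 0 + 0 + (a + (b + c)) + (y + 0 + 0)
  lemma = solve-∀
wt-through (_ ∷ _ ∷ _) _ _ _ _ _ (s≤s ()) _
wt-through _ (_ ∷ _ ∷ _) _ _ _ _ _ (s≤s ())

record K4 {N : ℕ} (g : SG N) (p q r s : Fin N) : Set where
  constructor k4
  field
    pq : Adj g p q
    pr : Adj g p r
    ps : Adj g p s
    qr : Adj g q r
    qs : Adj g q s
    rs : Adj g r s

K4-free : SG N → Set
K4-free g = ∀ {p q r s} → ¬ K4 g p q r s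

module K4Phase {N : ℕ} (𝒮 : Setting N) where
  open Setting 𝒮
  open Step 𝒮
  open K5⁻Phase 𝒮 using (near-K5)

  -- K₄ splits into the Hamiltonian paths `p q r s` and `q s p r`, and each vertex is an end of
  -- exactly one of them. So every outer edge prolongs one of the paths; `PT` and `QR` prevent a
  -- path from closing up.
  module Core {p q r s : Fin N} (k : K4 g p q r s) {P Q R T : List (Fin N)}
              (np : Nb g p (q ∷ r ∷ s ∷ P)) (nq : Nb g q (p ∷ r ∷ s ∷ Q)) (nr : Nb g r (p ∷ q ∷ s ∷ R)) (ns : Nb g s (p ∷ q ∷ r ∷ T))
              (sP : Short P) (sQ : Short Q) (sR : Short R) (sT : Short T) (PT : Apart P T) (QR : Apart Q R) where
    open K4 k
    private
      S : ∀ {u v} → Adj g u v → Adj g v u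
      S = Adj-sym g
      ne : ∀ {u v} → Adj g u v → u ≢ v
      ne = Adj⇒≢ g
    xs : List (Fin N)
    xs = p ∷ q ∷ r ∷ s ∷ []
    u4 : Unique xs
    u4 = (ne pq ∷ ne pr ∷ ne ps ∷ []) ∷ (ne qr ∷ ne qs ∷ []) ∷ (ne rs ∷ []) ∷ [] ∷ []
    outside : ∀ {v a b c X t} → Nb g v (a ∷ b ∷ c ∷ X) → v ∷ a ∷ b ∷ c ∷ [] ↭ xs → t ∈ X → t ∉ xs
    outside {v} {a} {b} {c} nb σ t∈ t∈xs = case ∈-resp-↭ (↭-sym σ) t∈xs of λ where
      (here e) → Nb-irr nb (there (there (there (subst (_∈ _) e t∈))))
      (there k) → unique-++⁻-disj (a ∷ b ∷ c ∷ []) (uniq nb) k t∈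
    σp : p ∷ q ∷ r ∷ s ∷ [] ↭ xs
    σp = ↭-refl
    σq : q ∷ p ∷ r ∷ s ∷ [] ↭ xs
    σq = swap q p ↭-refl
    σr : r ∷ p ∷ q ∷ s ∷ [] ↭ xs
    σr = ↭-sym (shift r (p ∷ q ∷ []) (s ∷ []))
    σs : s ∷ p ∷ q ∷ r ∷ [] ↭ xs
    σs = ↭-sym (shift s (p ∷ q ∷ r ∷ []) [])

    module Strand {a b c d : Fin N} {X Y : List (Fin N)} (σ : a ∷ b ∷ c ∷ d ∷ [] ↭ xs) (sX : Short X) (sY : Short Y)
                  (X∉ : ∀ {t} → t ∈ X → t ∉ xs) (Y∉ : ∀ {t} → t ∈ Y → t ∉ xs)
                  (aX : All (Adj g a) X) (dY : All (Adj g d) Y) (XY : Apart X Y) where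
      path : List (Fin N)
      path = X ++ a ∷ b ∷ c ∷ d ∷ Y
      private
        core⊆ : ∀ {t} → t ∈ a ∷ b ∷ c ∷ d ∷ [] → t ∈ xs
        core⊆ = ∈-resp-↭ σ
        uXY : ∀ {X : List (Fin N)} → Short X → Unique X
        uXY {[]} _ = []
        uXY {x ∷ []} _ = [] ∷ []
        uXY {_ ∷ _ ∷ _} (s≤s ())
      isP : IsP path
      isP = unique-++ (uXY sX) (unique-++ (unique-resp-↭ (↭-sym σ) u4) (uXY sY) (λ i j → Y∉ j (core⊆ i)))
              (λ i j → case ∈-++⁻ (a ∷ b ∷ c ∷ d ∷ []) j of
                [ (λ k → X∉ i (core⊆ k))
                , (λ k → XY i k) ]′)
          , subst (2 ≤_) (sym (length-++ X)) (≤-trans (s≤s (s≤s z≤n)) (m≤n+m _ (length X)))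
      rm : ∀ {e t} → e ∈ a ∷ b ∷ c ∷ d ∷ [] → Adj g e t → Room (dels xs g) t
      rm i e = roomN (_ ∷ []) ([] ∷ []) (core⊆ i ∷ []) (S e ∷ []) refl
      touch : ∀ {Ns : Vec (List (Fin N)) 2} {S} i → Vec.lookup Ns i ≡ path → Exc (dels xs g) S →
              Touch (dels xs g) Ns [] S ⊎ (∀ {t} → t ∈ X → t ∉ S) × (∀ {t} → t ∈ Y → t ∉ S)
      touch {Ns} {S} i eq E = go X Y sX sY aX dY eq
        where
        c⊆ : ∀ {e f} → All (_∈ e ∷ f ∷ xs) (a ∷ b ∷ c ∷ d ∷ [])
        c⊆ = All.tabulate λ i → there (there (core⊆ i))
        at-end : ∀ {t f e} → e ∈ a ∷ b ∷ c ∷ d ∷ [] → Adj g e t → End t (Vec.lookup Ns i) → t ∈ S →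
                 All (_∈ t ∷ f ∷ xs) (Vec.lookup Ns i) → Touch (dels xs g) Ns [] S
        at-end {t} {f} k e en t∈ al = touch1 none E i t en t∈ (rm k e) f al (λ _ _ → [])
        go : ∀ X Y → Short X → Short Y → All (Adj g a) X → All (Adj g d) Y → Vec.lookup Ns i ≡ X ++ a ∷ b ∷ c ∷ d ∷ Y →
             Touch (dels xs g) Ns [] S ⊎ (∀ {t} → t ∈ X → t ∉ S) × (∀ {t} → t ∈ Y → t ∉ S)
        go [] [] _ _ _ _ _ = inj₂ ((λ ()) , (λ ()))
        go (x ∷ []) [] _ _ (ax ∷ []) _ eq with member? x S
        ... | no n = inj₂ ((λ where (here refl) → n) , (λ ()))
        ... | yes x∈ = inj₁ (at-end {f = x} (here refl) ax (inj₁ (_ , eq)) x∈ (subst (All _) (sym eq) (here refl ∷ c⊆)))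
        go [] (y ∷ []) _ _ _ (dy ∷ []) eq with member? y S
        ... | no n = inj₂ ((λ ()) , (λ where (here refl) → n))
        ... | yes y∈ = inj₁ (at-end {f = y} (there (there (there (here refl)))) dy (inj₂ (_ , cong reverse eq)) y∈
                         (subst (All _) (sym eq) (Allₚ.++⁺ c⊆ (here refl ∷ []))))
        go (x ∷ []) (y ∷ []) _ _ (ax ∷ []) (dy ∷ []) eq with member? x S | member? y S
        ... | yes x∈ | _ = inj₁ (at-end {f = y} (here refl) ax (inj₁ (_ , eq)) x∈ (subst (All _) (sym eq) (here refl ∷ Allₚ.++⁺ c⊆ (there (here refl) ∷ []))))
        ... | no _ | yes y∈ = inj₁ (at-end {f = x} (there (there (there (here refl)))) dy (inj₂ (_ , cong reverse eq)) y∈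
                         (subst (All _) (sym eq) (there (here refl) ∷ Allₚ.++⁺ c⊆ (here refl ∷ []))))
        ... | no n | no m = inj₂ ((λ where (here refl) → n) , (λ where (here refl) → m))
        go (_ ∷ _ ∷ _) _ (s≤s ()) _ _ _ _
        go _ (_ ∷ _ ∷ _) _ (s≤s ()) _ _ _

    σ₂ : q ∷ s ∷ p ∷ r ∷ [] ↭ xs
    σ₂ = ↭-trans (prep q (shift p (s ∷ []) (r ∷ []))) (↭-trans (swap q p ↭-refl) (prep p (prep q (swap s r ↭-refl))))
    module P₁ = Strand ↭-refl sP sT (outside np σp) (outside ns σs) (All.tabulate λ i → All.lookup (all np) (there (there (there i))))
                  (All.tabulate λ i → All.lookup (all ns) (there (there (there i)))) PT
    module P₂ = Strand σ₂ sQ sR (outside nq σq) (outside nr σr) (All.tabulate λ i → All.lookup (all nq) (there (there (there i))))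
                  (All.tabulate λ i → All.lookup (all nr) (there (there (there i)))) QR
    Ns : Vec (List (Fin N)) 2
    Ns = P₁.path ∷ P₂.path ∷ []

    result : Result g ⌊ length W /2⌋
    result = [ inj₁ , (λ (S , E , u) → inj₂ (S , untouched none u E)) ]′
      (reduce [] (np ∷ Nb-del nq ∷ Nb-del (Nb-del nr) ∷ Nb-del (Nb-del (Nb-del ns)) ∷ []) none u4
        (inW ((_ , pq) ∷ (_ , S pq) ∷ (_ , S pr) ∷ (_ , S ps) ∷ [])) Ns (P₁.isP ∷ P₂.isP ∷ []) [] [] [] [] bal (s≤s z≤n) four-for-two
        (Untouched g xs) touch)
      where
      bal : star p (q ∷ r ∷ s ∷ P) ++ star q (r ∷ s ∷ Q) ++ star r (s ∷ R) ++ star s T ++ [] ≈ P₁.path ∷ P₂.path ∷ []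
      bal = same λ u v → trans (eq u v) (sym (cong₂ (λ a b → a + (b + 0)) (wt-through P T p q r s sP sT u v) (wt-through Q R q s p r sQ sR u v)))
        where
        eq : ∀ u v → WT (star p (q ∷ r ∷ s ∷ P) ++ star q (r ∷ s ∷ Q) ++ star r (s ∷ R) ++ star s T ++ []) u v ≡
             WT (star p P) u v + (δ p q u v + (δ q r u v + δ r s u v)) + WT (star s T) u v
             + (WT (star q Q) u v + (δ q s u v + (δ s p u v + δ p r u v)) + WT (star r R) u v + 0)
        eq u v rewrite WT-++ (star p P) (star q (r ∷ s ∷ Q) ++ star r (s ∷ R) ++ star s T ++ []) u v
                     | WT-++ (star q Q) (star r (s ∷ R) ++ star s T ++ []) u v
                     | WT-++ (star r R) (star s T ++ []) u v | WT-++ (star s T) [] u v | δ-comm s p u v =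
          l₁ (δ p q u v) (δ p r u v) (δ p s u v) (δ q r u v) (δ q s u v) (δ r s u v) (WT (star p P) u v) (WT (star q Q) u v) (WT (star r R) u v) (WT (star s T) u v)
          where
          l₁ : ∀ pq pr ps qr qs rs P Q R T → pq + 0 + (pr + 0 + (ps + 0 + (P + (qr + 0 + (qs + 0 + (Q + (rs + 0 + (R + (T + 0))))))))) ≡
                P + (pq + (qr + rs)) + T + (Q + (qs + (ps + pr)) + R + 0)
          l₁ = solve-∀
      touch : ∀ {S} → Exc (dels xs g) S → Touch (dels xs g) Ns [] S ⊎ Untouched g xs S
      touch {S} E with P₁.touch {Ns} {S} Fin.zero refl E | P₂.touch {Ns} {S} (Fin.suc Fin.zero) refl E
      ... | inj₁ t | _ = inj₁ t
      ... | inj₂ _ | inj₁ t = inj₁ t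
      ... | inj₂ (P∉ , T∉) | inj₂ (Q∉ , R∉) = inj₂ (untouchedBy none E
              ((_ , np , (Qx ∷ Rx ∷ Sx ∷ out P∉)) ∷ (_ , nq , (Px ∷ Rx ∷ Sx ∷ out Q∉)) ∷ (_ , nr , (Px ∷ Qx ∷ Sx ∷ out R∉)) ∷ (_ , ns , (Px ∷ Qx ∷ Rx ∷ out T∉)) ∷ []))
        where
        Px = inj₁ (here refl)
        Qx = inj₁ (there (here refl))
        Rx = inj₁ (there (there (here refl)))
        Sx = inj₁ (there (there (there (here refl))))
        out : ∀ {X} → (∀ {t} → t ∈ X → t ∉ S) → All (λ y → y ∈ xs ⊎ y ∉ S) X
        out f = All.tabulate (inj₂ ∘ f)

  common? : (X Y : List (Fin N)) → (∃[ t ] (t ∈ X × t ∈ Y)) ⊎ Apart X Y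
  common? [] Y = inj₂ λ ()
  common? (x ∷ X) Y with member? x Y
  ... | yes i = inj₁ (x , here refl , i)
  ... | no n = case common? X Y of
    [ (λ (t , i , j) → inj₁ (t , there i , j))
    , (λ a → inj₂ λ where
      (here refl) → n
      (there i) → a i) ]′

  short-eq : {X : List (Fin N)} {t u : Fin N} → Short X → t ∈ X → u ∈ X → u ≡ t
  short-eq {_ ∷ []} _ (here refl) (here refl) = refl
  short-eq {_ ∷ _ ∷ _} (s≤s ())

  -- The obstacle is an outer vertex `t` common to the two ends of one path. If `t` has a third
  -- neighbour in the K₄, the five vertices contain K₅⁻; if not, the ends are paired anew as `p`
  -- with `q` and `r` with `s`.
  K4-result : ∀ {p q r s} → K4 g p q r s → Result g ⌊ length W /2⌋
  K4-result {p} {q} {r} {s} k@(k4 pq pr ps qr qs rs) =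
    let P , np = nb-front (q ∷ r ∷ s ∷ []) ((ne qr ∷ ne qs ∷ []) ∷ (ne rs ∷ []) ∷ [] ∷ []) (pq ∷ pr ∷ ps ∷ [])
        Q , nq = nb-front (p ∷ r ∷ s ∷ []) ((ne pr ∷ ne ps ∷ []) ∷ (ne rs ∷ []) ∷ [] ∷ []) (S pq ∷ qr ∷ qs ∷ [])
        R , nr = nb-front (p ∷ q ∷ s ∷ []) ((ne pq ∷ ne ps ∷ []) ∷ (ne qs ∷ []) ∷ [] ∷ []) (S pr ∷ S qr ∷ rs ∷ [])
        T , ns = nb-front (p ∷ q ∷ r ∷ []) ((ne pq ∷ ne pr ∷ []) ∷ (ne qr ∷ []) ∷ [] ∷ []) (S ps ∷ S qs ∷ S rs ∷ [])
    in go np nq nr ns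
    where
    S : ∀ {u v} → Adj g u v → Adj g v u
    S = Adj-sym g
    ne : ∀ {u v} → Adj g u v → u ≢ v
    ne = Adj⇒≢ g
    short : ∀ {v a b c X} → Nb g v (a ∷ b ∷ c ∷ X) → Short X
    short {v} nb with bound g v (uniq nb) (all nb)
    ... | s≤s (s≤s (s≤s l)) = l
    to : ∀ {v a b c X t} → Nb g v (a ∷ b ∷ c ∷ X) → t ∈ X → Adj g t v
    to nb i = S (All.lookup (all nb) (there (there (there i))))
    new : ∀ {v a b c X t} → Nb g v (a ∷ b ∷ c ∷ X) → t ∈ X → t ∉ a ∷ b ∷ c ∷ []
    new {a = a} {b} {c} nb i j = unique-++⁻-disj (a ∷ b ∷ c ∷ []) (uniq nb) j i
    near : ∀ {t a b c d} → K4 g a b c d → t ≢ d → Adj g t a → Adj g t b → Adj g t c → Result g ⌊ length W /2⌋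
    near (k4 ab ac ad bc bd cd) t≢d ta tb tc = near-K5 (near5 t≢d ta tb tc (S ad) (S bd) (S cd) ab ac bc)
    go : ∀ {P Q R T} → Nb g p (q ∷ r ∷ s ∷ P) → Nb g q (p ∷ r ∷ s ∷ Q) → Nb g r (p ∷ q ∷ s ∷ R) → Nb g s (p ∷ q ∷ r ∷ T) → Result g ⌊ length W /2⌋
    go {P} {Q} {R} {T} np nq nr ns with common? P T | common? Q R
    ... | inj₂ PT | inj₂ QR = Core.result k np nq nr ns (short np) (short nq) (short nr) (short ns) PT QR
    ... | inj₁ (t , t∈P , t∈T) | _ with member? t Q | member? t R
    ...   | yes t∈Q | _ = near (k4 pq ps pr qs qr (S rs)) (λ e → new np t∈P (there (here e))) (to np t∈P) (to nq t∈Q) (to ns t∈T)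
    ...   | no _ | yes t∈R = near (k4 pr ps pq rs (S qr) (S qs)) (λ e → new np t∈P (here e)) (to np t∈P) (to nr t∈R) (to ns t∈T)
    ...   | no t∉Q | no t∉R = Core.result (k4 ps pr pq (S rs) (S qs) (S qr))
              (Nb-↭ (↭-trans (prep q (swap r s ↭-refl)) (↭-trans (swap q s ↭-refl) (prep s (swap q r ↭-refl)))) np)
              (Nb-↭ (prep p (swap q r ↭-refl)) ns) (Nb-↭ (prep p (swap q s ↭-refl)) nr) (Nb-↭ (prep p (swap r s ↭-refl)) nq)
              (short np) (short ns) (short nr) (short nq)
              (λ u∈ u∈Q → t∉Q (subst (_∈ Q) (short-eq (short np) t∈P u∈) u∈Q))
              (λ u∈ u∈R → t∉R (subst (_∈ R) (short-eq (short ns) t∈T u∈) u∈R))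
    go {P} {Q} {R} {T} np nq nr ns | inj₂ _ | inj₁ (t , t∈Q , t∈R) with member? t P | member? t T
    ...   | yes t∈P | _ = near (k4 qr (S pq) qs (S pr) rs ps) (λ e → new nq t∈Q (there (there (here e)))) (to nq t∈Q) (to nr t∈R) (to np t∈P)
    ...   | no _ | yes t∈T = near (k4 qr qs (S pq) rs (S pr) (S ps)) (λ e → new nq t∈Q (here e)) (to nq t∈Q) (to nr t∈R) (to ns t∈T)
    ...   | no t∉P | no t∉T = Core.result (k4 qr qs (S pq) rs (S pr) (S ps))
              (Nb-↭ (shifts (p ∷ []) (r ∷ s ∷ [])) nq) (Nb-↭ (↭-trans (swap p q ↭-refl) (prep q (swap p s ↭-refl))) nr)
              (Nb-↭ (shifts (p ∷ []) (q ∷ r ∷ [])) ns) np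
              (short nq) (short nr) (short ns) (short np)
              (λ u∈ u∈P → t∉P (subst (_∈ P) (short-eq (short nq) t∈Q u∈) u∈P))
              (λ u∈ u∈T → t∉T (subst (_∈ T) (short-eq (short nr) t∈R u∈) u∈T))

-- Lifting one pair, and exchanging it for another.

module OneLift {N : ℕ} {g : SG N} {xs : List (Fin N)} {c d s t : Fin N} (c∉ : c ∉ xs) (d∉ : d ∉ xs)
               (s∈ : s ∈ xs) (sc : Adj g s c) (t∈ : t ∈ xs) (td : Adj g t d) (c≢d : c ≢ d) (cd : adj g c d ≡ false) where
  gp : Gap (dels xs g) c d
  gp = gap c≢d (¬Adj⇒false (λ a → ¬Adj (dels-⊑ xs g a) cd)) (roomN (s ∷ []) ([] ∷ []) (s∈ ∷ []) (Adj-sym g sc ∷ []) refl)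
         (roomN (t ∷ []) ([] ∷ []) (t∈ ∷ []) (Adj-sym g td ∷ []) refl)
  h : SG N
  h = add c d (dels xs g) gp
  L : Lifted g xs ((c , d) ∷ []) h
  L = lift c∉ d∉ s∈ sc t∈ td none gp
  link : Adj h c d
  link = add-new gp
  room′ : ∀ {b s} → b ≢ c → b ≢ d → s ∈ xs → Adj g s b → Room h b
  room′ {b} {s} b≢c b≢d s∈ sb un al = roomN (s ∷ []) ([] ∷ []) (s∈ ∷ []) (Adj-sym g sb ∷ []) refl un
    (All.map (λ a → case add⁻ gp a of
      [ (λ a → a)
      , [ (λ (e , _) → contradiction (sym e) b≢c) , (λ (_ , e) → contradiction (sym e) b≢d) ]′ ]′) al)

Is-≢ : {a x c d : Fin N} → a ≢ c → a ≢ d → ¬ Is a x c d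
Is-≢ p q (inj₁ (e , _)) = p e
Is-≢ p q (inj₂ (e , _)) = q e

-- Beyond `x` the new path either stays among removed vertices or ends in one surviving neighbour
-- `c`, where it may enter a component as well.
data Tail {N : ℕ} (g : SG N) (xs : List (Fin N)) (x : Fin N) : List (Fin N) → Set where
  inside  : ∀ {tl} → All (_∈ xs) tl → Tail g xs x tl
  outside : ∀ c → c ∉ xs → Adj g x c → Tail g xs x (c ∷ [])

Off : {g : SG N} {xs : List (Fin N)} {x : Fin N} {tl : List (Fin N)} → Tail g xs x tl → List (Fin N) → Set
Off (inside _) S = ⊤
Off (outside c _ _) S = c ∉ S

Clear : {g : SG N} {xs : List (Fin N)} {x : Fin N} {tl : List (Fin N)} → Tail g xs x tl → Fin N → Set
Clear (inside _) f = ⊤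
Clear (outside c _ _) f = c ≢ f

module Fork {N : ℕ} (𝒮 : Setting N)
            {xs : List (Fin N)} {es : List (List (Fin N))} {x : Fin N} {tl : List (Fin N)}
            (st : Strip (Setting.g 𝒮) xs es) (unx : Unique xs) (xs⊆ : All (_∈ Setting.W 𝒮) xs) (x∈ : x ∈ xs) (T : Tail (Setting.g 𝒮) xs x tl) where
  open Setting 𝒮
  open Step 𝒮

  record Arm (e f k : Fin N) : Set where
    constructor arm
    field
      xe  : Adj g x e
      xf  : Adj g x f
      xk  : Adj g x k
      e∉  : e ∉ xs
      f∉  : f ∉ xs
      k∉  : k ∉ xs
      e≢f : e ≢ f
      e≢k : e ≢ k
      f≢k : f ≢ k
      cf  : Clear T f
      ck  : Clear T k
      isP : IsP (e ∷ x ∷ tl)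
      bal : es ≈ (e ∷ x ∷ tl) ∷ (f ∷ x ∷ k ∷ []) ∷ []

  module Attempt {e f k : Fin N} (A : Arm e f k) (fk : adj g f k ≡ false) (len : 1 ≤ length xs) (budget : Budget (length xs) 1) where
    open Arm A
    open OneLift {g = g} {xs} f∉ k∉ x∈ xf x∈ xk f≢k fk public
    Ns : Vec (List (Fin N)) 1
    Ns = (e ∷ x ∷ tl) ∷ []
    touch : ∀ {S} → Exc h S → Touch h Ns ((f , k) ∷ []) S ⊎ (e ∉ S × Off T S)
    touch {S} E with member? e S
    ... | yes e∈ = inj₁ (go T)
      where
      go : Tail g xs x tl → Touch h Ns ((f , k) ∷ []) S
      go (inside tl∈) = touch1 L E Fin.zero e (inj₁ (_ , refl)) e∈ (room′ e≢f e≢k x∈ xe) e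
        (here refl ∷ there (there x∈) ∷ All.map (λ i → there (there i)) tl∈) (λ _ _ → Is-≢ e≢f e≢k ∷ [])
      go (outside c _ _) = touch1 L E Fin.zero e (inj₁ (_ , refl)) e∈ (room′ e≢f e≢k x∈ xe) c
        (here refl ∷ there (there x∈) ∷ there (here refl) ∷ []) (λ _ _ → Is-≢ e≢f e≢k ∷ [])
    ... | no e∉S = case go T cf ck of [ inj₁ , (λ o → inj₂ (e∉S , o)) ]′
      where
      go : ∀ {tl} (T : Tail g xs x tl) → Clear T f → Clear T k → Touch h ((e ∷ x ∷ tl) ∷ []) ((f , k) ∷ []) S ⊎ Off T S
      go (inside _) _ _ = inj₂ tt
      go (outside c c∉ xc) c≢f c≢k with member? c S
      ... | no c∉S = inj₂ c∉S
      ... | yes c∈ = inj₁ (touch1 L E Fin.zero c (inj₂ (_ , refl)) c∈ (room′ c≢f c≢k x∈ xc) e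
              (there (here refl) ∷ there (there x∈) ∷ here refl ∷ []) (λ _ _ → Is-≢ c≢f c≢k ∷ []))
    result : Goal ⊎ ∃[ S ] (Exc h S × (e ∉ S × Off T S))
    result = reduce (lft f k (x ∷ []) ∷ []) st L unx xs⊆ Ns (isP ∷ []) (tt ∷ []) ([] ∷ []) ([] ∷ []) (x∈ ∷ []) bal len budget
               (λ S → e ∉ S × Off T S) touch

  removed : ∀ {ls h S} → Lifted g xs ls h → Exc h S → ∀ {t} → t ∈ xs → t ∉ S
  removed L E t∈ t∈S = let _ , _ , _ , a , _ = exc-degree E t∈S in lifted-∉ L a t∈

  -- If the lifted edge fk lies in an exceptional component avoiding e, then
  -- ke joins different components, and it may be lifted instead.
  fork : ∀ {e f k} → Arm e f k → Arm f k e → adj g f k ≡ false → 1 ≤ length xs → Budget (length xs) 1 →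
         (∀ {S} → (∀ {t} → t ∈ xs → t ∉ S) → e ∉ S → f ∉ S → k ∉ S → Off T S → Untouched g xs S) → Result g ⌊ length W /2⌋
  fork {e} {f} {k} A B fk len budget far with Attempt.result A fk len budget
  ... | inj₁ good = inj₁ good
  ... | inj₂ (S , E , e∉ , off) with member? f S
  ...   | no f∉ = inj₂ (S , untouched M.L (far (removed M.L E) e∉ f∉ (λ k∈ → f∉ (exc-closed E k∈ (Adj-sym M.h M.link))) off) E)
    where
    module M = Attempt A fk len budget
  ...   | yes f∈ = second (M₂.result)
    where
    module M = Attempt A fk len budget
    module M′ = Arm A
    k∈ : k ∈ S
    k∈ = exc-closed E f∈ M.link
    -- `k` lies in the component `S` of the first reduced graph and `e` does not, so they are not
    -- adjacent in `g` either.
    ke : adj g k e ≡ false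
    ke = ¬Adj⇒false λ a → e∉ (exc-closed E k∈ (lifted-old M.L M′.k∉ M′.e∉ a))
    module M₂ = Attempt B ke len budget
    second : Goal ⊎ ∃[ S ] (Exc M₂.h S × (f ∉ S × Off T S)) → Result g ⌊ length W /2⌋
    second (inj₁ good) = inj₁ good
    second (inj₂ (S₂ , E₂ , f∉ , off₂)) = inj₂ (S₂ , untouched M₂.L (far (removed M₂.L E₂) e∉₂ f∉ k∉₂ off₂) E₂)
      where
      k∉₂ : k ∉ S₂
      -- The other two edges of a triangle on `ke` are old edges, present in the first reduced graph
      -- too; they would lead from `k` to `e` inside `S`.
      k∉₂ k∈₂ = let t , kt , et = exc-triangle E₂ k∈₂ M₂.link in
        case add⁻ M₂.gp kt of
          [ (λ a → case add⁻ M₂.gp et of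
            [ (λ b → e∉ (exc-closed E (exc-closed E k∈ (add⁺ M.gp a)) (Adj-sym M.h (add⁺ M.gp b))))
            , [ (λ (_ , p) → Adj⇒≢ M₂.h et p) , (λ (p , _) → Adj⇒≢ M₂.h kt p) ]′ ]′)
          , [ (λ (_ , p) → Adj⇒≢ M₂.h et p) , (λ (p , _) → Adj⇒≢ M₂.h kt p) ]′ ]′
      e∉₂ : e ∉ S₂
      e∉₂ e∈₂ = k∉₂ (exc-closed E₂ e∈₂ (Adj-sym M₂.h M₂.link))

-- Even order: removing any one vertex.

module EvenPhase {N : ℕ} (𝒮 : Setting N) where
  open Setting 𝒮
  open Step 𝒮

  private
    S : ∀ {u v} → Adj g u v → Adj g v u
    S = Adj-sym g
    ne : ∀ {u v} → Adj g u v → u ≢ v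
    ne = Adj⇒≢ g
    single : ∀ {x y} → Adj g x y → y ∉ x ∷ []
    single a (here refl) = ne a refl

  drop : ∀ {x} → x ∈ W → Nb g x [] → Result g ⌊ length W /2⌋
  drop {x} x∈ nb = [ inj₁ , (λ (S , E , u) → inj₂ (S , untouched none u E)) ]′
    (reduce [] (nb ∷ []) none ([] ∷ []) (x∈ ∷ []) [] [] [] [] [] [] (same λ _ _ → refl) (s≤s z≤n) one-for-none
      (Untouched g (x ∷ [])) (λ E → inj₂ (untouchedBy none E ((_ , nb , []) ∷ []))))

  module _ {k : ℕ} (ev : length W ≡ k + k) {x : Fin N} where

    deg1 : ∀ {a} → Nb g x (a ∷ []) → Result g ⌊ length W /2⌋
    deg1 {a} nb@(nbr _ (xa ∷ []) _) = [ inj₁ , (λ (S , E , u) → inj₂ (S , untouched none u E)) ]′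
      (reduce [] (nb ∷ []) none ([] ∷ []) (sp xa ∷ []) Ns (((ne xa ∷ []) ∷ [] ∷ [] , s≤s (s≤s z≤n)) ∷ []) [] [] [] [] (same λ _ _ → refl) (s≤s z≤n)
        (one-for-one {k} ev) (Untouched g (x ∷ [])) touch)
      where
      Ns : Vec (List (Fin N)) 1
      Ns = (x ∷ a ∷ []) ∷ []
      touch : ∀ {S} → Exc (dels (x ∷ []) g) S → Touch (dels (x ∷ []) g) Ns [] S ⊎ Untouched g (x ∷ []) S
      touch {S′} E with member? a S′
      ... | no a∉ = inj₂ (untouchedBy none E ((_ , nb , inj₂ a∉ ∷ []) ∷ []))
      ... | yes a∈ = inj₁ (touch1 none E Fin.zero a (inj₂ (_ , refl)) a∈ (roomN (x ∷ []) ([] ∷ []) (here refl ∷ []) (S xa ∷ []) refl) a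
              (there (there (here refl)) ∷ here refl ∷ []) (λ _ _ → []))

    deg2 : ∀ {a b} → Nb g x (a ∷ b ∷ []) → Result g ⌊ length W /2⌋
    deg2 {a} {b} nb@(nbr ((a≢b ∷ []) ∷ _) (xa ∷ xb ∷ []) _) = [ inj₁ , (λ (S , E , u) → inj₂ (S , untouched none u E)) ]′
      (reduce [] (nb ∷ []) none ([] ∷ []) (sp xa ∷ []) Ns
        (((ne (S xa) ∷ a≢b ∷ []) ∷ (ne xb ∷ []) ∷ [] ∷ [] , s≤s (s≤s z≤n)) ∷ []) [] [] [] []
        (balanced (x ∷ a ∷ b ∷ []) x ((0 ∷ 1 ∷ []) ∷ (0 ∷ 2 ∷ []) ∷ []) ((1 ∷ 0 ∷ 2 ∷ []) ∷ []) refl refl refl) (s≤s z≤n)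
        (one-for-one {k} ev) (Untouched g (x ∷ [])) touch)
      where
      Ns : Vec (List (Fin N)) 1
      Ns = (a ∷ x ∷ b ∷ []) ∷ []
      touch : ∀ {S} → Exc (dels (x ∷ []) g) S → Touch (dels (x ∷ []) g) Ns [] S ⊎ Untouched g (x ∷ []) S
      touch {S′} E with member? a S′ | member? b S′
      ... | no a∉ | no b∉ = inj₂ (untouchedBy none E ((_ , nb , inj₂ a∉ ∷ inj₂ b∉ ∷ []) ∷ []))
      ... | yes a∈ | _ = inj₁ (touch1 none E Fin.zero a (inj₁ (_ , refl)) a∈ (roomN (x ∷ []) ([] ∷ []) (here refl ∷ []) (S xa ∷ []) refl) b
              (here refl ∷ there (there (here refl)) ∷ there (here refl) ∷ []) (λ _ _ → []))
      ... | no _ | yes b∈ = inj₁ (touch1 none E Fin.zero b (inj₂ (_ , refl)) b∈ (roomN (x ∷ []) ([] ∷ []) (here refl ∷ []) (S xb ∷ []) refl) a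
              (there (here refl) ∷ there (there (here refl)) ∷ here refl ∷ []) (λ _ _ → []))

    deg3 : ∀ {a b c} → Nb g x (a ∷ b ∷ c ∷ []) → adj g a b ≡ false → Result g ⌊ length W /2⌋
    deg3 {a} {b} {c} nb@(nbr ((a≢b ∷ a≢c ∷ []) ∷ (b≢c ∷ []) ∷ _) (xa ∷ xb ∷ xc ∷ []) _) ab =
      fork (arm xc xa xb (single xc) (single xa) (single xb) (a≢c ∘ sym) (b≢c ∘ sym) a≢b tt tt ((ne (S xc) ∷ []) ∷ [] ∷ [] , s≤s (s≤s z≤n))
              (balanced ρ x stars ((3 ∷ 0 ∷ []) ∷ (1 ∷ 0 ∷ 2 ∷ []) ∷ []) refl refl refl))
           (arm xa xb xc (single xa) (single xb) (single xc) a≢b a≢c b≢c tt tt ((ne (S xa) ∷ []) ∷ [] ∷ [] , s≤s (s≤s z≤n))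
              (balanced ρ x stars ((1 ∷ 0 ∷ []) ∷ (2 ∷ 0 ∷ 3 ∷ []) ∷ []) refl refl refl))
           ab (s≤s z≤n) (one-for-one {k} ev) far
      where
      open Fork 𝒮 {tl = []} (nb ∷ []) ([] ∷ []) (sp xa ∷ []) (here refl) (inside [])
      ρ = x ∷ a ∷ b ∷ c ∷ []
      stars = (0 ∷ 1 ∷ []) ∷ (0 ∷ 2 ∷ []) ∷ (0 ∷ 3 ∷ []) ∷ []
      far : ∀ {S} → (∀ {t} → t ∈ x ∷ [] → t ∉ S) → c ∉ S → a ∉ S → b ∉ S → ⊤ → Untouched g (x ∷ []) S
      far _ c∉ a∉ b∉ _ (here refl) e = case cover nb e of λ where
        (here refl) → a∉
        (there (here refl)) → b∉
        (there (there (here refl))) → c∉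

    -- `d` remains the far end of the new path in both attempts; only `a`, `b`, `c` exchange their
    -- roles.
    deg4 : ∀ {a b c d} → Nb g x (a ∷ b ∷ c ∷ d ∷ []) → adj g a b ≡ false → Result g ⌊ length W /2⌋
    deg4 {a} {b} {c} {d} nb@(nbr ((a≢b ∷ a≢c ∷ a≢d ∷ []) ∷ (b≢c ∷ b≢d ∷ []) ∷ (c≢d ∷ []) ∷ _) (xa ∷ xb ∷ xc ∷ xd ∷ []) _) ab =
      fork (arm xc xa xb (single xc) (single xa) (single xb) (a≢c ∘ sym) (b≢c ∘ sym) a≢b (a≢d ∘ sym) (b≢d ∘ sym)
              ((ne (S xc) ∷ c≢d ∷ []) ∷ (ne xd ∷ []) ∷ [] ∷ [] , s≤s (s≤s z≤n))
              (balanced ρ x stars ((3 ∷ 0 ∷ 4 ∷ []) ∷ (1 ∷ 0 ∷ 2 ∷ []) ∷ []) refl refl refl))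
           (arm xa xb xc (single xa) (single xb) (single xc) a≢b a≢c b≢c (b≢d ∘ sym) (c≢d ∘ sym)
              ((ne (S xa) ∷ a≢d ∷ []) ∷ (ne xd ∷ []) ∷ [] ∷ [] , s≤s (s≤s z≤n))
              (balanced ρ x stars ((1 ∷ 0 ∷ 4 ∷ []) ∷ (2 ∷ 0 ∷ 3 ∷ []) ∷ []) refl refl refl))
           ab (s≤s z≤n) (one-for-one {k} ev) far
      where
      open Fork 𝒮 {tl = d ∷ []} (nb ∷ []) ([] ∷ []) (sp xa ∷ []) (here refl) (outside d (single xd) xd)
      ρ = x ∷ a ∷ b ∷ c ∷ d ∷ []
      stars = (0 ∷ 1 ∷ []) ∷ (0 ∷ 2 ∷ []) ∷ (0 ∷ 3 ∷ []) ∷ (0 ∷ 4 ∷ []) ∷ []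
      far : ∀ {S} → (∀ {t} → t ∈ x ∷ [] → t ∉ S) → c ∉ S → a ∉ S → b ∉ S → d ∉ S → Untouched g (x ∷ []) S
      far _ c∉ a∉ b∉ d∉ (here refl) e = case cover nb e of λ where
        (here refl) → a∉
        (there (here refl)) → b∉
        (there (there (here refl))) → c∉
        (there (there (there (here refl)))) → d∉

-- In K₅ and K₅⁻ every vertex has degree at least three, so only the triangle is left.
exc-view : {h : SG N} {S : List (Fin N)} {b : Fin N} → Exc h S → b ∈ S → RoomN h b 2 →
           ∃[ s ] ∃[ t ] (Adj h b s × Adj h b t × Adj h s t × Closed h (b ∷ s ∷ t ∷ []))
exc-view (k3 i j k c) (here refl) _ = _ , _ , i , j , k , c
exc-view {h = h} (k3 {a} {b} i j k c) (there (here refl)) _ = _ , _ , Adj-sym h i , k , j , closed-↭ (swap a b ↭-refl) c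
exc-view {h = h} (k3 {a} {b} {d} i j k c) (there (there (here refl))) _ =
  _ , _ , Adj-sym h j , Adj-sym h k , i , closed-↭ (shift d (a ∷ b ∷ []) []) c
exc-view {h = h} {b = b} (k5 (near5 n p₁ p₂ p₃ q₁ q₂ q₃ r s t) _) b∈ rm = case b∈ of λ where
    (here refl) → absurd (ne r ∷ ne s ∷ []) (ne t ∷ []) (p₁ ∷ p₂ ∷ p₃ ∷ [])
    (there (here refl)) → absurd (ne r ∷ ne s ∷ []) (ne t ∷ []) (q₁ ∷ q₂ ∷ q₃ ∷ [])
    (there (there (here refl))) → absurd (n ∷ ne p₂ ∷ []) (ne q₂ ∷ []) (S p₁ ∷ S q₁ ∷ r ∷ [])
    (there (there (there (here refl)))) → absurd (n ∷ ne p₁ ∷ []) (ne q₁ ∷ []) (S p₂ ∷ S q₂ ∷ S r ∷ [])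
    (there (there (there (there (here refl))))) → absurd (n ∷ ne p₁ ∷ []) (ne q₁ ∷ []) (S p₃ ∷ S q₃ ∷ S s ∷ [])
  where
  S : ∀ {u v} → Adj h u v → Adj h v u
  S = Adj-sym h
  ne : ∀ {u v} → Adj h u v → u ≢ v
  ne = Adj⇒≢ h
  absurd : ∀ {A : Set} {u v w} → All (u ≢_) (v ∷ w ∷ []) → All (v ≢_) (w ∷ []) → All (Adj h b) (u ∷ v ∷ w ∷ []) → A
  absurd a b c = case rm (a ∷ b ∷ [] ∷ []) c of λ where (s≤s (s≤s ()))

-- Odd order: a vertex of degree two.

module Deg2Phase {N : ℕ} (𝒮 : Setting N) (noK4 : K4-free (Setting.g 𝒮))
                 {k : ℕ} (od : length (Setting.W 𝒮) ≡ suc (k + k)) where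
  open Setting 𝒮
  open Step 𝒮

  private
    S : ∀ {u v} → Adj g u v → Adj g v u
    S = Adj-sym g
    ne : ∀ {u v} → Adj g u v → u ≢ v
    ne = Adj⇒≢ g

  -- No new path is created, hence none can absorb. A component through the lifted edge is treated
  -- directly: that edge is peeled off and replaced by the path `v w b`.
  suppress : ∀ {w v b} → Nb g w (v ∷ b ∷ []) → adj g v b ≡ false → Result g ⌊ length W /2⌋
  suppress {w} {v} {b} nw@(nbr ((v≢b ∷ []) ∷ _) (wv ∷ wb ∷ []) _) vb =
    conclude (reduce (lft v b (w ∷ []) ∷ []) (nw ∷ []) L ([] ∷ []) (sp wv ∷ []) Ns [] (tt ∷ []) ([] ∷ []) ([] ∷ []) (here refl ∷ [])
      (balanced (w ∷ v ∷ b ∷ []) w ((0 ∷ 1 ∷ []) ∷ (0 ∷ 2 ∷ []) ∷ []) ((1 ∷ 0 ∷ 2 ∷ []) ∷ []) refl refl refl)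
      (s≤s z≤n) one-for-none (λ _ → ⊤) (λ _ → inj₂ tt))
    where
    xs = w ∷ []
    single : ∀ {y} → Adj g w y → y ∉ xs
    single a (here refl) = ne a refl
    open OneLift {g = g} {xs} (single wv) (single wb) (here refl) wv (here refl) wb v≢b vb
    Ns : Vec (List (Fin N)) 0
    Ns = []
    module _ {C : List (Fin N)} (E : Exc h C) (v∈ : v ∈ C) where
      b∈ : b ∈ C
      b∈ = exc-closed E v∈ link
      real : ∀ {s t} → v ≢ s → v ≢ t → Adj h s t → Adj g s t
      real v≢s v≢t a = case lifted-adj L a of
        [ (λ (_ , _ , e) → e)
        , (λ (_ , _ , r) → case r of any₁ [ (λ (e , _) → contradiction e v≢s) , (λ (e , _) → contradiction e v≢t) ]′) ]′
      -- The lifted edge ends at `v`, so the four other vertices of a K₅ would already form a K₄ in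
      -- `g`.
      notK5 : ¬ IsK5 {h = h} C
      notK5 (p , q , x , y , z , refl , near5 n p₁ p₂ p₃ q₁ q₂ q₃ r s t , pq) = case v∈ of λ where
          (here refl) → K q₁ q₂ q₃ r s t pq p₁ p₂ p₃
          (there (here refl)) → K p₁ p₂ p₃ r s t (Sh pq) q₁ q₂ q₃
          (there (there (here refl))) → K pq p₂ p₃ q₂ q₃ t (Sh p₁) (Sh q₁) r s
          (there (there (there (here refl)))) → K pq p₁ p₃ q₁ q₃ s (Sh p₂) (Sh q₂) (Sh r) t
          (there (there (there (there (here refl))))) → K pq p₁ p₂ q₁ q₂ r (Sh p₃) (Sh q₃) (Sh s) (Sh t)
        where
        Sh : ∀ {u v} → Adj h u v → Adj h v u
        Sh = Adj-sym h
        K : ∀ {a b c d} → Adj h a b → Adj h a c → Adj h a d → Adj h b c → Adj h b d → Adj h c d →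
            Adj h v a → Adj h v b → Adj h v c → Adj h v d → ⊥
        K ab ac ad bc bd cd va vb vc vd = noK4 (k4 (real A B ab) (real A C′ ac) (real A D bd′) (real B C′ bc) (real B D bd) (real C′ D cd))
          where
          bd′ = ad
          A = Adj⇒≢ h va
          B = Adj⇒≢ h vb
          C′ = Adj⇒≢ h vc
          D = Adj⇒≢ h vd
      finish : Result g ⌊ length W /2⌋
      finish with peel? E v∈ link
      ... | inj₂ K = contradiction K notK5
      ... | inj₁ P = case ih (dels C h) (unique-++⁻ʳ C (unique-resp-↭ W₂↭ (unique-++⁻ʳ xs (unique-resp-↭ W₁↭ un)))) <W (Supp-dels (lifted-supp L sp W₁↭) W₂↭) of
          [ (λ (D , isP , len , w) → inj₁ ((v ∷ w₀ ∷ b ∷ []) ∷ P.D ++ D ,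
            ((((ne (S wv) ∷ v≢b ∷ []) ∷ (ne wb ∷ []) ∷ [] ∷ []) , s≤s (s≤s z≤n)) ∷ Allₚ.++⁺ P.isP isP) ,
            length-bound len , λ u t → weight D w u t))
          , (λ (S₂ , E₂) → let E₃ , dis = exc-dels E E₂ in inj₂ (S₂ , untouched L (λ where
            (here refl) a y∈ → case cover nw a of λ where
              (here refl) → dis y∈ v∈
              (there (here refl)) → dis y∈ b∈) E₃)) ]′
        where
        w₀ = w
        module P = Peel P
        r₁ = removeAll {xs = xs} {W} ([] ∷ []) (sp wv ∷ [])
        W₁ = proj₁ r₁
        W₁↭ : W ↭ xs ++ W₁
        W₁↭ = proj₂ r₁
        r₂ = removeAll (exc-unique E) (exc-⊆ (lifted-supp L sp W₁↭) E)
        W₂ = proj₁ r₂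
        W₂↭ : W₁ ↭ C ++ W₂
        W₂↭ = proj₂ r₂
        lenW : length W ≡ suc (suc (length P.D + length P.D)) + length W₂
        lenW = trans (↭-length W₁↭) (cong suc (trans (↭-length W₂↭) (trans (length-++ C) (cong (_+ length W₂) P.len))))
        <W : length W₂ < length W
        <W = subst (length W₂ <_) (sym lenW) (s≤s (≤-trans (m≤n+m _ (length P.D + length P.D)) (ℕ.n≤1+n _)))
        -- Together with `w` the component has an even number of vertices, which pays for its peeled
        -- paths and for `v w b`.
        length-bound : ∀ {D : List (List (Fin N))} → length D ≤ ⌊ length W₂ /2⌋ → suc (length (P.D ++ D)) ≤ ⌊ length W /2⌋
        length-bound {D} le rewrite length-++ P.D {D} | lenW =
          s≤s (≤-trans (ℕ.+-monoʳ-≤ (length P.D) le) (≤-reflexive (half+ (length P.D) (length W₂))))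
        weight : ∀ D → (WT D ≗₂ ⟨ dels C h ⟩) → ∀ u t → wt (v ∷ w ∷ b ∷ []) u t + WT (P.D ++ D) u t ≡ ⟨ g ⟩ u t
        weight D w′ u t = ℕ.+-cancelʳ-≡ (δ v b u t) _ _ (trans
          (trans (cong (λ m → wt (v ∷ w ∷ b ∷ []) u t + m + δ v b u t) (trans (WT-++ P.D D u t) (cong (WT P.D u t +_) (w′ u t))))
            (l₁ (wt (v ∷ w ∷ b ∷ []) u t) (WT P.D u t) (⟨ dels C h ⟩ u t) (δ v b u t)))
          (trans (cong₂ _+_ (P.weight u t) (trans (cong (_+ (δ w b u t + 0)) (δ-comm v w u t)) refl))
            (trans (cong (_+ (δ w v u t + (δ w b u t + 0))) (lifted-weight L u t))
              (trans (l₂ (⟨ dels xs g ⟩ u t) (δ v b u t) (δ w v u t) (δ w b u t))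
                (cong (_+ δ v b u t) (sym (strip-weight (nw ∷ []) u t)))))))
          where
          l₁ : ∀ p d r e → p + (d + r) + e ≡ d + e + r + p
          l₁ = solve-∀
          l₂ : ∀ g e a b → g + (e + 0) + (a + (b + 0)) ≡ g + (a + 0 + (b + 0 + 0)) + e
          l₂ = solve-∀
    conclude : Goal ⊎ ∃[ C ] (Exc h C × ⊤) → Result g ⌊ length W /2⌋
    conclude (inj₁ good) = inj₁ good
    conclude (inj₂ (C , E , _)) with member? v C
    ... | yes v∈ = finish E v∈
    ... | no v∉ = inj₂ (C , untouched L (λ where
            (here refl) a y∈ → case cover nw a of λ where
              (here refl) → v∉ y∈
              (there (here refl)) → v∉ (exc-closed E y∈ (Adj-sym h link))) E)

  module _ {w v b : Fin N} (nw : Nb g w (v ∷ b ∷ [])) (vb : Adj g v b) where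
    private
      wv : Adj g w v
      wv = All.head (all nw)
      wb : Adj g w b
      wb = All.head (All.tail (all nw))
      uwvb : Unique (w ∷ v ∷ b ∷ [])
      uwvb = (ne wv ∷ ne wb ∷ []) ∷ (ne vb ∷ []) ∷ [] ∷ []
      path : ∀ i j is → distinctᵇ 3 (i ∷ j ∷ is) ≡ true → IsP (map (at (w ∷ v ∷ b ∷ []) w) (i ∷ j ∷ is))
      path i j is t = named (w ∷ v ∷ b ∷ []) w i j is refl uwvb t

    -- The triangle wvb hangs at b; the path through b is cut there.
    ear : ∀ {y Y} → Nb g v (w ∷ b ∷ []) → Nb g b (w ∷ v ∷ y ∷ Y) → Result g ⌊ length W /2⌋
    ear {y} {Y} nv nb = go (ih h (unique-++⁻ʳ xs (unique-resp-↭ W↭ un)) <W (Supp-dels sp W↭))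
      where
      xs : List (Fin N)
      xs = w ∷ v ∷ []
      h : SG N
      h = dels xs g
      rmv = removeAll {xs = xs} {W} ((ne wv ∷ []) ∷ [] ∷ []) (sp wv ∷ sp vb ∷ [])
      W′ = proj₁ rmv
      W↭ : W ↭ xs ++ W′
      W↭ = proj₂ rmv
      lenW : length W ≡ suc (suc (length W′))
      lenW = ↭-length W↭
      <W : length W′ < length W
      <W = subst (length W′ <_) (sym lenW) (s≤s (ℕ.n≤1+n _))
      y∉ : ∀ {t} → t ∈ y ∷ Y → t ∉ xs
      y∉ t∈ t∈xs = unique-++⁻-disj (w ∷ v ∷ []) (uniq nb) t∈xs t∈
      b∉ : b ∉ xs
      b∉ (here e) = ne wb (sym e)
      b∉ (there (here e)) = ne vb (sym e)
      nbh : Nb h b (y ∷ Y)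
      nbh = nb-dels (w ∷ v ∷ []) b∉ nb (here refl ∷ there (here refl) ∷ []) (All.tabulate y∉)
      fresh-xs : ∀ {D} → All IsP D → (WT D ≗₂ ⟨ h ⟩) → ∀ {t} → t ∈ xs → Fresh t D
      fresh-xs isP eq {t} t∈ = fresh isP (λ z → trans (eq t z) (⟨⟩-¬adj h (¬Adj⇒false λ a → proj₁ (dels⁻ xs g a) t∈)))
      Y≤ : length (y ∷ Y) ≤ 2
      Y≤ with bound g b (uniq nb) (all nb)
      ... | s≤s (s≤s l) = l
      go : Result h ⌊ length W′ /2⌋ → Result g ⌊ length W /2⌋
      go (inj₁ (D , isP , len , eq)) = inj₁ (Sp.D′ , Sp.isP , ≤-trans (≤-reflexive Sp.len) (≤-trans (s≤s len) (≤-reflexive (cong ⌊_/2⌋ (sym lenW)))) , wt-eq)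
        where
        -- One half of the cut path goes on along `b w v`, the other along `b v`, which uses up the
        -- three edges of the triangle.
        sl = split {b = b} {y} w (v ∷ []) v [] isP (≤-reflexive (sym (trans (eq b y) (⟨⟩-adj h (All.head (all nbh))))))
               ((ne wv ∷ []) ∷ [] ∷ []) ([] ∷ []) (fresh-xs isP eq) (λ where (here refl) → fresh-xs isP eq (there (here refl)))
        module Sp = Split sl
        wt-eq : ∀ u t → WT Sp.D′ u t ≡ ⟨ g ⟩ u t
        wt-eq u t = trans (Sp.weight u t) (trans (cong₂ _+_ (eq u t) (trans (trans (cong (wt (b ∷ w ∷ v ∷ []) u t +_) (sym (+-identityʳ _)))
            (weights (balanced (w ∷ v ∷ b ∷ []) w ((2 ∷ 0 ∷ 1 ∷ []) ∷ (2 ∷ 1 ∷ []) ∷ []) ((0 ∷ 1 ∷ []) ∷ (0 ∷ 2 ∷ []) ∷ (1 ∷ 2 ∷ []) ∷ []) refl refl refl) u t)) refl))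
            (sym (strip-weight (nw ∷ Nb-del nv ∷ []) u t)))
      go (inj₂ (C , E)) with member? b C
      ... | no b∉C = inj₂ (C , untouched none (untouchedBy none E
              ((_ , nw , inj₁ (there (here refl)) ∷ inj₂ b∉C ∷ []) ∷ (_ , nv , inj₁ (here refl) ∷ inj₂ b∉C ∷ []) ∷ [])) E)
      -- Having lost `w` and `v`, the vertex `b` has degree at most two, so the component is a
      -- triangle and the two triangles at `b` are removed together.
      ... | yes b∈ with exc-view E b∈ (λ un al → ≤-trans (count un al) Y≤)
        where
        count : RoomN h b (length (y ∷ Y))
        count {ns} un al with removeAll un (All.map (cover nbh) al)
        ... | ms , p = subst (length ns ≤_) (sym (trans (↭-length p) (length-++ ns))) (m≤m+n _ _)
      ...   | s , t , bs , bt , st , cl = bowtie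
        where
        s∉ : s ∉ xs
        s∉ = proj₁ (proj₂ (dels⁻ xs g bs))
        t∉ : t ∉ xs
        t∉ = proj₁ (proj₂ (dels⁻ xs g bt))
        gs : ∀ {u z} → Adj h u z → Adj g u z
        gs = dels-⊑ xs g
        out-of : ∀ {u z} → u ∉ xs → u ≢ b → u ∈ b ∷ s ∷ t ∷ [] → Adj g u z → z ∈ b ∷ s ∷ t ∷ []
        out-of {u} {z} u∉ u≢b u∈ a with member? z xs
        ... | no z∉ = cl u∈ (dels⁺ xs g u∉ z∉ a)
        ... | yes (here refl) = case cover nw (S a) of λ where
                (here refl) → contradiction (there (here refl)) u∉
                (there (here refl)) → contradiction refl u≢b
        ... | yes (there (here refl)) = case cover nv (S a) of λ where
                (here refl) → contradiction (here refl) u∉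
                (there (here refl)) → contradiction refl u≢b
        ns : Nb g s (b ∷ t ∷ [])
        ns = nbr ((ne (gs bt) ∷ []) ∷ [] ∷ []) (S (gs bs) ∷ gs st ∷ []) λ a → case out-of s∉ (ne (gs bs) ∘ sym) (there (here refl)) a of any₃
          here
          (λ e → contradiction (sym e) (ne a))
          (λ e → there (here e))
        nt : Nb g t (b ∷ s ∷ [])
        nt = nbr ((ne (gs bs) ∷ []) ∷ [] ∷ []) (S (gs bt) ∷ S (gs st) ∷ []) λ a → case out-of t∉ (ne (gs bt) ∘ sym) (there (there (here refl))) a of any₃
          here
          (λ e → there (here e))
          (λ e → contradiction (sym e) (ne a))
        u5 : Unique (w ∷ v ∷ b ∷ s ∷ t ∷ [])
        u5 = (ne wv ∷ ne wb ∷ (λ e → s∉ (here (sym e))) ∷ (λ e → t∉ (here (sym e))) ∷ [])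
           ∷ (ne vb ∷ (λ e → s∉ (there (here (sym e)))) ∷ (λ e → t∉ (there (here (sym e)))) ∷ [])
           ∷ (ne (gs bs) ∷ ne (gs bt) ∷ []) ∷ (ne (gs st) ∷ []) ∷ [] ∷ []
        nb₄ : Nb g b (w ∷ v ∷ s ∷ t ∷ [])
        nb₄ = nb4 (named-unique w (0 ∷ 1 ∷ 3 ∷ 4 ∷ []) u5 refl) (S wb ∷ S vb ∷ gs bs ∷ gs bt ∷ [])
        ys = w ∷ v ∷ b ∷ s ∷ t ∷ []
        bowtie : Result g ⌊ length W /2⌋
        bowtie = settle none (reduce []
            (nw ∷ Nb-del nv ∷ Nb-del (Nb-del nb₄) ∷ Nb-del (Nb-del-∉ (λ e → s∉ (there (here e))) (Nb-del-∉ (λ e → s∉ (here e)) ns (any₂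
                (λ e → ne wb e)
                (λ e → t∉ (here (sym e))))) (any₂
                (λ e → ne vb e)
                (λ e → t∉ (there (here (sym e))))))
              ∷ Nb-del (Nb-del (Nb-del-∉ (λ e → t∉ (there (here e))) (Nb-del-∉ (λ e → t∉ (here e)) nt (any₂
                (λ e → ne wb e)
                (λ e → s∉ (here (sym e))))) (any₂
                (λ e → ne vb e)
                (λ e → s∉ (there (here (sym e))))))) ∷ [])
            none u5 (inW ((_ , wv) ∷ (_ , vb) ∷ (_ , gs bs) ∷ (_ , gs st) ∷ (_ , S (gs bt)) ∷ []))
            ((w ∷ v ∷ b ∷ s ∷ t ∷ []) ∷ (w ∷ b ∷ t ∷ []) ∷ []) ((u5 , s≤s (s≤s z≤n)) ∷ named ys w 0 2 (4 ∷ []) refl u5 refl ∷ [])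
            [] [] [] [] (balanced ys w ((0 ∷ 1 ∷ []) ∷ (0 ∷ 2 ∷ []) ∷ (1 ∷ 2 ∷ []) ∷ (2 ∷ 3 ∷ []) ∷ (2 ∷ 4 ∷ []) ∷ (3 ∷ 4 ∷ []) ∷ [])
               ((0 ∷ 1 ∷ 2 ∷ 3 ∷ 4 ∷ []) ∷ (0 ∷ 2 ∷ 4 ∷ []) ∷ []) refl refl refl)
            (s≤s z≤n) (odd-for {k} 2 od) (Untouched g ys) (λ E → inj₂ (untouchedBy none E
              ((_ , nw , inj₁ (there (here refl)) ∷ inj₁ (there (there (here refl))) ∷ [])
               ∷ (_ , nv , inj₁ (here refl) ∷ inj₁ (there (there (here refl))) ∷ [])
               ∷ (_ , nb₄ , inj₁ (here refl) ∷ inj₁ (there (here refl)) ∷ inj₁ (there (there (there (here refl)))) ∷ inj₁ (there (there (there (there (here refl))))) ∷ [])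
               ∷ (_ , ns , inj₁ (there (there (here refl))) ∷ inj₁ (there (there (there (there (here refl))))) ∷ [])
               ∷ (_ , nt , inj₁ (there (there (here refl))) ∷ inj₁ (there (there (there (here refl)))) ∷ []) ∷ []))))

    -- Without `w` and `v` the vertex `b` is pendant. Its path is continued along `bv`, and the
    -- remaining edges form the new path `a v w b`.
    both3 : ∀ {a c} → Nb g v (w ∷ b ∷ a ∷ []) → Nb g b (w ∷ v ∷ c ∷ []) → Result g ⌊ length W /2⌋
    both3 {a} {c} nv@(nbr ((_ ∷ w≢a ∷ []) ∷ (b≢a ∷ []) ∷ _) (_ ∷ _ ∷ va ∷ []) _) nb@(nbr ((_ ∷ w≢c ∷ []) ∷ (v≢c ∷ []) ∷ _) _ _) =
      settle none (reduce (pnd b c (v ∷ []) ∷ []) (nw ∷ Nb-del nv ∷ []) none uxs (inW ((_ , wv) ∷ (_ , va) ∷ [])) Ns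
        (named ρ w 3 1 (0 ∷ 2 ∷ []) refl uρ refl ∷ []) ((All.head (all nbh) , λ a → case cover nbh a of any₁ (λ e → e)) ∷ []) ([] ∷ []) ([] ∷ []) (there (here refl) ∷ [])
        (balanced ρ w ((0 ∷ 1 ∷ []) ∷ (0 ∷ 2 ∷ []) ∷ (1 ∷ 2 ∷ []) ∷ (1 ∷ 3 ∷ []) ∷ []) ((3 ∷ 1 ∷ 0 ∷ 2 ∷ []) ∷ (2 ∷ 1 ∷ []) ∷ []) refl refl refl)
        (s≤s z≤n) two-for-one (Untouched g xs) touch)
      where
      xs : List (Fin N)
      xs = w ∷ v ∷ []
      uxs : Unique xs
      uxs = (ne wv ∷ []) ∷ [] ∷ []
      ρ = w ∷ v ∷ b ∷ a ∷ []
      uρ : Unique ρ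
      uρ = (ne wv ∷ ne wb ∷ w≢a ∷ []) ∷ (ne vb ∷ ne va ∷ []) ∷ (b≢a ∷ []) ∷ [] ∷ []
      Ns : Vec (List (Fin N)) 1
      Ns = (a ∷ v ∷ w ∷ b ∷ []) ∷ []
      b∉ : b ∉ xs
      b∉ (here e) = ne wb (sym e)
      b∉ (there (here e)) = ne vb (sym e)
      nbh : Nb (dels xs g) b (c ∷ [])
      nbh = nb-dels (w ∷ v ∷ []) b∉ nb (here refl ∷ there (here refl) ∷ [])
              ((any₂ (λ e → w≢c (sym e)) (λ e → v≢c (sym e))) ∷ [])
      b∉C : ∀ {C} → Exc (dels xs g) C → b ∉ C
      b∉C E b∈ with exc-degree E b∈
      ... | s , t , s≢t , bs , bt with cover nbh bs | cover nbh bt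
      ...   | here refl | here refl = s≢t refl
      touch : ∀ {C} → Exc (dels xs g) C → Touch (dels xs g) Ns ((b , c) ∷ []) C ⊎ Untouched g xs C
      touch {C} E with member? a C
      ... | yes a∈ = inj₁ (touch1 none E Fin.zero a (inj₁ (_ , refl)) a∈ (roomN (v ∷ []) ([] ∷ []) (there (here refl) ∷ []) (S va ∷ []) refl) b
            (here refl ∷ there (there (there (here refl))) ∷ there (there (here refl)) ∷ there (here refl) ∷ [])
            (λ x∈ _ → (λ where
              (inj₁ (e , _)) → b≢a (sym e)
              (inj₂ (_ , refl)) → b∉C E x∈) ∷ []))
      ... | no a∉ = inj₂ (untouchedBy none E ((_ , nw , inj₁ (there (here refl)) ∷ inj₂ (b∉C E) ∷ []) ∷ (_ , nv , inj₁ (here refl) ∷ inj₂ (b∉C E) ∷ inj₂ a∉ ∷ []) ∷ []))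

    -- The third neighbour `a` of `v` differs from `d`, so `v` and `d` are not adjacent and `vd` can
    -- stand for `v b d`.
    three-four : ∀ {a c d} → Nb g v (w ∷ b ∷ a ∷ []) → Nb g b (w ∷ v ∷ c ∷ d ∷ []) → a ≢ d → Result g ⌊ length W /2⌋
    three-four {a} {c} {d} nv nb@(nbr ((_ ∷ w≢c ∷ w≢d ∷ []) ∷ (v≢c ∷ v≢d ∷ []) ∷ (c≢d ∷ []) ∷ _) (_ ∷ _ ∷ bc ∷ bd ∷ []) _) a≢d =
      settle L (reduce (lft v d (b ∷ []) ∷ []) (nw ∷ Nb-del nb ∷ []) L ((ne wb ∷ []) ∷ [] ∷ []) (inW ((_ , wv) ∷ (_ , bc) ∷ [])) Ns
        (named ρ w 1 0 (2 ∷ 3 ∷ []) refl uρ refl ∷ []) (tt ∷ []) ([] ∷ []) ([] ∷ []) (there (here refl) ∷ [])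
        (balanced (w ∷ v ∷ b ∷ c ∷ d ∷ []) w ((0 ∷ 1 ∷ []) ∷ (0 ∷ 2 ∷ []) ∷ (2 ∷ 1 ∷ []) ∷ (2 ∷ 3 ∷ []) ∷ (2 ∷ 4 ∷ []) ∷ [])
          ((1 ∷ 0 ∷ 2 ∷ 3 ∷ []) ∷ (1 ∷ 2 ∷ 4 ∷ []) ∷ []) refl refl refl)
        (s≤s z≤n) two-for-one (Untouched g xs) touch)
      where
      xs : List (Fin N)
      xs = w ∷ b ∷ []
      ρ = w ∷ v ∷ b ∷ c ∷ []
      uρ : Unique ρ
      uρ = (ne wv ∷ ne wb ∷ w≢c ∷ []) ∷ (ne vb ∷ v≢c ∷ []) ∷ (ne bc ∷ []) ∷ [] ∷ []
      Ns : Vec (List (Fin N)) 1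
      Ns = (v ∷ w ∷ b ∷ c ∷ []) ∷ []
      v∉ : v ∉ xs
      v∉ (here e) = ne wv (sym e)
      v∉ (there (here e)) = ne vb e
      d∉ : d ∉ xs
      d∉ (here e) = w≢d (sym e)
      d∉ (there (here e)) = ne bd (sym e)
      vd : adj g v d ≡ false
      vd = Nb-∉ nv (any₃
        (λ e → w≢d (sym e))
        (λ e → ne bd (sym e))
        (λ e → a≢d (sym e)))
      open OneLift {g = g} {xs} v∉ d∉ (there (here refl)) (S vb) (there (here refl)) bd v≢d vd
      touch : ∀ {C} → Exc h C → Touch h Ns ((v , d) ∷ []) C ⊎ Untouched g xs C
      touch {C} E with member? c C | member? v C
      ... | yes c∈ | _ = inj₁ (touch1 L E Fin.zero c (inj₂ (_ , refl)) c∈ (room′ (v≢c ∘ sym) c≢d (there (here refl)) bc) v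
              (there (here refl) ∷ there (there (here refl)) ∷ there (there (there (here refl))) ∷ here refl ∷ []) (λ _ _ → Is-≢ (v≢c ∘ sym) c≢d ∷ []))
      ... | no c∉ | yes v∈ = inj₁ (touch2 L E Fin.zero v (inj₁ (_ , refl)) v∈
              (roomN-add gp (roomN (w ∷ b ∷ []) ((ne wb ∷ []) ∷ [] ∷ []) (here refl ∷ there (here refl) ∷ []) (S wv ∷ vb ∷ []) refl)) d
              (inj₁ (here refl) ∷ inj₁ (there (there (here refl))) ∷ inj₁ (there (there (there (here refl)))) ∷ inj₂ c∉ ∷ [])
              (λ _ x≢d → ([ (λ (_ , e) → x≢d e) , (λ (e , _) → v≢d e) ]′) ∷ []))
      ... | no c∉ | no v∉C = inj₂ (untouchedBy L E ((_ , nw , inj₂ v∉C ∷ inj₁ (there (here refl)) ∷ [])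
              ∷ (_ , nb , inj₁ (here refl) ∷ inj₂ v∉C ∷ inj₂ c∉ ∷ inj₂ (λ d∈ → v∉C (exc-closed E d∈ (Adj-sym h link))) ∷ []) ∷ []))

    four-free : ∀ {c d} → Nb g v (w ∷ b ∷ c ∷ d ∷ []) → adj g b d ≡ false → Result g ⌊ length W /2⌋
    four-free {c} {d} nv@(nbr ((_ ∷ w≢c ∷ w≢d ∷ []) ∷ (b≢c ∷ b≢d ∷ []) ∷ (c≢d ∷ []) ∷ _) (_ ∷ _ ∷ vc ∷ vd ∷ []) _) bd =
      settle L (reduce (lft b d (v ∷ []) ∷ []) (nw ∷ Nb-del nv ∷ []) L ((ne wv ∷ []) ∷ [] ∷ []) (inW ((_ , wv) ∷ (_ , vb) ∷ [])) Ns
        (named ρ w 2 0 (1 ∷ 3 ∷ []) refl uρ refl ∷ []) (tt ∷ []) ([] ∷ []) ([] ∷ []) (there (here refl) ∷ [])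
        (balanced (w ∷ v ∷ b ∷ c ∷ d ∷ []) w ((0 ∷ 1 ∷ []) ∷ (0 ∷ 2 ∷ []) ∷ (1 ∷ 2 ∷ []) ∷ (1 ∷ 3 ∷ []) ∷ (1 ∷ 4 ∷ []) ∷ [])
          ((2 ∷ 0 ∷ 1 ∷ 3 ∷ []) ∷ (2 ∷ 1 ∷ 4 ∷ []) ∷ []) refl refl refl)
        (s≤s z≤n) two-for-one (Untouched g xs) touch)
      where
      xs : List (Fin N)
      xs = w ∷ v ∷ []
      ρ = w ∷ v ∷ b ∷ c ∷ []
      uρ : Unique ρ
      uρ = (ne wv ∷ ne wb ∷ w≢c ∷ []) ∷ (ne vb ∷ ne vc ∷ []) ∷ (b≢c ∷ []) ∷ [] ∷ []
      Ns : Vec (List (Fin N)) 1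
      Ns = (b ∷ w ∷ v ∷ c ∷ []) ∷ []
      b∉ : b ∉ xs
      b∉ (here e) = ne wb (sym e)
      b∉ (there (here e)) = ne vb (sym e)
      d∉ : d ∉ xs
      d∉ (here e) = w≢d (sym e)
      d∉ (there (here e)) = ne vd (sym e)
      open OneLift {g = g} {xs} b∉ d∉ (there (here refl)) vb (there (here refl)) vd b≢d bd
      touch : ∀ {C} → Exc h C → Touch h Ns ((b , d) ∷ []) C ⊎ Untouched g xs C
      touch {C} E with member? c C | member? b C
      ... | yes c∈ | _ = inj₁ (touch1 L E Fin.zero c (inj₂ (_ , refl)) c∈ (room′ (b≢c ∘ sym) c≢d (there (here refl)) vc) b
              (there (here refl) ∷ there (there (here refl)) ∷ there (there (there (here refl))) ∷ here refl ∷ []) (λ _ _ → Is-≢ (b≢c ∘ sym) c≢d ∷ []))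
      ... | no c∉ | yes b∈ = inj₁ (touch2 L E Fin.zero b (inj₁ (_ , refl)) b∈
              (roomN-add gp (roomN (w ∷ v ∷ []) ((ne wv ∷ []) ∷ [] ∷ []) (here refl ∷ there (here refl) ∷ []) (S wb ∷ S vb ∷ []) refl)) d
              (inj₁ (here refl) ∷ inj₁ (there (there (here refl))) ∷ inj₁ (there (there (there (here refl)))) ∷ inj₂ c∉ ∷ [])
              (λ _ x≢d → ([ (λ (_ , e) → x≢d e) , (λ (e , _) → b≢d e) ]′) ∷ []))
      ... | no c∉ | no b∉C = inj₂ (untouchedBy L E ((_ , nw , inj₁ (there (here refl)) ∷ inj₂ b∉C ∷ [])
              ∷ (_ , nv , inj₁ (here refl) ∷ inj₂ b∉C ∷ inj₂ c∉ ∷ inj₂ (λ d∈ → b∉C (exc-closed E d∈ (Adj-sym h link))) ∷ []) ∷ []))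

    -- `c` and `d` are not adjacent, as `v b c d` would be a K₄. So `cd` can stand for `c v w b d`,
    -- through all three removed vertices, and a single new path `d v b c` takes the rest.
    four-four : ∀ {c d} → Nb g v (w ∷ b ∷ c ∷ d ∷ []) → Adj g b c → Adj g b d → Result g ⌊ length W /2⌋
    four-four {c} {d} nv@(nbr ((_ ∷ w≢c ∷ w≢d ∷ []) ∷ (b≢c ∷ b≢d ∷ []) ∷ (c≢d ∷ []) ∷ _) (_ ∷ _ ∷ vc ∷ vd ∷ []) _) bc bd =
      settle L (reduce (lft c d (v ∷ w ∷ b ∷ []) ∷ []) (nw ∷ Nb-del nv ∷ Nb-del (Nb-del nb) ∷ []) L uwvb (inW ((_ , wv) ∷ (_ , vb) ∷ (_ , bc) ∷ [])) Ns
        (named ρ w 4 1 (2 ∷ 3 ∷ []) refl uρ refl ∷ []) (tt ∷ []) ([] ∷ []) (named-unique w (1 ∷ 0 ∷ 2 ∷ []) uwvb refl)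
        (there (here refl) ∷ here refl ∷ there (there (here refl)) ∷ [])
        (balanced (w ∷ v ∷ b ∷ c ∷ d ∷ []) w ((0 ∷ 1 ∷ []) ∷ (0 ∷ 2 ∷ []) ∷ (1 ∷ 2 ∷ []) ∷ (1 ∷ 3 ∷ []) ∷ (1 ∷ 4 ∷ []) ∷ (2 ∷ 3 ∷ []) ∷ (2 ∷ 4 ∷ []) ∷ [])
          ((4 ∷ 1 ∷ 2 ∷ 3 ∷ []) ∷ (3 ∷ 1 ∷ 0 ∷ 2 ∷ 4 ∷ []) ∷ []) refl refl refl)
        (s≤s z≤n) (odd-for {k} 1 od) (Untouched g xs) touch)
      where
      xs : List (Fin N)
      xs = w ∷ v ∷ b ∷ []
      ρ = w ∷ v ∷ b ∷ c ∷ d ∷ []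
      uρ : Unique ρ
      uρ = (ne wv ∷ ne wb ∷ w≢c ∷ w≢d ∷ []) ∷ (ne vb ∷ ne vc ∷ ne vd ∷ []) ∷ (b≢c ∷ b≢d ∷ []) ∷ (c≢d ∷ []) ∷ [] ∷ []
      nb : Nb g b (w ∷ v ∷ c ∷ d ∷ [])
      nb = nb4 (named-unique w (0 ∷ 1 ∷ 3 ∷ 4 ∷ []) uρ refl) (S wb ∷ S vb ∷ bc ∷ bd ∷ [])
      cd : adj g c d ≡ false
      cd = ¬Adj⇒false λ a → noK4 (k4 vb vc vd bc bd a)
      Ns : Vec (List (Fin N)) 1
      Ns = (d ∷ v ∷ b ∷ c ∷ []) ∷ []
      c∉ : c ∉ xs
      c∉ (here e) = w≢c (sym e)
      c∉ (there (here e)) = ne vc (sym e)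
      c∉ (there (there (here e))) = b≢c (sym e)
      d∉ : d ∉ xs
      d∉ (here e) = w≢d (sym e)
      d∉ (there (here e)) = ne vd (sym e)
      d∉ (there (there (here e))) = b≢d (sym e)
      open OneLift {g = g} {xs} c∉ d∉ (there (here refl)) vc (there (here refl)) vd c≢d cd
      touch : ∀ {C} → Exc h C → Touch h Ns ((c , d) ∷ []) C ⊎ Untouched g xs C
      touch {C} E with member? c C
      ... | yes c∈ = inj₁ (touch1 L E Fin.zero c (inj₂ (_ , refl)) c∈
              (roomN-add gp (roomN (v ∷ b ∷ []) ((ne vb ∷ []) ∷ [] ∷ []) (there (here refl) ∷ there (there (here refl)) ∷ []) (S vc ∷ S bc ∷ []) refl)) d
              (there (here refl) ∷ there (there (there (here refl))) ∷ there (there (there (there (here refl)))) ∷ here refl ∷ [])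
              (λ _ x≢d → ([ (λ (_ , e) → x≢d e) , (λ (e , _) → c≢d e) ]′) ∷ []))
      ... | no c∉C = inj₂ (untouchedBy L E ((_ , nw , V ∷ B ∷ []) ∷ (_ , nv , here′ ∷ B ∷ inj₂ c∉C ∷ inj₂ d∉C ∷ [])
              ∷ (_ , nb , here′ ∷ V ∷ inj₂ c∉C ∷ inj₂ d∉C ∷ []) ∷ []))
        where
        here′ = inj₁ (here refl)
        V = inj₁ (there (here refl))
        B = inj₁ (there (there (here refl)))
        d∉C : d ∉ C
        d∉C d∈ = c∉C (exc-closed E d∈ (Adj-sym h link))

  triangle : ∀ {w v b} → Nb g w (v ∷ b ∷ []) → Adj g v b → Result g ⌊ length W /2⌋
  triangle {w} {v} {b} nw@(nbr ((v≢b ∷ []) ∷ _) (wv ∷ wb ∷ []) _) vb =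
    let X , nv = nb-front (w ∷ b ∷ []) ((ne wb ∷ []) ∷ [] ∷ []) (S wv ∷ vb ∷ [])
        Y , nb = nb-front (w ∷ v ∷ []) ((ne wv ∷ []) ∷ [] ∷ []) (S wb ∷ S vb ∷ [])
    in go nv nb
    where
    nw′ : Nb g w (b ∷ v ∷ [])
    nw′ = Nb-↭ (swap v b ↭-refl) nw
    tail : ∀ {a p q c d} → Nb g a (p ∷ q ∷ c ∷ d ∷ []) → Nb g a (p ∷ q ∷ d ∷ c ∷ [])
    tail {p = p} {q} {c} {d} = Nb-↭ (prep p (prep q (swap c d ↭-refl)))
    34-case : ∀ {v b a c d} → Nb g w (v ∷ b ∷ []) → Adj g v b → Nb g v (w ∷ b ∷ a ∷ []) → Nb g b (w ∷ v ∷ c ∷ d ∷ []) → Result g ⌊ length W /2⌋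
    34-case {a = a} {c} {d} nw vb nv nb@(nbr (_ ∷ _ ∷ (c≢d ∷ []) ∷ _) _ _) with a ≟ d
    ... | no a≢d = three-four nw vb nv nb a≢d
    ... | yes refl = three-four nw vb nv (tail nb) (c≢d ∘ sym)
    go : ∀ {X Y} → Nb g v (w ∷ b ∷ X) → Nb g b (w ∷ v ∷ Y) → Result g ⌊ length W /2⌋
    go {[]} {[]} nv nb = inj₂ (_ , k3 wv wb vb λ where
      (here refl) a → there (cover nw a)
      (there (here refl)) a → case cover nv a of any₂
        here
        (λ e → there (there (here e)))
      (there (there (here refl))) a → case cover nb a of any₂
        here
        (λ e → there (here e)))
    go {[]} {y ∷ Y} nv nb = ear nw vb nv nb
    go {x ∷ X} {[]} nv nb = ear nw′ (S vb) nb nv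
    go {a ∷ []} {c ∷ []} nv nb = both3 nw vb nv nb
    go {a ∷ []} {c ∷ d ∷ []} nv nb = 34-case nw vb nv nb
    go {c ∷ d ∷ []} {a ∷ []} nv nb = 34-case nw′ (S vb) nb nv
    go {c ∷ d ∷ []} {e ∷ f ∷ []} nv nb with Adj? g b d | Adj? g b c
    ... | inj₂ bd | _ = four-free nw vb nv bd
    ... | inj₁ _ | inj₂ bc = four-free nw vb (tail nv) bc
    ... | inj₁ bd | inj₁ bc = four-four nw vb nv bc bd
    go {_ ∷ _ ∷ _ ∷ _} nv _ = too-many nv
    go {_} {_ ∷ _ ∷ _ ∷ _} _ nb = too-many nb

  deg2 : ∀ {w v b} → Nb g w (v ∷ b ∷ []) → Result g ⌊ length W /2⌋
  deg2 {v = v} {b} nw with Adj? g v b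
  ... | inj₁ vb = triangle nw vb
  ... | inj₂ vb = suppress nw vb

-- A vertex of K₅ or K₅⁻ has three neighbours, so two can be avoided. Only the triangle `a y z`
-- leaves no choice.
exc-pick : {h : SG N} {S : List (Fin N)} {a : Fin N} → Exc h S → a ∈ S → (y z : Fin N) →
           (∃[ x ] (Adj h a x × x ≢ y × x ≢ z)) ⊎ (Adj h a y × Adj h y z)
exc-pick {N} {h} {S} {a} E a∈ y z = go E a∈
  where
  Sy : ∀ {u v} → Adj h u v → Adj h v u
  Sy = Adj-sym h
  ne : ∀ {u v} → Adj h u v → u ≢ v
  ne = Adj⇒≢ h
  pick2 : ∀ {s t} → Adj h a s → Adj h a t → Adj h s t → (∃[ x ] (Adj h a x × x ≢ y × x ≢ z)) ⊎ (Adj h a y × Adj h y z)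
  pick2 {s} {t} as at st with s ≟ y | s ≟ z | t ≟ y | t ≟ z
  ... | no p | no q | _ | _ = inj₁ (s , as , p , q)
  ... | _ | _ | no p | no q = inj₁ (t , at , p , q)
  ... | yes refl | _ | _ | yes refl = inj₂ (as , st)
  ... | _ | yes refl | yes refl | _ = inj₂ (at , Sy st)
  ... | yes refl | _ | yes refl | _ = contradiction refl (ne st)
  ... | _ | yes refl | _ | yes refl = contradiction refl (ne st)
  pick3 : ∀ {s t r} → Adj h a s → Adj h a t → Adj h a r → s ≢ t → s ≢ r → t ≢ r → ∃[ x ] (Adj h a x × x ≢ y × x ≢ z)
  pick3 {s} {t} {r} as at ar st sr tr with s ≟ y | s ≟ z | t ≟ y | t ≟ z
  ... | no p | no q | _ | _ = s , as , p , q
  ... | _ | _ | no p | no q = t , at , p , q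
  ... | yes refl | _ | _ | yes refl = r , ar , sr ∘ sym , tr ∘ sym
  ... | _ | yes refl | yes refl | _ = r , ar , tr ∘ sym , sr ∘ sym
  ... | yes refl | _ | yes refl | _ = contradiction refl st
  ... | _ | yes refl | _ | yes refl = contradiction refl st
  go : ∀ {S} → Exc h S → a ∈ S → (∃[ x ] (Adj h a x × x ≢ y × x ≢ z)) ⊎ (Adj h a y × Adj h y z)
  go (k3 i j k _) (here refl) = pick2 i j k
  go (k3 i j k _) (there (here refl)) = pick2 (Sy i) k j
  go (k3 i j k _) (there (there (here refl))) = pick2 (Sy j) (Sy k) i
  go (k5 (near5 n p₁ p₂ p₃ q₁ q₂ q₃ r s t) _) (here refl) = inj₁ (pick3 p₁ p₂ p₃ (ne r) (ne s) (ne t))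
  go (k5 (near5 n p₁ p₂ p₃ q₁ q₂ q₃ r s t) _) (there (here refl)) = inj₁ (pick3 q₁ q₂ q₃ (ne r) (ne s) (ne t))
  go (k5 (near5 n p₁ p₂ p₃ q₁ q₂ q₃ r s t) _) (there (there (here refl))) = inj₁ (pick3 (Sy p₁) (Sy q₁) r n (ne p₂) (ne q₂))
  go (k5 (near5 n p₁ p₂ p₃ q₁ q₂ q₃ r s t) _) (there (there (there (here refl)))) = inj₁ (pick3 (Sy p₂) (Sy q₂) (Sy r) n (ne p₁) (ne q₁))
  go (k5 (near5 n p₁ p₂ p₃ q₁ q₂ q₃ r s t) _) (there (there (there (there (here refl))))) = inj₁ (pick3 (Sy p₃) (Sy q₃) (Sy s) n (ne p₁) (ne q₁))

-- A vertex of degree four next to one of degree four or one.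

module _ {N : ℕ} (g : SG N) where

  -- Adjacent vertices v, w of degree four: the new path is a v w b, and the
  -- pairs cd and ef are lifted.
  record Valid (v w a c d b e f : Fin N) : Set where
    constructor valid
    field
      nv   : Nb g v (w ∷ a ∷ c ∷ d ∷ [])
      nw   : Nb g w (v ∷ b ∷ e ∷ f ∷ [])
      a≢b  : a ≢ b
      cd   : adj g c d ≡ false
      ef   : adj g e f ≡ false
      dist : ¬ Is c d e f

module PairPhase {N : ℕ} (𝒮 : Setting N) (noK4 : K4-free (Setting.g 𝒮)) where
  open Setting 𝒮
  open Step 𝒮

  private
    S : ∀ {u v} → Adj g u v → Adj g v u
    S = Adj-sym g
    ne : ∀ {u v} → Adj g u v → u ≢ v
    ne = Adj⇒≢ g

  module Try {v w a c d b e f : Fin N} (V : Valid g v w a c d b e f) where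
    open Valid V
    xs : List (Fin N)
    xs = v ∷ w ∷ []
    vw : Adj g v w
    vw = All.head (all nv)
    va : Adj g v a
    va = All.lookup (all nv) (there (here refl))
    vc : Adj g v c
    vc = All.lookup (all nv) (there (there (here refl)))
    vd : Adj g v d
    vd = All.lookup (all nv) (there (there (there (here refl))))
    wb : Adj g w b
    wb = All.lookup (all nw) (there (here refl))
    we : Adj g w e
    we = All.lookup (all nw) (there (there (here refl)))
    wf : Adj g w f
    wf = All.lookup (all nw) (there (there (there (here refl))))
    w≢a : w ≢ a
    w≢a = All.head (AllPairs.head (uniq nv))
    w≢c : w ≢ c
    w≢c = All.lookup (AllPairs.head (uniq nv)) (there (here refl))
    w≢d : w ≢ d
    w≢d = All.lookup (AllPairs.head (uniq nv)) (there (there (here refl)))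
    a≢c : a ≢ c
    a≢c = All.head (AllPairs.head (AllPairs.tail (uniq nv)))
    a≢d : a ≢ d
    a≢d = All.lookup (AllPairs.head (AllPairs.tail (uniq nv))) (there (here refl))
    c≢d′ : c ≢ d
    c≢d′ = All.head (AllPairs.head (AllPairs.tail (AllPairs.tail (uniq nv))))
    v≢b : v ≢ b
    v≢b = All.head (AllPairs.head (uniq nw))
    v≢e : v ≢ e
    v≢e = All.lookup (AllPairs.head (uniq nw)) (there (here refl))
    v≢f : v ≢ f
    v≢f = All.lookup (AllPairs.head (uniq nw)) (there (there (here refl)))
    b≢e : b ≢ e
    b≢e = All.head (AllPairs.head (AllPairs.tail (uniq nw)))
    b≢f : b ≢ f
    b≢f = All.lookup (AllPairs.head (AllPairs.tail (uniq nw))) (there (here refl))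
    e≢f : e ≢ f
    e≢f = All.head (AllPairs.head (AllPairs.tail (AllPairs.tail (uniq nw))))

    v-out : ∀ {t} → w ≢ t → Adj g v t → t ∉ xs
    v-out w≢t a (here e) = ne a (sym e)
    v-out w≢t a (there (here e)) = w≢t (sym e)
    w-out : ∀ {t} → v ≢ t → Adj g w t → t ∉ xs
    w-out v≢t a (here e) = v≢t (sym e)
    w-out v≢t a (there (here e)) = ne a (sym e)
    V∈ : v ∈ xs
    V∈ = here refl
    W∈ : w ∈ xs
    W∈ = there (here refl)
    uxs : Unique xs
    uxs = (ne vw ∷ []) ∷ [] ∷ []

    module O = OneLift {g = g} {xs} (v-out w≢c vc) (v-out w≢d vd) V∈ vc V∈ vd c≢d′ cd

    -- A vertex that lost an edge still has room; one that regained an edge lost two.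
    room-w : ∀ {t} → Adj g w t → Room O.h t
    room-w {t} wt with t ≟ c | t ≟ d
    ... | yes refl | _ = roomN-add O.gp (roomN (v ∷ w ∷ []) uxs (V∈ ∷ W∈ ∷ []) (S vc ∷ S wt ∷ []) refl)
    ... | no _ | yes refl = roomN-add O.gp (roomN (v ∷ w ∷ []) uxs (V∈ ∷ W∈ ∷ []) (S vd ∷ S wt ∷ []) refl)
    ... | no t≢c | no t≢d = O.room′ t≢c t≢d W∈ wt

    opaque
     gp : Gap O.h e f
     gp = gap e≢f (¬Adj⇒false (λ x → case add⁻ O.gp x of
            [ (λ y → ¬Adj (dels-⊑ xs g y) ef)
            , dist ]′)) (room-w we) (room-w wf)
     h : SG N
     h = add e f O.h gp
     L : Lifted g xs ((e , f) ∷ (c , d) ∷ []) h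
     L = lift (w-out v≢e we) (w-out v≢f wf) W∈ we W∈ wf O.L gp
     link-ef : Adj h e f
     link-ef = add-new gp
     link-cd : Adj h c d
     link-cd = add⁺ gp O.link

     room-common : Adj g w a → RoomN O.h a 2
     room-common wa un al = roomN (v ∷ w ∷ []) uxs (V∈ ∷ W∈ ∷ []) (S va ∷ S wa ∷ []) refl un (All.map (λ x → case add⁻ O.gp x of
         [ (λ y → y)
         , [ (λ (q , _) → contradiction (sym q) a≢c) , (λ (_ , q) → contradiction (sym q) a≢d) ]′ ]′) al)
     room-b : Room h b
     room-b un al = room-w wb un (All.map (λ x → case add⁻ gp x of
       [ (λ y → y)
       , [ (λ (q , _) → contradiction (sym q) b≢e) , (λ (_ , q) → contradiction (sym q) b≢f) ]′ ]′) al)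
     room-a : Room h a
     room-a un al with a ≟ e | a ≟ f
     ... | no a≢e | no a≢f = O.room′ a≢c a≢d V∈ va un (All.map (λ x → case add⁻ gp x of
       [ (λ y → y)
       , [ (λ (q , _) → contradiction (sym q) a≢e) , (λ (_ , q) → contradiction (sym q) a≢f) ]′ ]′) al)
     ... | yes refl | _ = roomN-add gp (room-common we) un al
     ... | no _ | yes refl = roomN-add gp (room-common wf) un al

     Ns : Vec (List (Fin N)) 1
     Ns = (a ∷ v ∷ w ∷ b ∷ []) ∷ []
     prot : List (Fin N × Fin N)
     prot = (e , f) ∷ (c , d) ∷ []

     -- Here `am` is itself a lifted edge, so a continuation from `a` must avoid both `b` and `m`.
     -- In the triangle `a b m` none exists, and the path is prolonged at its other end along `bm`.
     -- That edge is not lifted at `v`: otherwise `b` would be `c` or `d`, and `v w a b` a K₄.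
     a-shared : ∀ {C} → Exc h C → a ∈ C → Adj g w a → ∀ m → (∀ {x} → x ≢ m → ¬ Is a x e f) → a ≢ m → Touch h Ns prot C
     a-shared {C} E a∈ wa m fr a≢m with exc-pick E a∈ b m
     ... | inj₁ (x , ax , x≢b , x≢m) = touching Fin.zero a x (inj₁ (_ , refl)) a∈ ax
           (any₄
             (λ q → Adj⇒≢ h ax (sym q))
             (λ q → lifted-∉ L (Adj-sym h ax) (here q))
             (λ q → lifted-∉ L (Adj-sym h ax) (there (here q)))
             x≢b)
           room-a (fr x≢m ∷ Is-≢ a≢c a≢d ∷ [])
     ... | inj₂ (ab , bm) = touching Fin.zero b m (inj₂ (_ , refl)) b∈ bm
           (any₄
             (λ q → a≢m (sym q))
             (λ q → lifted-∉ L (Adj-sym h bm) (here q))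
             (λ q → lifted-∉ L (Adj-sym h bm) (there (here q)))
             (λ q → Adj⇒≢ h bm (sym q)))
           room-b (Is-≢ b≢e b≢f ∷ (λ i → b-not-c (endpoint i)) ∷ [])
       where
       b∈ : b ∈ C
       b∈ = exc-closed E a∈ ab
       gab : Adj g a b
       gab = case lifted-adj L ab of
         [ (λ (_ , _ , x) → x)
         , (λ (_ , _ , r) → case r of any₂ [ (λ (_ , q) → contradiction (sym q) b≢f) , (λ (q , _) → contradiction (sym q) b≢e) ]′ [ (λ (q , _) → contradiction (sym q) a≢c) , (λ (_ , q) → contradiction (sym q) a≢d) ]′) ]′
       endpoint : Is b m c d → b ≡ c ⊎ b ≡ d
       endpoint (inj₁ (q , _)) = inj₁ q
       endpoint (inj₂ (q , _)) = inj₂ q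
       b-not-c : ¬ (b ≡ c ⊎ b ≡ d)
       b-not-c (inj₁ refl) = noK4 (k4 vw va vc wa wb gab)
       b-not-c (inj₂ refl) = noK4 (k4 vw va vd wa wb gab)

     touch : ∀ {C} → Exc h C → Touch h Ns prot C ⊎ (a ∉ C × b ∉ C)
     touch {C} E with member? a C
     ... | yes a∈ = inj₁ (at-a (a ≟ e) (a ≟ f))
       where
       at-a : Dec (a ≡ e) → Dec (a ≡ f) → Touch h Ns prot C
       at-a (yes refl) _ = a-shared E a∈ we f (λ x≢f → ([ (λ (_ , q) → x≢f q)
         , (λ (q , _) → e≢f q) ]′)) e≢f
       at-a (no _) (yes refl) = a-shared E a∈ wf e (λ x≢e → ([ (λ (q , _) → e≢f (sym q))
         , (λ (_ , q) → x≢e q) ]′)) (e≢f ∘ sym)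
       at-a (no a≢e) (no a≢f) = touch1 L E Fin.zero a (inj₁ (_ , refl)) a∈ room-a b
         (here refl ∷ there (there (here refl)) ∷ there (there (there (here refl))) ∷ there (here refl) ∷ [])
         (λ _ _ → Is-≢ a≢e a≢f ∷ Is-≢ a≢c a≢d ∷ [])
     ... | no a∉ with member? b C
     ...   | no b∉ = inj₂ (a∉ , b∉)
     ...   | yes b∈ = inj₁ (at-b (b ≟ c) (b ≟ d))
       where
       go : ∀ m → (∀ {x} → x ≢ m → ¬ Is b x c d) → Touch h Ns prot C
       go m fr = touch2 L E Fin.zero b (inj₂ (_ , refl)) b∈ room-b m
         (inj₂ a∉ ∷ inj₁ (there (there (here refl))) ∷ inj₁ (there (there (there (here refl)))) ∷ inj₁ (here refl) ∷ [])
         (λ _ x≢m → Is-≢ b≢e b≢f ∷ fr x≢m ∷ [])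
       at-b : Dec (b ≡ c) → Dec (b ≡ d) → Touch h Ns prot C
       at-b (yes refl) _ = go d (λ x≢d → ([ (λ (_ , q) → x≢d q)
         , (λ (q , _) → c≢d′ q) ]′))
       at-b (no _) (yes refl) = go c (λ x≢c → ([ (λ (q , _) → c≢d′ (sym q))
         , (λ (_ , q) → x≢c q) ]′))
       at-b (no b≢c) (no b≢d) = go b (λ _ → Is-≢ b≢c b≢d)

     result : Goal ⊎ ∃[ C ] (Exc h C × a ∉ C × b ∉ C)
     result = reduce (lft e f (w ∷ []) ∷ lft c d (v ∷ []) ∷ []) (nv ∷ Nb-del nw ∷ []) L uxs (inW ((_ , vw) ∷ (_ , wb) ∷ [])) Ns
       (named (v ∷ w ∷ a ∷ b ∷ []) v 2 0 (1 ∷ 3 ∷ []) refl ((ne vw ∷ ne va ∷ v≢b ∷ []) ∷ (w≢a ∷ ne wb ∷ []) ∷ (a≢b ∷ []) ∷ [] ∷ []) refl ∷ [])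
       (tt ∷ tt ∷ []) (((λ i → dist (flip i)) ∷ []) ∷ [] ∷ []) ((ne (S vw) ∷ []) ∷ [] ∷ []) (W∈ ∷ V∈ ∷ [])
       (balanced (v ∷ w ∷ a ∷ c ∷ d ∷ b ∷ e ∷ f ∷ []) v
         ((0 ∷ 1 ∷ []) ∷ (0 ∷ 2 ∷ []) ∷ (0 ∷ 3 ∷ []) ∷ (0 ∷ 4 ∷ []) ∷ (1 ∷ 5 ∷ []) ∷ (1 ∷ 6 ∷ []) ∷ (1 ∷ 7 ∷ []) ∷ [])
         ((2 ∷ 0 ∷ 1 ∷ 5 ∷ []) ∷ (6 ∷ 1 ∷ 7 ∷ []) ∷ (3 ∷ 0 ∷ 4 ∷ []) ∷ []) refl refl refl)
       (s≤s z≤n) two-for-one (λ C → a ∉ C × b ∉ C) touch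
       where
       flip : Is e f c d → Is c d e f
       flip (inj₁ (p , q)) = inj₁ (sym p , sym q)
       flip (inj₂ (p , q)) = inj₂ (sym q , sym p)

     far : ∀ {C} → a ∉ C → b ∉ C → c ∉ C → e ∉ C → Exc h C → Result g ⌊ length W /2⌋
     far {C} a∉ b∉ c∉ e∉ E = inj₂ (C , untouched L (untouchedBy L E
       ((_ , nv , inj₁ W∈ ∷ inj₂ a∉ ∷ inj₂ c∉ ∷ inj₂ (λ d∈ → c∉ (exc-closed E d∈ (Adj-sym h link-cd))) ∷ [])
        ∷ (_ , nw , inj₁ V∈ ∷ inj₂ b∉ ∷ inj₂ e∉ ∷ inj₂ (λ f∈ → e∉ (exc-closed E f∈ (Adj-sym h link-ef))) ∷ []) ∷ [])) E)

  swap-valid : ∀ {v w a c d b e f} → Valid g v w a c d b e f → Valid g w v b e f a c d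
  swap-valid (valid nv nw a≢b cd ef dist) = valid nw nv (a≢b ∘ sym) ef cd ([ (λ (p , q) → dist (inj₁ (sym p , sym q)))
    , (λ (p , q) → dist (inj₂ (sym q , sym p))) ]′)

  -- Edges other than the lifted ones are common to all reductions at v, w.
  module _ {v w a c d b e f : Fin N} (V : Valid g v w a c d b e f) where
    private module T = Try V

    swap-exc : ∀ {C} → Exc T.h C → Exc (Try.h (swap-valid V)) C
    swap-exc = exc-transport (λ _ _ → to) (λ _ → from)
      where
      module T′ = Try (swap-valid V)
      swapped : ∀ {x y} {t : Fin N} → t ∉ x ∷ y ∷ [] → t ∉ y ∷ x ∷ []
      swapped n (here q) = n (there (here q))
      swapped n (there (here q)) = n (here q)
      orient : ∀ {h′ : SG N} {i j u t} → Adj h′ i j → Is i j u t → Adj h′ u t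
      orient x (inj₁ (refl , refl)) = x
      orient {h′} x (inj₂ (refl , refl)) = Adj-sym h′ x
      to : ∀ {u t} → Adj T.h u t → Adj T′.h u t
      to x = case lifted-adj T.L x of
        [ (λ (p , q , y) → lifted-old T′.L (swapped p) (swapped q) y)
        , (λ (_ , _ , r) → case r of any₂ (λ i → orient T′.link-cd i) (λ i → orient T′.link-ef i)) ]′
      from : ∀ {u t} → Adj T′.h u t → Adj T.h u t
      from x = case lifted-adj T′.L x of
        [ (λ (p , q , y) → lifted-old T.L (swapped p) (swapped q) y)
        , (λ (_ , _ , r) → case r of any₂ (λ i → orient T.link-cd i) (λ i → orient T.link-ef i)) ]′

    -- Since `d` is in `C` and `a` is not, they are not adjacent, and `a` and `c` may change places:
    -- the path becomes `c v w b` and `ad` is lifted. A triangle on `ad` would lead from `d` to `a`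
    -- in the previous graph. If `ef` now lies in an exceptional component, `b` and `e` change
    -- places at `w` in the same way.
    module _ {C : List (Fin N)} (E : Exc T.h C) (a∉ : a ∉ C) (b∉ : b ∉ C) (c∈ : c ∈ C) where
      private
        d∈ : d ∈ C
        d∈ = exc-closed E c∈ T.link-cd
        opaque
         V₁ : Valid g v w c a d b e f
         V₁ = valid (Nb-↭ (prep w (swap a c ↭-refl)) (Valid.nv V)) (Valid.nw V) (λ where refl → b∉ c∈)
           (¬Adj⇒false λ x → a∉ (exc-closed E d∈ (lifted-old T.L (T.v-out T.w≢d T.vd) (T.v-out T.w≢a T.va) (S x))))
           (Valid.ef V) λ where
             (inj₁ (refl , refl)) → a∉ (exc-closed E d∈ (Adj-sym T.h T.link-ef))
             (inj₂ (refl , refl)) → a∉ (exc-closed E d∈ T.link-ef)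
        module T₁ = Try V₁
        back₁ : ∀ {u t} → ¬ Is a d u t → Adj T₁.h u t → Adj T.h u t
        back₁ n x = case lifted-adj T₁.L x of λ where
          (inj₁ (p , q , y)) → lifted-old T.L p q y
          (inj₂ (_ , _ , here (inj₁ (refl , refl)))) → T.link-ef
          (inj₂ (_ , _ , here (inj₂ (refl , refl)))) → Adj-sym T.h T.link-ef
          (inj₂ (_ , _ , there (here i))) → contradiction i n
        d∉₁ : ∀ {C₁} → Exc T₁.h C₁ → d ∉ C₁
        d∉₁ E₁ d∈₁ with exc-triangle E₁ d∈₁ (Adj-sym T₁.h T₁.link-cd)
        ... | t , dt , at = a∉ (exc-closed E (exc-closed E d∈ (back₁ ([ (λ (q , _) → T.a≢d q)
                , (λ (q , _) → Adj⇒≢ T₁.h at q) ]′) dt))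
              (Adj-sym T.h (back₁ ([ (λ (_ , q) → Adj⇒≢ T₁.h dt q)
                , (λ (_ , q) → T.a≢d (sym q)) ]′) at)))
        module Again {C₁ : List (Fin N)} (E₁ : Exc T₁.h C₁) (c∉₁ : c ∉ C₁) (b∉₁ : b ∉ C₁) (e∈₁ : e ∈ C₁) where
          a∉₁ : a ∉ C₁
          a∉₁ a∈₁ = d∉₁ E₁ (exc-closed E₁ a∈₁ T₁.link-cd)
          f∈₁ : f ∈ C₁
          f∈₁ = exc-closed E₁ e∈₁ T₁.link-ef
          opaque
           V₂ : Valid g v w c a d e b f
           V₂ = valid (Valid.nv V₁) (Nb-↭ (prep v (swap b e ↭-refl)) (Valid.nw V)) (λ where refl → c∉₁ e∈₁) (Valid.cd V₁)
             (¬Adj⇒false λ x → b∉₁ (exc-closed E₁ f∈₁ (lifted-old T₁.L (T.w-out T.v≢f T.wf) (T.w-out T.v≢b T.wb) (S x)))) λ where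
               (inj₁ (q , _)) → Valid.a≢b V q
               (inj₂ (refl , _)) → a∉₁ f∈₁
          module T₂ = Try V₂
          back₂ : ∀ {u t} → ¬ Is b f u t → Adj T₂.h u t → Adj T₁.h u t
          back₂ n x = case lifted-adj T₂.L x of λ where
            (inj₁ (p , q , y)) → lifted-old T₁.L p q y
            (inj₂ (_ , _ , here i)) → contradiction i n
            (inj₂ (_ , _ , there (here (inj₁ (refl , refl))))) → T₁.link-cd
            (inj₂ (_ , _ , there (here (inj₂ (refl , refl))))) → Adj-sym T₁.h T₁.link-cd
          f∉₂ : ∀ {C₂} → Exc T₂.h C₂ → f ∉ C₂
          f∉₂ E₂ f∈₂ with exc-triangle E₂ f∈₂ (Adj-sym T₂.h T₂.link-ef)
          ... | t , ft , bt = b∉₁ (exc-closed E₁ (exc-closed E₁ f∈₁ (back₂ ([ (λ (q , _) → T.b≢f q)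
                  , (λ (q , _) → Adj⇒≢ T₂.h bt q) ]′) ft))
                (Adj-sym T₁.h (back₂ ([ (λ (_ , q) → Adj⇒≢ T₂.h ft q)
                  , (λ (_ , q) → T.b≢f (sym q)) ]′) bt)))
          d∉₂ : ∀ {C₂} → Exc T₂.h C₂ → d ∉ C₂
          d∉₂ E₂ d∈₂ with exc-triangle E₂ d∈₂ (Adj-sym T₂.h T₂.link-cd)
          ... | t , dt , at = a∉ (exc-closed E (exc-closed E d∈ (back₁ ([ (λ (q , _) → T.a≢d q)
                  , (λ (q , _) → Adj⇒≢ T₂.h at q) ]′) (back₂ ([ (λ (q , _) → b∉ (subst (_∈ C) (sym q) d∈))
                  , (λ (_ , q) → d∉₁ E₁ (subst (_∈ C₁) q f∈₁)) ]′) dt)))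
                (Adj-sym T.h (back₁ ([ (λ (_ , q) → Adj⇒≢ T₂.h dt q)
                  , (λ (_ , q) → T.a≢d (sym q)) ]′) (back₂ ([ (λ (q , _) → Valid.a≢b V (sym q))
                  , (λ (_ , q) → a∉₁ (subst (_∈ C₁) q f∈₁)) ]′) at))))
          again : Result g ⌊ length W /2⌋
          again with T₂.result
          ... | inj₁ good = inj₁ good
          ... | inj₂ (C₂ , E₂ , c∉₂ , e∉₂) = T₂.far c∉₂ e∉₂ (λ a∈ → d∉₂ E₂ (exc-closed E₂ a∈ T₂.link-cd)) (λ b∈ → f∉₂ E₂ (exc-closed E₂ b∈ T₂.link-ef)) E₂

      relift : Result g ⌊ length W /2⌋
      relift with T₁.result
      ... | inj₁ good = inj₁ good
      ... | inj₂ (C₁ , E₁ , c∉₁ , b∉₁) with member? e C₁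
      ...   | yes e∈₁ = Again.again E₁ c∉₁ b∉₁ e∈₁
      ...   | no e∉₁ = T₁.far c∉₁ b∉₁ (λ a∈ → d∉₁ E₁ (exc-closed E₁ a∈ T₁.link-cd)) e∉₁ E₁

  pair : ∀ {v w a c d b e f} → Valid g v w a c d b e f → Result g ⌊ length W /2⌋
  pair {c = c} {e = e} V with Try.result V
  ... | inj₁ good = inj₁ good
  ... | inj₂ (C , E , a∉ , b∉) with member? c C | member? e C
  ...   | yes c∈ | _ = relift V E a∉ b∉ c∈
  ...   | no _ | yes e∈ = relift (swap-valid V) (swap-exc V E) b∉ a∉ e∈
  ...   | no c∉ | no e∉ = Try.far V a∉ b∉ c∉ e∉ E

perm₁ : {x a b c : Fin N} {h : SG N} {v : Fin N} → Nb h v (x ∷ a ∷ b ∷ c ∷ []) → Nb h v (x ∷ b ∷ a ∷ c ∷ [])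
perm₁ {x = x} {a} {b} = Nb-↭ (prep x (swap a b ↭-refl))

perm₂ : {x a b c : Fin N} {h : SG N} {v : Fin N} → Nb h v (x ∷ a ∷ b ∷ c ∷ []) → Nb h v (x ∷ a ∷ c ∷ b ∷ [])
perm₂ {x = x} {a} {b} {c} = Nb-↭ (prep x (prep a (swap b c ↭-refl)))

wt-prefix : (X : List (Fin N)) (p : Fin N) (q : List (Fin N)) → Short X → ∀ u v → wt (X ++ p ∷ q) u v ≡ WT (star p X) u v + wt (p ∷ q) u v
wt-prefix [] p q _ u v = refl
wt-prefix (x ∷ []) p q _ u v = cong (_+ wt (p ∷ q) u v) (trans (δ-comm x p u v) (sym (trans (+-identityʳ _) (+-identityʳ _))))
wt-prefix (_ ∷ _ ∷ _) _ _ (s≤s ()) _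

module AdjacentPhase {N : ℕ} (𝒮 : Setting N) (noK4 : K4-free (Setting.g 𝒮)) where
  open Setting 𝒮
  open Step 𝒮
  open PairPhase 𝒮 noK4 using (pair)

  private
    S : ∀ {u v} → Adj g u v → Adj g v u
    S = Adj-sym g
    ne : ∀ {u v} → Adj g u v → u ≢ v
    ne = Adj⇒≢ g

  -- v, w, c, d, a, f span an octahedron with opposite pairs vf, wa, cd,
  -- possibly without the edge af.
  module Octahedron {v w c d a f : Fin N} (nv : Nb g v (w ∷ a ∷ c ∷ d ∷ [])) (nw : Nb g w (v ∷ f ∷ c ∷ d ∷ []))
                    (cf : Adj g c f) (df : Adj g d f) (ca : Adj g c a) (da : Adj g d a) (a≢f : a ≢ f) where
    vw = All.head (all nv)
    va = All.lookup (all nv) (there (here refl))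
    vc = All.lookup (all nv) (there (there (here refl)))
    vd = All.lookup (all nv) (there (there (there (here refl))))
    wf = All.lookup (all nw) (there (here refl))
    wc = All.lookup (all nw) (there (there (here refl)))
    wd = All.lookup (all nw) (there (there (there (here refl))))
    w≢a : w ≢ a
    w≢a = All.head (AllPairs.head (uniq nv))
    v≢f : v ≢ f
    v≢f = All.head (AllPairs.head (uniq nw))
    c≢d′ : c ≢ d
    c≢d′ = All.head (AllPairs.head (AllPairs.tail (AllPairs.tail (uniq nv))))
    xs : List (Fin N)
    xs = v ∷ w ∷ c ∷ d ∷ a ∷ f ∷ []
    uxs : Unique xs
    uxs = (ne vw ∷ ne vc ∷ ne vd ∷ ne va ∷ v≢f ∷ []) ∷ (ne wc ∷ ne wd ∷ w≢a ∷ ne wf ∷ []) ∷ (c≢d′ ∷ ne ca ∷ ne cf ∷ []) ∷ (ne da ∷ ne df ∷ []) ∷ (a≢f ∷ []) ∷ [] ∷ []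
    nc : Nb g c (v ∷ w ∷ f ∷ a ∷ [])
    nc = nb4 (named-unique v (0 ∷ 1 ∷ 5 ∷ 4 ∷ []) uxs refl) (S vc ∷ S wc ∷ cf ∷ ca ∷ [])
    nd : Nb g d (v ∷ w ∷ f ∷ a ∷ [])
    nd = nb4 (named-unique v (0 ∷ 1 ∷ 5 ∷ 4 ∷ []) uxs refl) (S vd ∷ S wd ∷ df ∷ da ∷ [])
    c∉d : c ∉ v ∷ w ∷ f ∷ a ∷ []
    c∉d = All≢⇒∉ (S′ (ne vc) ∷ S′ (ne wc) ∷ ne cf ∷ ne ca ∷ [])
      where
      S′ : ∀ {x y : Fin N} → x ≢ y → y ≢ x
      S′ n = n ∘ sym

    finish : ∀ {X Y X′ Y′} → Short X → Short Y → Nb g a (v ∷ c ∷ d ∷ X′) → Nb g f (w ∷ c ∷ d ∷ Y′) →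
             Nb (del d (del c (del w (del v g)))) a X → Nb (del a (del d (del c (del w (del v g))))) f Y →
             All (λ t → t ∈ xs ⊎ t ∈ X) X′ → All (λ t → t ∈ xs ⊎ t ∈ Y) Y′ →
             All (_∉ a ∷ v ∷ c ∷ w ∷ d ∷ []) X → All (_∉ f ∷ w ∷ v ∷ d ∷ a ∷ c ∷ []) Y → Result g ⌊ length W /2⌋
    finish {X} {Y} sX sY na nf nX nY X′⊆ Y′⊆ X∉ Y∉ = settle none (reduce []
        (nv ∷ Nb-del nw ∷ Nb-del (Nb-del nc) ∷ Nb-del-∉ (c≢d′ ∘ sym) (Nb-del (Nb-del nd)) (c∉d ∘ there ∘ there) ∷ nX ∷ nY ∷ [])
        none uxs (inW ((_ , vw) ∷ (_ , wf) ∷ (_ , cf) ∷ (_ , df) ∷ (_ , S va) ∷ (_ , S wf) ∷ [])) Ns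
        ((u₁ , l₁) ∷ (u₂ , l₂) ∷ named xs v 2 5 (3 ∷ []) refl uxs refl ∷ []) [] [] [] []
        (same bal) (s≤s z≤n) six-for-three (Untouched g xs) touch)
      where
      P₁ P₂ : List (Fin N)
      P₁ = X ++ a ∷ v ∷ c ∷ w ∷ d ∷ []
      P₂ = Y ++ f ∷ w ∷ v ∷ d ∷ a ∷ c ∷ []
      Ns : Vec (List (Fin N)) 3
      Ns = P₁ ∷ P₂ ∷ (c ∷ f ∷ d ∷ []) ∷ []
      u₁ : Unique P₁
      u₁ = unique-++ (uniq nX) (named-unique v (4 ∷ 0 ∷ 2 ∷ 1 ∷ 3 ∷ []) uxs refl) (λ i → All.lookup X∉ i)
      u₂ : Unique P₂
      u₂ = unique-++ (uniq nY) (named-unique v (5 ∷ 1 ∷ 0 ∷ 3 ∷ 4 ∷ 2 ∷ []) uxs refl) (λ i → All.lookup Y∉ i)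
      l₁ : 2 ≤ length P₁
      l₁ = subst (2 ≤_) (sym (length-++ X)) (≤-trans (s≤s (s≤s z≤n)) (m≤n+m 5 (length X)))
      l₂ : 2 ≤ length P₂
      l₂ = subst (2 ≤_) (sym (length-++ Y)) (≤-trans (s≤s (s≤s z≤n)) (m≤n+m 6 (length Y)))
      core : List (List (Fin N))
      core = star v (w ∷ a ∷ c ∷ d ∷ []) ++ star w (f ∷ c ∷ d ∷ []) ++ star c (f ∷ a ∷ []) ++ star d (f ∷ a ∷ [])
      eq : core ≈ (a ∷ v ∷ c ∷ w ∷ d ∷ []) ∷ (f ∷ w ∷ v ∷ d ∷ a ∷ c ∷ []) ∷ (c ∷ f ∷ d ∷ []) ∷ []
      eq = balanced xs v
        ((0 ∷ 1 ∷ []) ∷ (0 ∷ 4 ∷ []) ∷ (0 ∷ 2 ∷ []) ∷ (0 ∷ 3 ∷ []) ∷ (1 ∷ 5 ∷ []) ∷ (1 ∷ 2 ∷ []) ∷ (1 ∷ 3 ∷ []) ∷ (2 ∷ 5 ∷ []) ∷ (2 ∷ 4 ∷ []) ∷ (3 ∷ 5 ∷ []) ∷ (3 ∷ 4 ∷ []) ∷ [])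
        ((4 ∷ 0 ∷ 2 ∷ 1 ∷ 3 ∷ []) ∷ (5 ∷ 1 ∷ 0 ∷ 3 ∷ 4 ∷ 2 ∷ []) ∷ (2 ∷ 5 ∷ 3 ∷ []) ∷ []) refl refl refl
      bal : ∀ u t → WT (core ++ star a X ++ star f Y ++ []) u t ≡ WT (P₁ ∷ P₂ ∷ (c ∷ f ∷ d ∷ []) ∷ []) u t
      bal u t = trans (WT-++ core (star a X ++ star f Y ++ []) u t) (trans (cong₂ _+_ (weights eq u t)
          (trans (WT-++ (star a X) (star f Y ++ []) u t) (cong (WT (star a X) u t +_) (WT-++ (star f Y) [] u t))))
          (trans (lemma (wt (a ∷ v ∷ c ∷ w ∷ d ∷ []) u t) (wt (f ∷ w ∷ v ∷ d ∷ a ∷ c ∷ []) u t) (wt (c ∷ f ∷ d ∷ []) u t) (WT (star a X) u t) (WT (star f Y) u t))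
            (sym (cong₂ (λ x y → x + (y + (wt (c ∷ f ∷ d ∷ []) u t + 0))) (wt-prefix X a (v ∷ c ∷ w ∷ d ∷ []) sX u t) (wt-prefix Y f (w ∷ v ∷ d ∷ a ∷ c ∷ []) sY u t)))))
        where
        lemma : ∀ p q r x y → p + (q + (r + 0)) + (x + (y + 0)) ≡ x + p + (y + q + (r + 0))
        lemma = solve-∀
      aX : ∀ {t} → t ∈ X → Adj g a t
      aX i = case All.lookup (all nX) i of λ e → proj₂ (proj₂ (del⁻ v g (proj₂ (proj₂ (del⁻ w _ (proj₂ (proj₂ (del⁻ c _ (proj₂ (proj₂ (del⁻ d _ e)))))))))))
      fY : ∀ {t} → t ∈ Y → Adj g f t
      fY i = case All.lookup (all nY) i of λ e → proj₂ (proj₂ (del⁻ v g (proj₂ (proj₂ (del⁻ w _ (proj₂ (proj₂ (del⁻ c _ (proj₂ (proj₂ (del⁻ d _ (proj₂ (proj₂ (del⁻ a _ e))))))))))))))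
      end : ∀ {Z q} → Short Z → ∀ {t} → t ∈ Z → End t (Z ++ q)
      end {_ ∷ []} _ (here refl) = inj₁ (_ , refl)
      end {_ ∷ _ ∷ _} (s≤s ()) _
      within : ∀ {Z q} → Short Z → ∀ {t} → t ∈ Z → All (_∈ xs) q → All (_∈ t ∷ t ∷ xs) (Z ++ q)
      within {_ ∷ []} _ (here refl) q⊆ = here refl ∷ All.map (λ i → there (there i)) q⊆
      within {_ ∷ _ ∷ _} (s≤s ()) _ _
      V = here refl
      Wx = there (here refl)
      C′ = there (there (here refl))
      D′ = there (there (there (here refl)))
      A′ = there (there (there (there (here refl))))
      F′ = there (there (there (there (there (here refl)))))
      touch : ∀ {S} → Exc (dels xs g) S → Touch (dels xs g) Ns [] S ⊎ Untouched g xs S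
      touch {S′} E with common? X S′ | common? Y S′
        where open K4Phase 𝒮 using (common?)
      ... | inj₁ (t , t∈X , t∈) | _ = inj₁ (touch1 none E Fin.zero t (end sX t∈X) t∈
              (roomN (a ∷ []) ([] ∷ []) (A′ ∷ []) (S (aX t∈X) ∷ []) refl) t (within sX t∈X (A′ ∷ V ∷ C′ ∷ Wx ∷ D′ ∷ [])) (λ _ _ → []))
      ... | inj₂ _ | inj₁ (t , t∈Y , t∈) = inj₁ (touch1 none E (Fin.suc Fin.zero) t (end sY t∈Y) t∈
              (roomN (f ∷ []) ([] ∷ []) (F′ ∷ []) (S (fY t∈Y) ∷ []) refl) t (within sY t∈Y (F′ ∷ Wx ∷ V ∷ D′ ∷ A′ ∷ C′ ∷ [])) (λ _ _ → []))
      ... | inj₂ X∉S | inj₂ Y∉S = inj₂ (untouchedBy none E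
              ((_ , nv , inj₁ Wx ∷ inj₁ A′ ∷ inj₁ C′ ∷ inj₁ D′ ∷ []) ∷ (_ , nw , inj₁ V ∷ inj₁ F′ ∷ inj₁ C′ ∷ inj₁ D′ ∷ [])
               ∷ (_ , nc , inj₁ V ∷ inj₁ Wx ∷ inj₁ F′ ∷ inj₁ A′ ∷ []) ∷ (_ , nd , inj₁ V ∷ inj₁ Wx ∷ inj₁ F′ ∷ inj₁ A′ ∷ [])
               ∷ (_ , na , inj₁ V ∷ inj₁ C′ ∷ inj₁ D′ ∷ All.map (λ { (inj₁ i) → inj₁ i ; (inj₂ i) → inj₂ (X∉S i) }) X′⊆)
               ∷ (_ , nf , inj₁ Wx ∷ inj₁ C′ ∷ inj₁ D′ ∷ All.map (λ { (inj₁ i) → inj₁ i ; (inj₂ i) → inj₂ (Y∉S i) }) Y′⊆) ∷ []))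

    result : Result g ⌊ length W /2⌋
    result = go (fourth ((ne vc ∷ ne vd ∷ []) ∷ (c≢d′ ∷ []) ∷ [] ∷ []) (S va ∷ S ca ∷ S da ∷ []))
                (fourth ((ne wc ∷ ne wd ∷ []) ∷ (c≢d′ ∷ []) ∷ [] ∷ []) (S wf ∷ S cf ∷ S df ∷ []))
      where
      aw : ∀ {X} → Nb g a X → w ∉ X
      aw na w∈ = case cover nw (S (All.lookup (all na) w∈)) of any₄
        (λ e → ne va (sym e))
        a≢f
        (λ e → ne ca (sym e))
        (λ e → ne da (sym e))
      fv : ∀ {Y} → Nb g f Y → v ∉ Y
      fv nf v∈ = case cover nv (S (All.lookup (all nf) v∈)) of any₄
        (λ e → ne wf (sym e))
        (λ e → a≢f (sym e))
        (λ e → ne cf (sym e))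
        (λ e → ne df (sym e))
      left : ∀ {X} → Nb g a (v ∷ c ∷ d ∷ X) → Nb (del d (del c (del w (del v g)))) a X
      left na = Nb-del (Nb-del (Nb-del-∉ (w≢a ∘ sym) (Nb-del na) (aw na ∘ there)))
      right : ∀ {Y} → Nb g f (w ∷ c ∷ d ∷ Y) → Nb (del d (del c (del w (del v g)))) f Y
      right nf = Nb-del (Nb-del (Nb-del (Nb-del-∉ (v≢f ∘ sym) nf (fv nf))))
      X-ok : ∀ {x} → Nb g a (v ∷ c ∷ d ∷ x ∷ []) → x ∉ a ∷ v ∷ c ∷ w ∷ d ∷ []
      X-ok na@(nbr ((_ ∷ _ ∷ v≢x ∷ []) ∷ (_ ∷ c≢x ∷ []) ∷ (d≢x ∷ []) ∷ _) (_ ∷ _ ∷ _ ∷ ax ∷ []) _) =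
        All≢⇒∉ ((ne ax ∘ sym) ∷ (v≢x ∘ sym) ∷ (c≢x ∘ sym) ∷ (λ e → aw na (there (there (there (here (sym e)))))) ∷ (d≢x ∘ sym) ∷ [])
      Y-ok : ∀ {y} → y ≢ a → Nb g f (w ∷ c ∷ d ∷ y ∷ []) → y ∉ f ∷ w ∷ v ∷ d ∷ a ∷ c ∷ []
      Y-ok y≢a nf@(nbr ((_ ∷ _ ∷ w≢y ∷ []) ∷ (_ ∷ c≢y ∷ []) ∷ (d≢y ∷ []) ∷ _) (_ ∷ _ ∷ _ ∷ fy ∷ []) _) =
        All≢⇒∉ ((ne fy ∘ sym) ∷ (w≢y ∘ sym) ∷ (λ e → fv nf (there (there (there (here (sym e)))))) ∷ (d≢y ∘ sym) ∷ y≢a ∷ (c≢y ∘ sym) ∷ [])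
      A∈ : a ∈ xs
      A∈ = there (there (there (there (here refl))))
      go : Fourth g a v c d → Fourth g f w c d → Result g ⌊ length W /2⌋
      go (none na) (none nf) = finish z≤n z≤n na nf (left na) (Nb-del-∉ (a≢f ∘ sym) (right nf) λ ()) [] [] [] []
      go (one x na) (none nf) = finish (s≤s z≤n) z≤n na nf (left na) (Nb-del-∉ (a≢f ∘ sym) (right nf) λ ()) (inj₂ (here refl) ∷ []) [] (X-ok na ∷ []) []
      go (none na) (one y nf) with y ≟ a
      ... | yes refl = finish z≤n z≤n na nf (left na) (Nb-del (right nf)) [] (inj₁ A∈ ∷ []) [] []
      ... | no y≢a = finish z≤n (s≤s z≤n) na nf (left na) (Nb-del-∉ (a≢f ∘ sym) (right nf) (any₁ (λ e → y≢a (sym e)))) [] (inj₂ (here refl) ∷ []) [] (Y-ok y≢a nf ∷ [])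
      go (one x na) (one y nf) with y ≟ a
      ... | yes refl = finish (s≤s z≤n) z≤n na nf (left na) (Nb-del (right nf)) (inj₂ (here refl) ∷ []) (inj₁ A∈ ∷ []) (X-ok na ∷ []) []
      ... | no y≢a = finish (s≤s z≤n) (s≤s z≤n) na nf (left na) (Nb-del-∉ (a≢f ∘ sym) (right nf) (any₁ (λ e → y≢a (sym e))))
              (inj₂ (here refl) ∷ []) (inj₂ (here refl) ∷ []) (X-ok na ∷ []) (Y-ok y≢a nf ∷ [])

  -- Three pairwise adjacent neighbours would form a K₄ with `v`.
  open-triple : ∀ {v w x y z} → Nb g v (w ∷ x ∷ y ∷ z ∷ []) →
                ∃[ a ] ∃[ c ] ∃[ d ] (Nb g v (w ∷ a ∷ c ∷ d ∷ []) × adj g c d ≡ false)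
  open-triple {x = x} {y} {z} nb@(nbr _ (_ ∷ vx ∷ vy ∷ vz ∷ []) _) with Adj? g y z | Adj? g x z | Adj? g x y
  ... | inj₂ yz | _ | _ = _ , _ , _ , nb , yz
  ... | inj₁ _ | inj₂ xz | _ = _ , _ , _ , perm₁ nb , xz
  ... | inj₁ _ | inj₁ _ | inj₂ xy = _ , _ , _ , perm₂ (perm₁ (perm₂ nb)) , trans (symm g y x) xy
  ... | inj₁ yz | inj₁ xz | inj₁ xy = contradiction (k4 vx vy vz xy xz yz) noK4

  -- Both `v` and `w` have a non-adjacent pair to lift. The difficulty is to choose the pairs
  -- different and at the same time to leave different path ends `a` and `b`.
  adjacent-fours : ∀ {v w x y z p q r} → Nb g v (w ∷ x ∷ y ∷ z ∷ []) → Nb g w (v ∷ p ∷ q ∷ r ∷ []) → Result g ⌊ length W /2⌋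
  adjacent-fours {v} {w} {p = p} {q} {r} nv₀ nw with open-triple nv₀
  ... | a , c , d , nv@(nbr ((w≢a ∷ w≢c ∷ w≢d ∷ []) ∷ (a≢c ∷ a≢d ∷ []) ∷ (c≢d ∷ []) ∷ _) (vw ∷ va ∷ vc ∷ vd ∷ []) _) , cd
    with member? a (p ∷ q ∷ r ∷ [])
  ... | yes a∈ = shared a∈
    where
    with-a : ∀ {e f} → Nb g w (v ∷ a ∷ e ∷ f ∷ []) → Result g ⌊ length W /2⌋
    with-a {e} {f} nw@(nbr (_ ∷ (a≢e ∷ a≢f ∷ []) ∷ (e≢f ∷ []) ∷ _) (_ ∷ wa ∷ we ∷ wf ∷ []) _) with Adj? g a e | Adj? g a f
    ... | inj₂ ae | _ = pair (valid nv (perm₁ (perm₂ nw)) a≢f cd ae ([ (λ (e , _) → a≢c (sym e))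
            , (λ (_ , e) → a≢d (sym e)) ]′))
    ... | inj₁ _ | inj₂ af = pair (valid nv (perm₁ nw) a≢e cd af ([ (λ (e , _) → a≢c (sym e))
            , (λ (_ , e) → a≢d (sym e)) ]′))
    -- Now `v`, `w`, `e`, `f` are all the neighbours of `a`, and `c` is none of them. So `ac` can be
    -- lifted at `v` while the new path is `d v w a`.
    ... | inj₁ ae | inj₁ af = pair (valid (perm₁ (perm₂ nv)) nw (a≢d ∘ sym) ac ef ([ (λ (e , _) → a≢e e)
            , (λ (e , _) → a≢f e) ]′))
      where
      nb-a : Nb g a (v ∷ w ∷ e ∷ f ∷ [])
      nb-a with uniq nw
      ... | (v≢a ∷ v≢e ∷ v≢f ∷ []) ∷ _ = nb4 ((ne vw ∷ v≢e ∷ v≢f ∷ []) ∷ (ne we ∷ ne wf ∷ []) ∷ (e≢f ∷ []) ∷ [] ∷ []) (S va ∷ S wa ∷ ae ∷ af ∷ [])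
      ac : adj g a c ≡ false
      ac = Nb-∉ nb-a λ where
        (here e) → ne vc (sym e)
        (there (here e)) → w≢c (sym e)
        (there (there (here refl))) → noK4 (k4 vw va vc wa we ae)
        (there (there (there (here refl)))) → noK4 (k4 vw va vc wa wf af)
      ef : adj g e f ≡ false
      ef = ¬Adj⇒false λ x → noK4 (k4 wa we wf ae af x)
    shared : a ∈ p ∷ q ∷ r ∷ [] → Result g ⌊ length W /2⌋
    shared (here refl) = with-a nw
    shared (there (here refl)) = with-a (perm₁ nw)
    shared (there (there (here refl))) = with-a (perm₁ (perm₂ nw))
  -- Any non-adjacent pair at `w` other than `c d` will do. If there is none, `c` and `d` are
  -- neighbours of `w` and its remaining neighbour is joined to both.
  ... | no a∉ = try nw a∉ (is? c d q r) (is? c d p r) (is? c d p q)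
    where
    rest : ∀ {f} → Nb g w (v ∷ f ∷ c ∷ d ∷ []) → a ≢ f → Adj g f c → Adj g f d → Result g ⌊ length W /2⌋
    rest {f} nw@(nbr (_ ∷ (f≢c ∷ f≢d ∷ []) ∷ _) _ _) a≢f fc fd with Adj? g a d | Adj? g a c
    ... | inj₂ ad | _ = pair (valid (perm₁ nv) nw (f≢c ∘ sym) ad cd ([ (λ (e , _) → a≢c e)
            , (λ (e , _) → a≢d e) ]′))
    ... | inj₁ _ | inj₂ ac = pair (valid (perm₁ (perm₂ nv)) nw (f≢d ∘ sym) ac cd ([ (λ (e , _) → a≢c e)
            , (λ (e , _) → a≢d e) ]′))
    -- All four of `v`, `w`, `a`, `f` are joined to both `c` and `d`: no other pair is free, and the
    -- octahedron is treated as a whole.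
    ... | inj₁ ad | inj₁ ac = Octahedron.result nv nw (S fc) (S fd) (S ac) (S ad) a≢f
    orient : ∀ {f e k} → Nb g w (v ∷ f ∷ e ∷ k ∷ []) → a ≢ f → Is c d e k → Adj g f e → Adj g f k → Result g ⌊ length W /2⌋
    orient nw a≢f (inj₁ (refl , refl)) fe fk = rest nw a≢f fe fk
    orient nw a≢f (inj₂ (refl , refl)) fe fk = rest (perm₂ nw) a≢f fk fe
    free : ∀ {b e f} → Nb g w (v ∷ b ∷ e ∷ f ∷ []) → a ≢ b → ¬ Is c d e f → Result g ⌊ length W /2⌋ ⊎ Adj g e f
    free {b} {e} {f} nw a≢b n with Adj? g e f
    ... | inj₁ x = inj₂ x
    ... | inj₂ x = inj₁ (pair (valid nv nw a≢b cd x n))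
    try : ∀ {x y z} → Nb g w (v ∷ x ∷ y ∷ z ∷ []) → a ∉ x ∷ y ∷ z ∷ [] → Dec (Is c d y z) → Dec (Is c d x z) → Dec (Is c d x y) → Result g ⌊ length W /2⌋
    try {x} {y} {z} nw@(nbr (_ ∷ (x≢y ∷ x≢z ∷ []) ∷ (y≢z ∷ []) ∷ _) (_ ∷ wx ∷ wy ∷ wz ∷ []) _) a∉ i₁ i₂ i₃ =
        go i₁ i₂ i₃
      where
      nx = perm₁ nw
      nz = perm₁ (perm₂ nw)
      ax = λ e → a∉ (here e)
      ay = λ e → a∉ (there (here e))
      az = λ e → a∉ (there (there (here e)))
      use : Result g ⌊ length W /2⌋ ⊎ Adj g x y → Result g ⌊ length W /2⌋ ⊎ Adj g x z → (Adj g x y → Adj g x z → Result g ⌊ length W /2⌋) → Result g ⌊ length W /2⌋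
      use (inj₁ r) _ _ = r
      use (inj₂ _) (inj₁ r) _ = r
      use (inj₂ p) (inj₂ q) k = k p q
      clash : ∀ {p q r s} → Is c d p q → Is c d r s → (p ≡ r × q ≡ s) ⊎ (p ≡ s × q ≡ r)
      clash i j = Is-trans (Is-sym i) j
      go : Dec (Is c d y z) → Dec (Is c d x z) → Dec (Is c d x y) → Result g ⌊ length W /2⌋
      go (yes i) (no j) (no k) = use (free nz az k) (free nx ay j) (orient nw ax i)
      go (no i) (yes j) (no k) = case free nz az k of
        [ (λ r → r)
        , (λ xy → case free nw ax i of
          [ (λ r → r)
          , (λ yz → orient nx ay j (S xy) yz) ]′) ]′
      go (no i) (no j) (yes k) = case free nx ay j of
        [ (λ r → r)
        , (λ xz → case free nw ax i of
          [ (λ r → r)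
          , (λ yz → orient nz az k (S xz) (S yz)) ]′) ]′
      go (no i) (no j) (no k) = case free nw ax i of
        [ (λ r → r)
        , (λ yz → use (free nz az k) (free nx ay j) λ xy xz → contradiction (k4 wx wy wz xy xz yz) noK4) ]′
      go (yes i) (yes j) _ = case clash i j of [ (λ (p , _) → contradiction (sym p) x≢y) , (λ (p , _) → contradiction p y≢z) ]′
      go (yes i) (no _) (yes j) = case clash i j of [ (λ (p , _) → contradiction (sym p) x≢y) , (λ (_ , p) → contradiction (sym p) x≢z) ]′
      go (no _) (yes i) (yes j) = case clash i j of [ (λ (_ , p) → contradiction (sym p) y≢z) , (λ (p , _) → contradiction p x≢y) ]′

  -- The leaf `v` is removed together with `w`: the two pay for one path, which ends `w v`.
  four-one : ∀ {v w x y z} → Nb g v (w ∷ []) → Nb g w (v ∷ x ∷ y ∷ z ∷ []) → Result g ⌊ length W /2⌋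
  four-one {v} {w} nv nw₀ with open-triple nw₀
  ... | z , x , y , nw@(nbr ((v≢z ∷ v≢x ∷ v≢y ∷ []) ∷ (z≢x ∷ z≢y ∷ []) ∷ (x≢y ∷ []) ∷ _) (wv ∷ wz ∷ wx ∷ wy ∷ []) _) , xy =
    fork (arm wz wx wy (out v≢z wz) (out v≢x wx) (out v≢y wy) z≢x z≢y x≢y tt tt ((ne (S wz) ∷ v≢z ∘ sym ∷ []) ∷ (ne wv ∷ []) ∷ [] ∷ [] , s≤s (s≤s z≤n))
            (balanced ρ v stars ((2 ∷ 1 ∷ 0 ∷ []) ∷ (3 ∷ 1 ∷ 4 ∷ []) ∷ []) refl refl refl))
         (arm wx wy wz (out v≢x wx) (out v≢y wy) (out v≢z wz) x≢y (z≢x ∘ sym) (z≢y ∘ sym) tt tt ((ne (S wx) ∷ v≢x ∘ sym ∷ []) ∷ (ne wv ∷ []) ∷ [] ∷ [] , s≤s (s≤s z≤n))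
            (balanced ρ v stars ((3 ∷ 1 ∷ 0 ∷ []) ∷ (4 ∷ 1 ∷ 2 ∷ []) ∷ []) refl refl refl))
         xy (s≤s z≤n) two-for-one far
    where
    open Fork 𝒮 {x = w} {tl = v ∷ []} (nw ∷ Nb-del nv ∷ []) ((ne wv ∷ []) ∷ [] ∷ []) (sp wv ∷ sp (S wv) ∷ []) (here refl) (inside (there (here refl) ∷ []))
    ρ = v ∷ w ∷ z ∷ x ∷ y ∷ []
    stars = (1 ∷ 0 ∷ []) ∷ (1 ∷ 2 ∷ []) ∷ (1 ∷ 3 ∷ []) ∷ (1 ∷ 4 ∷ []) ∷ []
    out : ∀ {t} → v ≢ t → Adj g w t → t ∉ w ∷ v ∷ []
    out v≢t a (here e) = ne a (sym e)
    out v≢t a (there (here e)) = v≢t (sym e)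
    far : ∀ {C} → (∀ {t} → t ∈ w ∷ v ∷ [] → t ∉ C) → z ∉ C → x ∉ C → y ∉ C → ⊤ → Untouched g (w ∷ v ∷ []) C
    far o z∉ x∉ y∉ _ (here refl) e = case cover nw e of λ where
      (here refl) → o (there (here refl))
      (there (here refl)) → z∉
      (there (there (here refl))) → x∉
      (there (there (there (here refl)))) → y∉
    far o z∉ x∉ y∉ _ (there (here refl)) e = case cover nv e of λ where
      (here refl) → o (here refl)

-- Reductions that keep the degrees of most vertices.

nb-length : {g : SG N} {v : Fin N} {ns ms : List (Fin N)} → Nb g v ns → Nb g v ms → length ns ≤ length ms
nb-length {ns = ns} nb nb′ with removeAll (uniq nb) (All.map (cover nb′) (all nb))
... | rest , p = subst (length ns ≤_) (sym (trans (↭-length p) (length-++ ns))) (m≤m+n _ _)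

front : {g : SG N} {v t : Fin N} {ns : List (Fin N)} → Nb g v ns → t ∈ ns → ∃[ ms ] (Nb g v (t ∷ ms) × length ns ≡ suc (length ms))
front nb t∈ with extract t∈
... | ms , p = ms , Nb-↭ p nb , ↭-length p

-- Only degrees matter here. K₃ has three vertices of degree two; K₅ and K₅⁻ alike contain three
-- pairwise adjacent vertices of degree four.
data Shape {N : ℕ} (h : SG N) (S : List (Fin N)) : Set where
  three : ∀ {a b c} → a ∈ S → b ∈ S → c ∈ S → Nb h a (b ∷ c ∷ []) → Nb h b (a ∷ c ∷ []) → Nb h c (a ∷ b ∷ []) → Shape h S
  five  : ∀ {x y z X Y Z} → x ∈ S → y ∈ S → z ∈ S → Adj h x y → Adj h x z → Adj h y z →
          Nb h x X → Nb h y Y → Nb h z Z → length X ≡ 4 → length Y ≡ 4 → length Z ≡ 4 → Shape h S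

shape : {h : SG N} {S : List (Fin N)} → Exc h S → Shape h S
shape {h = h} (k3 {a} {b} {c} i j k cl) = three (here refl) (there (here refl)) (there (there (here refl)))
  (nb-closed ((ne k ∷ []) ∷ [] ∷ []) (i ∷ j ∷ []) cl)
  (nb-closed ((ne j ∷ []) ∷ [] ∷ []) (Sy i ∷ k ∷ []) (closed-↭ (swap a b ↭-refl) cl))
  (nb-closed ((ne i ∷ []) ∷ [] ∷ []) (Sy j ∷ Sy k ∷ []) (closed-↭ (shift c (a ∷ b ∷ []) []) cl))
  where
  Sy : ∀ {u v} → Adj h u v → Adj h v u
  Sy = Adj-sym h
  ne : ∀ {u v} → Adj h u v → u ≢ v
  ne = Adj⇒≢ h
shape {h = h} (k5 {p} {q} {x} {y} {z} (near5 n p₁ p₂ p₃ q₁ q₂ q₃ r s t) _) =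
  five (there (there (here refl))) (there (there (there (here refl)))) (there (there (there (there (here refl))))) r s t
    (nb4 ((n ∷ ne p₂ ∷ ne p₃ ∷ []) ∷ (ne q₂ ∷ ne q₃ ∷ []) ∷ (ne t ∷ []) ∷ [] ∷ []) (Sy p₁ ∷ Sy q₁ ∷ r ∷ s ∷ []))
    (nb4 ((n ∷ ne p₁ ∷ ne p₃ ∷ []) ∷ (ne q₁ ∷ ne q₃ ∷ []) ∷ (ne s ∷ []) ∷ [] ∷ []) (Sy p₂ ∷ Sy q₂ ∷ Sy r ∷ t ∷ []))
    (nb4 ((n ∷ ne p₁ ∷ ne p₂ ∷ []) ∷ (ne q₁ ∷ ne q₂ ∷ []) ∷ (ne r ∷ []) ∷ [] ∷ []) (Sy p₃ ∷ Sy q₃ ∷ Sy s ∷ Sy t ∷ []))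
    refl refl refl
  where
  Sy : ∀ {u v} → Adj h u v → Adj h v u
  Sy = Adj-sym h
  ne : ∀ {u v} → Adj h u v → u ≢ v
  ne = Adj⇒≢ h

IsAny : List (Fin N × Fin N) → Fin N → Fin N → Set
IsAny ls u t = Any (λ cd → Is (proj₁ cd) (proj₂ cd) u t) ls

no-lifted-triangle : (ls : List (Fin N × Fin N)) {x y z : Fin N} → length ls ≤ 2 → x ≢ y → x ≢ z → y ≢ z →
                     IsAny ls x y → IsAny ls x z → IsAny ls y z → ⊥
no-lifted-triangle {N} ls {x} {y} {z} l x≢y x≢z y≢z = go ls l
  where
  xyz : ∀ {c d} → Is c d x y → Is c d x z → ⊥
  xyz i j = case Is-trans (Is-sym i) j of [ (λ (_ , q) → y≢z q) , (λ (q , _) → x≢z q) ]′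
  yxz : ∀ {c d} → Is c d x y → Is c d y z → ⊥
  yxz i j = case Is-trans (Is-sym i) j of [ (λ (q , _) → x≢y q) , (λ (q , _) → x≢z q) ]′
  zxy : ∀ {c d} → Is c d x z → Is c d y z → ⊥
  zxy i j = case Is-trans (Is-sym i) j of [ (λ (q , _) → x≢y q) , (λ (q , _) → x≢z q) ]′
  go : ∀ ls → length ls ≤ 2 → IsAny ls x y → IsAny ls x z → IsAny ls y z → ⊥
  go _ _ (here i) (here j) _ = xyz i j
  go _ _ (here i) _ (here j) = yxz i j
  go _ _ _ (here i) (here j) = zxy i j
  go (_ ∷ _ ∷ []) _ (there (here i)) (there (here j)) _ = xyz i j
  go (_ ∷ _ ∷ []) _ (there (here i)) _ (there (here j)) = yxz i j
  go (_ ∷ _ ∷ []) _ _ (there (here i)) (there (here j)) = zxy i j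
  go (_ ∷ _ ∷ _ ∷ _) (s≤s (s≤s ()))

-- The degree of u is the same in g and in h.
record Keep {N : ℕ} (g h : SG N) (u : Fin N) : Set where
  constructor keep
  field
    {ns ms} : List (Fin N)
    inh : Nb h u ns
    ing : Nb g u ms
    len : length ms ≡ length ns

-- The part of the neighbourhood of u affected by lifting cd at x.
record Part {N : ℕ} (g : SG N) (c d x u : Fin N) : Set where
  constructor part-of
  field
    R P : List (Fin N)
    uR  : Unique R
    R≡  : All (_≡ x) R
    aR  : All (Adj g u) R
    hit : Adj g x u → x ∈ R
    uP  : Unique P
    P≡  : All (Is c d u) P
    cov : ∀ {t} → Is c d u t → t ∈ P
    len : length R ≡ length P

part : {g : SG N} {c d x u : Fin N} → c ≢ d → Adj g x c → Adj g x d → (Adj g x u → u ≡ c ⊎ u ≡ d) → Part g c d x u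
part {g = g} {c} {d} {x} {u} c≢d xc xd f with u ≟ c | u ≟ d
... | yes refl | _ = part-of (x ∷ []) (d ∷ []) ([] ∷ []) (refl ∷ []) (Adj-sym g xc ∷ []) (λ _ → here refl) ([] ∷ []) (inj₁ (refl , refl) ∷ [])
      ([ (λ (_ , q) → here (sym q)) , (λ (_ , q) → contradiction (sym q) c≢d) ]′) refl
... | no _ | yes refl = part-of (x ∷ []) (c ∷ []) ([] ∷ []) (refl ∷ []) (Adj-sym g xd ∷ []) (λ _ → here refl) ([] ∷ []) (inj₂ (refl , refl) ∷ [])
      ([ (λ (q , _) → contradiction q c≢d) , (λ (q , _) → here (sym q)) ]′) refl
... | no p | no q = part-of [] [] [] [] [] (λ a → ⊥-elim ([ p , q ]′ (f a))) [] [] ([ (λ (e , _) → ⊥-elim (p (sym e))) , (λ (_ , e) → ⊥-elim (q (sym e))) ]′) refl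

module Keeping {N : ℕ} {g : SG N} {xs : List (Fin N)} {ls : List (Fin N × Fin N)} {h : SG N} (L : Lifted g xs ls h) where

  -- `u` loses the removed neighbours `R` and gains the lifted partners `P`. The latter were not
  -- adjacent to `u` before, so equal lengths keep the degree.
  keep-by : ∀ {u} (R P : List (Fin N)) → u ∉ xs → Unique R → All (_∈ xs) R → All (Adj g u) R → (∀ {x} → x ∈ xs → Adj g x u → x ∈ R) →
            Unique P → All (IsAny ls u) P → (∀ {t} → IsAny ls u t → t ∈ P) → All (λ t → adj g u t ≡ false) P → length R ≡ length P → Keep g h u
  keep-by {u} R P u∉ uR R⊆ aR hit uP P≡ cov nP len with nb-front R uR aR
  ... | ms , nb = keep (nbr uPm aPm cPm) nb (trans (length-++ R) (trans (cong (_+ length ms) len) (sym (length-++ P))))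
    where
    ms∉ : ∀ {t} → t ∈ ms → t ∉ xs
    ms∉ t∈ t∈xs = unique-++⁻-disj R (uniq nb) (hit t∈xs (Adj-sym g (All.lookup (all nb) (∈-++⁺ʳ R t∈)))) t∈
    uPm : Unique (P ++ ms)
    uPm = unique-++ uP (unique-++⁻ʳ R (uniq nb)) (λ t∈P t∈ms → ¬Adj (All.lookup (all nb) (∈-++⁺ʳ R t∈ms)) (All.lookup nP t∈P))
    orient : ∀ {t} → IsAny ls u t → Adj h u t
    orient i = go (lifted-new L) i
      where
      go : ∀ {ls t} → All (λ cd → Adj h (proj₁ cd) (proj₂ cd)) ls → IsAny ls u t → Adj h u t
      go (a ∷ _) (here (inj₁ (refl , refl))) = a
      go (a ∷ _) (here (inj₂ (refl , refl))) = Adj-sym h a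
      go (_ ∷ as) (there i) = go as i
    aPm : All (Adj h u) (P ++ ms)
    aPm = Allₚ.++⁺ (All.map orient P≡) (All.tabulate λ t∈ → lifted-old L u∉ (ms∉ t∈) (All.lookup (all nb) (∈-++⁺ʳ R t∈)))
    cPm : ∀ {t} → Adj h u t → t ∈ P ++ ms
    cPm a = case lifted-adj L a of
      [ (λ (_ , t∉ , b) → ∈-++⁺ʳ P (case ∈-++⁻ R (cover nb b) of
        [ (λ i → contradiction (All.lookup R⊆ i) t∉)
        , (λ i → i) ]′))
      , (λ (_ , _ , i) → ∈-++⁺ˡ (cov i)) ]′

keep-one : {g : SG N} {xs : List (Fin N)} {c d : Fin N} {h : SG N} → Lifted g xs ((c , d) ∷ []) h → {x u : Fin N} → u ∉ xs → x ∈ xs →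
           adj g c d ≡ false → Part g c d x u → (∀ {y} → y ∈ xs → y ≢ x → adj g y u ≡ false) → Keep g h u
keep-one {g = g} L {x} {u} u∉ x∈ cd p other = Keeping.keep-by L R P u∉ uR (All.map (λ e → subst (_∈ _) (sym e) x∈) R≡) aR
    (λ {y} y∈ a → case y ≟ x of λ where
      (yes refl) → hit a
      (no y≢x) → contradiction (other y∈ y≢x) (¬Adj a))
    uP (All.map here P≡) (any₁ cov) (All.map nonadj P≡) len
  where
  open Part p
  nonadj : ∀ {t} → Is _ _ u t → adj g u t ≡ false
  nonadj (inj₁ (refl , refl)) = cd
  nonadj (inj₂ (refl , refl)) = trans (symm g _ _) cd

keep-two : {g : SG N} {xs : List (Fin N)} {c d e f : Fin N} {h : SG N} → Lifted g xs ((e , f) ∷ (c , d) ∷ []) h → {x y u : Fin N} → u ∉ xs → x ∈ xs → y ∈ xs → x ≢ y →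
           adj g c d ≡ false → adj g e f ≡ false → ¬ Is c d e f → Part g c d x u → Part g e f y u →
           (∀ {z} → z ∈ xs → z ≢ x → z ≢ y → adj g z u ≡ false) → Keep g h u
keep-two {g = g} {xs} {c} {d} {e} {f} L {x} {y} {u} u∉ x∈ y∈ x≢y cd ef dist p q other = Keeping.keep-by L (P₁.R ++ P₂.R) (P₁.P ++ P₂.P) u∉
    (unique-++ P₁.uR P₂.uR (λ i j → x≢y (trans (sym (All.lookup P₁.R≡ i)) (All.lookup P₂.R≡ j))))
    (Allₚ.++⁺ (All.map (λ e → subst (_∈ _) (sym e) x∈) P₁.R≡) (All.map (λ e → subst (_∈ _) (sym e) y∈) P₂.R≡))
    (Allₚ.++⁺ P₁.aR P₂.aR) hits
    (unique-++ P₁.uP P₂.uP (λ i j → dist (Is-trans (All.lookup P₁.P≡ i) (Is-sym (All.lookup P₂.P≡ j)))))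
    (Allₚ.++⁺ (All.map (there ∘ here) P₁.P≡) (All.map here P₂.P≡))
    (any₂
      (λ i → ∈-++⁺ʳ P₁.P (P₂.cov i))
      (λ i → ∈-++⁺ˡ (P₁.cov i)))
    (Allₚ.++⁺ (All.map (nonadj cd) P₁.P≡) (All.map (nonadj ef) P₂.P≡))
    (trans (length-++ P₁.R) (trans (cong₂ _+_ P₁.len P₂.len) (sym (length-++ P₁.P))))
  where
  module P₁ = Part p
  module P₂ = Part q
  hits : ∀ {z} → z ∈ xs → Adj g z u → z ∈ P₁.R ++ P₂.R
  hits {z} z∈ a with z ≟ x | z ≟ y
  ... | yes refl | _ = ∈-++⁺ˡ (P₁.hit a)
  ... | no _ | yes refl = ∈-++⁺ʳ P₁.R (P₂.hit a)
  ... | no z≢x | no z≢y = contradiction (other z∈ z≢x z≢y) (¬Adj a)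
  nonadj : ∀ {c d} → adj g c d ≡ false → ∀ {t} → Is c d u t → adj g u t ≡ false
  nonadj cd (inj₁ (refl , refl)) = cd
  nonadj cd (inj₂ (refl , refl)) = trans (symm g _ _) cd

record LastSetting (N : ℕ) : Set where
  no-eta-equality
  field
    setting : Setting N
  open Setting setting public
  field
    noK4 : K4-free g
    k    : ℕ
    od   : length W ≡ suc (k + k)
    no2  : ∀ {v a b} → ¬ Nb g v (a ∷ b ∷ [])
    four⇒3 : ∀ {w v x y z} → Nb g w (v ∷ x ∷ y ∷ z ∷ []) → ∃[ a ] ∃[ c ] Nb g v (w ∷ a ∷ c ∷ [])

module LastPhase {N : ℕ} (ℒ : LastSetting N) where
  open LastSetting ℒ
  open Step setting

  private
    S : ∀ {u v} → Adj g u v → Adj g v u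
    S = Adj-sym g
    ne : ∀ {u v} → Adj g u v → u ≢ v
    ne = Adj⇒≢ g

  rot : ∀ {h : SG N} {w v x y z} → Nb h w (v ∷ x ∷ y ∷ z ∷ []) → Nb h w (x ∷ y ∷ z ∷ v ∷ [])
  rot {v = v} {x} {y} {z} = Nb-↭ (++-comm (v ∷ []) (x ∷ y ∷ z ∷ []))

  no-44 : ∀ {x y X Y} → Nb g x X → Nb g y Y → length X ≡ 4 → length Y ≡ 4 → ¬ Adj g x y
  no-44 nx ny lx ly xy with front nx (cover nx xy)
  ... | a ∷ b ∷ c ∷ [] , nx′ , _ = let _ , _ , n3 = four⇒3 nx′ in
          case subst (_≤ 3) ly (nb-length ny n3) of λ where (s≤s (s≤s (s≤s ())))
  ... | [] , _ , e = case trans (sym lx) e of λ ()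
  ... | _ ∷ [] , _ , e = case trans (sym lx) e of λ ()
  ... | _ ∷ _ ∷ [] , _ , e = case trans (sym lx) e of λ ()
  ... | _ ∷ _ ∷ _ ∷ _ ∷ _ , _ , e = case trans (sym lx) e of λ ()

  deg2-⊥ : ∀ {h u s t} → Nb h u (s ∷ t ∷ []) → Keep g h u → ⊥
  deg2-⊥ {u = u} nh (keep {ns} {ms} inh ing len) = go ms ing (trans len (ℕ.≤-antisym (nb-length inh nh) (nb-length nh inh)))
    where
    go : ∀ ms → Nb g u ms → length ms ≡ 2 → ⊥
    go (_ ∷ _ ∷ []) nb _ = no2 nb

  -- Without vertices of degree two and adjacent vertices of degree four, an
  -- exceptional component needs vertices that lost edges.
  quiet : ∀ {xs ls h C} → Lifted g xs ls h → length ls ≤ 2 → Exc h C → (Ex : List (Fin N)) → length Ex ≤ 2 →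
          (∀ {u} → u ∈ Ex → u ∈ C → Room h u) → (∀ {u} → u ∈ C → u ∉ Ex → Keep g h u) → ⊥
  quiet {ls = ls} {h} {C} L l≤ E Ex ex≤ rm kp with shape E
  -- `Ex` cannot contain all three vertices, and one outside it would have degree two in `g`.
  ... | three {a} {b} {c} a∈ b∈ c∈ na@(nbr ((b≢c ∷ []) ∷ _) (ab ∷ ac ∷ []) _) nb nc with member? a Ex | member? b Ex | member? c Ex
  ...   | no a∉ | _ | _ = deg2-⊥ na (kp a∈ a∉)
  ...   | yes _ | no b∉ | _ = deg2-⊥ nb (kp b∈ b∉)
  ...   | yes _ | yes _ | no c∉ = deg2-⊥ nc (kp c∈ c∉)
  ...   | yes i | yes j | yes k with removeAll {xs = a ∷ b ∷ c ∷ []} {Ex} ((Adj⇒≢ h ab ∷ Adj⇒≢ h ac ∷ []) ∷ (b≢c ∷ []) ∷ [] ∷ []) (i ∷ j ∷ k ∷ [])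
  ...     | ms , p = case subst (_≤ 2) (↭-length p) ex≤ of λ where (s≤s (s≤s ()))
  quiet {ls = ls} {h} {C} L l≤ E Ex ex≤ rm kp | five {x} {y} {z} x∈ y∈ z∈ xy xz yz nx ny nz lx ly lz =
    no-lifted-triangle ls l≤ (Adj⇒≢ h xy) (Adj⇒≢ h xz) (Adj⇒≢ h yz) (fake xy x∈ y∈ nx ny lx ly) (fake xz x∈ z∈ nx nz lx lz) (fake yz y∈ z∈ ny nz ly lz)
    where
    four : ∀ {u U} → u ∈ C → Nb h u U → length U ≡ 4 → ∃[ ms ] (Nb g u ms × length ms ≡ 4)
    four {u} u∈ nu lu with kp u∈ (λ u∈Ex → case subst (_≤ 3) lu (rm u∈Ex u∈ (uniq nu) (all nu)) of λ where (s≤s (s≤s (s≤s ()))))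
    ... | keep inh ing len = _ , ing , trans len (trans (ℕ.≤-antisym (nb-length inh nu) (nb-length nu inh)) lu)
    -- Both ends have degree four in `g` as well, so they are not adjacent there. All three sides of
    -- the triangle would be lifted edges, of which there are at most two.
    fake : ∀ {u t U T} → Adj h u t → u ∈ C → t ∈ C → Nb h u U → Nb h t T → length U ≡ 4 → length T ≡ 4 → IsAny ls u t
    fake ut u∈ t∈ nu nt lu lt = case lifted-adj L ut of λ where
      (inj₂ (_ , _ , i)) → i
      (inj₁ (_ , _ , e)) → let _ , gu , gl = four u∈ nu lu ; _ , gt , gl′ = four t∈ nt lt in ⊥-elim (no-44 gu gt gl gl′ e)

module TwoLift {N : ℕ} {g : SG N} {xs : List (Fin N)} {c d e f x y : Fin N} (c∉ : c ∉ xs) (d∉ : d ∉ xs) (e∉ : e ∉ xs) (f∉ : f ∉ xs)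
               (x∈ : x ∈ xs) (y∈ : y ∈ xs) (x≢y : x ≢ y) (xc : Adj g x c) (xd : Adj g x d) (ye : Adj g y e) (yf : Adj g y f)
               (c≢d : c ≢ d) (e≢f : e ≢ f) (cd : adj g c d ≡ false) (ef : adj g e f ≡ false) (dist : ¬ Is c d e f) where
  module O = OneLift {g = g} {xs} c∉ d∉ x∈ xc x∈ xd c≢d cd
  room-y : ∀ {t} → Adj g y t → Room O.h t
  room-y {t} yt with t ≟ c | t ≟ d
  ... | yes refl | _ = roomN-add O.gp (roomN (x ∷ y ∷ []) ((x≢y ∷ []) ∷ [] ∷ []) (x∈ ∷ y∈ ∷ []) (Adj-sym g xc ∷ Adj-sym g yt ∷ []) refl)
  ... | no _ | yes refl = roomN-add O.gp (roomN (x ∷ y ∷ []) ((x≢y ∷ []) ∷ [] ∷ []) (x∈ ∷ y∈ ∷ []) (Adj-sym g xd ∷ Adj-sym g yt ∷ []) refl)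
  ... | no t≢c | no t≢d = O.room′ t≢c t≢d y∈ yt
  gp : Gap O.h e f
  gp = gap e≢f (¬Adj⇒false (λ a → case add⁻ O.gp a of
         [ (λ b → ¬Adj (dels-⊑ xs g b) ef)
         , dist ]′)) (room-y ye) (room-y yf)
  h : SG N
  h = add e f O.h gp
  L : Lifted g xs ((e , f) ∷ (c , d) ∷ []) h
  L = lift e∉ f∉ y∈ ye y∈ yf O.L gp
  room-b : ∀ {b} → Adj g y b → b ≢ e → b ≢ f → Room h b
  room-b yb b≢e b≢f un al = room-y yb un (All.map (λ a → case add⁻ gp a of
    [ (λ a → a)
    , [ (λ (q , _) → contradiction (sym q) b≢e) , (λ (_ , q) → contradiction (sym q) b≢f) ]′ ]′) al)

keep-none : {g : SG N} {xs : List (Fin N)} {u : Fin N} → u ∉ xs → (∀ {y} → y ∈ xs → adj g y u ≡ false) → Keep g (dels xs g) u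
keep-none u∉ other = Keeping.keep-by none [] [] u∉ [] [] [] (λ y∈ a → contradiction (other y∈) (¬Adj a)) [] [] (λ ()) [] refl

nb≡3 : {g : SG N} {v a b c : Fin N} {ms : List (Fin N)} → Nb g v (a ∷ b ∷ c ∷ []) → Nb g v ms → length ms ≡ 3
nb≡3 n3 nm = ℕ.≤-antisym (nb-length nm n3) (nb-length n3 nm)

nb3 : {g : SG N} {v a b c x y z : Fin N} → Nb g v (a ∷ b ∷ c ∷ []) → Unique (x ∷ y ∷ z ∷ []) → All (Adj g v) (x ∷ y ∷ z ∷ []) → Nb g v (x ∷ y ∷ z ∷ [])
nb3 nb un al with nb-front _ un al
... | [] , nb′ = nb′
... | _ ∷ _ , nb′ = case nb≡3 nb nb′ of λ ()

nb3′ : {g : SG N} {v a b c x y : Fin N} → Nb g v (a ∷ b ∷ c ∷ []) → x ≢ y → Adj g v x → Adj g v y → ∃[ z ] Nb g v (x ∷ y ∷ z ∷ [])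
nb3′ nb x≢y vx vy with nb-front _ ((x≢y ∷ []) ∷ [] ∷ []) (vx ∷ vy ∷ [])
... | z ∷ [] , nb′ = z , nb′
... | [] , nb′ = case nb≡3 nb nb′ of λ ()
... | _ ∷ _ ∷ _ , nb′ = case nb≡3 nb nb′ of λ ()

-- A vertex of degree four whose neighbours have degree three.

module FinalPhase {N : ℕ} (ℒ : LastSetting N) where
  open LastSetting ℒ
  open Step setting
  open LastPhase ℒ

  private
    S : ∀ {u v} → Adj g u v → Adj g v u
    S = Adj-sym g
    ne : ∀ {u v} → Adj g u v → u ≢ v
    ne = Adj⇒≢ g

    moved : ∀ {x y u : Fin N} → y ≡ x → adj g x u ≡ false → adj g y u ≡ false
    moved refl e = e

  Done : Set
  Done = Result g ⌊ length W /2⌋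

  sure : ∀ {h : SG N} → (∀ {C} → Exc h C → ⊥) → Goal ⊎ ∃[ C ] (Exc h C × ⊤) → Done
  sure n (inj₁ good) = inj₁ good
  sure n (inj₂ (C , E , _)) = ⊥-elim (n E)

  -- Of the surviving vertices only `b` loses an edge for good; `a`, `c`, `e`, `f` get theirs back
  -- by lifting at `v` and at `w`. The pairs must differ, or the same edge would be added twice.
  spoke : ∀ {w v a b c e f} → Nb g w (v ∷ b ∷ e ∷ f ∷ []) → Nb g v (w ∷ a ∷ c ∷ []) →
          adj g a c ≡ false → adj g e f ≡ false → ¬ Is a c e f → Done
  spoke {w} {v} {a} {b} {c} {e} {f} nw@(nbr ((v≢b ∷ v≢e ∷ v≢f ∷ []) ∷ (b≢e ∷ b≢f ∷ []) ∷ (e≢f ∷ []) ∷ _) (wv ∷ wb ∷ we ∷ wf ∷ []) _)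
        nv@(nbr ((w≢a ∷ w≢c ∷ []) ∷ (a≢c ∷ []) ∷ _) (vw ∷ va ∷ vc ∷ []) _) ac ef dist =
    sure (λ E → quiet L (s≤s (s≤s z≤n)) E (b ∷ []) (s≤s z≤n) (λ where (here refl) _ → room-b wb b≢e b≢f) (λ u∈ u∉ → kept (out E u∈) (u∉ ∘ here)))
      (reduce (lft e f (w ∷ []) ∷ lft a c (v ∷ []) ∷ []) (nv ∷ Nb-del nw ∷ []) L uxs (inW ((_ , vw) ∷ (_ , wv) ∷ [])) ((v ∷ w ∷ b ∷ []) ∷ [])
        ((((ne vw ∷ v≢b ∷ []) ∷ (ne wb ∷ []) ∷ [] ∷ []) , s≤s (s≤s z≤n)) ∷ []) (tt ∷ tt ∷ []) (((λ i → dist (Is-sym i)) ∷ []) ∷ [] ∷ [])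
        ((ne wv ∷ []) ∷ [] ∷ []) (there (here refl) ∷ here refl ∷ [])
        (balanced (v ∷ w ∷ a ∷ c ∷ b ∷ e ∷ f ∷ []) v
          ((0 ∷ 1 ∷ []) ∷ (0 ∷ 2 ∷ []) ∷ (0 ∷ 3 ∷ []) ∷ (1 ∷ 4 ∷ []) ∷ (1 ∷ 5 ∷ []) ∷ (1 ∷ 6 ∷ []) ∷ [])
          ((0 ∷ 1 ∷ 4 ∷ []) ∷ (5 ∷ 1 ∷ 6 ∷ []) ∷ (2 ∷ 0 ∷ 3 ∷ []) ∷ []) refl refl refl)
        (s≤s z≤n) two-for-one (λ _ → ⊤) (λ _ → inj₂ tt))
    where
    xs : List (Fin N)
    xs = v ∷ w ∷ []
    uxs : Unique xs
    uxs = (ne vw ∷ []) ∷ [] ∷ []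
    v-out : ∀ {t} → w ≢ t → Adj g v t → t ∉ xs
    v-out w≢t x (here q) = ne x (sym q)
    v-out w≢t x (there (here q)) = w≢t (sym q)
    w-out : ∀ {t} → v ≢ t → Adj g w t → t ∉ xs
    w-out v≢t x (here q) = v≢t (sym q)
    w-out v≢t x (there (here q)) = ne x (sym q)
    open TwoLift {g = g} {xs} (v-out w≢a va) (v-out w≢c vc) (w-out v≢e we) (w-out v≢f wf) (here refl) (there (here refl)) (ne vw) va vc we wf a≢c e≢f ac ef dist
    out : ∀ {C u} → Exc h C → u ∈ C → u ∉ xs
    out E u∈ = let _ , _ , _ , a , _ = exc-degree E u∈ in lifted-∉ L a
    kept : ∀ {u} → u ∉ xs → u ≢ b → Keep g h u
    kept {u} u∉ u≢b = keep-two L u∉ (here refl) (there (here refl)) (ne vw) ac ef dist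
      (part a≢c va vc λ x → case cover nv x of any₃
        (λ q → contradiction (there (here q)) u∉)
        inj₁
        inj₂)
      (part e≢f we wf λ x → case cover nw x of any₄
        (λ q → contradiction (here q) u∉)
        (λ q → contradiction q u≢b)
        inj₁
        inj₂)
      (any₂ (λ q n _ → contradiction q n) (λ q _ n → contradiction q n))

  -- The wheel with hub w and rim v a b c.
  wheel : ∀ {w v a b c} → Nb g w (v ∷ b ∷ a ∷ c ∷ []) → Nb g v (w ∷ a ∷ c ∷ []) → Adj g b a → Adj g b c → Done
  wheel {w} {v} {a} {b} {c} nw@(nbr ((v≢b ∷ v≢a ∷ v≢c ∷ []) ∷ (b≢a ∷ b≢c ∷ []) ∷ (a≢c ∷ []) ∷ _) (wv ∷ wb ∷ wa ∷ wc ∷ []) _)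
        nv@(nbr _ (_ ∷ va ∷ vc ∷ []) _) ba bc =
    sure (λ E → quiet none z≤n E [] z≤n (λ ()) (λ u∈ _ → keep-none (out E u∈) (λ y∈ → ¬Adj⇒false λ x → out E u∈ (closed y∈ x))))
      (reduce [] (nw ∷ Nb-del nv ∷ Nb-del-∉ (v≢b ∘ sym) (Nb-del nb) (All≢⇒∉ (v≢a ∷ v≢c ∷ [])) ∷ Nb-del (Nb-del (Nb-del na))
          ∷ Nb-del-∉ (a≢c ∘ sym) (Nb-del (Nb-del (Nb-del nc))) (λ ()) ∷ []) none u5 (inW ((_ , wv) ∷ (_ , va) ∷ (_ , ba) ∷ (_ , S wa) ∷ (_ , S wc) ∷ []))
        ((v ∷ a ∷ w ∷ c ∷ b ∷ []) ∷ (c ∷ v ∷ w ∷ b ∷ a ∷ []) ∷ [])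
        (named xs w 1 3 (0 ∷ 4 ∷ 2 ∷ []) refl u5 refl ∷ named xs w 4 1 (0 ∷ 2 ∷ 3 ∷ []) refl u5 refl ∷ []) [] [] [] []
        (balanced xs w ((0 ∷ 1 ∷ []) ∷ (0 ∷ 2 ∷ []) ∷ (0 ∷ 3 ∷ []) ∷ (0 ∷ 4 ∷ []) ∷ (1 ∷ 3 ∷ []) ∷ (1 ∷ 4 ∷ []) ∷ (2 ∷ 3 ∷ []) ∷ (2 ∷ 4 ∷ []) ∷ [])
          ((1 ∷ 3 ∷ 0 ∷ 4 ∷ 2 ∷ []) ∷ (4 ∷ 1 ∷ 0 ∷ 2 ∷ 3 ∷ []) ∷ []) refl refl refl)
        (s≤s z≤n) (odd-for {k} 2 od) (λ _ → ⊤) (λ _ → inj₂ tt))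
    where
    xs : List (Fin N)
    xs = w ∷ v ∷ b ∷ a ∷ c ∷ []
    u5 : Unique xs
    u5 = (ne wv ∷ ne wb ∷ ne wa ∷ ne wc ∷ []) ∷ uniq nw
    -- The rim vertices are neighbours of `w`, so they have degree three and no edge leaves the
    -- wheel. Its eight edges form two Hamiltonian paths.
    nb : Nb g b (w ∷ a ∷ c ∷ [])
    nb = nb3 (proj₂ (proj₂ (four⇒3 (Nb-↭ (swap v b ↭-refl) nw)))) ((ne wa ∷ ne wc ∷ []) ∷ (a≢c ∷ []) ∷ [] ∷ []) (S wb ∷ ba ∷ bc ∷ [])
    na : Nb g a (w ∷ v ∷ b ∷ [])
    na = nb3 (proj₂ (proj₂ (four⇒3 (rot (rot nw))))) ((ne wv ∷ ne wb ∷ []) ∷ (v≢b ∷ []) ∷ [] ∷ []) (S wa ∷ S va ∷ S ba ∷ [])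
    nc : Nb g c (w ∷ v ∷ b ∷ [])
    nc = nb3 (proj₂ (proj₂ (four⇒3 (rot (rot (rot nw)))))) ((ne wv ∷ ne wb ∷ []) ∷ (v≢b ∷ []) ∷ [] ∷ []) (S wc ∷ S vc ∷ S bc ∷ [])
    out : ∀ {C u} → Exc (dels xs g) C → u ∈ C → u ∉ xs
    out E u∈ = let _ , _ , _ , a , _ = exc-degree E u∈ in proj₁ (dels⁻ xs g a)
    W′ : w ∈ xs
    W′ = here refl
    V′ : v ∈ xs
    V′ = there (here refl)
    B′ : b ∈ xs
    B′ = there (there (here refl))
    A′ : a ∈ xs
    A′ = there (there (there (here refl)))
    C′ : c ∈ xs
    C′ = there (there (there (there (here refl))))
    via : ∀ {y ns u} → Nb g y ns → All (_∈ xs) ns → Adj g y u → u ∈ xs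
    via nb al x = All.lookup al (cover nb x)
    closed : Closed g xs
    closed y∈ x = All.lookup {P = λ y → ∀ {u} → Adj g y u → u ∈ xs}
      (via nw (V′ ∷ B′ ∷ A′ ∷ C′ ∷ []) ∷ via nv (W′ ∷ A′ ∷ C′ ∷ []) ∷ via nb (W′ ∷ A′ ∷ C′ ∷ [])
        ∷ via na (W′ ∷ V′ ∷ B′ ∷ []) ∷ via nc (W′ ∷ V′ ∷ B′ ∷ []) ∷ []) y∈ x

  -- `x`, `y`, `z` are not pairwise adjacent, or there would be a K₄. A non-adjacent pair other than
  -- `a c` gives a spoke; otherwise `a c` is the only one, and the third vertex closes the rim of a
  -- wheel.
  open-star : ∀ {w v x y z a c} → Nb g w (v ∷ x ∷ y ∷ z ∷ []) → Nb g v (w ∷ a ∷ c ∷ []) → adj g a c ≡ false → Done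
  open-star {w} {v} {x} {y} {z} {a} {c} nw@(nbr (_ ∷ (x≢y ∷ x≢z ∷ []) ∷ (y≢z ∷ []) ∷ _) (_ ∷ wx ∷ wy ∷ wz ∷ []) _) nv ac =
      go (is? a c y z) (is? a c x z) (is? a c x y)
    where
    nx = perm₁ nw
    nz = perm₁ (perm₂ nw)
    free : ∀ {b e f} → Nb g w (v ∷ b ∷ e ∷ f ∷ []) → ¬ Is a c e f → Done ⊎ Adj g e f
    free {b} {e} {f} nw n with Adj? g e f
    ... | inj₁ i = inj₂ i
    ... | inj₂ i = inj₁ (spoke nw nv ac i n)
    rim : ∀ {b e f} → Nb g w (v ∷ b ∷ e ∷ f ∷ []) → Is a c e f → Adj g b e → Adj g b f → Done
    rim nw (inj₁ (refl , refl)) be bf = wheel nw nv be bf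
    rim nw (inj₂ (refl , refl)) be bf = wheel (perm₂ nw) nv bf be
    both : ∀ {A B : Set} → Done ⊎ A → Done ⊎ B → (A → B → Done) → Done
    both (inj₁ r) _ _ = r
    both (inj₂ _) (inj₁ r) _ = r
    both (inj₂ p) (inj₂ q) k = k p q
    clash : ∀ {p q r s} → Is a c p q → Is a c r s → (p ≡ r × q ≡ s) ⊎ (p ≡ s × q ≡ r)
    clash i j = Is-trans (Is-sym i) j
    go : Dec (Is a c y z) → Dec (Is a c x z) → Dec (Is a c x y) → Done
    go (no i) (no j) (no k) = both (free nw i) (both′ (free nx j) (free nz k)) λ yz (xz , xy) → contradiction (k4 wx wy wz xy xz yz) noK4
      where
      both′ : ∀ {A B : Set} → Done ⊎ A → Done ⊎ B → Done ⊎ (A × B)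
      both′ (inj₁ r) _ = inj₁ r
      both′ (inj₂ _) (inj₁ r) = inj₁ r
      both′ (inj₂ p) (inj₂ q) = inj₂ (p , q)
    go (yes i) (no j) (no k) = both (free nx j) (free nz k) λ xz xy → rim nw i xy xz
    go (no i) (yes j) (no k) = both (free nw i) (free nz k) λ yz xy → rim nx j (S xy) yz
    go (no i) (no j) (yes k) = both (free nw i) (free nx j) λ yz xz → rim nz k (S xz) (S yz)
    go (yes i) (yes j) _ = case clash i j of
      [ (λ (p , _) → contradiction (sym p) x≢y)
      , (λ (p , _) → contradiction p y≢z) ]′
    go (yes i) (no _) (yes j) = case clash i j of
      [ (λ (p , _) → contradiction (sym p) x≢y)
      , (λ (_ , p) → contradiction (sym p) x≢z) ]′
    go (no _) (yes i) (yes j) = case clash i j of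
      [ (λ (_ , p) → contradiction (sym p) y≢z)
      , (λ (p , _) → contradiction p x≢y) ]′

  fresh-out : ∀ {xs ls h C u} → Lifted g xs ls h → Exc h C → u ∈ C → u ∉ xs
  fresh-out L E u∈ = let _ , _ , _ , a , _ = exc-degree E u∈ in lifted-∉ L a

  -- The diamond v, a hangs between w and c.
  record Diamond (w v a c p q : Fin N) : Set where
    constructor diamond
    field
      nw : Nb g w (v ∷ a ∷ p ∷ q ∷ [])
      nv : Nb g v (w ∷ a ∷ c ∷ [])
      na : Nb g a (w ∷ v ∷ c ∷ [])
      wc : adj g w c ≡ false

  module AtDiamond {w v a c p q : Fin N} (d : Diamond w v a c p q) where
    open Diamond d public
    wv = All.head (all nw)
    wa = All.lookup (all nw) (there (here refl))
    wp = All.lookup (all nw) (there (there (here refl)))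
    wq = All.lookup (all nw) (there (there (there (here refl))))
    va = All.lookup (all nv) (there (here refl))
    vc = All.lookup (all nv) (there (there (here refl)))
    ac = All.lookup (all na) (there (there (here refl)))
    v≢p : v ≢ p
    v≢p = All.lookup (AllPairs.head (uniq nw)) (there (here refl))
    v≢q : v ≢ q
    v≢q = All.lookup (AllPairs.head (uniq nw)) (there (there (here refl)))
    a≢p : a ≢ p
    a≢p = All.head (AllPairs.head (AllPairs.tail (uniq nw)))
    a≢q : a ≢ q
    a≢q = All.lookup (AllPairs.head (AllPairs.tail (uniq nw))) (there (here refl))
    p≢q : p ≢ q
    p≢q = All.head (AllPairs.head (AllPairs.tail (AllPairs.tail (uniq nw))))
    w≢c : w ≢ c
    w≢c = All.lookup (AllPairs.head (uniq nv)) (there (here refl))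
    p≢c : p ≢ c
    p≢c refl = contradiction wc (¬Adj wp)
    q≢c : q ≢ c
    q≢c refl = contradiction wc (¬Adj wq)
    xs : List (Fin N)
    xs = w ∷ v ∷ a ∷ c ∷ []
    uxs : Unique xs
    uxs = (ne wv ∷ ne wa ∷ w≢c ∷ []) ∷ (ne va ∷ ne vc ∷ []) ∷ (ne ac ∷ []) ∷ [] ∷ []
    W∈ : w ∈ xs
    W∈ = here refl
    C∈ : c ∈ xs
    C∈ = there (there (there (here refl)))
    p∉ : p ∉ xs
    p∉ = All≢⇒∉ ((ne wp ∘ sym) ∷ (v≢p ∘ sym) ∷ (a≢p ∘ sym) ∷ p≢c ∷ [])
    q∉ : q ∉ xs
    q∉ = All≢⇒∉ ((ne wq ∘ sym) ∷ (v≢q ∘ sym) ∷ (a≢q ∘ sym) ∷ q≢c ∷ [])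
    strip : ∀ {X} → Nb g c (v ∷ a ∷ X) → Strip g xs (star w (v ∷ a ∷ p ∷ q ∷ []) ++ star v (a ∷ c ∷ []) ++ star a (c ∷ []) ++ star c X ++ [])
    strip nc = nw ∷ Nb-del nv ∷ Nb-del (Nb-del na) ∷ Nb-del (Nb-del (Nb-del-∉ (w≢c ∘ sym) nc (λ w∈ → ¬Adj (S (All.lookup (all nc) w∈)) wc))) ∷ []
    ex : All (_∈ W) xs
    ex = inW ((_ , wv) ∷ (_ , va) ∷ (_ , ac) ∷ (_ , S vc) ∷ [])
    from-w : ∀ {u} → u ∉ xs → Adj g w u → u ≡ p ⊎ u ≡ q
    from-w u∉ x = case cover nw x of any₄
      (λ e → contradiction (there (here e)) u∉)
      (λ e → contradiction (there (there (here e))) u∉)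
      inj₁
      inj₂
    not-v : ∀ {u} → u ∉ xs → adj g v u ≡ false
    not-v u∉ = Nb-∉ nv (any₃
      (λ e → u∉ (here e))
      (λ e → u∉ (there (there (here e))))
      (λ e → u∉ (there (there (there (here e))))))
    not-a : ∀ {u} → u ∉ xs → adj g a u ≡ false
    not-a u∉ = Nb-∉ na (any₃
      (λ e → u∉ (here e))
      (λ e → u∉ (there (here e)))
      (λ e → u∉ (there (there (there (here e))))))

    -- Lifting `pq` through `w` restores the degrees on that side, so only `t` can lose an edge. The
    -- ends of the new paths absorb nothing here; the degrees alone exclude exceptional components.
    far-3 : ∀ {t} → Nb g c (v ∷ a ∷ t ∷ []) → adj g p q ≡ false → Done
    far-3 {t} nc@(nbr ((v≢a ∷ v≢t ∷ []) ∷ (a≢t ∷ []) ∷ _) (_ ∷ _ ∷ ct ∷ []) _) pq =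
      sure (λ E → quiet L (s≤s z≤n) E (t ∷ []) (s≤s z≤n) (λ where (here refl) _ → room-t (t ≟ p) (t ≟ q)) (λ u∈ u∉ → kept (fresh-out L E u∈) (u∉ ∘ here)))
        (reduce (lft p q (w ∷ []) ∷ []) (strip nc) L uxs ex ((t ∷ c ∷ v ∷ w ∷ a ∷ []) ∷ (v ∷ a ∷ c ∷ []) ∷ [])
          (named ρ w 4 3 (1 ∷ 0 ∷ 2 ∷ []) refl uρ refl ∷ named ρ w 1 2 (3 ∷ []) refl uρ refl ∷ []) (tt ∷ []) ([] ∷ []) ([] ∷ []) (W∈ ∷ [])
          (balanced (w ∷ v ∷ a ∷ c ∷ t ∷ p ∷ q ∷ []) w
            ((0 ∷ 1 ∷ []) ∷ (0 ∷ 2 ∷ []) ∷ (0 ∷ 5 ∷ []) ∷ (0 ∷ 6 ∷ []) ∷ (1 ∷ 2 ∷ []) ∷ (1 ∷ 3 ∷ []) ∷ (2 ∷ 3 ∷ []) ∷ (3 ∷ 4 ∷ []) ∷ [])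
            ((4 ∷ 3 ∷ 1 ∷ 0 ∷ 2 ∷ []) ∷ (1 ∷ 2 ∷ 3 ∷ []) ∷ (5 ∷ 0 ∷ 6 ∷ []) ∷ []) refl refl refl)
          (s≤s z≤n) four-for-two (λ _ → ⊤) (λ _ → inj₂ tt))
      where
      open OneLift {g = g} {xs} p∉ q∉ W∈ wp W∈ wq p≢q pq
      w≢t : w ≢ t
      w≢t refl = contradiction wc (¬Adj (S ct))
      ρ = w ∷ v ∷ a ∷ c ∷ t ∷ []
      uρ : Unique ρ
      uρ = (ne wv ∷ ne wa ∷ w≢c ∷ w≢t ∷ []) ∷ (ne va ∷ ne vc ∷ v≢t ∷ []) ∷ (ne ac ∷ a≢t ∷ []) ∷ (ne ct ∷ []) ∷ [] ∷ []
      room-t : Dec (t ≡ p) → Dec (t ≡ q) → Room h t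
      room-t (yes refl) _ = roomN-add gp (roomN (w ∷ c ∷ []) ((w≢c ∷ []) ∷ [] ∷ []) (W∈ ∷ C∈ ∷ []) (S wp ∷ S ct ∷ []) refl)
      room-t (no _) (yes refl) = roomN-add gp (roomN (w ∷ c ∷ []) ((w≢c ∷ []) ∷ [] ∷ []) (W∈ ∷ C∈ ∷ []) (S wq ∷ S ct ∷ []) refl)
      room-t (no t≢p) (no t≢q) = room′ t≢p t≢q C∈ ct
      kept : ∀ {u} → u ∉ xs → u ≢ t → Keep g h u
      kept {u} u∉ u≢t = keep-one L u∉ W∈ pq (part p≢q wp wq (from-w u∉)) (any₄
        (λ e n → contradiction e n)
        (λ e _ → moved e (not-v u∉))
        (λ e _ → moved e (not-a u∉))
        (λ e _ → moved e (Nb-∉ nc (any₃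
          (λ e → u∉ (there (here e)))
          (λ e → u∉ (there (there (here e))))
          u≢t))))

    -- Lifting on both sides of the diamond restores every degree, provided that the two pairs
    -- differ.
    far-4 : ∀ {s t} → Nb g c (v ∷ a ∷ s ∷ t ∷ []) → adj g p q ≡ false → adj g s t ≡ false → ¬ Is p q s t → Done
    far-4 {s} {t} nc@(nbr ((v≢a ∷ v≢s ∷ v≢t ∷ []) ∷ (a≢s ∷ a≢t ∷ []) ∷ (s≢t ∷ []) ∷ _) (_ ∷ _ ∷ cs ∷ ct ∷ []) _) pq st dist =
      sure (λ E → quiet L (s≤s (s≤s z≤n)) E [] z≤n (λ ()) (λ u∈ _ → kept (fresh-out L E u∈)))
        (reduce (lft s t (c ∷ []) ∷ lft p q (w ∷ []) ∷ []) (strip nc) L uxs ex ((c ∷ v ∷ w ∷ a ∷ []) ∷ (v ∷ a ∷ c ∷ []) ∷ [])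
          (named xs w 3 1 (0 ∷ 2 ∷ []) refl uxs refl ∷ named xs w 1 2 (3 ∷ []) refl uxs refl ∷ []) (tt ∷ tt ∷ []) (((λ i → dist (Is-sym i)) ∷ []) ∷ [] ∷ [])
          (((w≢c ∘ sym) ∷ []) ∷ [] ∷ []) (C∈ ∷ W∈ ∷ [])
          (balanced (w ∷ v ∷ a ∷ c ∷ s ∷ t ∷ p ∷ q ∷ []) w
            ((0 ∷ 1 ∷ []) ∷ (0 ∷ 2 ∷ []) ∷ (0 ∷ 6 ∷ []) ∷ (0 ∷ 7 ∷ []) ∷ (1 ∷ 2 ∷ []) ∷ (1 ∷ 3 ∷ []) ∷ (2 ∷ 3 ∷ []) ∷ (3 ∷ 4 ∷ []) ∷ (3 ∷ 5 ∷ []) ∷ [])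
            ((3 ∷ 1 ∷ 0 ∷ 2 ∷ []) ∷ (1 ∷ 2 ∷ 3 ∷ []) ∷ (4 ∷ 3 ∷ 5 ∷ []) ∷ (6 ∷ 0 ∷ 7 ∷ []) ∷ []) refl refl refl)
          (s≤s z≤n) four-for-two (λ _ → ⊤) (λ _ → inj₂ tt))
      where
      c-out : ∀ {z} → v ≢ z → a ≢ z → Adj g c z → z ∉ xs
      c-out v≢z a≢z cz = All≢⇒∉ ((λ where refl → contradiction wc (¬Adj (S cz))) ∷ (v≢z ∘ sym) ∷ (a≢z ∘ sym) ∷ (ne cz ∘ sym) ∷ [])
      open TwoLift {g = g} {xs} p∉ q∉ (c-out v≢s a≢s cs) (c-out v≢t a≢t ct) W∈ C∈ w≢c wp wq cs ct p≢q s≢t pq st dist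
      kept : ∀ {u} → u ∉ xs → Keep g h u
      kept {u} u∉ = keep-two L u∉ W∈ C∈ w≢c pq st dist (part p≢q wp wq (from-w u∉))
        (part s≢t cs ct λ x → case cover nc x of any₄
          (λ e → contradiction (there (here e)) u∉)
          (λ e → contradiction (there (there (here e))) u∉)
          inj₁
          inj₂) (any₄
        (λ e n _ → contradiction e n)
        (λ e _ _ → moved e (not-v u∉))
        (λ e _ _ → moved e (not-a u∉))
        (λ e _ n → contradiction e n))

    -- Two diamonds meeting at w.
    double : Adj g p q → Done
    double pq with nb3′ (proj₂ (proj₂ (four⇒3 (rot (rot nw))))) (ne wq) (S wp) pq
    ... | e , np@(nbr ((_ ∷ w≢e ∷ []) ∷ (q≢e ∷ []) ∷ _) (_ ∷ _ ∷ pe ∷ []) _) with Adj? g q e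
    ...   | inj₂ qe = open-star (rot (rot nw)) np qe
    ...   | inj₁ qe = go (c ≟ e)
      where
      nq : Nb g q (w ∷ p ∷ e ∷ [])
      nq = nb3 (proj₂ (proj₂ (four⇒3 (rot (rot (rot nw)))))) ((ne wp ∷ w≢e ∷ []) ∷ (ne pe ∷ []) ∷ [] ∷ []) (S wq ∷ S pq ∷ qe ∷ [])
      v∉p : v ∉ w ∷ q ∷ e ∷ []
      v∉p i = case cover nv (S (All.lookup (all np) i)) of any₃
        (λ r → ne wp (sym r))
        (λ r → a≢p (sym r))
        p≢c
      go : Dec (c ≡ e) → Done
      -- Both diamonds hang between `w` and `c`: the six vertices are a component with ten edges.
      go (yes refl) = sure (λ E → quiet none z≤n E [] z≤n (λ ()) (λ u∈ _ → keep-none (fresh-out none E u∈) (λ y∈ → ¬Adj⇒false λ x → fresh-out none E u∈ (closed y∈ x))))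
        (reduce [] (nw ∷ Nb-del nv ∷ Nb-del (Nb-del na) ∷ Nb-del-∉ (a≢p ∘ sym) (Nb-del-∉ (v≢p ∘ sym) (Nb-del np) (v∉p ∘ there)) a∉p
            ∷ Nb-del (Nb-del-∉ (a≢q ∘ sym) (Nb-del-∉ (v≢q ∘ sym) (Nb-del nq) (v∉q ∘ there)) a∉q)
            ∷ Nb-del (Nb-del (Nb-del (Nb-del (Nb-del-∉ (w≢c ∘ sym) nc (λ i → ¬Adj (S (All.lookup (all nc) i)) wc))))) ∷ [])
          none u6 (inW ((_ , wv) ∷ (_ , va) ∷ (_ , ac) ∷ (_ , pq) ∷ (_ , qe) ∷ (_ , S vc) ∷ []))
          ((v ∷ w ∷ p ∷ c ∷ a ∷ []) ∷ (c ∷ v ∷ a ∷ w ∷ q ∷ p ∷ []) ∷ (c ∷ q ∷ []) ∷ [])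
          (named ys w 1 0 (3 ∷ 5 ∷ 2 ∷ []) refl u6 refl ∷ named ys w 5 1 (2 ∷ 0 ∷ 4 ∷ 3 ∷ []) refl u6 refl ∷ named ys w 5 4 [] refl u6 refl ∷ []) [] [] [] []
          (balanced ys w ((0 ∷ 1 ∷ []) ∷ (0 ∷ 2 ∷ []) ∷ (0 ∷ 3 ∷ []) ∷ (0 ∷ 4 ∷ []) ∷ (1 ∷ 2 ∷ []) ∷ (1 ∷ 5 ∷ []) ∷ (2 ∷ 5 ∷ []) ∷ (3 ∷ 4 ∷ []) ∷ (3 ∷ 5 ∷ []) ∷ (4 ∷ 5 ∷ []) ∷ [])
            ((1 ∷ 0 ∷ 3 ∷ 5 ∷ 2 ∷ []) ∷ (5 ∷ 1 ∷ 2 ∷ 0 ∷ 4 ∷ 3 ∷ []) ∷ (5 ∷ 4 ∷ []) ∷ []) refl refl refl)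
          (s≤s z≤n) six-for-three (λ _ → ⊤) (λ _ → inj₂ tt))
        where
        ys : List (Fin N)
        ys = w ∷ v ∷ a ∷ p ∷ q ∷ c ∷ []
        u6 : Unique ys
        u6 = (ne wv ∷ ne wa ∷ ne wp ∷ ne wq ∷ w≢c ∷ []) ∷ (ne va ∷ v≢p ∷ v≢q ∷ ne vc ∷ []) ∷ (a≢p ∷ a≢q ∷ ne ac ∷ []) ∷ (p≢q ∷ p≢c ∷ []) ∷ (q≢c ∷ []) ∷ [] ∷ []
        nc : Nb g c (v ∷ a ∷ p ∷ q ∷ [])
        nc = nb4 (named-unique w (1 ∷ 2 ∷ 3 ∷ 4 ∷ []) u6 refl) (S vc ∷ S ac ∷ S pe ∷ S qe ∷ [])
        a∉p : a ∉ q ∷ c ∷ []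
        a∉p = All≢⇒∉ (a≢q ∷ ne ac ∷ [])
        v∉q : v ∉ w ∷ p ∷ c ∷ []
        v∉q = All≢⇒∉ ((ne wv ∘ sym) ∷ v≢p ∷ ne vc ∷ [])
        a∉q : a ∉ p ∷ c ∷ []
        a∉q = All≢⇒∉ (a≢p ∷ ne ac ∷ [])
        W′ : w ∈ ys
        W′ = here refl
        V′ : v ∈ ys
        V′ = there (here refl)
        A′ : a ∈ ys
        A′ = there (there (here refl))
        P′ : p ∈ ys
        P′ = there (there (there (here refl)))
        Q′ : q ∈ ys
        Q′ = there (there (there (there (here refl))))
        C′ : c ∈ ys
        C′ = there (there (there (there (there (here refl)))))
        via : ∀ {y ns u} → Nb g y ns → All (_∈ ys) ns → Adj g y u → u ∈ ys
        via nb al x = All.lookup al (cover nb x)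
        closed : Closed g ys
        closed y∈ x = All.lookup {P = λ y → ∀ {u} → Adj g y u → u ∈ ys}
          (via nw (V′ ∷ A′ ∷ P′ ∷ Q′ ∷ []) ∷ via nv (W′ ∷ A′ ∷ C′ ∷ []) ∷ via na (W′ ∷ V′ ∷ C′ ∷ [])
            ∷ via np (W′ ∷ Q′ ∷ C′ ∷ []) ∷ via nq (W′ ∷ P′ ∷ C′ ∷ []) ∷ via nc (V′ ∷ A′ ∷ P′ ∷ Q′ ∷ []) ∷ []) y∈ x
      -- The far ends `c` and `e` are the only surviving vertices that lose edges, which is as many
      -- as `quiet` tolerates.
      go (no c≢e) = sure (λ E → quiet none z≤n E (c ∷ e ∷ []) (s≤s (s≤s z≤n)) (λ where
              (here refl) _ → roomN (v ∷ []) ([] ∷ []) (there (here refl) ∷ []) (S vc ∷ []) refl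
              (there (here refl)) _ → roomN (p ∷ []) ([] ∷ []) (there (there (there (here refl))) ∷ []) (S pe ∷ []) refl)
            (λ u∈ u∉ → keep-none (fresh-out none E u∈) (λ y∈ → ¬Adj⇒false λ x → case leaves y∈ x of
              [ (λ i → fresh-out none E u∈ i)
              , u∉ ]′)))
        (reduce [] (nw ∷ Nb-del nv ∷ Nb-del (Nb-del na) ∷ Nb-del-∉ (a≢p ∘ sym) (Nb-del-∉ (v≢p ∘ sym) (Nb-del np) (v∉p ∘ there)) (All≢⇒∉ (a≢q ∷ a≢e ∷ []))
            ∷ Nb-del (Nb-del-∉ (a≢q ∘ sym) (Nb-del-∉ (v≢q ∘ sym) (Nb-del nq) (All≢⇒∉ (v≢p ∷ v≢e ∷ []))) (All≢⇒∉ (a≢p ∷ a≢e ∷ []))) ∷ [])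
          none u5 (inW ((_ , wv) ∷ (_ , va) ∷ (_ , ac) ∷ (_ , pq) ∷ (_ , qe) ∷ []))
          ((v ∷ c ∷ a ∷ w ∷ p ∷ e ∷ q ∷ []) ∷ (a ∷ v ∷ w ∷ q ∷ p ∷ []) ∷ [])
          (named ρ w 1 5 (2 ∷ 0 ∷ 3 ∷ 6 ∷ 4 ∷ []) refl uρ refl ∷ named ρ w 2 1 (0 ∷ 4 ∷ 3 ∷ []) refl uρ refl ∷ []) [] [] [] []
          (balanced ρ w ((0 ∷ 1 ∷ []) ∷ (0 ∷ 2 ∷ []) ∷ (0 ∷ 3 ∷ []) ∷ (0 ∷ 4 ∷ []) ∷ (1 ∷ 2 ∷ []) ∷ (1 ∷ 5 ∷ []) ∷ (2 ∷ 5 ∷ []) ∷ (3 ∷ 4 ∷ []) ∷ (3 ∷ 6 ∷ []) ∷ (4 ∷ 6 ∷ []) ∷ [])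
            ((1 ∷ 5 ∷ 2 ∷ 0 ∷ 3 ∷ 6 ∷ 4 ∷ []) ∷ (2 ∷ 1 ∷ 0 ∷ 4 ∷ 3 ∷ []) ∷ []) refl refl refl)
          (s≤s z≤n) (odd-for {k} 2 od) (λ _ → ⊤) (λ _ → inj₂ tt))
        where
        ys : List (Fin N)
        ys = w ∷ v ∷ a ∷ p ∷ q ∷ []
        ρ = w ∷ v ∷ a ∷ p ∷ q ∷ c ∷ e ∷ []
        v≢e : v ≢ e
        v≢e refl = v∉p (there (there (here refl)))
        a≢e : a ≢ e
        a≢e refl = case cover na (S pe) of any₃
          (λ r → ne wp (sym r))
          (λ r → v≢p (sym r))
          p≢c
        u5 : Unique ys
        u5 = (ne wv ∷ ne wa ∷ ne wp ∷ ne wq ∷ []) ∷ (ne va ∷ v≢p ∷ v≢q ∷ []) ∷ (a≢p ∷ a≢q ∷ []) ∷ (p≢q ∷ []) ∷ [] ∷ []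
        uρ : Unique ρ
        uρ = (ne wv ∷ ne wa ∷ ne wp ∷ ne wq ∷ w≢c ∷ w≢e ∷ []) ∷ (ne va ∷ v≢p ∷ v≢q ∷ ne vc ∷ v≢e ∷ []) ∷ (a≢p ∷ a≢q ∷ ne ac ∷ a≢e ∷ [])
           ∷ (p≢q ∷ p≢c ∷ ne pe ∷ []) ∷ (q≢c ∷ ne qe ∷ []) ∷ (c≢e ∷ []) ∷ [] ∷ []
        leaves : ∀ {y u} → y ∈ ys → Adj g y u → u ∈ ys ⊎ u ∈ c ∷ e ∷ []
        leaves y∈ x = All.lookup {P = λ y → ∀ {u} → Adj g y u → u ∈ ys ⊎ u ∈ c ∷ e ∷ []}
          ((λ x → inj₁ (there (cover nw x)))
            ∷ (λ x → case cover nv x of any₃ (inj₁ ∘ here) (λ r → inj₁ (there (there (here r)))) (inj₂ ∘ here))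
            ∷ (λ x → case cover na x of any₃ (inj₁ ∘ here) (λ r → inj₁ (there (here r))) (inj₂ ∘ here))
            ∷ (λ x → case cover np x of any₃ (inj₁ ∘ here) (λ r → inj₁ (there (there (there (there (here r)))))) (inj₂ ∘ there ∘ here))
            ∷ (λ x → case cover nq x of any₃ (inj₁ ∘ here) (λ r → inj₁ (there (there (there (here r))))) (inj₂ ∘ there ∘ here))
            ∷ []) y∈ x

  at-diamond : ∀ {w v a c p q} → Diamond w v a c p q → Done
  at-diamond {w} {v} {a} {c} {p} {q} d = go₁ (Adj? g p q)
    where
    open AtDiamond d
    go₂ : adj g p q ≡ false → ∀ {ms} → Nb g c (v ∷ a ∷ ms) → Done
    go₂ pq {[]} nc = contradiction nc no2
    go₂ pq {t ∷ []} nc = far-3 nc pq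
    go₂ pq {s ∷ t ∷ []} nc with Adj? g s t | is? p q s t
    -- Seen from `c`, the diamond `v`, `a` hangs between `c` and `w`, and `s t` starts a second one.
    ... | inj₁ st | _ = AtDiamond.double (diamond nc (Nb-↭ σv nv) (Nb-↭ σa na) (trans (symm g c w) wc)) st
      where
      σv : w ∷ a ∷ c ∷ [] ↭ c ∷ a ∷ w ∷ []
      σv = ↭-sym (↭-reverse (w ∷ a ∷ c ∷ []))
      σa : w ∷ v ∷ c ∷ [] ↭ c ∷ v ∷ w ∷ []
      σa = ↭-sym (↭-reverse (w ∷ v ∷ c ∷ []))
    ... | inj₂ st | no n = far-4 nc pq st n
    -- Here `p` and `q` are joined to both `w` and `c`, and `p` has one more neighbour `z`. If `c`
    -- and `z` are not adjacent, `p` opens the star at `w`; and none of the four neighbours of `c`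
    -- can be `z`.
    ... | inj₂ st | yes i with nb3′ (proj₂ (proj₂ (four⇒3 (rot (rot nw))))) w≢c (S wp) (pc i)
      where
      pc : Is p q s t → Adj g p c
      pc (inj₁ (refl , _)) = S (All.lookup (all nc) (there (there (here refl))))
      pc (inj₂ (refl , _)) = S (All.lookup (all nc) (there (there (there (here refl)))))
    ...   | z , np with Adj? g c z
    ...     | inj₂ cz = open-star (rot (rot nw)) np cz
    ...     | inj₁ cz = ⊥-elim (none-left i)
      where
      pz : Adj g p z
      pz = All.lookup (all np) (there (there (here refl)))
      none-left : Is p q s t → ⊥
      none-left i = case cover nc cz of λ where
          (here refl) → p∉v (S pz)
          (there (here refl)) → p∉a (S pz)
          (there (there (here refl))) → st-case i
          (there (there (there (here refl)))) → st-case′ i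
        where
        p∉v : Adj g v p → ⊥
        p∉v x = ¬Adj x (not-v p∉)
        p∉a : Adj g a p → ⊥
        p∉a x = ¬Adj x (not-a p∉)
        st-case : Is p q z t → ⊥
        st-case (inj₁ (e , _)) = ne pz e
        st-case (inj₂ (_ , refl)) = ¬Adj pz pq
        st-case′ : Is p q s z → ⊥
        st-case′ (inj₁ (_ , refl)) = ¬Adj pz pq
        st-case′ (inj₂ (e , _)) = ne pz e
    go₂ pq {_ ∷ _ ∷ _ ∷ _} nc = too-many nc
    go₁ : Adj g p q ⊎ adj g p q ≡ false → Done
    go₁ (inj₁ pq) = double pq
    go₁ (inj₂ pq) = go₂ pq (proj₂ (nb-front (v ∷ a ∷ []) ((ne va ∷ []) ∷ [] ∷ []) (S vc ∷ S ac ∷ [])))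

  module Triangle {w v a c : Fin N} (nv : Nb g v (w ∷ a ∷ c ∷ [])) (ac : Adj g a c) (wa : adj g w a ≡ false) (wc : adj g w c ≡ false) where
    va = All.lookup (all nv) (there (here refl))
    vc = All.lookup (all nv) (there (there (here refl)))
    vw = All.head (all nv)
    xs : List (Fin N)
    xs = a ∷ c ∷ []
    v∉ : v ∉ xs
    v∉ = All≢⇒∉ (ne va ∷ ne vc ∷ [])

    -- The triangle is contracted to `v`, which trades `a` and `c` for `s` and `t`. All degrees are
    -- kept; `s ≢ t` makes the two lifted edges different.
    contract : ∀ {s t} → Nb g a (v ∷ c ∷ s ∷ []) → Nb g c (v ∷ a ∷ t ∷ []) → s ≢ t → Done
    contract {s} {t} na@(nbr ((_ ∷ v≢s ∷ []) ∷ (c≢s ∷ []) ∷ _) (_ ∷ _ ∷ as ∷ []) _) nc@(nbr ((_ ∷ v≢t ∷ []) ∷ (a≢t ∷ []) ∷ _) (_ ∷ _ ∷ ct ∷ []) _) s≢t =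
      sure (λ E → quiet L (s≤s (s≤s z≤n)) E [] z≤n (λ ()) (λ u∈ _ → kept (fresh-out L E u∈)))
        (reduce (lft v t (c ∷ []) ∷ lft v s (a ∷ []) ∷ []) (na ∷ Nb-del (Nb-↭ (swap v a ↭-refl) nc) ∷ []) L ((ne ac ∷ []) ∷ [] ∷ []) (inW ((_ , ac) ∷ (_ , S ac) ∷ []))
          ((a ∷ c ∷ []) ∷ []) ((((ne ac ∷ []) ∷ [] ∷ []) , s≤s (s≤s z≤n)) ∷ []) (tt ∷ tt ∷ []) (((λ i → dist (Is-sym i)) ∷ []) ∷ [] ∷ [])
          ((ne (S ac) ∷ []) ∷ [] ∷ []) (there (here refl) ∷ here refl ∷ [])
          (balanced (a ∷ c ∷ v ∷ s ∷ t ∷ []) a ((0 ∷ 2 ∷ []) ∷ (0 ∷ 1 ∷ []) ∷ (0 ∷ 3 ∷ []) ∷ (1 ∷ 2 ∷ []) ∷ (1 ∷ 4 ∷ []) ∷ [])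
            ((0 ∷ 1 ∷ []) ∷ (2 ∷ 1 ∷ 4 ∷ []) ∷ (2 ∷ 0 ∷ 3 ∷ []) ∷ []) refl refl refl)
          (s≤s z≤n) two-for-one (λ _ → ⊤) (λ _ → inj₂ tt))
      where
      dist : ¬ Is v s v t
      dist (inj₁ (_ , e)) = s≢t e
      dist (inj₂ (e , _)) = v≢t e
      vs : adj g v s ≡ false
      vs = Nb-∉ nv (All≢⇒∉ ((λ where refl → ¬Adj (S as) wa) ∷ (ne as ∘ sym) ∷ (c≢s ∘ sym) ∷ []))
      vt : adj g v t ≡ false
      vt = Nb-∉ nv (All≢⇒∉ ((λ where refl → ¬Adj (S ct) wc) ∷ (a≢t ∘ sym) ∷ (ne ct ∘ sym) ∷ []))
      open TwoLift {g = g} {xs} v∉ (All≢⇒∉ ((ne as ∘ sym) ∷ (c≢s ∘ sym) ∷ [])) v∉ (All≢⇒∉ ((a≢t ∘ sym) ∷ (ne ct ∘ sym) ∷ []))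
        (here refl) (there (here refl)) (ne ac) (S va) as (S vc) ct v≢s v≢t vs vt dist
      kept : ∀ {u} → u ∉ xs → Keep g h u
      kept {u} u∉ = keep-two L u∉ (here refl) (there (here refl)) (ne ac) vs vt dist
        (part v≢s (S va) as λ x → case cover na x of any₃
          inj₁
          (λ e → contradiction (there (here e)) u∉)
          inj₂)
        (part v≢t (S vc) ct λ x → case cover nc x of any₃
          inj₁
          (λ e → contradiction (here e) u∉)
          inj₂) (any₂ (λ e n _ → contradiction e n) (λ e _ n → contradiction e n))

    -- With a common outer neighbour `y` the two lifted edges would coincide. Instead `v` and `y`
    -- become pendant, and their paths are continued to `a` and to `c`.
    pendants : ∀ {y z} → Nb g a (v ∷ c ∷ y ∷ []) → Nb g c (v ∷ a ∷ y ∷ []) → Nb g y (a ∷ c ∷ z ∷ []) → Done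
    pendants {y} {z} na@(nbr ((_ ∷ v≢y ∷ []) ∷ (c≢y ∷ []) ∷ _) (_ ∷ _ ∷ ay ∷ []) _) nc ny@(nbr ((_ ∷ a≢z ∷ []) ∷ (c≢z ∷ []) ∷ _) (_ ∷ _ ∷ yz ∷ []) _) =
      sure (λ E → quiet none z≤n E (v ∷ y ∷ []) (s≤s (s≤s z≤n)) (λ where
            (here refl) _ → roomN (a ∷ []) ([] ∷ []) (here refl ∷ []) (va ∷ []) refl
            (there (here refl)) _ → roomN (a ∷ []) ([] ∷ []) (here refl ∷ []) (S ay ∷ []) refl)
          (λ u∈ u∉ → keep-none (fresh-out none E u∈) (λ y∈ → ¬Adj⇒false λ x → u∉ (leaves (fresh-out none E u∈) y∈ x))))
        (reduce (pnd v w (a ∷ []) ∷ pnd y z (c ∷ []) ∷ []) (na ∷ Nb-del (Nb-↭ (swap v a ↭-refl) nc) ∷ []) none ((ne ac ∷ []) ∷ [] ∷ []) (inW ((_ , ac) ∷ (_ , S ac) ∷ []))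
          ((v ∷ c ∷ a ∷ y ∷ []) ∷ []) ((((ne vc ∷ ne va ∷ v≢y ∷ []) ∷ (ne (S ac) ∷ c≢y ∷ []) ∷ (ne ay ∷ []) ∷ [] ∷ []) , s≤s (s≤s z≤n)) ∷ [])
          ((All.head (all hv) , (λ x → case cover hv x of any₁ (λ e → e))) ∷ (All.head (all hy) , (λ x → case cover hy x of any₁ (λ e → e))) ∷ [])
          (((v≢y ∘ sym) ∷ []) ∷ [] ∷ []) ((ne ac ∷ []) ∷ [] ∷ []) (here refl ∷ there (here refl) ∷ [])
          (balanced (a ∷ c ∷ v ∷ y ∷ []) a ((0 ∷ 2 ∷ []) ∷ (0 ∷ 1 ∷ []) ∷ (0 ∷ 3 ∷ []) ∷ (1 ∷ 2 ∷ []) ∷ (1 ∷ 3 ∷ []) ∷ [])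
            ((2 ∷ 1 ∷ 0 ∷ 3 ∷ []) ∷ (2 ∷ 0 ∷ []) ∷ (3 ∷ 1 ∷ []) ∷ []) refl refl refl)
          (s≤s z≤n) two-for-one (λ _ → ⊤) (λ _ → inj₂ tt))
      where
      hv : Nb (dels xs g) v (w ∷ [])
      hv = nb-dels (a ∷ c ∷ []) v∉ (Nb-↭ (++-comm (w ∷ []) (a ∷ c ∷ [])) nv) (here refl ∷ there (here refl) ∷ [])
             (All≢⇒∉ (All.head (AllPairs.head (uniq nv)) ∷ All.lookup (AllPairs.head (uniq nv)) (there (here refl)) ∷ []) ∷ [])
      hy : Nb (dels xs g) y (z ∷ [])
      hy = nb-dels (a ∷ c ∷ []) (All≢⇒∉ ((ne ay ∘ sym) ∷ (c≢y ∘ sym) ∷ [])) ny (here refl ∷ there (here refl) ∷ []) (All≢⇒∉ ((a≢z ∘ sym) ∷ (c≢z ∘ sym) ∷ []) ∷ [])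
      leaves : ∀ {t u} → u ∉ xs → t ∈ xs → Adj g t u → u ∈ v ∷ y ∷ []
      leaves {u = u} u∉ t∈ x = All.lookup {P = λ t → Adj g t u → u ∈ v ∷ y ∷ []}
        ((λ x → case cover na x of any₃ here (λ e → contradiction (there (here e)) u∉) (there ∘ here))
          ∷ (λ x → case cover nc x of any₃ here (λ e → contradiction (here e) u∉) (there ∘ here)) ∷ []) t∈ x

    result : Done
    result = go (proj₂ (nb-front (v ∷ c ∷ []) ((ne vc ∷ []) ∷ [] ∷ []) (S va ∷ ac ∷ []))) (proj₂ (nb-front (v ∷ a ∷ []) ((ne va ∷ []) ∷ [] ∷ []) (S vc ∷ S ac ∷ [])))
      where
      at-y : ∀ {y ms} → Nb g a (v ∷ c ∷ y ∷ []) → Nb g c (v ∷ a ∷ y ∷ []) → Nb g y (a ∷ c ∷ ms) → Done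
      at-y {ms = []} na nc ny = contradiction ny no2
      at-y {ms = z ∷ []} na nc ny = pendants na nc ny
      -- A vertex `y` of degree four sees `c` and `a` as a diamond hanging between `y` and `v`.
      at-y {y} {ms = z ∷ t ∷ []} na@(nbr ((_ ∷ v≢y ∷ []) ∷ _) _ _) nc ny = at-diamond (diamond ny (Nb-↭ (↭-trans (swap v c ↭-refl) (↭-trans (prep c (swap v y ↭-refl)) (swap c y ↭-refl))) na)
        (Nb-↭ (↭-trans (swap v a ↭-refl) (↭-trans (prep a (swap v y ↭-refl)) (swap a y ↭-refl))) nc)
        (trans (symm g y v) (Nb-∉ nv (All≢⇒∉ ((λ where refl → ¬Adj (S (All.lookup (all na) (there (there (here refl))))) wa)
           ∷ (ne (All.lookup (all na) (there (there (here refl)))) ∘ sym) ∷ (ne (All.lookup (all nc) (there (there (here refl)))) ∘ sym) ∷ [])))))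
      at-y {y} {ms = _ ∷ _ ∷ _ ∷ _} _ _ ny = too-many ny
      go : ∀ {X Y} → Nb g a (v ∷ c ∷ X) → Nb g c (v ∷ a ∷ Y) → Done
      go {[]} na _ = contradiction na no2
      go {_} {[]} _ nc = contradiction nc no2
      go {_ ∷ _ ∷ []} na _ = open-star na (Nb-↭ (swap w a ↭-refl) nv) wc
      go {_} {_ ∷ _ ∷ []} _ nc = open-star nc (Nb-↭ (++-comm (w ∷ a ∷ []) (c ∷ [])) nv) wa
      go {s ∷ []} {t ∷ []} na nc with s ≟ t
      ... | no s≢t = contract na nc s≢t
      ... | yes refl = at-y na nc (proj₂ (nb-front (a ∷ c ∷ []) ((ne ac ∷ []) ∷ [] ∷ [])
              (S (All.lookup (all na) (there (there (here refl)))) ∷ S (All.lookup (all nc) (there (there (here refl)))) ∷ [])))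
      go {_ ∷ _ ∷ _ ∷ _} na _ = too-many na
      go {_} {_ ∷ _ ∷ _ ∷ _} _ nc = too-many nc

  degree-four : ∀ {w v x y z} → Nb g w (v ∷ x ∷ y ∷ z ∷ []) → Done
  degree-four {w} {v} nw with four⇒3 nw
  ... | a , c , nv = go (Adj? g a c) (Adj? g w a) (Adj? g w c)
    where
    hang : ∀ {a c} → Nb g v (w ∷ a ∷ c ∷ []) → Adj g a c → Adj g w a → Done
    hang {a} {c} nv@(nbr ((w≢a ∷ w≢c ∷ []) ∷ _) (vw ∷ va ∷ vc ∷ []) _) ac wa with nb-front (v ∷ a ∷ []) ((ne va ∷ []) ∷ [] ∷ []) (S vw ∷ wa ∷ [])
    ... | p ∷ q ∷ [] , nw′ = at-diamond (diamond nw′ nv (nb3 (proj₂ (proj₂ (four⇒3 (Nb-↭ (swap v a ↭-refl) nw′)))) ((ne (S vw) ∷ w≢c ∷ []) ∷ (ne vc ∷ []) ∷ [] ∷ []) (S wa ∷ S va ∷ ac ∷ []))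
            (¬Adj⇒false λ wc → noK4 (k4 vw va vc wa wc ac)))
    ... | [] , nw′ = case nb-length nw nw′ of λ where (s≤s (s≤s ()))
    ... | _ ∷ [] , nw′ = case nb-length nw nw′ of λ where (s≤s (s≤s (s≤s ())))
    ... | _ ∷ _ ∷ _ ∷ _ , nw′ = case nb-length nw′ nw of λ where (s≤s (s≤s (s≤s (s≤s ()))))
    go : Adj g a c ⊎ adj g a c ≡ false → Adj g w a ⊎ adj g w a ≡ false → Adj g w c ⊎ adj g w c ≡ false → Done
    go (inj₂ ac) _ _ = open-star nw nv ac
    go (inj₁ ac) (inj₂ wa) (inj₂ wc) = Triangle.result nv ac wa wc
    go (inj₁ ac) (inj₁ wa) _ = hang nv ac wa
    go (inj₁ ac) (inj₂ _) (inj₁ wc) = hang (Nb-↭ (prep w (swap a c ↭-refl)) nv) (S ac) wc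

-- Parity and the handshake argument.

K4? : (g : SG N) → Dec (∃[ p ] ∃[ q ] ∃[ r ] ∃[ s ] K4 g p q r s)
K4? {N} g = Fin.any? λ p → Fin.any? λ q → Fin.any? λ r → Fin.any? λ s →
  map′ (λ (a , b , c , d , e , f) → k4 a b c d e f) (λ (k4 a b c d e f) → a , b , c , d , e , f)
    (adj? p q ×-dec adj? p r ×-dec adj? p s ×-dec adj? q r ×-dec adj? q s ×-dec adj? r s)
  where
  adj? : ∀ u v → Dec (Adj g u v)
  adj? u v with Adj? g u v
  ... | inj₁ a = yes a
  ... | inj₂ f = no λ a → ¬Adj a f

parity : ∀ n → ∃[ k ] (n ≡ k + k ⊎ n ≡ suc (k + k))
parity zero = 0 , inj₁ refl
parity (suc n) with parity n
... | k , inj₁ refl = k , inj₂ refl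
... | k , inj₂ refl = suc k , inj₁ (cong suc (sym (ℕ.+-suc k k)))

even≢odd : ∀ a b → a + a ≢ suc (b + b)
even≢odd (suc a) zero e = case trans (sym (ℕ.+-suc a a)) (ℕ.suc-injective e) of λ ()
even≢odd (suc a) (suc b) e = even≢odd a b (ℕ.suc-injective (trans (sym (ℕ.+-suc a a)) (trans (ℕ.suc-injective e) (cong suc (ℕ.+-suc b b)))))

Σ[_] : List (Fin N) → (Fin N → ℕ) → ℕ
Σ[ [] ] f = 0
Σ[ x ∷ xs ] f = f x + Σ[ xs ] f

module Handshake {N : ℕ} (g : SG N) where

  Σ-+ : ∀ xs (f h : Fin N → ℕ) → Σ[ xs ] (λ x → f x + h x) ≡ Σ[ xs ] f + Σ[ xs ] h
  Σ-+ [] f h = refl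
  Σ-+ (x ∷ xs) f h rewrite Σ-+ xs f h = lemma (f x) (h x) (Σ[ xs ] f) (Σ[ xs ] h)
    where
    lemma : ∀ a b c d → a + b + (c + d) ≡ a + c + (b + d)
    lemma = solve-∀

  Σ-cong : ∀ xs {f h : Fin N → ℕ} → (∀ x → f x ≡ h x) → Σ[ xs ] f ≡ Σ[ xs ] h
  Σ-cong [] e = refl
  Σ-cong (x ∷ xs) e = cong₂ _+_ (e x) (Σ-cong xs e)

  -- A further vertex adds its row and its column of the adjacency matrix, which agree by symmetry;
  -- its diagonal entry is zero.
  even-sum : ∀ xs → ∃[ m ] Σ[ xs ] (λ x → Σ[ xs ] (⟨ g ⟩ x)) ≡ m + m
  even-sum [] = 0 , refl
  even-sum (x ∷ xs) with even-sum xs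
  ... | m , e = Σ[ xs ] (⟨ g ⟩ x) + m , (begin
      ⟨ g ⟩ x x + s + Σ[ xs ] (λ y → ⟨ g ⟩ y x + Σ[ xs ] (⟨ g ⟩ y)) ≡⟨ cong₂ (λ a b → a + s + b) (cong b2n (irr g x)) (Σ-+ xs (λ y → ⟨ g ⟩ y x) (λ y → Σ[ xs ] (⟨ g ⟩ y))) ⟩
      s + (Σ[ xs ] (λ y → ⟨ g ⟩ y x) + Σ[ xs ] (λ y → Σ[ xs ] (⟨ g ⟩ y))) ≡⟨ cong₂ (λ a b → s + (a + b)) (Σ-cong xs (λ y → cong b2n (symm g y x))) e ⟩
      s + (s + (m + m)) ≡⟨ lemma s m ⟩
      s + m + (s + m) ∎)
    where
    open ≡-Reasoning
    s = Σ[ xs ] (⟨ g ⟩ x)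
    lemma : ∀ s m → s + (s + (m + m)) ≡ s + m + (s + m)
    lemma = solve-∀

  degree-sum : ∀ x W → Unique W → ∃[ ns ] (Unique ns × All (Adj g x) ns × (∀ {u} → u ∈ W → Adj g x u → u ∈ ns) × All (_∈ W) ns × length ns ≡ Σ[ W ] (⟨ g ⟩ x))
  degree-sum x [] [] = [] , [] , [] , (λ ()) , [] , refl
  degree-sum x (y ∷ W) (y≢ ∷ un) with degree-sum x W un | Adj? g x y
  ... | ns , u , a , c , i , e | inj₁ xy = y ∷ ns , (∉⇒All≢ (λ y∈ → All≢⇒∉ y≢ (All.lookup i y∈)) ∷ u) , xy ∷ a ,
          (λ where
            (here refl) _ → here refl
            (there k) b → there (c k b)) , here refl ∷ All.map there i , cong₂ _+_ (sym (⟨⟩-adj g xy)) e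
  ... | ns , u , a , c , i , e | inj₂ n = ns , u , a ,
          (λ where
            (here refl) b → contradiction n (¬Adj b)
            (there k) b → c k b) , All.map there i , trans e (cong (_+ Σ[ W ] (⟨ g ⟩ x)) (sym (⟨⟩-¬adj g n)))

  odd-sum : ∀ xs (f : Fin N → ℕ) → (∀ {x} → x ∈ xs → ∃[ m ] f x ≡ suc (m + m)) → ∃[ m ] Σ[ xs ] f ≡ length xs + (m + m)
  odd-sum [] f h = 0 , refl
  odd-sum (x ∷ xs) f h with h (here refl) | odd-sum xs f (h ∘ there)
  ... | m , e | m′ , e′ = m + m′ , trans (cong₂ _+_ e e′) (lemma m m′ (length xs))
    where
    lemma : ∀ a b l → suc (a + a) + (l + (b + b)) ≡ suc (l + (a + b + (a + b)))
    lemma = solve-∀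

  handshake : ∀ {W k} → Unique W → Supp g W → length W ≡ suc (k + k) → (∀ {x} → x ∈ W → ∃[ ns ] (Nb g x ns × ∃[ m ] length ns ≡ suc (m + m))) → ⊥
  handshake {W} {k} un sp od odd with even-sum W | odd-sum W (λ x → Σ[ W ] (⟨ g ⟩ x)) odd′
    where
    odd′ : ∀ {x} → x ∈ W → ∃[ m ] Σ[ W ] (⟨ g ⟩ x) ≡ suc (m + m)
    odd′ {x} x∈ with degree-sum x W un | odd x∈
    ... | ns , u , a , c , _ , e | ms , nb , m , e′ = m , trans (sym e) (trans (ℕ.≤-antisym (nb-length nb′ nb) (nb-length nb nb′)) e′)
      where
      nb′ : Nb g x ns
      nb′ = nbr u a (λ b → c (sp (Adj-sym g b)) b)
  ... | a , e | b , e′ = even≢odd a (k + b) (trans (sym e) (trans e′ (trans (cong (_+ (b + b)) od) (lemma k b))))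
    where
    lemma : ∀ k b → suc (k + k) + (b + b) ≡ suc (k + b + (k + b))
    lemma = solve-∀

-- Choice of the reduction and the induction.

module Main {N : ℕ} (𝒮 : Setting N) (noK4 : K4-free (Setting.g 𝒮)) where
  open Setting 𝒮

  Done : Set
  Done = Result g ⌊ length W /2⌋

  degree-of : Fin N → ℕ
  degree-of x = length (proj₁ (nbs g x))

  open EvenPhase 𝒮 using (drop; deg1; deg2; deg3; deg4)

  nonadjacent : ∀ {x a b c ms} → Nb g x (a ∷ b ∷ c ∷ ms) →
                ∃[ p ] ∃[ q ] ∃[ r ] (Nb g x (p ∷ q ∷ r ∷ ms) × adj g p q ≡ false)
  nonadjacent {x} {a} {b} {c} {ms} nb@(nbr _ (xa ∷ xb ∷ xc ∷ _) _) with Adj? g a b | Adj? g a c | Adj? g b c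
  ... | inj₂ n | _ | _ = _ , _ , _ , nb , n
  ... | inj₁ _ | inj₂ n | _ = _ , _ , _ , Nb-↭ (prep a (swap b c ↭-refl)) nb , n
  ... | inj₁ _ | inj₁ _ | inj₂ n = _ , _ , _ , Nb-↭ (shifts (a ∷ []) (b ∷ c ∷ [])) nb , n
  ... | inj₁ ab | inj₁ ac | inj₁ bc = contradiction (k4 xa xb xc ab ac bc) noK4

  even : ∀ {k x} → length W ≡ k + k → x ∈ W → Done
  even {k} {x} ev x∈ = go (proj₂ (nbs g x))
    where
    go : ∀ {ns} → Nb g x ns → Done
    go {[]} nb = drop x∈ nb
    go {_ ∷ []} nb = deg1 {k} ev nb
    go {_ ∷ _ ∷ []} nb = deg2 {k} ev nb
    go {_ ∷ _ ∷ _ ∷ []} nb = let _ , _ , _ , nb′ , n = nonadjacent nb in deg3 {k} ev nb′ n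
    go {_ ∷ _ ∷ _ ∷ _ ∷ []} nb = let _ , _ , _ , nb′ , n = nonadjacent nb in deg4 {k} ev nb′ n
    go {_ ∷ _ ∷ _ ∷ _ ∷ _ ∷ _} nb = too-many nb

  odd : ∀ {k} → length W ≡ suc (k + k) → Done
  odd {k} od with Any.any? (λ x → degree-of x ℕ.≟ 0) W | Fin.any? (λ x → degree-of x ℕ.≟ 2)
                | Fin.any? (λ w → Fin.any? λ v → (degree-of w ℕ.≟ 4) ×-dec adj? w v ×-dec ¬? (degree-of v ℕ.≟ 3))
                | Fin.any? (λ x → degree-of x ℕ.≟ 4)
    where
    adj? : ∀ u v → Dec (Adj g u v)
    adj? u v with Adj? g u v
    ... | inj₁ a = yes a
    ... | inj₂ f = no λ a → ¬Adj a f
  ... | yes p | _ | _ | _ = let x , x∈ , e = find p in go (proj₂ (nbs g x)) x∈ e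
    where
    go : ∀ {x ns} → Nb g x ns → x ∈ W → length ns ≡ 0 → Done
    go {ns = []} nb x∈ _ = drop x∈ nb
  ... | no _ | yes (x , e) | _ | _ = go (proj₂ (nbs g x)) e
    where
    go : ∀ {x ns} → Nb g x ns → length ns ≡ 2 → Done
    go {ns = _ ∷ _ ∷ []} nb _ = Deg2Phase.deg2 𝒮 noK4 {k} od nb
  ... | no _ | no n2 | yes (w , v , d4 , wv , n3) | _ = go (proj₂ (nbs g w)) (proj₂ (nbs g v)) d4 n2′ n3
    where
    open AdjacentPhase 𝒮 noK4
    n2′ : degree-of v ≢ 2
    n2′ e = n2 (v , e)
    shift4 : ∀ {ns} → Nb g w ns → length ns ≡ 4 → ∃[ x ] ∃[ y ] ∃[ z ] Nb g w (v ∷ x ∷ y ∷ z ∷ [])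
    shift4 nw e with front nw (cover nw wv)
    ... | x ∷ y ∷ z ∷ [] , nw′ , _ = x , y , z , nw′
    ... | [] , _ , e′ = case trans (sym e) e′ of λ ()
    ... | _ ∷ [] , _ , e′ = case trans (sym e) e′ of λ ()
    ... | _ ∷ _ ∷ [] , _ , e′ = case trans (sym e) e′ of λ ()
    ... | _ ∷ _ ∷ _ ∷ _ ∷ _ , _ , e′ = case trans (sym e) e′ of λ ()
    -- A neighbour of `w` has degree at least one; with two and three excluded, degrees one and four
    -- remain.
    go : ∀ {ns ms} → Nb g w ns → Nb g v ms → length ns ≡ 4 → length ms ≢ 2 → length ms ≢ 3 → Done
    go nw nv d4 n2 n3 with front nv (cover nv (Adj-sym g wv)) | shift4 nw d4
    ... | [] , nv′ , _ | _ , _ , _ , nw′ = four-one nv′ nw′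
    ... | _ ∷ [] , _ , e | _ = contradiction e n2
    ... | _ ∷ _ ∷ [] , _ , e | _ = contradiction e n3
    ... | _ ∷ _ ∷ _ ∷ [] , nv′ , _ | _ , _ , _ , nw′ = adjacent-fours nw′ nv′
    ... | _ ∷ _ ∷ _ ∷ _ ∷ _ , nv′ , _ | _ = too-many nv′
  ... | no _ | no n2 | no n43 | yes (w , d4) = go (proj₂ (nbs g w)) d4
    where
    no2 : ∀ {v a b} → ¬ Nb g v (a ∷ b ∷ [])
    no2 {v} nb = n2 (v , ℕ.≤-antisym (nb-length (proj₂ (nbs g v)) nb) (nb-length nb (proj₂ (nbs g v))))
    four⇒3 : ∀ {w v x y z} → Nb g w (v ∷ x ∷ y ∷ z ∷ []) → ∃[ a ] ∃[ c ] Nb g v (w ∷ a ∷ c ∷ [])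
    four⇒3 {w} {v} nw with degree-of v ℕ.≟ 3
    ... | no n = contradiction (w , v , ℕ.≤-antisym (nb-length (proj₂ (nbs g w)) nw) (nb-length nw (proj₂ (nbs g w))) , All.head (all nw) , n) n43
    ... | yes e with front (proj₂ (nbs g v)) (cover (proj₂ (nbs g v)) (Adj-sym g (All.head (all nw))))
    ...   | a ∷ c ∷ [] , nv , _ = a , c , nv
    ...   | [] , _ , e′ = case trans (sym e) e′ of λ ()
    ...   | _ ∷ [] , _ , e′ = case trans (sym e) e′ of λ ()
    ...   | _ ∷ _ ∷ _ ∷ _ , _ , e′ = case trans (sym e) e′ of λ ()
    go : ∀ {ns} → Nb g w ns → length ns ≡ 4 → Done
    go {_ ∷ _ ∷ _ ∷ _ ∷ []} nw _ = FinalPhase.degree-four (record { setting = 𝒮 ; noK4 = noK4 ; k = k ; od = od ; no2 = no2 ; four⇒3 = four⇒3 }) nw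
  ... | no n0 | no n2 | no _ | no n4 = ⊥-elim (Handshake.handshake g {k = k} un sp od λ {x} x∈ →
          _ , proj₂ (nbs g x) , go (proj₂ (nbs g x)) (λ e → n0 (lose x∈ e)) (λ e → n2 (x , e)) (λ e → n4 (x , e)))
    where
    go : ∀ {x ns} → Nb g x ns → length ns ≢ 0 → length ns ≢ 2 → length ns ≢ 4 → ∃[ m ] length ns ≡ suc (m + m)
    go {ns = []} _ n _ _ = contradiction refl n
    go {ns = _ ∷ []} _ _ _ _ = 0 , refl
    go {ns = _ ∷ _ ∷ []} _ _ n _ = contradiction refl n
    go {ns = _ ∷ _ ∷ _ ∷ []} _ _ _ _ = 1 , refl
    go {ns = _ ∷ _ ∷ _ ∷ _ ∷ []} _ _ _ n = contradiction refl n
    go {ns = _ ∷ _ ∷ _ ∷ _ ∷ _ ∷ _} nb _ _ _ = too-many nb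

step : (g : SG N) {W : List (Fin N)} → Below N (length W) → Unique W → Supp g W → Result g ⌊ length W /2⌋
step {N} g {W} ih un sp with K4? g
... | yes (_ , _ , _ , _ , k) = K4Phase.K4-result (record { g = g ; W = W ; ih = ih ; un = un ; sp = sp }) k
... | no n = go {proj₁ (parity (length W))} W ih un sp (proj₂ (parity (length W)))
  where
  noK4 : K4-free g
  noK4 k = n (_ , _ , _ , _ , k)
  go : ∀ {k} W → Below N (length W) → Unique W → Supp g W → length W ≡ k + k ⊎ length W ≡ suc (k + k) → Result g ⌊ length W /2⌋
  go [] _ _ sp _ = inj₁ ([] , [] , z≤n , λ u v → sym (⟨⟩-¬adj g (¬Adj⇒false λ a → case sp a of λ ())))
  go {k} (x ∷ W) ih un sp (inj₁ e) = Main.even (record { g = g ; W = x ∷ W ; ih = ih ; un = un ; sp = sp }) noK4 {k} e (here refl)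
  go {k} (x ∷ W) ih un sp (inj₂ o) = Main.odd (record { g = g ; W = x ∷ W ; ih = ih ; un = un ; sp = sp }) noK4 {k} o

below : ∀ n → Below N n
below (suc n) h un (s≤s l) sp = step h (λ h′ un′ l′ sp′ → below n h′ un′ (≤-trans l′ l) sp′) un sp

-- Return to graphs, path decompositions and `pn`.

module Interpretation {n : ℕ} (G : Graph n) (Δ≤4 : maxDegree G ≤ 4) where
  private
    module Gr = Graph G
    V = Fin n

  _~_ : V → V → Set
  _~_ = Graph._~_ G

  adjᵇ : V → V → Bool
  adjᵇ u v = does (Gr._~?_ u v)

  adjᵇ⁻ : ∀ {u v} → adjᵇ u v ≡ true → u ~ v
  adjᵇ⁻ {u} {v} e with Gr._~?_ u v
  ... | yes a = a

  adjᵇ⁺ : ∀ {u v} → u ~ v → adjᵇ u v ≡ true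
  adjᵇ⁺ {u} {v} a with Gr._~?_ u v
  ... | yes _ = refl
  ... | no n = contradiction a n

  graph : SG n
  graph = record
    { adj = adjᵇ
    ; symm = sy
    ; irr = λ u → ¬true⇒false (λ e → Gr.~-irrefl refl (adjᵇ⁻ e))
    ; bound′ = λ v {ns} un al → ≤-trans (bd v un al) (≤-trans (All.lookup (xs≤max 0 (map (degree G) (allFin n))) (∈-map⁺ (degree G) (∈-allFin v))) Δ≤4)
    }
    where
    sy : ∀ u v → adjᵇ u v ≡ adjᵇ v u
    sy u v with Gr._~?_ u v | Gr._~?_ v u
    ... | yes _ | yes _ = refl
    ... | no _ | no _ = refl
    ... | yes a | no b = contradiction (Gr.~-sym a) b
    ... | no a | yes b = contradiction (Gr.~-sym b) a
    bd : ∀ v {ns} → Unique ns → All (λ u → adjᵇ v u ≡ true) ns → length ns ≤ degree G v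
    bd v {ns} un al with removeAll {W = filter (Gr._~?_ v) (allFin n)} un (All.map (λ {u} e → ∈-filter⁺ (Gr._~?_ v) (∈-allFin u) (adjᵇ⁻ e)) al)
    ... | ms , p = subst (length ns ≤_) (sym (trans (↭-length p) (length-++ ns))) (m≤m+n _ _)

  Adj⁻ : ∀ {u v} → Adj graph u v → u ~ v
  Adj⁻ (edge e) = adjᵇ⁻ e

  Adj⁺ : ∀ {u v} → u ~ v → Adj graph u v
  Adj⁺ a = edge (adjᵇ⁺ a)

  opaque
    unfolding δ
    δ-hit : ∀ (u v : V) → 1 ≤ δ u v u v
    δ-hit u v rewrite ι-refl u | ι-refl v = s≤s z≤n

  step-wt : ∀ p {u v : V} → (u , v) ∈ steps p → 1 ≤ wt p u v
  step-wt (x ∷ y ∷ p) (here refl) = ≤-trans (δ-hit x y) (m≤m+n _ _)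
  step-wt (x ∷ q@(y ∷ p)) {u} {v} (there i) = ≤-trans (step-wt q i) (m≤n+m _ (δ x y u v))

  edge-wt : ∀ p {u v : V} → HasEdge p u v → 1 ≤ wt p u v
  edge-wt p (inj₁ i) = step-wt p i
  edge-wt p {u} {v} (inj₂ i) = subst (1 ≤_) (wt-sym p v u) (step-wt p i)

  wt-edge : ∀ p {u v : V} → 1 ≤ wt p u v → HasEdge p u v
  wt-edge p {u} {v} l = case wt-step p l of λ where
      (inj₁ (A , B , refl)) → inj₁ (mid A)
      (inj₂ (A , B , refl)) → inj₂ (mid A)
    where
    mid : ∀ A {x y : V} {B} → (x , y) ∈ steps (A ++ x ∷ y ∷ B)
    mid [] = here refl
    mid (a ∷ []) = there (here refl)
    mid (a ∷ A@(_ ∷ _)) = there (mid A)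

  linked : ∀ (p : List V) → (∀ {u v} → (u , v) ∈ steps p → u ~ v) → Linked _~_ p
  linked [] f = []
  linked (x ∷ []) f = [-]
  linked (x ∷ y ∷ p) f = f (here refl) ∷ linked (y ∷ p) (f ∘ there)

  -- Every multiplicity in `graph` is zero or one. Multiplicity one gives covering, a second path
  -- through the same edge would give two, and a step between non-adjacent vertices would give a
  -- positive value where `graph` has zero.
  decompose : ∀ {D} → All IsP D → (WT D ≗₂ ⟨ graph ⟩) → IsPathDecomposition G D
  decompose {D} isP eq = mkIsPathDecomposition
    (All.tabulate λ {p} p∈ → mkIsPath (proj₂ (All.lookup isP p∈))
      (linked p (λ {u} {v} i → Adj⁻ (⟨⟩-pos graph (subst (1 ≤_) (eq u v) (≤-trans (step-wt p i) (WT-∈ p∈ u v))))))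
      (proj₁ (All.lookup isP p∈)))
    (disjoint D (λ u v → ≤-trans (≤-reflexive (eq u v)) (at-most-one u v)))
    (λ u v a → case WT-pos D (≤-reflexive (sym (trans (eq u v) (⟨⟩-adj graph (Adj⁺ a))))) of λ where
      (A , p , B , refl , l) → lose (∈-++⁺ʳ A (here refl)) (wt-edge p l))
    where
    at-most-one : ∀ u v → ⟨ graph ⟩ u v ≤ 1
    at-most-one u v with adjᵇ u v
    ... | true = s≤s z≤n
    ... | false = z≤n
    disjoint : ∀ D → (∀ u v → WT D u v ≤ 1) → AllPairs EdgeDisjoint D
    disjoint [] _ = []
    disjoint (p ∷ D) le = All.tabulate (λ {q} q∈ u v i j →
        case ≤-trans (ℕ.+-mono-≤ (edge-wt p i) (≤-trans (edge-wt q j) (WT-∈ q∈ u v))) (le u v) of λ where (s≤s ()))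
      ∷ disjoint D (λ u v → ≤-trans (m≤n+m _ (wt p u v)) (le u v))

  module Component (conn : Connected G) {S : List V} (E : Exc graph S) where

    reach : ∀ {u v} → u ∈ S → Star _~_ u v → v ∈ S
    reach u∈ ε = u∈
    reach u∈ (a ◅ s) = reach (exc-closed E u∈ (Adj⁺ a)) s

    -- In a connected graph a closed set with an element contains every vertex.
    everywhere : ∀ {s} → s ∈ S → ∀ v → v ∈ S
    everywhere {s} s∈ v = reach s∈ (conn s v)

  iso : ∀ {S} → Unique S → (∀ v → v ∈ S) → (H : Graph (length S)) →
        (∀ i j → (lookup S i ~ lookup S j) ⇔ Graph._~_ H i j) → G ≅ H
  iso {S} un full H e = record
    { bijection = mk↔ₛ′ to (lookup S) (λ i → lookup-injective un _ _ (sym (lookup-index (full (lookup S i))))) (λ v → sym (lookup-index (full v)))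
    ; adjacency = λ u v → subst₂ (λ x y → (x ~ y) ⇔ Graph._~_ H (to u) (to v)) (sym (lookup-index (full u))) (sym (lookup-index (full v))) (e (to u) (to v))
    }
    where
    to : V → Fin (length S)
    to v = Any.index (full v)

  complete-iso : ∀ {S} → Unique S → (∀ v → v ∈ S) → (∀ i j → i ≢ j → Adj graph (lookup S i) (lookup S j)) → G ≅ complete (length S)
  complete-iso {S} un full adj = iso un full (complete (length S)) λ i j → mk⇔ (λ { a refl → Gr.~-irrefl refl a }) (λ i≢j → Adj⁻ (adj i j i≢j))

  pattern 0F = Fin.zero
  pattern 1F = Fin.suc Fin.zero
  pattern 2F = Fin.suc (Fin.suc Fin.zero)
  pattern 3F = Fin.suc (Fin.suc (Fin.suc Fin.zero))
  pattern 4F = Fin.suc (Fin.suc (Fin.suc (Fin.suc Fin.zero)))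

  exceptional : Connected G → ∀ {S} → Exc graph S → (G ≅ K₃) ⊎ (G ≅ K₅) ⊎ (G ≅ K₅⁻)
  exceptional conn E@(k3 {a} {b} {c} ab ac bc _) = inj₁ (complete-iso (exc-unique E) (Component.everywhere conn E (here refl)) adjacent)
    where
    Sy : ∀ {u v} → Adj graph u v → Adj graph v u
    Sy = Adj-sym graph
    adjacent : ∀ i j → i ≢ j → Adj graph (lookup (a ∷ b ∷ c ∷ []) i) (lookup (a ∷ b ∷ c ∷ []) j)
    adjacent 0F 0F n = contradiction refl n
    adjacent 0F 1F _ = ab
    adjacent 0F 2F _ = ac
    adjacent 1F 0F _ = Sy ab
    adjacent 1F 1F n = contradiction refl n
    adjacent 1F 2F _ = bc
    adjacent 2F 0F _ = Sy ac
    adjacent 2F 1F _ = Sy bc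
    adjacent 2F 2F n = contradiction refl n
  exceptional conn E@(k5 {p} {q} {x} {y} {z} (near5 p≢q px py pz qx qy qz xy xz yz) _) = inj₂ (go (Adj? graph p q))
    where
    Sy : ∀ {u v} → Adj graph u v → Adj graph v u
    Sy = Adj-sym graph
    -- `p` and `q` come at positions 0 and 1, where `K₅⁻` has its deleted edge.
    S₅ : List V
    S₅ = p ∷ q ∷ x ∷ y ∷ z ∷ []
    full : ∀ v → v ∈ S₅
    full = Component.everywhere conn E (here refl)
    Apart₅ : Fin 5 → Fin 5 → Set
    Apart₅ i j = i ≢ j × ¬ ((i ≡ 0F × j ≡ 1F) ⊎ (i ≡ 1F × j ≡ 0F))
    most : ∀ i j → Apart₅ i j → Adj graph (lookup S₅ i) (lookup S₅ j)
    most 0F 0F (n , _) = contradiction refl n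
    most 0F 1F (_ , n) = contradiction (inj₁ (refl , refl)) n
    most 0F 2F _ = px
    most 0F 3F _ = py
    most 0F 4F _ = pz
    most 1F 0F (_ , n) = contradiction (inj₂ (refl , refl)) n
    most 1F 1F (n , _) = contradiction refl n
    most 1F 2F _ = qx
    most 1F 3F _ = qy
    most 1F 4F _ = qz
    most 2F 0F _ = Sy px
    most 2F 1F _ = Sy qx
    most 2F 2F (n , _) = contradiction refl n
    most 2F 3F _ = xy
    most 2F 4F _ = xz
    most 3F 0F _ = Sy py
    most 3F 1F _ = Sy qy
    most 3F 2F _ = Sy xy
    most 3F 3F (n , _) = contradiction refl n
    most 3F 4F _ = yz
    most 4F 0F _ = Sy pz
    most 4F 1F _ = Sy qz
    most 4F 2F _ = Sy xz
    most 4F 3F _ = Sy yz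
    most 4F 4F (n , _) = contradiction refl n
    every : Adj graph p q → ∀ i j → i ≢ j → Adj graph (lookup S₅ i) (lookup S₅ j)
    every pq 0F 1F _ = pq
    every pq 1F 0F _ = Sy pq
    every pq 0F 0F n = contradiction refl n
    every pq 1F 1F n = contradiction refl n
    every pq 0F (Fin.suc (Fin.suc j)) n = most 0F (Fin.suc (Fin.suc j)) (n , λ where (inj₁ (_ , ())) ; (inj₂ (() , _)))
    every pq 1F (Fin.suc (Fin.suc j)) n = most 1F (Fin.suc (Fin.suc j)) (n , λ where (inj₁ (() , _)) ; (inj₂ (_ , ())))
    every pq (Fin.suc (Fin.suc i)) j n = most (Fin.suc (Fin.suc i)) j (n , λ where (inj₁ (() , _)) ; (inj₂ (() , _)))
    go : Adj graph p q ⊎ adj graph p q ≡ false → (G ≅ K₅) ⊎ (G ≅ K₅⁻)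
    go (inj₁ pq) = inj₁ (complete-iso (exc-unique E) full (every pq))
    go (inj₂ pq) = inj₂ (iso (exc-unique E) full K₅⁻ λ i j → mk⇔ (to i j) (λ a → Adj⁻ (most i j a)))
      where
      to : ∀ i j → lookup S₅ i ~ lookup S₅ j → Apart₅ i j
      to i j a = (λ where refl → Gr.~-irrefl refl a) , λ where
        (inj₁ (refl , refl)) → ¬Adj (Adj⁺ a) pq
        (inj₂ (refl , refl)) → ¬Adj (Sy (Adj⁺ a)) pq

theorem4p1 : ∀ (n : ℕ) (G : Graph n) →
    Connected G →
    maxDegree G ≤ 4 →
    (pn G ≤ ⌊ n /2⌋) ⊎ (G ≅ K₃) ⊎ (G ≅ K₅) ⊎ (G ≅ K₅⁻)
theorem4p1 n G conn Δ≤4 with below (suc (length (allFin n))) graph (Uniqueₚ.allFin⁺ n) ≤-refl (λ {u} _ → ∈-allFin u)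
  where open Interpretation G Δ≤4
... | inj₁ (D , isP , len , eq) = inj₁ (≤-trans (proj₂ (pn-isLeast G) _ (D , Interpretation.decompose G Δ≤4 isP eq , refl))
        (≤-trans len (≤-reflexive (cong ⌊_/2⌋ (length-tabulate (λ i → i))))))
... | inj₂ (S , E) = inj₂ (Interpretation.exceptional G Δ≤4 conn E)
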